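{- Let $p_n$ denote the number of \textsf{Z}-convex polyominoes with semi-perimeter $n+2$, and let $P(t)=\sum_{n\geq 0}p_n t^{n+2}$. Then \[ P(t)=t^2+2t^3+7t^4+28t^5+116t^6+484t^7+O(t^8) =\frac{2t^4(1-2t)^2d(t)}{(1-4t)^2(1-3t)(1-t)}+\frac{t^2(1-6t+10t^2-2t^3-t^4)}{(1-4t)(1-3t)(1-t)}, \] where $d(t)=\frac12\left(1-2t-\sqrt{1-4t}\right)$. More generally, let $P(x,y)=\sum_{Q} x^{\mathrm{col}(Q)}y^{\mathrm{row}(Q)}$, the sum over all \textsf{Z}-convex polyominoes $Q$, where $\mathrm{col}(Q)$ and $\mathrm{row}(Q)$ are the numbers of columns and rows of $Q$. Let $d(x,y)$ be the unique formal power series satisfying $d=(x+d)(y+d)$, namely \[ d(x,y)=\tfrac12\left(1-x-y-\sqrt{\Delta}\right),\qquad \Delta=(1-x-y)^2-4xy . \] Then $P(x,y)$ is a rational function of $x$, $y$ and $d(x,y)$; more precisely, \[ P(x,y)=\frac{2x^2y^2d(x,y)}{\Delta^2}\cdot\frac{(1-x-y)^2}{(1-x-y)^2-xy} +\frac{xy(1-x-y)^2(1-x-y-xy)-x^2y^2(1-x-y-3xy)}{\Delta\,\big((1-x-y)^2-xy\big)}. \]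
   Context: A cell is a unit square of the lattice $\mathbb Z\times\mathbb Z$; a polyomino is a finite connected union of cells having no cut point, considered up to translation. A column (row) of a polyomino is its intersection with a vertical (horizontal) infinite strip of cells. A polyomino is convex if every such row and every such column intersection is connected. The semi-perimeter of a convex polyomino is half the length of its boundary, i.e. the number of its rows plus the number of its columns. A path in a polyomino is a self-avoiding sequence of cells of the polyomino, each consecutive pair being adjacent, i.e. a sequence of unit steps of types $N=(0,1)$, $S=(0,-1)$, $E=(1,0)$, $W=(-1,0)$; it is monotone if it uses steps of at most two types. For a path with step sequence $u_1\cdots u_k$, each index $i$ with $u_i\neq u_{i+1}$ is a change of direction. A convex polyomino is \textsf{Z}-convex (2-convex) if every pair of its cells can be connected by a monotone path inside the polyomino with at most two changes of direction. -}

module Defs where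

open import Data.Nat using (ℕ; zero; suc; _∸_; _≡ᵇ_; _≤_)
open import Data.Integer using (ℤ; +_; _+_; _*_; -_)
open import Data.Bool using (Bool; true; false; if_then_else_)
open import Data.Fin using (Fin; toℕ)
open import Data.Vec using (Vec; lookup)
open import Data.List using (List; []; _∷_; length)
open import Data.List.Relation.Unary.All using (All)
open import Data.List.Relation.Unary.Unique.Propositional using (Unique)
open import Data.List.Membership.Propositional using (_∈_)
open import Data.Product using (Σ; ∃; _×_; _,_)
open import Data.Sum using (_⊎_)
open import Relation.Binary.PropositionalEquality using (_≡_)

-- A cell is identified with its lower-left lattice point (x , y).
Cell : Set
Cell = ℤ × ℤ

data Dir : Set where
  N S E W : Dir

step : Dir → Cell → Cell
step N (x , y) = x , y + (+ 1)
step S (x , y) = x , y + (- (+ 1))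
step E (x , y) = x + (+ 1) , y
step W (x , y) = x + (- (+ 1)) , y

positions : Cell → List Dir → List Cell
positions p []       = p ∷ []
positions p (u ∷ us) = p ∷ positions (step u p) us

endpoint : Cell → List Dir → Cell
endpoint p []       = p
endpoint p (u ∷ us) = endpoint (step u p) us

sameDir : Dir → Dir → Bool
sameDir N N = true
sameDir S S = true
sameDir E E = true
sameDir W W = true
sameDir _ _ = false

changes : List Dir → ℕ
changes []           = 0
changes (u ∷ [])     = 0
changes (u ∷ v ∷ us) = (if sameDir u v then 0 else 1) Data.Nat.+ changes (v ∷ us)

Monotone : List Dir → Set
Monotone us = Σ Dir λ a → Σ Dir λ b → All (λ u → u ≡ a ⊎ u ≡ b) us

-- Polyominoes placed in their bounding box [0,c) × [0,r):
-- column i , row j is present iff  lookup (lookup M i) j ≡ true.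

Mat : ℕ → ℕ → Set
Mat c r = Vec (Vec Bool r) c

_∈Q_ : {c r : ℕ} → Cell → Mat c r → Set
_∈Q_ {c} {r} (x , y) M =
  Σ (Fin c) λ i → Σ (Fin r) λ j →
    (x ≡ + toℕ i) × (y ≡ + toℕ j) × (lookup (lookup M i) j ≡ true)

record Path {c r : ℕ} (M : Mat c r) (a b : Cell) : Set where
  field
    steps        : List Dir
    inside       : All (λ p → p ∈Q M) (positions a steps)
    selfAvoiding : Unique (positions a steps)
    ends         : endpoint a steps ≡ b

open Path public

IsPolyomino : {c r : ℕ} → Mat c r → Set
IsPolyomino M =
  (Σ Cell λ a → a ∈Q M) ×
  (∀ a b → a ∈Q M → b ∈Q M → Path M a b)

IsConvex : {c r : ℕ} → Mat c r → Set
IsConvex M =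
  (∀ x y₁ y₂ y → (x , y₁) ∈Q M → (x , y₂) ∈Q M →
     y₁ Data.Integer.≤ y → y Data.Integer.≤ y₂ → (x , y) ∈Q M) ×
  (∀ y x₁ x₂ x → (x₁ , y) ∈Q M → (x₂ , y) ∈Q M →
     x₁ Data.Integer.≤ x → x Data.Integer.≤ x₂ → (x , y) ∈Q M)

IsZConvex : {c r : ℕ} → Mat c r → Set
IsZConvex M =
  IsPolyomino M × IsConvex M ×
  (∀ a b → a ∈Q M → b ∈Q M →
     Σ (Path M a b) λ π → Monotone (steps π) × (changes (steps π) ≤ 2))

-- the bounding box is exactly c × r: every column and every row meets M
-- (this fixes the translation class: one representative per polyomino
--  with c columns and r rows)
Tight : {c r : ℕ} → Mat c r → Set
Tight {c} {r} M =
  (∀ (i : Fin c) → Σ (Fin r) λ j → lookup (lookup M i) j ≡ true) ×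
  (∀ (j : Fin r) → Σ (Fin c) λ i → lookup (lookup M i) j ≡ true)

ZPoly : (c r : ℕ) → Mat c r → Set
ZPoly c r M = Tight M × IsZConvex M

HasCount : (c r n : ℕ) → Set
HasCount c r n =
  Σ (List (Mat c r)) λ L →
    Unique L × (∀ M → (M ∈ L → ZPoly c r M) × (ZPoly c r M → M ∈ L)) ×
    (length L ≡ n)

sumTo : ℕ → (ℕ → ℤ) → ℤ
sumTo zero    f = f 0
sumTo (suc n) f = sumTo n f + f (suc n)

Ser : Set
Ser = ℕ → ℤ

_≈₁_ : Ser → Ser → Set
f ≈₁ g = ∀ n → f n ≡ g n

infixl 6 _+₁_ _-₁_
infixl 7 _*₁_
infixr 8 _^₁_
infix 4 _≈₁_

_+₁_ : Ser → Ser → Ser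
(f +₁ g) n = f n + g n

_-₁_ : Ser → Ser → Ser
(f -₁ g) n = f n + (- g n)

_*₁_ : Ser → Ser → Ser
(f *₁ g) n = sumTo n (λ k → f k * g (n ∸ k))

#₁ : ℕ → Ser
#₁ k n = if n ≡ᵇ 0 then + k else + 0

t : Ser
t n = if n ≡ᵇ 1 then + 1 else + 0

_^₁_ : Ser → ℕ → Ser
f ^₁ zero  = #₁ 1
f ^₁ suc k = f *₁ (f ^₁ k)

-- two variables x , y ; coefficient of x^i y^j is f i j
Ser₂ : Set
Ser₂ = ℕ → ℕ → ℤ

_≈₂_ : Ser₂ → Ser₂ → Set
f ≈₂ g = ∀ i j → f i j ≡ g i j

infixl 6 _+₂_ _-₂_
infixl 7 _*₂_
infixr 8 _^₂_
infix 4 _≈₂_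

_+₂_ : Ser₂ → Ser₂ → Ser₂
(f +₂ g) i j = f i j + g i j

_-₂_ : Ser₂ → Ser₂ → Ser₂
(f -₂ g) i j = f i j + (- g i j)

_*₂_ : Ser₂ → Ser₂ → Ser₂
(f *₂ g) i j = sumTo i (λ a → sumTo j (λ b → f a b * g (i ∸ a) (j ∸ b)))

#₂ : ℕ → Ser₂
#₂ k i j = if i ≡ᵇ 0 then (if j ≡ᵇ 0 then + k else + 0) else + 0

X : Ser₂
X i j = if i ≡ᵇ 1 then (if j ≡ᵇ 0 then + 1 else + 0) else + 0

Y : Ser₂
Y i j = if i ≡ᵇ 0 then (if j ≡ᵇ 1 then + 1 else + 0) else + 0

_^₂_ : Ser₂ → ℕ → Ser₂
f ^₂ zero  = #₂ 1
f ^₂ suc k = f *₂ (f ^₂ k)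

-- The generating functions, from a counting function N
-- (N c r = number of Z-convex polyominoes with c columns and r rows)

P₂ : (ℕ → ℕ → ℕ) → Ser₂
P₂ cnt c r = + cnt c r

-- P(t) = Σ_Q t^(semi-perimeter) ; coefficient of t^m = Σ_{c+r=m} N c r
P₁ : (ℕ → ℕ → ℕ) → Ser
P₁ cnt m = sumTo m (λ c → + cnt c (m ∸ c))

Δ : Ser₂
Δ = (#₂ 1 -₂ X -₂ Y) ^₂ 2 -₂ #₂ 4 *₂ X *₂ Y

module Submission where

-- A polyomino is encoded by its columns, intervals I₀, I₁, … of rows.  Z-convexity says that any two
-- columns overlap or some column between them contains both.  If no column is full then, up to a
-- reflection, the last column touching the bottom row precedes the first one touching the top row;
-- their common rows form a core, on the left of which the columns grow and on the right of which
-- they shrink.  The only remaining condition links a left column, a right column and the columns in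
-- between, and it becomes local when rows and columns are read in the right order: all that has to
-- be remembered is one number D, the height difference between the two sides.  So the polyominoes
-- are the runs of an automaton with a counter D, and its generating functions are determined by a
-- linear system.  The kernel of this system has the root z = 1/(1 - x - d); a combination of z^D
-- and of the series for stacks of nested intervals solves the system, and summing over D gives the
-- bivariate formula.  Setting x = y = t gives the univariate one.

-- The link between a left and a right column is a condition on pairs with an existential over the
-- columns between, so it looks non-local. The columns between `e` and `w` form a staircase, along
-- which the rows above and below the core are discarded. If the left column of a pair is read
-- first, the next unread column of the staircase contains both. If the right one is read first, all
-- unread columns of the staircase end below its top, so the two must overlap, and of the unread
-- left columns only the first one matters. Hence one difference of heights suffices. On the
-- algebraic side, a = x + d and b = y + d give d = ab, x = a(1 - b), y = b(1 - a), and 1 - a - b is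
-- the square root of Δ. Stacks inside h rows have the series ½((1 - √x)^(-h) + (1 + √x)^(-h));
-- carrying it as `f` together with its difference `g` avoids √x. The closed forms are multiplied by
-- `K′ Δ′`, so that the only inverse ever needed is that of 1 - a.

-- Rings of formal power series in one and two variables.

module SeriesRings where

  open import Defs hiding (N; S; E; W; step)
  open import Level using (0ℓ)
  open import Algebra.Bundles using (CommutativeRing)
  open import Data.Nat using (ℕ; zero; suc; _∸_; _≤_; z≤n)
  import Data.Nat.Properties as ℕₚ
  open import Data.Integer using (ℤ; +_)
  import Data.Integer as ℤ
  import Data.Integer.Properties as ℤₚ
  open import Data.Product using (_,_)
  open import Relation.Binary.PropositionalEquality using (_≡_; refl; sym; trans; cong)
  open import Relation.Binary.Bundles using (Setoid)
  open import Function using (_∘_)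

  module PowerSeries (R : CommutativeRing 0ℓ 0ℓ) where

    open CommutativeRing R renaming (Carrier to A; refl to ≈-refl; sym to ≈-sym; trans to ≈-trans)
    open import Algebra.Properties.CommutativeSemigroup +-commutativeSemigroup using (interchange)
    open import Relation.Binary.Reasoning.Setoid setoid

    ∑ : ℕ → (ℕ → A) → A
    ∑ zero    f = f 0
    ∑ (suc n) f = ∑ n f + f (suc n)

    ∑-cong≤ : ∀ n {f g : ℕ → A} → (∀ k → k ≤ n → f k ≈ g k) → ∑ n f ≈ ∑ n g
    ∑-cong≤ zero    e = e 0 z≤n
    ∑-cong≤ (suc n) e = +-cong (∑-cong≤ n (λ k k≤n → e k (ℕₚ.m≤n⇒m≤1+n k≤n))) (e (suc n) ℕₚ.≤-refl)

    ∑-cong : ∀ n {f g : ℕ → A} → (∀ k → f k ≈ g k) → ∑ n f ≈ ∑ n g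
    ∑-cong n e = ∑-cong≤ n (λ k _ → e k)

    ∑-+ : ∀ n (f g : ℕ → A) → ∑ n (λ k → f k + g k) ≈ ∑ n f + ∑ n g
    ∑-+ zero    f g = ≈-refl
    ∑-+ (suc n) f g = ≈-trans (+-congʳ (∑-+ n f g)) (interchange _ _ _ _)

    ∑-*ˡ : ∀ n c (f : ℕ → A) → ∑ n (λ k → c * f k) ≈ c * ∑ n f
    ∑-*ˡ zero    c f = ≈-refl
    ∑-*ˡ (suc n) c f = ≈-trans (+-congʳ (∑-*ˡ n c f)) (≈-sym (distribˡ c _ _))

    ∑-0 : ∀ n → ∑ n (λ _ → 0#) ≈ 0#
    ∑-0 zero    = ≈-refl
    ∑-0 (suc n) = ≈-trans (+-identityʳ _) (∑-0 n)

    ∑-head : ∀ n (f : ℕ → A) → ∑ (suc n) f ≈ f 0 + ∑ n (f ∘ suc)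
    ∑-head zero    f = ≈-refl
    ∑-head (suc n) f = ≈-trans (+-congʳ (∑-head n f)) (+-assoc _ _ _)

    infix  4 _≋_
    infixl 7 _⊛_

    _≋_ : (ℕ → A) → (ℕ → A) → Set
    f ≋ g = ∀ n → f n ≈ g n

    _⊛_ : (ℕ → A) → (ℕ → A) → ℕ → A
    (f ⊛ g) n = ∑ n (λ k → f k * g (n ∸ k))

    one : ℕ → A
    one zero    = 1#
    one (suc _) = 0#

    ⊛-cong : ∀ {f f′ g g′} → f ≋ f′ → g ≋ g′ → f ⊛ g ≋ f′ ⊛ g′
    ⊛-cong p q n = ∑-cong n (λ k → *-cong (p k) (q (n ∸ k)))

    ⊛-suc : ∀ f g n → (f ⊛ g) (suc n) ≈ f 0 * g (suc n) + ((f ∘ suc) ⊛ g) n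
    ⊛-suc f g n = ∑-head n (λ k → f k * g (suc n ∸ k))

    ⊛-suc′ : ∀ f g n → (f ⊛ g) (suc n) ≈ (f ⊛ (g ∘ suc)) n + f (suc n) * g 0
    ⊛-suc′ f g n = +-cong
      (∑-cong≤ n (λ k k≤n → *-congˡ (reflexive (cong g (ℕₚ.+-∸-assoc 1 k≤n)))))
      (*-congˡ (reflexive (cong g (ℕₚ.n∸n≡0 n))))

    -- Peeling off the first term of one product and the last term of the other gives the same
    -- recursion, so the induction closes without reindexing a sum.
    ⊛-comm : ∀ f g → f ⊛ g ≋ g ⊛ f
    ⊛-comm f g zero    = *-comm _ _
    ⊛-comm f g (suc n) = begin
      (f ⊛ g) (suc n)                       ≈⟨ ⊛-suc f g n ⟩
      f 0 * g (suc n) + ((f ∘ suc) ⊛ g) n   ≈⟨ +-cong (*-comm _ _) (⊛-comm (f ∘ suc) g n) ⟩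
      g (suc n) * f 0 + (g ⊛ (f ∘ suc)) n   ≈⟨ +-comm _ _ ⟩
      (g ⊛ (f ∘ suc)) n + g (suc n) * f 0   ≈⟨ ⊛-suc′ g f n ⟨
      (g ⊛ f) (suc n)                       ∎

    ⊛-distribʳ : ∀ h f g → (λ n → f n + g n) ⊛ h ≋ (λ n → (f ⊛ h) n + (g ⊛ h) n)
    ⊛-distribʳ h f g n = ≈-trans (∑-cong n (λ k → distribʳ _ _ _)) (∑-+ n _ _)

    ⊛-scale : ∀ c f g → (λ n → c * f n) ⊛ g ≋ (λ n → c * (f ⊛ g) n)
    ⊛-scale c f g n = ≈-trans (∑-cong n (λ k → *-assoc _ _ _)) (∑-*ˡ n c _)

    ⊛-assoc : ∀ f g h → (f ⊛ g) ⊛ h ≋ f ⊛ (g ⊛ h)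
    ⊛-assoc f g h zero    = *-assoc _ _ _
    ⊛-assoc f g h (suc n) = begin
      ((f ⊛ g) ⊛ h) (suc n)
        ≈⟨ ⊛-suc (f ⊛ g) h n ⟩
      (f 0 * g 0) * h (suc n) + (((f ⊛ g) ∘ suc) ⊛ h) n
        ≈⟨ +-cong (*-assoc _ _ _) (⊛-cong {g = h} (⊛-suc f g) (λ _ → ≈-refl) n) ⟩
      f 0 * (g 0 * h (suc n)) + ((λ m → f 0 * g (suc m) + ((f ∘ suc) ⊛ g) m) ⊛ h) n
        ≈⟨ +-congˡ (⊛-distribʳ h (λ m → f 0 * g (suc m)) ((f ∘ suc) ⊛ g) n) ⟩
      f 0 * (g 0 * h (suc n)) + (((λ m → f 0 * g (suc m)) ⊛ h) n + (((f ∘ suc) ⊛ g) ⊛ h) n)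
        ≈⟨ +-congˡ (+-cong (⊛-scale (f 0) (g ∘ suc) h n) (⊛-assoc (f ∘ suc) g h n)) ⟩
      f 0 * (g 0 * h (suc n)) + (f 0 * ((g ∘ suc) ⊛ h) n + ((f ∘ suc) ⊛ (g ⊛ h)) n)
        ≈⟨ +-assoc _ _ _ ⟨
      (f 0 * (g 0 * h (suc n)) + f 0 * ((g ∘ suc) ⊛ h) n) + ((f ∘ suc) ⊛ (g ⊛ h)) n
        ≈⟨ +-congʳ (distribˡ _ _ _) ⟨
      f 0 * (g 0 * h (suc n) + ((g ∘ suc) ⊛ h) n) + ((f ∘ suc) ⊛ (g ⊛ h)) n
        ≈⟨ +-congʳ (*-congˡ (⊛-suc g h n)) ⟨
      f 0 * (g ⊛ h) (suc n) + ((f ∘ suc) ⊛ (g ⊛ h)) n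
        ≈⟨ ⊛-suc f (g ⊛ h) n ⟨
      (f ⊛ (g ⊛ h)) (suc n) ∎

    ⊛-identityˡ : ∀ f → one ⊛ f ≋ f
    ⊛-identityˡ f zero    = *-identityˡ _
    ⊛-identityˡ f (suc n) = begin
      (one ⊛ f) (suc n)                             ≈⟨ ⊛-suc one f n ⟩
      1# * f (suc n) + ((λ _ → 0#) ⊛ f) n           ≈⟨ +-cong (*-identityˡ _) (≈-trans (∑-cong n (λ _ → zeroˡ _)) (∑-0 n)) ⟩
      f (suc n) + 0#                                ≈⟨ +-identityʳ _ ⟩
      f (suc n)                                     ∎

    -- Any multiplication that agrees with the Cauchy product makes sequences a ring.
    ring-of : (_*′_ : (ℕ → A) → (ℕ → A) → ℕ → A) → (∀ f g → f *′ g ≋ f ⊛ g) →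
              (one′ : ℕ → A) → one′ ≋ one → CommutativeRing 0ℓ 0ℓ
    ring-of _*′_ *′≋ one′ one≋ = record
      { Carrier = ℕ → A ; _≈_ = _≋_ ; _+_ = λ f g n → f n + g n ; _*_ = _*′_
      ; -_ = λ f n → - f n ; 0# = λ _ → 0# ; 1# = one′
      ; isCommutativeRing = record
        { isRing = record
          { +-isAbelianGroup = record
            { isGroup = record
              { isMonoid = record
                { isSemigroup = record
                  { isMagma = record
                    { isEquivalence = record
                      { refl = λ _ → ≈-refl ; sym = λ p n → ≈-sym (p n) ; trans = λ p q n → ≈-trans (p n) (q n) }
                    ; ∙-cong = λ p q n → +-cong (p n) (q n) }
                  ; assoc = λ f g h n → +-assoc _ _ _ }
                ; identity = (λ f n → +-identityˡ _) , (λ f n → +-identityʳ _) }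
              ; inverse = (λ f n → -‿inverseˡ _) , (λ f n → -‿inverseʳ _)
              ; ⁻¹-cong = λ p n → -‿cong (p n) }
            ; comm = λ f g n → +-comm _ _ }
          ; *-cong = λ {f} {f′} {g} {g′} p q → *′-via {f} {g} {f′} {g′} (⊛-cong p q)
          ; *-assoc = λ f g h n → ≈-trans (*′≋ _ h n) (≈-trans (⊛-cong {g = h} (*′≋ f g) (λ _ → ≈-refl) n)
              (≈-trans (⊛-assoc f g h n) (≈-sym (≈-trans (*′≋ f _ n) (⊛-cong {f = f} (λ _ → ≈-refl) (*′≋ g h) n)))))
          ; *-identity = (λ f → idˡ f) , (λ f n → ≈-trans (*′-comm f one′ n) (idˡ f n))
          ; distrib = (λ f g h n → ≈-trans (*′-comm f _ n) (≈-trans (dʳ f g h n) (+-cong (*′-comm g f n) (*′-comm h f n))))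
                    , dʳ
          }
        ; *-comm = *′-comm } }
      where
      *′-via : ∀ {f g f′ g′} → f ⊛ g ≋ f′ ⊛ g′ → f *′ g ≋ f′ *′ g′
      *′-via {f} {g} {f′} {g′} e n = ≈-trans (*′≋ f g n) (≈-trans (e n) (≈-sym (*′≋ f′ g′ n)))
      *′-comm : ∀ f g → f *′ g ≋ g *′ f
      *′-comm f g = *′-via {f} {g} {g} {f} (⊛-comm f g)
      idˡ : ∀ f → one′ *′ f ≋ f
      idˡ f n = ≈-trans (*′≋ one′ f n) (≈-trans (⊛-cong {g = f} one≋ (λ _ → ≈-refl) n) (⊛-identityˡ f n))
      dʳ : ∀ f g h → (λ n → g n + h n) *′ f ≋ (λ n → (g *′ f) n + (h *′ f) n)
      dʳ f g h n = ≈-trans (*′≋ _ f n) (≈-trans (⊛-distribʳ f g h n) (≈-sym (+-cong (*′≋ g f n) (*′≋ h f n))))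

  module PSℤ = PowerSeries ℤₚ.+-*-commutativeRing

  sumTo≡∑ : ∀ n f → sumTo n f ≡ PSℤ.∑ n f
  sumTo≡∑ zero    f = refl
  sumTo≡∑ (suc n) f = cong (ℤ._+ f (suc n)) (sumTo≡∑ n f)

  Ser-ring : CommutativeRing 0ℓ 0ℓ
  Ser-ring = PSℤ.ring-of _*₁_ (λ f g n → sumTo≡∑ n _) (#₁ 1) λ { zero → refl ; (suc n) → refl }

  module PSSer = PowerSeries Ser-ring

  sumTo≡∑₂ : ∀ n (F : ℕ → Ser) j → sumTo n (λ a → F a j) ≡ PSSer.∑ n F j
  sumTo≡∑₂ zero    F j = refl
  sumTo≡∑₂ (suc n) F j = cong (ℤ._+ F (suc n) j) (sumTo≡∑₂ n F j)

  -- The construction is iterated: the coefficient of x^i is itself a series in y, and the double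
  -- sum in `_*₂_` is the Cauchy product over `Ser-ring`, read off at y^j.
  Ser₂-ring : CommutativeRing 0ℓ 0ℓ
  Ser₂-ring = PSSer.ring-of _*₂_ (λ f g n j → sumTo≡∑₂ n (λ k → f k *₁ g (n ∸ k)) j) (#₂ 1)
    λ { zero zero → refl ; zero (suc j) → refl ; (suc i) j → refl }

-- Closed forms for the linear system and for the sums over the counter.

module ClosedForms where

  open import Level using (0ℓ)
  open import Algebra.Bundles using (CommutativeRing)
  open import Algebra.Solver.Ring.AlmostCommutativeRing using (fromCommutativeRing; _-Raw-AlmostCommutative⟶_)
  import Algebra.Solver.Ring
  open import Data.Integer using (ℤ; +_)
  import Data.Integer as ℤ
  open import Data.Nat using (ℕ; suc)
  open import Data.Maybe using (just; nothing)
  open import Relation.Nullary using (yes; no)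
  open import Relation.Binary.Definitions using (WeaklyDecidable)
  open import Relation.Binary.PropositionalEquality using (_≡_)
  import Relation.Binary.PropositionalEquality as ≡

  -- Polynomial expressions over arbitrary operations, so that the same definitions
  -- serve as ring elements and as input to the ring solver.
  module Poly {C : Set} (_+_ _*_ _-_ : C → C → C) (κ : ℤ → C) where

    infixl 6 _⊕_ _⊖_
    infixl 7 _⊗_
    _⊕_ _⊗_ _⊖_ : C → C → C
    _⊕_ = _+_
    _⊗_ = _*_
    _⊖_ = _-_

    I : C
    I = κ (+ 1)

    -- The trailing factor `I` makes this unfold to the same term as the exponent 2 of `_^₁_` and
    -- `_^₂_`.
    sq : C → C
    sq a = a ⊗ (a ⊗ I)

    module _ (x y : C) where

      -- In the notation of the next comment, `P₀` and `u` are the two coordinates of the product w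
      -- m = P₀ + q u, reduced by q² = x. `Δ′` and `K′` are the denominators of the bivariate
      -- formula.
      u m₀ P₀ Δ′ K′ : C
      u  = I ⊖ x ⊖ y
      m₀ = I ⊕ x ⊖ y
      P₀ = (I ⊖ y) ⊗ m₀ ⊖ κ (+ 2) ⊗ x
      Δ′ = sq u ⊖ κ (+ 4) ⊗ x ⊗ y
      K′ = sq u ⊖ x ⊗ y

      -- The part of each closed form that is linear in f = f(h) and g = f(h) - f(h-1).  In terms of
      -- q with q² = x and q f = g it is a multiple of f: with w = 1 - y - q, m = 1 + x - y + 2q and
      -- v = w - x(1 - q) the factors are x y² w m, x y w² m, x w v m, x (1 - q) v m and x y² q w m.
      stQB stC stQA stWA stT : C → C → C
      stQB f g = x ⊗ y ⊗ y ⊗ (P₀ ⊗ f ⊕ u ⊗ g)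
      stC  f g = x ⊗ y ⊗ (((I ⊖ y) ⊗ P₀ ⊖ x ⊗ u) ⊗ f ⊕ ((I ⊖ y) ⊗ u ⊖ P₀) ⊗ g)
      stQA f g = x ⊗ ((u ⊗ P₀ ⊖ (I ⊖ x) ⊗ u ⊗ x) ⊗ f ⊕ (u ⊗ u ⊖ (I ⊖ x) ⊗ P₀) ⊗ g)
      stWA f g = x ⊗ ((c₀ ⊖ x ⊗ c₁) ⊗ f ⊕ (c₁ ⊖ c₀) ⊗ g)
        where
        c₀ c₁ : C
        c₀ = u ⊗ m₀ ⊖ κ (+ 2) ⊗ x ⊗ (I ⊖ x)
        c₁ = κ (+ 2) ⊗ u ⊖ (I ⊖ x) ⊗ m₀
      stT f g = x ⊗ y ⊗ y ⊗ (x ⊗ u ⊗ f ⊕ P₀ ⊗ g)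

    -- The coefficients of z^h up to the factor - d² u, where z = 1/(1 - a) is a root of the kernel
    -- of the system, a = x + d and b = y + d.
    zzQB zzC zzQA zzWA zzT : C → C → C
    zzQB a b = (I ⊖ b) ⊗ ((I ⊖ a) ⊗ (I ⊖ a))
    zzC  a b = a ⊗ (I ⊖ b) ⊗ (I ⊖ a)
    zzQA a b = a ⊗ (I ⊖ b)
    zzWA a b = a
    zzT  a b = (I ⊖ b) ⊗ zzQB a b

  ℤ-hom : CommutativeRing 0ℓ 0ℓ → Set
  ℤ-hom R = ℤ.+-*-rawRing -Raw-AlmostCommutative⟶ fromCommutativeRing R

  module Closed (R : CommutativeRing 0ℓ 0ℓ) (hom : ℤ-hom R) where

    open CommutativeRing R
    open _-Raw-AlmostCommutative⟶_ hom using (⟦_⟧) public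
    open import Relation.Binary.Reasoning.Setoid setoid

    ≟ᶜ : WeaklyDecidable (λ a b → ⟦ a ⟧ ≈ ⟦ b ⟧)
    ≟ᶜ a b with a ℤ.≟ b
    ... | yes ≡.refl = just refl
    ... | no _     = nothing

    module Sv = Algebra.Solver.Ring ℤ.+-*-rawRing (fromCommutativeRing R) hom ≟ᶜ
    open Sv using (solve; _:=_; Polynomial) public

    module T = Poly _+_ _*_ _-_ ⟦_⟧
    module Q {n : ℕ} = Poly {Polynomial n} Sv._:+_ Sv._:*_ Sv._:-_ Sv.con
    open Q using (_⊕_; _⊗_; _⊖_; I)

    stQB-eq : ∀ x y f g → T.stQB x y f g ≈ y * T.stQB x y f g + y * T.stC x y f g + T.stT x y f g
    stQB-eq = solve 4 (λ x y f g → Q.stQB x y f g := y ⊗ Q.stQB x y f g ⊕ y ⊗ Q.stC x y f g ⊕ Q.stT x y f g) refl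

    stC-eq : ∀ x y f g → T.stC x y f g ≈ x * T.stC x y f g + x * T.stQB x y f g + y * T.stQA x y f g
    stC-eq = solve 4 (λ x y f g → Q.stC x y f g := x ⊗ Q.stC x y f g ⊕ x ⊗ Q.stQB x y f g ⊕ y ⊗ Q.stQA x y f g) refl

    stQA-eq : ∀ x y f g → T.stQA x y f g ≈ T.stC x y f g + x * T.stWA x y f g + T.K′ x y * T.Δ′ x y * (x * f)
    stQA-eq = solve 4 (λ x y f g → Q.stQA x y f g := Q.stC x y f g ⊕ x ⊗ Q.stWA x y f g ⊕ Q.K′ x y ⊗ Q.Δ′ x y ⊗ (x ⊗ f)) refl

    -- Here (f , g) belongs to height h + 1. The pair at height h is (f - g , g - x f), so a
    -- relation between neighbouring heights becomes a polynomial identity in `f` and `g`.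
    stWA-eq : ∀ x y f g → T.stWA x y (f - g) (g - x * f) ≈ T.stQA x y (f - g) (g - x * f) + y * T.stWA x y f g
    stWA-eq = solve 4 (λ x y f g → Q.stWA x y (f ⊖ g) (g ⊖ x ⊗ f) := Q.stQA x y (f ⊖ g) (g ⊖ x ⊗ f) ⊕ y ⊗ Q.stWA x y f g) refl

    stT-eq : ∀ x y f g → T.stT x y f g ≈ T.stT x y (f - g) (g - x * f) + x * T.stQB x y f g
    stT-eq = solve 4 (λ x y f g → Q.stT x y f g := Q.stT x y (f ⊖ g) (g ⊖ x ⊗ f) ⊕ x ⊗ Q.stQB x y f g) refl

    module Root (x y d : Carrier) (d-root : d ≈ (x + d) * (y + d)) where

      open T using (u; Δ′; K′; P₀; stQB; stC; stQA; stWA; stT; zzQB; zzC; zzQA; zzWA; zzT)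

      a b γ 𝟙 : Carrier
      a = x + d
      b = y + d
      𝟙 = ⟦ + 1 ⟧
      γ = d * d * u x y

      -- Since d = ab, both variables factor in terms of `a` and `b`. This rational parametrisation
      -- turns the kernel relations below into polynomial identities.
      x≈ : x ≈ a * (𝟙 - b)
      x≈ = begin
        x                        ≈⟨ solve 2 (λ x d → x := (x ⊕ d) ⊖ d) refl x d ⟩
        (x + d) - d              ≈⟨ +-congˡ (-‿cong d-root) ⟩
        (x + d) - a * b          ≈⟨ solve 2 (λ a b → a ⊖ a ⊗ b := a ⊗ (I ⊖ b)) refl a b ⟩
        a * (𝟙 - b)              ∎

      y≈ : y ≈ b * (𝟙 - a)
      y≈ = begin
        y                        ≈⟨ solve 2 (λ y d → y := (y ⊕ d) ⊖ d) refl y d ⟩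
        (y + d) - d              ≈⟨ +-congˡ (-‿cong d-root) ⟩
        (y + d) - a * b          ≈⟨ solve 2 (λ a b → b ⊖ a ⊗ b := b ⊗ (I ⊖ a)) refl a b ⟩
        b * (𝟙 - a)              ∎

      d² : d * d ≈ u x y * d - x * y
      d² = begin
        d * d
          ≈⟨ solve 3 (λ x y d → d ⊗ d := u′ x y ⊗ d ⊖ x ⊗ y ⊕ ((x ⊕ d) ⊗ (y ⊕ d) ⊖ d)) refl x y d ⟩
        u x y * d - x * y + (a * b - d)
          ≈⟨ +-congˡ (trans (+-congʳ (sym d-root)) (-‿inverseʳ d)) ⟩
        u x y * d - x * y + 0#
          ≈⟨ +-identityʳ _ ⟩
        u x y * d - x * y ∎
        where u′ = Q.u

      zQB-eq : zzQB a b ≈ y * zzQB a b + y * zzC a b + zzT a b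
      zQB-eq = trans
        (solve 2 (λ a b → Q.zzQB a b := b ⊗ (I ⊖ a) ⊗ Q.zzQB a b ⊕ b ⊗ (I ⊖ a) ⊗ Q.zzC a b ⊕ Q.zzT a b) refl a b)
        (+-congʳ (+-cong (*-congʳ (sym y≈)) (*-congʳ (sym y≈))))

      zC-eq : zzC a b ≈ x * zzC a b + x * zzQB a b + y * zzQA a b
      zC-eq = trans
        (solve 2 (λ a b → Q.zzC a b := a ⊗ (I ⊖ b) ⊗ Q.zzC a b ⊕ a ⊗ (I ⊖ b) ⊗ Q.zzQB a b ⊕ b ⊗ (I ⊖ a) ⊗ Q.zzQA a b) refl a b)
        (+-cong (+-cong (*-congʳ (sym x≈)) (*-congʳ (sym x≈))) (*-congʳ (sym y≈)))

      zQA-eq : zzQA a b ≈ zzC a b + x * zzWA a b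
      zQA-eq = trans
        (solve 2 (λ a b → Q.zzQA a b := Q.zzC a b ⊕ a ⊗ (I ⊖ b) ⊗ Q.zzWA a b) refl a b)
        (+-congˡ (*-congʳ (sym x≈)))

      zWA-eq : zzWA a b * (𝟙 - a) ≈ zzQA a b * (𝟙 - a) + y * zzWA a b
      zWA-eq = trans
        (solve 2 (λ a b → Q.zzWA a b ⊗ (I ⊖ a) := Q.zzQA a b ⊗ (I ⊖ a) ⊕ b ⊗ (I ⊖ a) ⊗ Q.zzWA a b) refl a b)
        (+-congˡ (*-congʳ (sym y≈)))

      zT-eq : zzT a b ≈ zzT a b * (𝟙 - a) + x * zzQB a b
      zT-eq = trans
        (solve 2 (λ a b → Q.zzT a b := Q.zzT a b ⊗ (I ⊖ a) ⊕ a ⊗ (I ⊖ b) ⊗ Q.zzQB a b) refl a b)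
        (+-congˡ (*-congʳ (sym x≈)))

      -- The condition T 0 = 0 determines the multiple `γ` of the kernel solution. At height 0 the
      -- stack part is x²y²u, and d² = a²b² supplies the factors that complete `zzT` to x²y².
      zT-init : γ * zzT a b ≈ stT x y 𝟙 ⟦ + 0 ⟧
      zT-init = begin
        d * d * u x y * zzT a b
          ≈⟨ *-congʳ (*-congʳ (*-cong d-root d-root)) ⟩
        a * b * (a * b) * u x y * zzT a b
          ≈⟨ solve 3 (λ a b u → a ⊗ b ⊗ (a ⊗ b) ⊗ u ⊗ Q.zzT a b :=
               a ⊗ (I ⊖ b) ⊗ (b ⊗ (I ⊖ a)) ⊗ (b ⊗ (I ⊖ a)) ⊗ (a ⊗ (I ⊖ b) ⊗ u)) refl a b (u x y) ⟩
        a * (𝟙 - b) * (b * (𝟙 - a)) * (b * (𝟙 - a)) * (a * (𝟙 - b) * u x y)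
          ≈⟨ *-cong (*-cong (*-cong x≈ y≈) y≈) (*-congʳ x≈) ⟨
        x * y * y * (x * u x y)
          ≈⟨ solve 4 (λ x y u p → x ⊗ y ⊗ y ⊗ (x ⊗ u) := x ⊗ y ⊗ y ⊗ (x ⊗ u ⊗ I ⊕ p ⊗ Sv.con (+ 0))) refl x y (u x y) (P₀ x y) ⟩
        stT x y 𝟙 ⟦ + 0 ⟧ ∎

      -- The recurrences run downwards, from h + 1 to h, because in that direction all three are
      -- polynomial; upwards, `ζ` would need the inverse of 1 - a.
      module Sequences (f g ζ : ℕ → Carrier)
        (f-eq : ∀ h → f h ≈ f (suc h) - g (suc h)) (g-eq : ∀ h → g h ≈ g (suc h) - x * f (suc h))
        (ζ-eq : ∀ h → ζ h ≈ (𝟙 - a) * ζ (suc h))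
        (f₀ : f 0 ≈ 𝟙) (g₀ : g 0 ≈ ⟦ + 0 ⟧) (ζ₀ : ζ 0 ≈ 𝟙) where

        nQB nC nQA nWA nT : ℕ → Carrier
        nQB h = stQB x y (f h) (g h) - γ * (zzQB a b * ζ h)
        nC  h = stC  x y (f h) (g h) - γ * (zzC  a b * ζ h)
        nQA h = stQA x y (f h) (g h) - γ * (zzQA a b * ζ h)
        nWA h = stWA x y (f h) (g h) - γ * (zzWA a b * ζ h)
        nT  h = stT  x y (f h) (g h) - γ * (zzT  a b * ζ h)

        nQB-eq : ∀ h → nQB h ≈ y * nQB h + y * nC h + nT h
        nQB-eq h = begin
          nQB h
            ≈⟨ +-cong (stQB-eq x y (f h) (g h)) (-‿cong (*-congˡ (*-congʳ zQB-eq))) ⟩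
          (y * s₁ + y * s₂ + s₃) - γ * ((y * z₁ + y * z₂ + z₃) * ζ h)
            ≈⟨ solve 9 (λ y s₁ s₂ s₃ z₁ z₂ z₃ c w → (y ⊗ s₁ ⊕ y ⊗ s₂ ⊕ s₃) ⊖ c ⊗ ((y ⊗ z₁ ⊕ y ⊗ z₂ ⊕ z₃) ⊗ w) :=
                 y ⊗ (s₁ ⊖ c ⊗ (z₁ ⊗ w)) ⊕ y ⊗ (s₂ ⊖ c ⊗ (z₂ ⊗ w)) ⊕ (s₃ ⊖ c ⊗ (z₃ ⊗ w))) refl
                 y s₁ s₂ s₃ z₁ z₂ z₃ γ (ζ h) ⟩
          y * nQB h + y * nC h + nT h ∎
          where
          s₁ = stQB x y (f h) (g h)
          s₂ = stC x y (f h) (g h)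
          s₃ = stT x y (f h) (g h)
          z₁ = zzQB a b
          z₂ = zzC a b
          z₃ = zzT a b

        nC-eq : ∀ h → nC h ≈ x * nC h + x * nQB h + y * nQA h
        nC-eq h = begin
          nC h
            ≈⟨ +-cong (stC-eq x y (f h) (g h)) (-‿cong (*-congˡ (*-congʳ zC-eq))) ⟩
          (x * s₁ + x * s₂ + y * s₃) - γ * ((x * z₁ + x * z₂ + y * z₃) * ζ h)
            ≈⟨ solve 10 (λ x y s₁ s₂ s₃ z₁ z₂ z₃ c w → (x ⊗ s₁ ⊕ x ⊗ s₂ ⊕ y ⊗ s₃) ⊖ c ⊗ ((x ⊗ z₁ ⊕ x ⊗ z₂ ⊕ y ⊗ z₃) ⊗ w) :=
                 x ⊗ (s₁ ⊖ c ⊗ (z₁ ⊗ w)) ⊕ x ⊗ (s₂ ⊖ c ⊗ (z₂ ⊗ w)) ⊕ y ⊗ (s₃ ⊖ c ⊗ (z₃ ⊗ w))) refl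
                 x y s₁ s₂ s₃ z₁ z₂ z₃ γ (ζ h) ⟩
          x * nC h + x * nQB h + y * nQA h ∎
          where
          s₁ = stC x y (f h) (g h)
          s₂ = stQB x y (f h) (g h)
          s₃ = stQA x y (f h) (g h)
          z₁ = zzC a b
          z₂ = zzQB a b
          z₃ = zzQA a b

        nQA-eq : ∀ h → nQA h ≈ nC h + x * nWA h + K′ x y * Δ′ x y * (x * f h)
        nQA-eq h = begin
          nQA h
            ≈⟨ +-cong (stQA-eq x y (f h) (g h)) (-‿cong (*-congˡ (*-congʳ zQA-eq))) ⟩
          (s₁ + x * s₂ + s₃) - γ * ((z₁ + x * z₂) * ζ h)
            ≈⟨ solve 8 (λ x s₁ s₂ s₃ z₁ z₂ c w → (s₁ ⊕ x ⊗ s₂ ⊕ s₃) ⊖ c ⊗ ((z₁ ⊕ x ⊗ z₂) ⊗ w) :=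
                 (s₁ ⊖ c ⊗ (z₁ ⊗ w)) ⊕ x ⊗ (s₂ ⊖ c ⊗ (z₂ ⊗ w)) ⊕ s₃) refl
                 x s₁ s₂ s₃ z₁ z₂ γ (ζ h) ⟩
          nC h + x * nWA h + s₃ ∎
          where
          s₁ = stC x y (f h) (g h)
          s₂ = stWA x y (f h) (g h)
          s₃ = K′ x y * Δ′ x y * (x * f h)
          z₁ = zzC a b
          z₂ = zzWA a b

        st-shift : (st : Carrier → Carrier → Carrier) → (∀ {p q r s} → p ≈ q → r ≈ s → st p r ≈ st q s) →
          ∀ h → st (f h) (g h) ≈ st (f (suc h) - g (suc h)) (g (suc h) - x * f (suc h))
        st-shift st st-cong h = st-cong (f-eq h) (g-eq h)

        lin-cong : ∀ {k₁ k₂ k₃ p q r s} → p ≈ q → r ≈ s → k₁ * (k₂ * p + k₃ * r) ≈ k₁ * (k₂ * q + k₃ * s)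
        lin-cong e e′ = *-congˡ (+-cong (*-congˡ e) (*-congˡ e′))

        nWA-eq : ∀ h → nWA h ≈ nQA h + y * nWA (suc h)
        nWA-eq h = begin
          nWA h
            ≈⟨ +-cong (trans (st-shift (stWA x y) lin-cong h) (trans (stWA-eq x y (f (suc h)) (g (suc h)))
                 (+-congʳ (sym (st-shift (stQA x y) lin-cong h)))))
                 (-‿cong (*-congˡ (trans (*-congˡ (ζ-eq h)) (trans (sym (*-assoc _ _ _)) (*-congʳ zWA-eq))))) ⟩
          (s₁ + y * s₂) - γ * ((z₁ * (𝟙 - a) + y * z₂) * ζ (suc h))
            ≈⟨ solve 8 (λ y s₁ s₂ z₁ z₂ c w o → (s₁ ⊕ y ⊗ s₂) ⊖ c ⊗ ((z₁ ⊗ o ⊕ y ⊗ z₂) ⊗ w) :=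
                 (s₁ ⊖ c ⊗ (z₁ ⊗ (o ⊗ w))) ⊕ y ⊗ (s₂ ⊖ c ⊗ (z₂ ⊗ w))) refl
                 y s₁ s₂ z₁ z₂ γ (ζ (suc h)) (𝟙 - a) ⟩
          (s₁ - γ * (z₁ * ((𝟙 - a) * ζ (suc h)))) + y * nWA (suc h)
            ≈⟨ +-congʳ (+-congˡ (-‿cong (*-congˡ (*-congˡ (sym (ζ-eq h)))))) ⟩
          nQA h + y * nWA (suc h) ∎
          where
          s₁ = stQA x y (f h) (g h)
          s₂ = stWA x y (f (suc h)) (g (suc h))
          z₁ = zzQA a b
          z₂ = zzWA a b

        nT-suc : ∀ h → nT (suc h) ≈ nT h + x * nQB (suc h)
        nT-suc h = begin
          nT (suc h)
            ≈⟨ +-cong (trans (stT-eq x y (f (suc h)) (g (suc h))) (+-congʳ (sym (st-shift (stT x y) lin-cong h))))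
                 (-‿cong (*-congˡ (*-congʳ zT-eq))) ⟩
          (s₁ + x * s₂) - γ * ((z₁ * (𝟙 - a) + x * z₂) * ζ (suc h))
            ≈⟨ solve 8 (λ x s₁ s₂ z₁ z₂ c w o → (s₁ ⊕ x ⊗ s₂) ⊖ c ⊗ ((z₁ ⊗ o ⊕ x ⊗ z₂) ⊗ w) :=
                 (s₁ ⊖ c ⊗ (z₁ ⊗ (o ⊗ w))) ⊕ x ⊗ (s₂ ⊖ c ⊗ (z₂ ⊗ w))) refl
                 x s₁ s₂ z₁ z₂ γ (ζ (suc h)) (𝟙 - a) ⟩
          (s₁ - γ * (z₁ * ((𝟙 - a) * ζ (suc h)))) + x * nQB (suc h)
            ≈⟨ +-congʳ (+-congˡ (-‿cong (*-congˡ (*-congˡ (sym (ζ-eq h)))))) ⟩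
          nT h + x * nQB (suc h) ∎
          where
          s₁ = stT x y (f h) (g h)
          s₂ = stQB x y (f (suc h)) (g (suc h))
          z₁ = zzT a b
          z₂ = zzQB a b

        nT-zero : nT 0 ≈ ⟦ + 0 ⟧
        nT-zero = begin
          nT 0
            ≈⟨ +-cong (lin-cong f₀ g₀) (-‿cong (*-congˡ (*-congˡ ζ₀))) ⟩
          stT x y 𝟙 ⟦ + 0 ⟧ - γ * (zzT a b * 𝟙)
            ≈⟨ solve 3 (λ s c z → s ⊖ c ⊗ (z ⊗ I) := s ⊖ c ⊗ z) refl (stT x y 𝟙 ⟦ + 0 ⟧) γ (zzT a b) ⟩
          stT x y 𝟙 ⟦ + 0 ⟧ - γ * zzT a b
            ≈⟨ +-congˡ (-‿cong zT-init) ⟩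
          stT x y 𝟙 ⟦ + 0 ⟧ - stT x y 𝟙 ⟦ + 0 ⟧
            ≈⟨ solve 1 (λ s → s ⊖ s := Sv.con (+ 0)) refl (stT x y 𝟙 ⟦ + 0 ⟧) ⟩
          ⟦ + 0 ⟧ ∎

      -- ff, fg, gg, fz and gz stand for the sums of y^h times f f, f g, g g, f ζ and g ζ at h + 1.
      module Final (ff fg gg fz gz sq : Carrier)
        (ff-eq : 𝟙 + y * ff ≈ ff - ⟦ + 2 ⟧ * fg + gg)
        (fg-eq : y * fg ≈ (𝟙 + x) * fg - x * ff - gg)
        (gg-eq : y * gg ≈ gg - ⟦ + 2 ⟧ * x * fg + x * x * ff)
        (fz-eq : 𝟙 + y * fz ≈ (𝟙 - a) * (fz - gz))
        (gz-eq : y * gz ≈ (𝟙 - a) * (gz - x * fz))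
        (sq-eq : K′ x y * Δ′ x y * sq ≈ x * y * y * (P₀ x y * ff + u x y * fg) - γ * (zzQB a b * fz)) where

        zero-difference : ∀ {p q} → p ≈ q → q - p ≈ ⟦ + 0 ⟧
        zero-difference {p} {q} e = trans (+-congʳ (sym e)) (solve 1 (λ p → p ⊖ p := Sv.con (+ 0)) refl p)

        -- Cramer's rule: the three hypotheses are a linear system for `ff`, `fg`, `gg` with
        -- determinant `u Δ′`, and the multipliers of the equations are the cofactors of the first
        -- column. For `uΔfg` they are those of the second.
        uΔff : u x y * Δ′ x y * ff ≈ P₀ x y
        uΔff = begin
          u x y * Δ′ x y * ff
            ≈⟨ solve 5 (λ x y ff fg gg → Q.u x y ⊗ Q.Δ′ x y ⊗ ff :=
                 Q.P₀ x y ⊕ Q.P₀ x y ⊗ (ff ⊖ Sv.con (+ 2) ⊗ fg ⊕ gg ⊖ (I ⊕ y ⊗ ff))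
                   ⊕ Sv.con (+ 2) ⊗ Q.u x y ⊗ ((I ⊕ x) ⊗ fg ⊖ x ⊗ ff ⊖ gg ⊖ y ⊗ fg)
                   ⊕ (I ⊖ x ⊕ y) ⊗ (gg ⊖ Sv.con (+ 2) ⊗ x ⊗ fg ⊕ x ⊗ x ⊗ ff ⊖ y ⊗ gg)) refl x y ff fg gg ⟩
          P₀ x y + P₀ x y * _ + ⟦ + 2 ⟧ * u x y * _ + (𝟙 - x + y) * _
            ≈⟨ +-cong (+-cong (+-congˡ (*-congˡ (zero-difference ff-eq))) (*-congˡ (zero-difference fg-eq))) (*-congˡ (zero-difference gg-eq)) ⟩
          P₀ x y + P₀ x y * ⟦ + 0 ⟧ + ⟦ + 2 ⟧ * u x y * ⟦ + 0 ⟧ + (𝟙 - x + y) * ⟦ + 0 ⟧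
            ≈⟨ solve 3 (λ p q r → p ⊕ p ⊗ o ⊕ q ⊗ o ⊕ r ⊗ o := p) refl (P₀ x y) (⟦ + 2 ⟧ * u x y) (𝟙 - x + y) ⟩
          P₀ x y ∎
          where
          o : ∀ {n} → Polynomial n
          o = Sv.con (+ 0)

        uΔfg : u x y * Δ′ x y * fg ≈ x * u x y
        uΔfg = begin
          u x y * Δ′ x y * fg
            ≈⟨ solve 5 (λ x y ff fg gg → Q.u x y ⊗ Q.Δ′ x y ⊗ fg :=
                 x ⊗ Q.u x y ⊕ x ⊗ Q.u x y ⊗ (ff ⊖ Sv.con (+ 2) ⊗ fg ⊕ gg ⊖ (I ⊕ y ⊗ ff))
                   ⊕ ((I ⊖ y) ⊗ (I ⊖ y) ⊖ x ⊗ x) ⊗ ((I ⊕ x) ⊗ fg ⊖ x ⊗ ff ⊖ gg ⊖ y ⊗ fg)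
                   ⊕ Q.u x y ⊗ (gg ⊖ Sv.con (+ 2) ⊗ x ⊗ fg ⊕ x ⊗ x ⊗ ff ⊖ y ⊗ gg)) refl x y ff fg gg ⟩
          x * u x y + x * u x y * _ + ((𝟙 - y) * (𝟙 - y) - x * x) * _ + u x y * _
            ≈⟨ +-cong (+-cong (+-congˡ (*-congˡ (zero-difference ff-eq))) (*-congˡ (zero-difference fg-eq))) (*-congˡ (zero-difference gg-eq)) ⟩
          x * u x y + x * u x y * ⟦ + 0 ⟧ + ((𝟙 - y) * (𝟙 - y) - x * x) * ⟦ + 0 ⟧ + u x y * ⟦ + 0 ⟧
            ≈⟨ solve 3 (λ p q r → p ⊕ p ⊗ o ⊕ q ⊗ o ⊕ r ⊗ o := p) refl (x * u x y) ((𝟙 - y) * (𝟙 - y) - x * x) (u x y) ⟩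
          x * u x y ∎
          where
          o : ∀ {n} → Polynomial n
          o = Sv.con (+ 0)

        -- The second equation says gz = a fz up to the factor 1 - b, and then the first one gives
        -- fz = 1 / ((1 - a)(1 - a - b)). The factor 1 - b is kept on both sides in order to avoid a
        -- division.
        fz-closed : (𝟙 - a) * (𝟙 - b) * (𝟙 - a - b) * fz ≈ 𝟙 - b
        fz-closed = begin
          (𝟙 - a) * (𝟙 - b) * (𝟙 - a - b) * fz
            ≈⟨ solve 4 (λ a b fz gz → (I ⊖ a) ⊗ (I ⊖ b) ⊗ (I ⊖ a ⊖ b) ⊗ fz :=
                 (I ⊖ b) ⊕ (I ⊖ b) ⊗ ((I ⊖ a) ⊗ (fz ⊖ gz) ⊖ (I ⊕ b ⊗ (I ⊖ a) ⊗ fz))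
                   ⊕ ((I ⊖ a) ⊗ (gz ⊖ a ⊗ (I ⊖ b) ⊗ fz) ⊖ b ⊗ (I ⊖ a) ⊗ gz)) refl a b fz gz ⟩
          (𝟙 - b) + (𝟙 - b) * ((𝟙 - a) * (fz - gz) - (𝟙 + b * (𝟙 - a) * fz))
                  + ((𝟙 - a) * (gz - a * (𝟙 - b) * fz) - b * (𝟙 - a) * gz)
            ≈⟨ +-cong (+-congˡ (*-congˡ (zero-difference (trans (+-congˡ (*-congʳ (sym y≈))) fz-eq))))
                      (zero-difference (trans (*-congʳ (sym y≈)) (trans gz-eq (*-congˡ (+-congˡ (-‿cong (*-congʳ x≈))))))) ⟩
          (𝟙 - b) + (𝟙 - b) * ⟦ + 0 ⟧ + ⟦ + 0 ⟧
            ≈⟨ solve 1 (λ b → b ⊕ b ⊗ Sv.con (+ 0) ⊕ Sv.con (+ 0) := b) refl (𝟙 - b) ⟩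
          𝟙 - b ∎

        d[u-2d] : (u x y - ⟦ + 2 ⟧ * d) * d ≈ ⟦ + 2 ⟧ * (x * y) - u x y * d
        d[u-2d] = begin
          (u x y - ⟦ + 2 ⟧ * d) * d             ≈⟨ solve 2 (λ u d → (u ⊖ Sv.con (+ 2) ⊗ d) ⊗ d := u ⊗ d ⊖ Sv.con (+ 2) ⊗ (d ⊗ d)) refl (u x y) d ⟩
          u x y * d - ⟦ + 2 ⟧ * (d * d)         ≈⟨ +-congˡ (-‿cong (*-congˡ d²)) ⟩
          u x y * d - ⟦ + 2 ⟧ * (u x y * d - x * y)
            ≈⟨ solve 3 (λ u d p → u ⊗ d ⊖ Sv.con (+ 2) ⊗ (u ⊗ d ⊖ p) := Sv.con (+ 2) ⊗ p ⊖ u ⊗ d) refl (u x y) d (x * y) ⟩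
          ⟦ + 2 ⟧ * (x * y) - u x y * d ∎

        δ≈ : 𝟙 - a - b ≈ u x y - ⟦ + 2 ⟧ * d
        δ≈ = solve 3 (λ x y d → I ⊖ (x ⊕ d) ⊖ (y ⊕ d) := Q.u x y ⊖ Sv.con (+ 2) ⊗ d) refl x y d

        -- So 1 - a - b plays the role of the square root in the formula for d.
        Δ≈ : Δ′ x y ≈ (𝟙 - a - b) * (𝟙 - a - b)
        Δ≈ = begin
          Δ′ x y
            ≈⟨ solve 3 (λ x y d → Q.Δ′ x y := (I ⊖ (x ⊕ d) ⊖ (y ⊕ d)) ⊗ (I ⊖ (x ⊕ d) ⊖ (y ⊕ d))
                 ⊕ Sv.con (+ 4) ⊗ (d ⊖ (x ⊕ d) ⊗ (y ⊕ d))) refl x y d ⟩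
          (𝟙 - a - b) * (𝟙 - a - b) + ⟦ + 4 ⟧ * (d - a * b)
            ≈⟨ +-congˡ (*-congˡ (zero-difference (sym d-root))) ⟩
          (𝟙 - a - b) * (𝟙 - a - b) + ⟦ + 4 ⟧ * ⟦ + 0 ⟧
            ≈⟨ solve 1 (λ e → e ⊕ Sv.con (+ 4) ⊗ Sv.con (+ 0) := e) refl ((𝟙 - a - b) * (𝟙 - a - b)) ⟩
          (𝟙 - a - b) * (𝟙 - a - b) ∎

        -- One of the two factors 1 - a - b cancels the denominator of `fz`; the other meets a
        -- factor `d` and is reduced by `d[u-2d]`. The result is therefore linear in `d`.
        Δγfz : Δ′ x y * (γ * (zzQB a b * fz)) ≈ x * y * u x y * (⟦ + 2 ⟧ * (x * y) - u x y * d)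
        Δγfz = begin
          Δ′ x y * (γ * (zzQB a b * fz))
            ≈⟨ *-congʳ Δ≈ ⟩
          (𝟙 - a - b) * (𝟙 - a - b) * (γ * (zzQB a b * fz))
            ≈⟨ solve 4 (λ a b c fz → (I ⊖ a ⊖ b) ⊗ (I ⊖ a ⊖ b) ⊗ (c ⊗ (Q.zzQB a b ⊗ fz)) :=
                 (I ⊖ a ⊖ b) ⊗ c ⊗ (I ⊖ a) ⊗ ((I ⊖ a) ⊗ (I ⊖ b) ⊗ (I ⊖ a ⊖ b) ⊗ fz)) refl a b γ fz ⟩
          (𝟙 - a - b) * γ * (𝟙 - a) * ((𝟙 - a) * (𝟙 - b) * (𝟙 - a - b) * fz)
            ≈⟨ *-congˡ fz-closed ⟩
          (𝟙 - a - b) * (d * d * u x y) * (𝟙 - a) * (𝟙 - b)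
            ≈⟨ *-congʳ (*-congʳ (*-congˡ (*-congʳ (*-congˡ d-root)))) ⟩
          (𝟙 - a - b) * (d * (a * b) * u x y) * (𝟙 - a) * (𝟙 - b)
            ≈⟨ solve 5 (λ a b d u s → s ⊗ (d ⊗ (a ⊗ b) ⊗ u) ⊗ (I ⊖ a) ⊗ (I ⊖ b) :=
                 a ⊗ (I ⊖ b) ⊗ (b ⊗ (I ⊖ a)) ⊗ u ⊗ (s ⊗ d)) refl a b d (u x y) (𝟙 - a - b) ⟩
          a * (𝟙 - b) * (b * (𝟙 - a)) * u x y * ((𝟙 - a - b) * d)
            ≈⟨ *-cong (*-congʳ (*-cong (sym x≈) (sym y≈))) (trans (*-congʳ δ≈) d[u-2d]) ⟩
          x * y * u x y * (⟦ + 2 ⟧ * (x * y) - u x y * d) ∎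

        total : Carrier
        total = x * y * ((𝟙 - x) * ff + ⟦ + 2 ⟧ * sq)

        rhs : Carrier
        rhs = ⟦ + 2 ⟧ * T.sq x * T.sq y * d * T.sq (u x y)
            + Δ′ x y * (x * y * T.sq (u x y) * (u x y - x * y) - T.sq x * T.sq y * (u x y - ⟦ + 3 ⟧ * x * y))

        -- The sums `ff` and `fg` are known only after multiplication by `u Δ′`, which leaves one
        -- factor `u` on both sides. It is cancelled once the ring is known to be that of power
        -- series.
        u-total : u x y * (total * T.sq (Δ′ x y) * K′ x y) ≈ u x y * rhs
        u-total = begin
          U * (total * T.sq D * Κ)
            ≈⟨ solve 7 (λ x y U D Κ ff sq → U ⊗ (x ⊗ y ⊗ ((I ⊖ x) ⊗ ff ⊕ Sv.con (+ 2) ⊗ sq) ⊗ Q.sq D ⊗ Κ) :=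
                 x ⊗ y ⊗ ((I ⊖ x) ⊗ Κ ⊗ D ⊗ (U ⊗ D ⊗ ff) ⊕ Sv.con (+ 2) ⊗ U ⊗ (D ⊗ (Κ ⊗ D ⊗ sq)))) refl x y U D Κ ff sq ⟩
          x * y * ((𝟙 - x) * Κ * D * (U * D * ff) + ⟦ + 2 ⟧ * U * (D * (Κ * D * sq)))
            ≈⟨ *-congˡ (+-cong (*-congˡ uΔff) (*-congˡ (trans (*-congˡ sq-eq) (distrib-minus D _ _)))) ⟩
          x * y * ((𝟙 - x) * Κ * D * P + ⟦ + 2 ⟧ * U * (D * (x * y * y * (P * ff + U * fg)) - D * (γ * (zzQB a b * fz))))
            ≈⟨ *-congˡ (+-congˡ (*-congˡ (+-congˡ (-‿cong Δγfz)))) ⟩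
          x * y * ((𝟙 - x) * Κ * D * P + ⟦ + 2 ⟧ * U * (D * (x * y * y * (P * ff + U * fg)) - ρ))
            ≈⟨ solve 10 (λ x y U D Κ P ff fg ρ t → x ⊗ y ⊗ (t ⊕ Sv.con (+ 2) ⊗ U ⊗ (D ⊗ (x ⊗ y ⊗ y ⊗ (P ⊗ ff ⊕ U ⊗ fg)) ⊖ ρ)) :=
                 x ⊗ y ⊗ (t ⊕ Sv.con (+ 2) ⊗ (x ⊗ y ⊗ y ⊗ (P ⊗ (U ⊗ D ⊗ ff) ⊕ U ⊗ (U ⊗ D ⊗ fg)) ⊖ U ⊗ ρ))) refl
                 x y U D Κ P ff fg ρ ((𝟙 - x) * Κ * D * P) ⟩
          x * y * ((𝟙 - x) * Κ * D * P + ⟦ + 2 ⟧ * (x * y * y * (P * (U * D * ff) + U * (U * D * fg)) - U * ρ))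
            ≈⟨ *-congˡ (+-congˡ (*-congˡ (+-congʳ (*-congˡ (+-cong (*-congˡ uΔff) (*-congˡ uΔfg)))))) ⟩
          x * y * ((𝟙 - x) * Κ * D * P + ⟦ + 2 ⟧ * (x * y * y * (P * P + U * (x * U)) - U * ρ))
            ≈⟨ solve 3 (λ x y d →
                 x ⊗ y ⊗ ((I ⊖ x) ⊗ Q.K′ x y ⊗ Q.Δ′ x y ⊗ Q.P₀ x y
                   ⊕ Sv.con (+ 2) ⊗ (x ⊗ y ⊗ y ⊗ (Q.P₀ x y ⊗ Q.P₀ x y ⊕ Q.u x y ⊗ (x ⊗ Q.u x y))
                     ⊖ Q.u x y ⊗ (x ⊗ y ⊗ Q.u x y ⊗ (Sv.con (+ 2) ⊗ (x ⊗ y) ⊖ Q.u x y ⊗ d)))) :=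
                 Q.u x y ⊗ (Sv.con (+ 2) ⊗ Q.sq x ⊗ Q.sq y ⊗ d ⊗ Q.sq (Q.u x y)
                   ⊕ Q.Δ′ x y ⊗ (x ⊗ y ⊗ Q.sq (Q.u x y) ⊗ (Q.u x y ⊖ x ⊗ y) ⊖ Q.sq x ⊗ Q.sq y ⊗ (Q.u x y ⊖ Sv.con (+ 3) ⊗ x ⊗ y)))) refl x y d ⟩
          U * rhs ∎
          where
          U = u x y
          D = Δ′ x y
          Κ = K′ x y
          P = P₀ x y
          ρ = x * y * u x y * (⟦ + 2 ⟧ * (x * y) - u x y * d)
          distrib-minus : ∀ p q r → p * (q - r) ≈ p * q - p * r
          distrib-minus = solve 3 (λ p q r → p ⊗ (q ⊖ r) := p ⊗ q ⊖ p ⊗ r) refl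

      -- `S` stands for the sum of y^h times the h-th term. Products of the sequences at h are, by
      -- the recurrences, combinations of products at h + 1, while `S-step` shifts the index by one.
      -- Comparing the two gives the linear equations of `Final`.
      module Sums (f g ζ : ℕ → Carrier)
        (f-eq : ∀ h → f h ≈ f (suc h) - g (suc h)) (g-eq : ∀ h → g h ≈ g (suc h) - x * f (suc h))
        (ζ-eq : ∀ h → ζ h ≈ (𝟙 - a) * ζ (suc h))
        (f₀ : f 0 ≈ 𝟙) (g₀ : g 0 ≈ ⟦ + 0 ⟧) (ζ₀ : ζ 0 ≈ 𝟙)
        (S : (ℕ → Carrier) → Carrier)
        (S-cong : ∀ {p q} → (∀ h → p h ≈ q h) → S p ≈ S q)
        (S-step : ∀ p → S p ≈ p 0 + y * S (λ h → p (suc h)))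
        (S-+ : ∀ p q → S (λ h → p h + q h) ≈ S p + S q)
        (S-* : ∀ c p → S (λ h → c * p h) ≈ c * S p)
        (nf QB : ℕ → Carrier) (nf-eq : ∀ D → nf D + x * f (suc D) ≈ f (suc D))
        (QB-eq : ∀ D → K′ x y * Δ′ x y * QB D ≈
                       stQB x y (f (suc D)) (g (suc D)) - γ * (zzQB a b * ζ (suc D))) where

        o : ∀ {n} → Polynomial n
        o = Sv.con (+ 0)

        S₃ : ∀ k₁ k₂ k₃ p q r →
             S (λ h → k₁ * p h + k₂ * q h + k₃ * r h) ≈ k₁ * S p + k₂ * S q + k₃ * S r
        S₃ k₁ k₂ k₃ p q r = trans (S-+ _ _) (+-cong (trans (S-+ _ _) (+-cong (S-* k₁ p) (S-* k₂ q))) (S-* k₃ r))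

        ffₛ fgₛ ggₛ fzₛ gzₛ fqₛ : ℕ → Carrier
        ffₛ h = f (suc h) * f (suc h)
        fgₛ h = f (suc h) * g (suc h)
        ggₛ h = g (suc h) * g (suc h)
        fzₛ h = f (suc h) * ζ (suc h)
        gzₛ h = g (suc h) * ζ (suc h)
        fqₛ h = f (suc h) * QB h

        ff-eq : 𝟙 + y * S ffₛ ≈ S ffₛ - ⟦ + 2 ⟧ * S fgₛ + S ggₛ
        ff-eq = begin
          𝟙 + y * S ffₛ
            ≈⟨ +-congʳ (trans (*-cong f₀ f₀) (solve 0 (I ⊗ I := I) refl)) ⟨
          f 0 * f 0 + y * S ffₛ
            ≈⟨ S-step (λ h → f h * f h) ⟨
          S (λ h → f h * f h)
            ≈⟨ S-cong (λ h → trans (*-cong (f-eq h) (f-eq h))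
                 (solve 2 (λ f g → (f ⊖ g) ⊗ (f ⊖ g) := I ⊗ (f ⊗ f) ⊕ (o ⊖ Sv.con (+ 2)) ⊗ (f ⊗ g) ⊕ I ⊗ (g ⊗ g)) refl (f (suc h)) (g (suc h)))) ⟩
          S (λ h → 𝟙 * ffₛ h + (⟦ + 0 ⟧ - ⟦ + 2 ⟧) * fgₛ h + 𝟙 * ggₛ h)
            ≈⟨ S₃ _ _ _ ffₛ fgₛ ggₛ ⟩
          𝟙 * S ffₛ + (⟦ + 0 ⟧ - ⟦ + 2 ⟧) * S fgₛ + 𝟙 * S ggₛ
            ≈⟨ solve 3 (λ p q r → I ⊗ p ⊕ (o ⊖ Sv.con (+ 2)) ⊗ q ⊕ I ⊗ r := p ⊖ Sv.con (+ 2) ⊗ q ⊕ r) refl _ _ _ ⟩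
          S ffₛ - ⟦ + 2 ⟧ * S fgₛ + S ggₛ ∎

        fg-eq : y * S fgₛ ≈ (𝟙 + x) * S fgₛ - x * S ffₛ - S ggₛ
        fg-eq = begin
          y * S fgₛ
            ≈⟨ solve 1 (λ p → p := I ⊗ o ⊕ p) refl _ ⟩
          𝟙 * ⟦ + 0 ⟧ + y * S fgₛ
            ≈⟨ +-congʳ (*-cong f₀ g₀) ⟨
          f 0 * g 0 + y * S fgₛ
            ≈⟨ S-step (λ h → f h * g h) ⟨
          S (λ h → f h * g h)
            ≈⟨ S-cong (λ h → trans (*-cong (f-eq h) (g-eq h))
                 (solve 3 (λ x f g → (f ⊖ g) ⊗ (g ⊖ x ⊗ f) := (I ⊕ x) ⊗ (f ⊗ g) ⊕ (o ⊖ x) ⊗ (f ⊗ f) ⊕ (o ⊖ I) ⊗ (g ⊗ g)) refl x (f (suc h)) (g (suc h)))) ⟩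
          S (λ h → (𝟙 + x) * fgₛ h + (⟦ + 0 ⟧ - x) * ffₛ h + (⟦ + 0 ⟧ - 𝟙) * ggₛ h)
            ≈⟨ S₃ _ _ _ fgₛ ffₛ ggₛ ⟩
          (𝟙 + x) * S fgₛ + (⟦ + 0 ⟧ - x) * S ffₛ + (⟦ + 0 ⟧ - 𝟙) * S ggₛ
            ≈⟨ solve 4 (λ x p q r → (I ⊕ x) ⊗ p ⊕ (o ⊖ x) ⊗ q ⊕ (o ⊖ I) ⊗ r := (I ⊕ x) ⊗ p ⊖ x ⊗ q ⊖ r) refl x _ _ _ ⟩
          (𝟙 + x) * S fgₛ - x * S ffₛ - S ggₛ ∎

        gg-eq : y * S ggₛ ≈ S ggₛ - ⟦ + 2 ⟧ * x * S fgₛ + x * x * S ffₛ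
        gg-eq = begin
          y * S ggₛ
            ≈⟨ solve 1 (λ p → p := o ⊗ o ⊕ p) refl _ ⟩
          ⟦ + 0 ⟧ * ⟦ + 0 ⟧ + y * S ggₛ
            ≈⟨ +-congʳ (*-cong g₀ g₀) ⟨
          g 0 * g 0 + y * S ggₛ
            ≈⟨ S-step (λ h → g h * g h) ⟨
          S (λ h → g h * g h)
            ≈⟨ S-cong (λ h → trans (*-cong (g-eq h) (g-eq h))
                 (solve 3 (λ x f g → (g ⊖ x ⊗ f) ⊗ (g ⊖ x ⊗ f) := I ⊗ (g ⊗ g) ⊕ (o ⊖ Sv.con (+ 2) ⊗ x) ⊗ (f ⊗ g) ⊕ x ⊗ x ⊗ (f ⊗ f)) refl x (f (suc h)) (g (suc h)))) ⟩
          S (λ h → 𝟙 * ggₛ h + (⟦ + 0 ⟧ - ⟦ + 2 ⟧ * x) * fgₛ h + x * x * ffₛ h)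
            ≈⟨ S₃ _ _ _ ggₛ fgₛ ffₛ ⟩
          𝟙 * S ggₛ + (⟦ + 0 ⟧ - ⟦ + 2 ⟧ * x) * S fgₛ + x * x * S ffₛ
            ≈⟨ solve 4 (λ x p q r → I ⊗ p ⊕ (o ⊖ Sv.con (+ 2) ⊗ x) ⊗ q ⊕ x ⊗ x ⊗ r := p ⊖ Sv.con (+ 2) ⊗ x ⊗ q ⊕ x ⊗ x ⊗ r) refl x _ _ _ ⟩
          S ggₛ - ⟦ + 2 ⟧ * x * S fgₛ + x * x * S ffₛ ∎

        fz-eq : 𝟙 + y * S fzₛ ≈ (𝟙 - a) * (S fzₛ - S gzₛ)
        fz-eq = begin
          𝟙 + y * S fzₛ
            ≈⟨ +-congʳ (trans (*-cong f₀ ζ₀) (solve 0 (I ⊗ I := I) refl)) ⟨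
          f 0 * ζ 0 + y * S fzₛ
            ≈⟨ S-step (λ h → f h * ζ h) ⟨
          S (λ h → f h * ζ h)
            ≈⟨ S-cong (λ h → trans (*-cong (f-eq h) (ζ-eq h))
                 (solve 4 (λ e f g z → (f ⊖ g) ⊗ (e ⊗ z) := e ⊗ (f ⊗ z) ⊕ (o ⊖ e) ⊗ (g ⊗ z) ⊕ o ⊗ (f ⊗ z)) refl (𝟙 - a) (f (suc h)) (g (suc h)) (ζ (suc h)))) ⟩
          S (λ h → (𝟙 - a) * fzₛ h + (⟦ + 0 ⟧ - (𝟙 - a)) * gzₛ h + ⟦ + 0 ⟧ * fzₛ h)
            ≈⟨ S₃ _ _ _ fzₛ gzₛ fzₛ ⟩
          (𝟙 - a) * S fzₛ + (⟦ + 0 ⟧ - (𝟙 - a)) * S gzₛ + ⟦ + 0 ⟧ * S fzₛ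
            ≈⟨ solve 3 (λ e p q → e ⊗ p ⊕ (o ⊖ e) ⊗ q ⊕ o ⊗ p := e ⊗ (p ⊖ q)) refl (𝟙 - a) _ _ ⟩
          (𝟙 - a) * (S fzₛ - S gzₛ) ∎

        gz-eq : y * S gzₛ ≈ (𝟙 - a) * (S gzₛ - x * S fzₛ)
        gz-eq = begin
          y * S gzₛ
            ≈⟨ solve 1 (λ p → p := o ⊗ I ⊕ p) refl _ ⟩
          ⟦ + 0 ⟧ * 𝟙 + y * S gzₛ
            ≈⟨ +-congʳ (*-cong g₀ ζ₀) ⟨
          g 0 * ζ 0 + y * S gzₛ
            ≈⟨ S-step (λ h → g h * ζ h) ⟨
          S (λ h → g h * ζ h)
            ≈⟨ S-cong (λ h → trans (*-cong (g-eq h) (ζ-eq h))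
                 (solve 5 (λ x e f g z → (g ⊖ x ⊗ f) ⊗ (e ⊗ z) := e ⊗ (g ⊗ z) ⊕ (o ⊖ e ⊗ x) ⊗ (f ⊗ z) ⊕ o ⊗ (f ⊗ z)) refl x (𝟙 - a) (f (suc h)) (g (suc h)) (ζ (suc h)))) ⟩
          S (λ h → (𝟙 - a) * gzₛ h + (⟦ + 0 ⟧ - (𝟙 - a) * x) * fzₛ h + ⟦ + 0 ⟧ * fzₛ h)
            ≈⟨ S₃ _ _ _ gzₛ fzₛ fzₛ ⟩
          (𝟙 - a) * S gzₛ + (⟦ + 0 ⟧ - (𝟙 - a) * x) * S fzₛ + ⟦ + 0 ⟧ * S fzₛ
            ≈⟨ solve 4 (λ x e p q → e ⊗ q ⊕ (o ⊖ e ⊗ x) ⊗ p ⊕ o ⊗ p := e ⊗ (q ⊖ x ⊗ p)) refl x (𝟙 - a) _ _ ⟩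
          (𝟙 - a) * (S gzₛ - x * S fzₛ) ∎

        fq-eq : K′ x y * Δ′ x y * S fqₛ ≈
                x * y * y * (P₀ x y * S ffₛ + u x y * S fgₛ) - γ * (zzQB a b * S fzₛ)
        fq-eq = begin
          K′ x y * Δ′ x y * S fqₛ
            ≈⟨ S-* _ fqₛ ⟨
          S (λ h → K′ x y * Δ′ x y * fqₛ h)
            ≈⟨ S-cong (λ h → trans (solve 3 (λ k f q → k ⊗ (f ⊗ q) := f ⊗ (k ⊗ q)) refl (K′ x y * Δ′ x y) (f (suc h)) (QB h))
                 (trans (*-congˡ (QB-eq h))
                 (solve 8 (λ w P u γ zz f g z → f ⊗ (w ⊗ (P ⊗ f ⊕ u ⊗ g) ⊖ γ ⊗ (zz ⊗ z)) :=
                    w ⊗ P ⊗ (f ⊗ f) ⊕ w ⊗ u ⊗ (f ⊗ g) ⊕ (o ⊖ γ ⊗ zz) ⊗ (f ⊗ z)) refl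
                    (x * y * y) (P₀ x y) (u x y) γ (zzQB a b) (f (suc h)) (g (suc h)) (ζ (suc h))))) ⟩
          S (λ h → x * y * y * P₀ x y * ffₛ h + x * y * y * u x y * fgₛ h + (⟦ + 0 ⟧ - γ * zzQB a b) * fzₛ h)
            ≈⟨ S₃ _ _ _ ffₛ fgₛ fzₛ ⟩
          x * y * y * P₀ x y * S ffₛ + x * y * y * u x y * S fgₛ + (⟦ + 0 ⟧ - γ * zzQB a b) * S fzₛ
            ≈⟨ solve 8 (λ w P u γ zz p q r → w ⊗ P ⊗ p ⊕ w ⊗ u ⊗ q ⊕ (o ⊖ γ ⊗ zz) ⊗ r :=
                 w ⊗ (P ⊗ p ⊕ u ⊗ q) ⊖ γ ⊗ (zz ⊗ r)) refl (x * y * y) (P₀ x y) (u x y) γ (zzQB a b) _ _ _ ⟩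
          x * y * y * (P₀ x y * S ffₛ + u x y * S fgₛ) - γ * (zzQB a b * S fzₛ) ∎

        open Final (S ffₛ) (S fgₛ) (S ggₛ) (S fzₛ) (S gzₛ) (S fqₛ) ff-eq fg-eq gg-eq fz-eq gz-eq fq-eq public
          using (total; rhs; u-total)

        gf : Carrier
        gf = y * S (λ D → f (suc D) * (x * nf D) + ⟦ + 2 ⟧ * (f (suc D) * (x * QB D)))

        gf≈total : gf ≈ total
        gf≈total = begin
          gf
            ≈⟨ *-congˡ (S-cong (λ D → trans (+-congʳ (*-congˡ (*-congˡ (nf≈ D))))
                 (solve 4 (λ x f q c → f ⊗ (x ⊗ ((I ⊖ x) ⊗ f)) ⊕ c ⊗ (f ⊗ (x ⊗ q)) :=
                    x ⊗ (I ⊖ x) ⊗ (f ⊗ f) ⊕ x ⊗ c ⊗ (f ⊗ q) ⊕ o ⊗ (f ⊗ f)) refl x (f (suc D)) (QB D) ⟦ + 2 ⟧))) ⟩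
          y * S (λ D → x * (𝟙 - x) * ffₛ D + x * ⟦ + 2 ⟧ * fqₛ D + ⟦ + 0 ⟧ * ffₛ D)
            ≈⟨ *-congˡ (S₃ _ _ _ ffₛ fqₛ ffₛ) ⟩
          y * (x * (𝟙 - x) * S ffₛ + x * ⟦ + 2 ⟧ * S fqₛ + ⟦ + 0 ⟧ * S ffₛ)
            ≈⟨ solve 4 (λ x y p q → y ⊗ (x ⊗ (I ⊖ x) ⊗ p ⊕ x ⊗ Sv.con (+ 2) ⊗ q ⊕ o ⊗ p) :=
                 x ⊗ y ⊗ ((I ⊖ x) ⊗ p ⊕ Sv.con (+ 2) ⊗ q)) refl x y _ _ ⟩
          total ∎
          where
          nf≈ : ∀ D → nf D ≈ (𝟙 - x) * f (suc D)
          nf≈ D = begin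
            nf D                                    ≈⟨ solve 3 (λ n x f → n := (n ⊕ x ⊗ f) ⊖ x ⊗ f) refl (nf D) x (f (suc D)) ⟩
            (nf D + x * f (suc D)) - x * f (suc D)  ≈⟨ +-congʳ (nf-eq D) ⟩
            f (suc D) - x * f (suc D)               ≈⟨ solve 2 (λ x f → f ⊖ x ⊗ f := (I ⊖ x) ⊗ f) refl x (f (suc D)) ⟩
            (𝟙 - x) * f (suc D)                     ∎

        u-gf : u x y * (gf * T.sq (Δ′ x y) * K′ x y) ≈ u x y * rhs
        u-gf = trans (*-congˡ (*-congʳ (*-congʳ gf≈total))) u-total

-- Bivariate series: approximation by total degree, fixed points, uniqueness.

module BivariateSeries where

  open import Defs hiding (N; S; E; W; step)
  open SeriesRings
  open ClosedForms
  open import Level using (0ℓ)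
  open import Algebra.Bundles using (CommutativeRing)
  open import Data.Bool using (if_then_else_)
  open import Data.Nat using (ℕ; zero; suc; _∸_; _≤_; _<_; z≤n; s≤s; _≡ᵇ_)
  import Data.Nat as ℕ
  import Data.Nat.Properties as ℕₚ
  open import Data.Integer using (ℤ; +_)
  import Data.Integer as ℤ
  import Data.Integer.Properties as ℤₚ
  open import Data.Product using (Σ; _×_; _,_; proj₁)
  open import Relation.Binary.PropositionalEquality using (_≡_; refl; sym; trans; cong; cong₂)
  open import Function using (_∘_)

  module PowerSeries+ (R : CommutativeRing 0ℓ 0ℓ) where

    open CommutativeRing R renaming (Carrier to A; refl to ≈-refl; sym to ≈-sym; trans to ≈-trans)
    open PowerSeries R

    zero-⊛ : ∀ e f → (∀ n → e n ≈ 0#) → e ⊛ f ≋ (λ _ → 0#)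
    zero-⊛ e f e≈0 n = ≈-trans (∑-cong n (λ k → ≈-trans (*-congʳ (e≈0 k)) (zeroˡ _))) (∑-0 n)

    const-⊛ : ∀ e f → (∀ n → e (suc n) ≈ 0#) → e ⊛ f ≋ (λ n → e 0 * f n)
    const-⊛ e f e≈0 zero    = ≈-refl
    const-⊛ e f e≈0 (suc n) = ≈-trans (⊛-suc e f n) (≈-trans (+-congˡ (zero-⊛ (e ∘ suc) f e≈0 n)) (+-identityʳ _))

    shift-⊛ : ∀ e f → e 0 ≈ 0# → e ∘ suc ≋ one → ∀ n → (e ⊛ f) (suc n) ≈ f n
    shift-⊛ e f e₀ e≈ n = ≈-trans (⊛-suc e f n) (≈-trans
      (+-cong (≈-trans (*-congʳ e₀) (zeroˡ _)) (≈-trans (⊛-cong {g = f} e≈ (λ _ → ≈-refl) n) (⊛-identityˡ f n)))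
      (+-identityˡ _))

  module S⁺ = PowerSeries+ ℤₚ.+-*-commutativeRing
  module S₂⁺ = PowerSeries+ Ser-ring

  module R₂ = CommutativeRing Ser₂-ring

  *₁-⊛ : ∀ (f g : Ser) n → (f *₁ g) n ≡ (PSℤ._⊛_ f g) n
  *₁-⊛ f g n = sumTo≡∑ n _

  *₂-⊛ : ∀ (f g : Ser₂) n j → (f *₂ g) n j ≡ (PSSer._⊛_ f g) n j
  *₂-⊛ f g n j = sumTo≡∑₂ n (λ k → f k *₁ g (n ∸ k)) j

  konst₁ : ℤ → Ser
  konst₁ k n = if n ≡ᵇ 0 then k else + 0

  konst₁-* : ∀ k f n → (konst₁ k *₁ f) n ≡ k ℤ.* f n
  konst₁-* k f n = trans (*₁-⊛ (konst₁ k) f n) (S⁺.const-⊛ (konst₁ k) f (λ _ → refl) n)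

  konst : ℤ → Ser₂
  konst k i j = if i ≡ᵇ 0 then (if j ≡ᵇ 0 then k else + 0) else + 0

  konst-* : ∀ k f i j → (konst k *₂ f) i j ≡ k ℤ.* f i j
  konst-* k f i j = trans (*₂-⊛ (konst k) f i j)
    (trans (S₂⁺.const-⊛ (konst k) f (λ _ _ → refl) i j) (konst₁-* k (f i) j))

  t-suc : ∀ f n → (t *₁ f) (suc n) ≡ f n
  t-suc f n = trans (*₁-⊛ t f (suc n)) (S⁺.shift-⊛ t f refl (λ { zero → refl ; (suc _) → refl }) n)

  X-suc : ∀ f i j → (X *₂ f) (suc i) j ≡ f i j
  X-suc f i j = trans (*₂-⊛ X f (suc i) j)
    (S₂⁺.shift-⊛ X f (λ _ → refl) (λ { zero zero → refl ; zero (suc _) → refl ; (suc _) _ → refl }) i j)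

  X-zero : ∀ f j → (X *₂ f) 0 j ≡ + 0
  X-zero f j = trans (*₂-⊛ X f 0 j) (trans (*₁-⊛ (X 0) (f 0) j) (S⁺.zero-⊛ (X 0) (f 0) (λ _ → refl) j))

  Y-⊛ : ∀ f i j → (Y *₂ f) i j ≡ (t *₁ f i) j
  Y-⊛ f i j = trans (*₂-⊛ Y f i j) (S₂⁺.const-⊛ Y f (λ _ _ → refl) i j)

  Y-suc : ∀ f i j → (Y *₂ f) i (suc j) ≡ f i j
  Y-suc f i j = trans (Y-⊛ f i (suc j)) (t-suc (f i) j)

  Y-zero : ∀ f i → (Y *₂ f) i 0 ≡ + 0
  Y-zero f i = Y-⊛ f i 0

  Ser-hom : ℤ-hom Ser-ring
  Ser-hom = record
    { ⟦_⟧ = konst₁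
    ; +-homo = λ { a b zero → refl ; a b (suc n) → refl }
    ; *-homo = λ { a b zero → sym (konst₁-* a (konst₁ b) 0)
                 ; a b (suc n) → sym (trans (konst₁-* a (konst₁ b) (suc n)) (ℤₚ.*-zeroʳ a)) }
    ; -‿homo = λ { a zero → refl ; a (suc n) → refl }
    ; 0-homo = λ { zero → refl ; (suc n) → refl }
    ; 1-homo = λ { zero → refl ; (suc n) → refl } }

  Ser₂-hom : ℤ-hom Ser₂-ring
  Ser₂-hom = record
    { ⟦_⟧ = konst
    ; +-homo = λ { a b zero zero → refl ; a b zero (suc n) → refl ; a b (suc m) n → refl }
    ; *-homo = λ { a b zero zero → sym (konst-* a (konst b) 0 0)
                 ; a b zero (suc n) → sym (trans (konst-* a (konst b) 0 (suc n)) (ℤₚ.*-zeroʳ a))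
                 ; a b (suc m) n → sym (trans (konst-* a (konst b) (suc m) n) (ℤₚ.*-zeroʳ a)) }
    ; -‿homo = λ { a zero zero → refl ; a zero (suc n) → refl ; a (suc m) n → refl }
    ; 0-homo = λ { zero zero → refl ; zero (suc n) → refl ; (suc m) n → refl }
    ; 1-homo = λ { zero zero → refl ; zero (suc n) → refl ; (suc m) n → refl } }

  agree : ℕ → Ser₂ → Ser₂ → Set
  agree n f g = ∀ i j → i ℕ.+ j < n → f i j ≡ g i j

  agree-all : ∀ {f g} → (∀ n → agree n f g) → f ≈₂ g
  agree-all e i j = e (suc (i ℕ.+ j)) i j ℕₚ.≤-refl

  ≈⇒agree : ∀ {n f g} → f ≈₂ g → agree n f g
  ≈⇒agree e i j _ = e i j

  agree-trans : ∀ {n f g h} → agree n f g → agree n g h → agree n f h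
  agree-trans p q i j l = trans (p i j l) (q i j l)

  agree-sym : ∀ {n f g} → agree n f g → agree n g f
  agree-sym p i j l = sym (p i j l)

  agree-+ : ∀ {n f f′ g g′} → agree n f f′ → agree n g g′ → agree n (f +₂ g) (f′ +₂ g′)
  agree-+ p q i j l = cong₂ ℤ._+_ (p i j l) (q i j l)

  sumTo-cong≤ : ∀ n {f g : ℕ → ℤ} → (∀ k → k ≤ n → f k ≡ g k) → sumTo n f ≡ sumTo n g
  sumTo-cong≤ zero    e = e 0 z≤n
  sumTo-cong≤ (suc n) e = cong₂ ℤ._+_ (sumTo-cong≤ n (λ k l → e k (ℕₚ.m≤n⇒m≤1+n l))) (e (suc n) ℕₚ.≤-refl)

  -- As `h` has no constant term, each of its nonzero coefficients meets coefficients of strictly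
  -- lower total degree: multiplication by `h` is a contraction.
  agree-* : ∀ {n f g} h → h 0 0 ≡ + 0 → agree n f g → agree (suc n) (h *₂ f) (h *₂ g)
  agree-* {n} {f} {g} h h₀ e i j (s≤s l) = sumTo-cong≤ i (λ a a≤i → sumTo-cong≤ j (λ b b≤j → term a b a≤i b≤j))
    where
    drop< : ∀ a b → a ≤ i → b ≤ j → 0 < a ℕ.+ b → (i ∸ a) ℕ.+ (j ∸ b) < n
    drop< a b a≤i b≤j pos = ℕₚ.≤-trans (begin-strict
        (i ∸ a) ℕ.+ (j ∸ b)                         <⟨ ℕₚ.m<m+n _ pos ⟩
        ((i ∸ a) ℕ.+ (j ∸ b)) ℕ.+ (a ℕ.+ b)         ≡⟨ +-interchange (i ∸ a) (j ∸ b) a b ⟩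
        ((i ∸ a) ℕ.+ a) ℕ.+ ((j ∸ b) ℕ.+ b)         ≡⟨ cong₂ ℕ._+_ (ℕₚ.m∸n+n≡m a≤i) (ℕₚ.m∸n+n≡m b≤j) ⟩
        i ℕ.+ j                                     ∎) l
      where
      open ℕₚ.≤-Reasoning
      open import Algebra.Properties.CommutativeSemigroup ℕₚ.+-commutativeSemigroup renaming (interchange to +-interchange)
    term : ∀ a b → a ≤ i → b ≤ j → h a b ℤ.* f (i ∸ a) (j ∸ b) ≡ h a b ℤ.* g (i ∸ a) (j ∸ b)
    term zero zero _ _ = trans (cong (ℤ._* f i j) h₀) (sym (cong (ℤ._* g i j) h₀))
    term zero (suc b) p q = cong (h 0 (suc b) ℤ.*_) (e _ _ (drop< 0 (suc b) p q (s≤s z≤n)))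
    term (suc a) b p q = cong (h (suc a) b ℤ.*_) (e _ _ (drop< (suc a) b p q (s≤s z≤n)))

  agree-X : ∀ {n f g} → agree n f g → agree (suc n) (X *₂ f) (X *₂ g)
  agree-X = agree-* X refl

  agree-Y : ∀ {n f g} → agree n f g → agree (suc n) (Y *₂ f) (Y *₂ g)
  agree-Y = agree-* Y refl

  -- This is the tool for cancelling a factor 1 - g with constant term 1: from (1 - g) h = 0, the
  -- coefficients of `h` vanish degree by degree.
  zero-of-fixed : ∀ {g h} → g 0 0 ≡ + 0 → h ≈₂ g *₂ h → h ≈₂ R₂.0#
  zero-of-fixed {g} {h} g₀ e = agree-all all
    where
    all : ∀ n → agree n h R₂.0#
    all zero    i j ()
    all (suc n) = agree-trans (≈⇒agree e) (agree-trans (agree-* g g₀ (all n)) (≈⇒agree (R₂.zeroʳ g)))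

  -- The constant term is part of the hypotheses because the map for `d` contracts only on series
  -- without constant term. The iterates stabilise in each degree, and `fix` reads the coefficient
  -- (i , j) at a stage where it is final.
  module Fix (Φ : Ser₂ → Ser₂) (c : ℤ) (Φ-const : ∀ f → f 0 0 ≡ c → Φ f 0 0 ≡ c)
    (contract : ∀ {n f g} → f 0 0 ≡ c → g 0 0 ≡ c → agree n f g → agree (suc n) (Φ f) (Φ g)) where

    iter : ℕ → Ser₂
    iter zero    = konst c
    iter (suc n) = Φ (iter n)

    iter-const : ∀ n → iter n 0 0 ≡ c
    iter-const zero    = refl
    iter-const (suc n) = Φ-const (iter n) (iter-const n)

    iter-agree : ∀ n {m} → n ≤ m → agree n (iter n) (iter m)
    iter-agree zero    _ i j ()
    iter-agree (suc n) {suc m} (s≤s n≤m) = contract (iter-const n) (iter-const m) (iter-agree n n≤m)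

    fix : Ser₂
    fix i j = iter (suc (i ℕ.+ j)) i j

    fix-const : fix 0 0 ≡ c
    fix-const = iter-const 1

    fix-agree : ∀ n → agree n fix (iter n)
    fix-agree n i j l = iter-agree (suc (i ℕ.+ j)) l i j ℕₚ.≤-refl

    fix-eq : fix ≈₂ Φ fix
    fix-eq i j = sym (contract fix-const (iter-const (i ℕ.+ j)) (fix-agree (i ℕ.+ j)) i j ℕₚ.≤-refl)

  module D-series where

    Φ : Ser₂ → Ser₂
    Φ d = (X +₂ d) *₂ (Y +₂ d)

    contract : ∀ {n f g} → f 0 0 ≡ + 0 → g 0 0 ≡ + 0 → agree n f g → agree (suc n) (Φ f) (Φ g)
    -- One factor is changed at a time; commutativity brings the changed one to the right.
    contract {n} {f} {g} f₀ g₀ e = agree-trans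
      (agree-* (X +₂ f) (cong (λ w → + 0 ℤ.+ w) f₀) (agree-+ {f = Y} (≈⇒agree (λ _ _ → refl)) e))
      (agree-trans (≈⇒agree (R₂.*-comm (X +₂ f) (Y +₂ g)))
      (agree-trans (agree-* (Y +₂ g) (cong (λ w → + 0 ℤ.+ w) g₀) (agree-+ {f = X} (≈⇒agree (λ _ _ → refl)) e))
      (≈⇒agree (R₂.*-comm (Y +₂ g) (X +₂ g)))))

    open Fix Φ (+ 0) (λ f f₀ → trans (cong (λ z → (+ 0 ℤ.+ z) ℤ.* (+ 0 ℤ.+ z)) f₀) refl) contract public

  d-exists : Σ Ser₂ λ d → (d 0 0 ≡ + 0) × (d ≈₂ (X +₂ d) *₂ (Y +₂ d))
  d-exists = D-series.fix , D-series.fix-const , D-series.fix-eq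

  module Inverse (g : Ser₂) (g₀ : g 0 0 ≡ + 0) where

    open Fix (λ z → #₂ 1 +₂ g *₂ z) (+ 1)
      (λ f _ → cong (λ w → + 1 ℤ.+ w ℤ.* f 0 0) g₀)
      (λ {n} {f} {h} _ _ e → agree-+ {f = #₂ 1} (≈⇒agree (λ _ _ → refl)) (agree-* g g₀ e))
      using (fix; fix-eq) public
    open Closed Ser₂-ring Ser₂-hom using (solve; _:=_; module Q)
    open Q

    inverse : (#₂ 1 -₂ g) *₂ fix ≈₂ #₂ 1
    inverse = R₂.trans (solve 2 (λ g z → (I ⊖ g) ⊗ z := z ⊖ g ⊗ z) R₂.refl g fix)
      (R₂.trans (R₂.+-congʳ fix-eq) (solve 2 (λ g z → (I ⊕ g ⊗ z) ⊖ g ⊗ z := I) R₂.refl g fix))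

  Σʸ : (ℕ → Ser₂) → Ser₂
  Σʸ a i j = sumTo j (λ h → a h i (j ∸ h))

  Σʸ-step : ∀ a → Σʸ a ≈₂ a 0 +₂ Y *₂ Σʸ (a ∘ suc)
  Σʸ-step a i zero    = sym (trans (cong (λ w → a 0 i 0 ℤ.+ w) (Y-zero (Σʸ (a ∘ suc)) i)) (ℤₚ.+-identityʳ _))
  Σʸ-step a i (suc j) = trans (sumTo≡∑ (suc j) _) (trans (PSℤ.∑-head j _)
    (cong (λ w → a 0 i (suc j) ℤ.+ w) (trans (sym (sumTo≡∑ j _)) (sym (Y-suc (Σʸ (a ∘ suc)) i j)))))

  Σʸ-cong : ∀ {a b} → (∀ h → a h ≈₂ b h) → Σʸ a ≈₂ Σʸ b
  Σʸ-cong e i j = sumTo-cong≤ j (λ h _ → e h i (j ∸ h))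

  Σʸ-+ : ∀ a b → Σʸ (λ h → a h +₂ b h) ≈₂ Σʸ a +₂ Σʸ b
  Σʸ-+ a b i j = trans (sumTo≡∑ j _) (trans (PSℤ.∑-+ j _ _) (sym (cong₂ ℤ._+_ (sumTo≡∑ j _) (sumTo≡∑ j _))))

  -- Proved degree by degree: `Σʸ-step` exposes a factor `Y` in front of the tail, so no sums have
  -- to be exchanged.
  Σʸ-* : ∀ c a → Σʸ (λ h → c *₂ a h) ≈₂ c *₂ Σʸ a
  Σʸ-* c a = agree-all (λ n → go n a)
    where
    open Closed Ser₂-ring Ser₂-hom using (solve; _:=_; module Q)
    open Q
    go : ∀ n a → agree n (Σʸ (λ h → c *₂ a h)) (c *₂ Σʸ a)
    go zero    a i j ()
    go (suc n) a = agree-trans (≈⇒agree (Σʸ-step (λ h → c *₂ a h)))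
      (agree-trans (agree-+ {f = c *₂ a 0} (≈⇒agree (λ _ _ → refl)) (agree-Y (go n (a ∘ suc))))
      (≈⇒agree (R₂.trans
        (solve 4 (λ c y a s → c ⊗ a ⊕ y ⊗ (c ⊗ s) := c ⊗ (a ⊕ y ⊗ s)) R₂.refl c Y (a 0) (Σʸ (a ∘ suc)))
        (R₂.*-cong {c} {c} {a 0 +₂ Y *₂ Σʸ (a ∘ suc)} {Σʸ a} (λ _ _ → refl) (R₂.sym {x = Σʸ a} {y = a 0 +₂ Y *₂ Σʸ (a ∘ suc)} (Σʸ-step a))))))

  -- One summand for each way in which a run may begin in the phase concerned. `I` is the
  -- contribution of the last step, and `T (suc D)` belongs to the phase of reading right columns
  -- with counter `D`; the shift lets that recursion start from zero.
  record System (I QB C QA WA T : ℕ → Ser₂) : Set where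
    field
      QB-eq : ∀ D → QB D ≈₂ Y *₂ QB D +₂ Y *₂ C D +₂ T (suc D)
      C-eq  : ∀ D → C D ≈₂ X *₂ C D +₂ X *₂ QB D +₂ Y *₂ QA D
      QA-eq : ∀ D → QA D ≈₂ C D +₂ X *₂ WA D +₂ I D
      WA-eq : ∀ D → WA D ≈₂ QA D +₂ Y *₂ WA (suc D)
      T-suc : ∀ D → T (suc D) ≈₂ T D +₂ X *₂ QB D
      T-0   : T 0 ≈₂ R₂.0#

  -- Some terms carry neither `X` nor `Y`, so the system as a whole is not visibly a contraction.
  -- Within one degree the equations are used in the order T, QB, C, QA, WA, which settles every
  -- such term before it is needed; T is treated by induction on `D`. The counter grows in the
  -- equation for WA, hence the induction on the degree for all `D` at once.
  system-unique : ∀ {I QB C QA WA T QB′ C′ QA′ WA′ T′} →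
    System I QB C QA WA T → System I QB′ C′ QA′ WA′ T′ → ∀ D → QB D ≈₂ QB′ D
  system-unique {I} {QB} {C} {QA} {WA} {T} {QB′} {C′} {QA′} {WA′} {T′} s s′ D = agree-all (λ n → proj₁ (go n) D)
    where
    module s = System s
    module s′ = System s′
    via : ∀ {n f f′ g g′} → f ≈₂ g → f′ ≈₂ g′ → agree n g g′ → agree n f f′
    via p q e = agree-trans (≈⇒agree p) (agree-trans e (agree-sym (≈⇒agree q)))
    go : ∀ n → (∀ D → agree n (QB D) (QB′ D)) × (∀ D → agree n (C D) (C′ D)) ×
               (∀ D → agree n (QA D) (QA′ D)) × (∀ D → agree n (WA D) (WA′ D))
    go zero    = (λ _ _ _ ()) , (λ _ _ _ ()) , (λ _ _ _ ()) , (λ _ _ _ ())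
    go (suc n) with go n
    ... | qb , c , qa , wa = qb⁺ , c⁺ , qa⁺ , wa⁺
      where
      t⁺ : ∀ D → agree (suc n) (T D) (T′ D)
      t⁺ zero    = via s.T-0 s′.T-0 (≈⇒agree (λ _ _ → refl))
      t⁺ (suc D) = via (s.T-suc D) (s′.T-suc D) (agree-+ (t⁺ D) (agree-X (qb D)))
      qb⁺ : ∀ D → agree (suc n) (QB D) (QB′ D)
      qb⁺ D = via (s.QB-eq D) (s′.QB-eq D) (agree-+ (agree-+ (agree-Y (qb D)) (agree-Y (c D))) (t⁺ (suc D)))
      c⁺ : ∀ D → agree (suc n) (C D) (C′ D)
      c⁺ D = via (s.C-eq D) (s′.C-eq D) (agree-+ (agree-+ (agree-X (c D)) (agree-X (qb D))) (agree-Y (qa D)))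
      qa⁺ : ∀ D → agree (suc n) (QA D) (QA′ D)
      qa⁺ D = via (s.QA-eq D) (s′.QA-eq D) (agree-+ (agree-+ (c⁺ D) (agree-X (wa D))) (≈⇒agree (λ _ _ → refl)))
      wa⁺ : ∀ D → agree (suc n) (WA D) (WA′ D)
      wa⁺ D = via (s.WA-eq D) (s′.WA-eq D) (agree-+ (qa⁺ D) (agree-Y (wa (suc D))))

-- The bivariate generating function.

module GeneratingFunction where

  open import Defs hiding (N; S; E; W; step)
  open SeriesRings
  open ClosedForms
  open BivariateSeries
  open import Level using (0ℓ)
  open import Algebra.Bundles using (CommutativeRing)
  open import Data.Nat using (ℕ; zero; suc)
  open import Data.Integer using (ℤ; +_)
  import Data.Integer as ℤ
  open import Relation.Binary.PropositionalEquality using (_≡_; refl; sym; trans; cong)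
  open import Function using (_∘_)

  module Scale (R : CommutativeRing 0ℓ 0ℓ) (hom : ℤ-hom R) where

    open CommutativeRing R renaming (refl to ≈-refl; sym to ≈-sym; trans to ≈-trans)
    open Closed R hom
    open Q using (_⊕_; _⊗_; _⊖_; I)

    scale₃ : ∀ k {p p₁ p₂ p₃} u₁ u₂ u₃ → p ≈ u₁ * p₁ + u₂ * p₂ + u₃ * p₃ →
             k * p ≈ u₁ * (k * p₁) + u₂ * (k * p₂) + u₃ * (k * p₃)
    scale₃ k {p} {p₁} {p₂} {p₃} u₁ u₂ u₃ e = ≈-trans (*-congˡ e)
      (solve 7 (λ k u₁ p₁ u₂ p₂ u₃ p₃ → k ⊗ (u₁ ⊗ p₁ ⊕ u₂ ⊗ p₂ ⊕ u₃ ⊗ p₃) :=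
         u₁ ⊗ (k ⊗ p₁) ⊕ u₂ ⊗ (k ⊗ p₂) ⊕ u₃ ⊗ (k ⊗ p₃)) ≈-refl k u₁ p₁ u₂ p₂ u₃ p₃)

    one-l : ∀ p → ⟦ + 1 ⟧ * p ≈ p
    one-l = solve 1 (λ p → I ⊗ p := p) ≈-refl

    scaleQB : ∀ k y {q c t} → q ≈ y * q + y * c + t → k * q ≈ y * (k * q) + y * (k * c) + k * t
    scaleQB k y {q} {c} {t} e = ≈-trans (scale₃ k y y ⟦ + 1 ⟧ (≈-trans e (+-congˡ (≈-sym (one-l t))))) (+-congˡ (one-l (k * t)))

    scaleQA : ∀ k x {q c w i} → q ≈ c + x * w + i → k * q ≈ k * c + x * (k * w) + k * i
    scaleQA k x {q} {c} {w} {i} e = ≈-trans (scale₃ k ⟦ + 1 ⟧ x ⟦ + 1 ⟧ (≈-trans e (+-cong (+-congʳ (≈-sym (one-l c))) (≈-sym (one-l i)))))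
      (+-cong (+-congʳ (one-l (k * c))) (one-l (k * i)))

    scaleWA : ∀ k x {q c w} → q ≈ c + x * w → k * q ≈ k * c + x * (k * w)
    scaleWA k x {q} {c} {w} e = ≈-trans (*-congˡ e) (solve 4 (λ k c x w → k ⊗ (c ⊕ x ⊗ w) := k ⊗ c ⊕ x ⊗ (k ⊗ w)) ≈-refl k c x w)

    scale-0 : ∀ k {p} → p ≈ 0# → k * p ≈ 0#
    scale-0 k e = ≈-trans (*-congˡ e) (zeroʳ k)

    minus : ∀ {p q r} → p ≈ q + r → q ≈ p - r
    minus {p} {q} {r} e = ≈-trans (solve 2 (λ q r → q := (q ⊕ r) ⊖ r) ≈-refl q r) (+-congʳ (≈-sym e))

    sub-zero : ∀ {p q} → p - q ≈ 0# → p ≈ q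
    sub-zero {p} {q} e = ≈-trans (solve 2 (λ p q → p := (p ⊖ q) ⊕ q) ≈-refl p q) (≈-trans (+-congʳ e) (+-identityˡ q))

    -- Puts the cancellation of `u` into the form required by `zero-of-fixed`: the difference of the
    -- two sides equals itself times x + y.
    cancel-step : ∀ x y {p q} → (⟦ + 1 ⟧ - x - y) * p ≈ (⟦ + 1 ⟧ - x - y) * q → p - q ≈ (x + y) * (p - q)
    cancel-step x y {p} {q} e = sub-zero (≈-trans
      (solve 4 (λ x y p q → (p ⊖ q) ⊖ (x ⊕ y) ⊗ (p ⊖ q) := (I ⊖ x ⊖ y) ⊗ p ⊖ (I ⊖ x ⊖ y) ⊗ q) ≈-refl x y p q)
      (≈-trans (+-congʳ e) (-‿inverseʳ _)))

  scale-system : ∀ k {I QB C QA WA T} → System I QB C QA WA T →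
    System (λ D → k *₂ I D) (λ D → k *₂ QB D) (λ D → k *₂ C D) (λ D → k *₂ QA D) (λ D → k *₂ WA D) (λ D → k *₂ T D)
  scale-system k {I} {QB} {C} {QA} {WA} {T} s = record
    { QB-eq = λ D → scaleQB k Y {QB D} {C D} {T (suc D)} (QB-eq D)
    ; C-eq  = λ D → scale₃ k {C D} {C D} {QB D} {QA D} X X Y (C-eq D)
    ; QA-eq = λ D → scaleQA k X {QA D} {C D} {WA D} {I D} (QA-eq D)
    ; WA-eq = λ D → scaleWA k Y {WA D} {QA D} {WA (suc D)} (WA-eq D)
    ; T-suc = λ D → scaleWA k X {T (suc D)} {T D} {QB D} (T-suc D)
    ; T-0   = scale-0 k {T 0} T-0 }
    where
    open System s
    open Scale Ser₂-ring Ser₂-hom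

  -- The interface between combinatorics and algebra: `f`, `g` and `nf` belong to stacks, the five
  -- sequences of the system to runs, and `P-eq` sums over the counter. Each factor 2 stands for a
  -- reflection.
  record Counted (P : Ser₂) : Set where
    field
      f g nf QB C QA WA T : ℕ → Ser₂
      f-0    : f 0 ≈₂ #₂ 1
      g-0    : g 0 ≈₂ #₂ 0
      f-suc  : ∀ h → f (suc h) ≈₂ f h +₂ g (suc h)
      g-suc  : ∀ h → g (suc h) ≈₂ g h +₂ X *₂ f (suc h)
      nf-eq  : ∀ D → nf D +₂ X *₂ f (suc D) ≈₂ f (suc D)
      system : System (λ D → X *₂ f (suc D)) QB C QA WA T
      P-eq   : P ≈₂ Y *₂ Σʸ (λ D → f (suc D) *₂ (X *₂ nf D) +₂ #₂ 2 *₂ (f (suc D) *₂ (X *₂ QB D)))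

  -- A syntax for both sides of the identity, so that it can be carried over to x = y = t by one
  -- recursion over expressions.
  data Ex : Set where
    X′ Y′ d′ P′ : Ex
    con′ : ℤ → Ex
    _+′_ _*′_ _-′_ : Ex → Ex → Ex

  module E = Poly _+′_ _*′_ _-′_ con′

  eval₂ : Ser₂ → Ser₂ → Ex → Ser₂
  eval₂ d P X′ = X
  eval₂ d P Y′ = Y
  eval₂ d P d′ = d
  eval₂ d P P′ = P
  eval₂ d P (con′ k) = konst k
  eval₂ d P (p +′ q) = eval₂ d P p +₂ eval₂ d P q
  eval₂ d P (p *′ q) = eval₂ d P p *₂ eval₂ d P q
  eval₂ d P (p -′ q) = eval₂ d P p -₂ eval₂ d P q

  -- Bracketed as the operators of the stated formula associate, with `E.sq` for the second powers,
  -- so that `eval₂` unfolds to the two sides of the theorem.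
  lhsE rhsE : Ex
  lhsE = (P′ *′ E.sq (E.Δ′ X′ Y′)) *′ E.K′ X′ Y′
  rhsE = ((((con′ (+ 2) *′ E.sq X′) *′ E.sq Y′) *′ d′) *′ E.sq (E.u X′ Y′))
      +′ (E.Δ′ X′ Y′ *′ ((((X′ *′ Y′) *′ E.sq (E.u X′ Y′)) *′ (E.u X′ Y′ -′ (X′ *′ Y′)))
                       -′ ((E.sq X′ *′ E.sq Y′) *′ (E.u X′ Y′ -′ ((con′ (+ 3) *′ X′) *′ Y′)))))

  bivariate : ∀ {P} → Counted P → ∀ d → d 0 0 ≡ + 0 → d ≈₂ (X +₂ d) *₂ (Y +₂ d) →
              eval₂ d P lhsE ≈₂ eval₂ d P rhsE
  bivariate {P} cnt d d₀ d-root =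
    R₂.trans {eval₂ d P lhsE} {gf *₂ T.sq (T.Δ′ X Y) *₂ T.K′ X Y} {rhs}
      (R₂.*-cong {P *₂ T.sq (T.Δ′ X Y)} {gf *₂ T.sq (T.Δ′ X Y)} {T.K′ X Y} {T.K′ X Y}
        (R₂.*-cong {P} {gf} {T.sq (T.Δ′ X Y)} {T.sq (T.Δ′ X Y)} P-eq (λ _ _ → refl)) (λ _ _ → refl))
      (sub-zero {gf *₂ T.sq (T.Δ′ X Y) *₂ T.K′ X Y} {rhs}
        (zero-of-fixed {X +₂ Y} {gf *₂ T.sq (T.Δ′ X Y) *₂ T.K′ X Y -₂ rhs} refl
          (cancel-step X Y {gf *₂ T.sq (T.Δ′ X Y) *₂ T.K′ X Y} {rhs} u-gf)))
    where
    open Counted cnt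
    open Scale Ser₂-ring Ser₂-hom
    open Closed Ser₂-ring Ser₂-hom using (module T; module Root)
    open Root X Y d d-root using (a; γ; module Sequences; module Sums)
    -- a = x + d has no constant term, so the kernel root z = 1/(1 - a) is a power series; `ζ h` is
    -- its h-th power.
    module Z = Inverse a (cong (λ w → + 0 ℤ.+ w) d₀)

    ζ : ℕ → Ser₂
    ζ zero    = #₂ 1
    ζ (suc h) = Z.fix *₂ ζ h

    ζ-eq : ∀ h → ζ h ≈₂ (#₂ 1 -₂ a) *₂ ζ (suc h)
    ζ-eq h = R₂.sym {(#₂ 1 -₂ a) *₂ (Z.fix *₂ ζ h)} {ζ h}
      (R₂.trans {(#₂ 1 -₂ a) *₂ (Z.fix *₂ ζ h)} {((#₂ 1 -₂ a) *₂ Z.fix) *₂ ζ h} {ζ h}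
        (R₂.sym {((#₂ 1 -₂ a) *₂ Z.fix) *₂ ζ h} {(#₂ 1 -₂ a) *₂ (Z.fix *₂ ζ h)} (R₂.*-assoc (#₂ 1 -₂ a) Z.fix (ζ h)))
        (R₂.trans {((#₂ 1 -₂ a) *₂ Z.fix) *₂ ζ h} {#₂ 1 *₂ ζ h} {ζ h}
          (R₂.*-cong {(#₂ 1 -₂ a) *₂ Z.fix} {#₂ 1} {ζ h} {ζ h} Z.inverse (λ _ _ → refl)) (R₂.*-identityˡ (ζ h))))

    f-eq : ∀ h → f h ≈₂ f (suc h) -₂ g (suc h)
    f-eq h = minus {f (suc h)} {f h} {g (suc h)} (f-suc h)
    g-eq : ∀ h → g h ≈₂ g (suc h) -₂ X *₂ f (suc h)
    g-eq h = minus {g (suc h)} {g h} {X *₂ f (suc h)} (g-suc h)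

    open Sequences f g ζ f-eq g-eq ζ-eq f-0 g-0 (λ _ _ → refl)

    k : Ser₂
    k = T.K′ X Y *₂ T.Δ′ X Y

    -- Counter `D` goes with stacks inside D + 1 rows, hence the shift by `suc`. Only `nT` begins at
    -- height 0, where it vanishes by the choice of `γ`.
    n-system : System (λ D → k *₂ (X *₂ f (suc D))) (nQB ∘ suc) (nC ∘ suc) (nQA ∘ suc) (nWA ∘ suc) nT
    n-system = record
      { QB-eq = λ D → nQB-eq (suc D)
      ; C-eq  = λ D → nC-eq (suc D)
      ; QA-eq = λ D → nQA-eq (suc D)
      ; WA-eq = λ D → nWA-eq (suc D)
      ; T-suc = nT-suc
      ; T-0   = λ i j → trans (nT-zero i j) (Ser₂-hom-0 i j) }
      where
      Ser₂-hom-0 : konst (+ 0) ≈₂ R₂.0#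
      Ser₂-hom-0 zero zero = refl
      Ser₂-hom-0 zero (suc j) = refl
      Ser₂-hom-0 (suc i) j = refl

    QB-closed : ∀ D → k *₂ QB D ≈₂ nQB (suc D)
    QB-closed = system-unique (scale-system k system) n-system

    open Sums f g ζ f-eq g-eq ζ-eq f-0 g-0 (λ _ _ → refl) Σʸ Σʸ-cong Σʸ-step Σʸ-+ Σʸ-* nf QB nf-eq QB-closed
      using (gf; rhs; u-gf)

-- Specialisation to one variable.

module Diagonal where

  open import Defs hiding (N; S; E; W; step)
  open SeriesRings
  open ClosedForms
  open BivariateSeries
  open GeneratingFunction
  open import Level using (0ℓ)
  open import Algebra.Bundles using (CommutativeRing)
  open import Data.Nat using (zero; suc; _∸_; _<_; s≤s)
  import Data.Nat.Properties as ℕₚ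
  open import Data.Nat.Induction using (<-rec)
  open import Data.Integer using (ℤ; +_)
  import Data.Integer as ℤ
  import Data.Integer.Properties as ℤₚ
  open import Data.Product using (Σ; _×_; _,_; proj₁; proj₂)
  open import Data.Sum using (inj₁; inj₂)
  open import Relation.Binary.PropositionalEquality using (_≡_; refl; sym; trans; cong; cong₂; module ≡-Reasoning)

  module R₁ = CommutativeRing Ser-ring

  -- The substitution x = y = t. In particular `P₁ cnt` is `diag (P₂ cnt)` by definition.
  diag : Ser₂ → Ser
  diag f m = sumTo m (λ c → f c (m ∸ c))

  diag-cong : ∀ {f g} → f ≈₂ g → diag f ≈₁ diag g
  diag-cong e m = sumTo-cong≤ m (λ c _ → e c (m ∸ c))

  diag-+ : ∀ f g → diag (f +₂ g) ≈₁ diag f +₁ diag g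
  diag-+ f g m = trans (sumTo≡∑ m _) (trans (PSℤ.∑-+ m _ _) (sym (cong₂ ℤ._+_ (sumTo≡∑ m _) (sumTo≡∑ m _))))

  diag-neg : ∀ f m → diag (λ i j → ℤ.- f i j) m ≡ ℤ.- diag f m
  diag-neg f m = go m (λ c → f c (m ∸ c))
    where
    go : ∀ n h → sumTo n (λ c → ℤ.- h c) ≡ ℤ.- sumTo n h
    go zero    h = refl
    go (suc n) h = trans (cong (ℤ._+ (ℤ.- h (suc n))) (go n h)) (sym (ℤₚ.neg-distrib-+ (sumTo n h) (h (suc n))))

  diag-minus : ∀ f g → diag (f -₂ g) ≈₁ diag f -₁ diag g
  diag-minus f g m = trans (diag-+ f (λ i j → ℤ.- g i j) m) (cong (λ w → diag f m ℤ.+ w) (diag-neg g m))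

  diag-scale : ∀ k f m → diag (konst k *₂ f) m ≡ k ℤ.* diag f m
  diag-scale k f m = trans (sumTo-cong≤ m (λ c _ → konst-* k f c (m ∸ c)))
    (trans (sumTo≡∑ m _) (trans (PSℤ.∑-*ˡ m k _) (cong (k ℤ.*_) (sym (sumTo≡∑ m _)))))

  diag-X : ∀ f → diag (X *₂ f) ≈₁ t *₁ diag f
  diag-X f zero    = X-zero f 0
  diag-X f (suc m) = begin
    diag (X *₂ f) (suc m)                                             ≡⟨ sumTo≡∑ (suc m) _ ⟩
    PSℤ.∑ (suc m) (λ c → (X *₂ f) c (suc m ∸ c))                      ≡⟨ PSℤ.∑-head m _ ⟩
    (X *₂ f) 0 (suc m) ℤ.+ PSℤ.∑ m (λ c → (X *₂ f) (suc c) (m ∸ c))   ≡⟨ cong₂ ℤ._+_ (X-zero f (suc m)) (sym (sumTo≡∑ m _)) ⟩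
    + 0 ℤ.+ sumTo m (λ c → (X *₂ f) (suc c) (m ∸ c))                  ≡⟨ ℤₚ.+-identityˡ _ ⟩
    sumTo m (λ c → (X *₂ f) (suc c) (m ∸ c))                          ≡⟨ sumTo-cong≤ m (λ c _ → X-suc f c (m ∸ c)) ⟩
    diag f m                                                          ≡⟨ t-suc (diag f) m ⟨
    (t *₁ diag f) (suc m)                                             ∎
    where open ≡-Reasoning

  diag-Y : ∀ f → diag (Y *₂ f) ≈₁ t *₁ diag f
  diag-Y f zero    = Y-zero f 0
  diag-Y f (suc m) = begin
    diag (Y *₂ f) (suc m)
      ≡⟨ cong₂ ℤ._+_ (sumTo-cong≤ m (λ c c≤m → trans (cong ((Y *₂ f) c) (ℕₚ.+-∸-assoc 1 c≤m)) (Y-suc f c (m ∸ c))))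
                     (trans (cong ((Y *₂ f) (suc m)) (ℕₚ.n∸n≡0 m)) (Y-zero f (suc m))) ⟩
    diag f m ℤ.+ + 0        ≡⟨ ℤₚ.+-identityʳ _ ⟩
    diag f m                ≡⟨ t-suc (diag f) m ⟨
    (t *₁ diag f) (suc m)   ∎
    where open ≡-Reasoning

  -- `dx` takes all terms divisible by x and `dy` only those free of x, so that no term is taken
  -- twice in `split₂`.
  dx dy : Ser₂ → Ser₂
  dx f i j = f (suc i) j
  dy f zero    j = f 0 (suc j)
  dy f (suc i) j = + 0

  split₂ : ∀ f → f ≈₂ konst (f 0 0) +₂ X *₂ dx f +₂ Y *₂ dy f
  split₂ f zero zero = sym (trans (cong₂ ℤ._+_ (cong (λ w → f 0 0 ℤ.+ w) (X-zero (dx f) 0)) (Y-zero (dy f) 0))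
    (trans (ℤₚ.+-identityʳ _) (ℤₚ.+-identityʳ _)))
  split₂ f zero (suc j) = sym (trans (cong₂ ℤ._+_ (cong (λ w → + 0 ℤ.+ w) (X-zero (dx f) (suc j))) (Y-suc (dy f) 0 j)) (ℤₚ.+-identityˡ _))
  split₂ f (suc i) j = sym (trans (cong₂ ℤ._+_ (trans (cong (λ w → + 0 ℤ.+ w) (X-suc (dx f) i j)) (ℤₚ.+-identityˡ (f (suc i) j))) (Y-dy j)) (ℤₚ.+-identityʳ (f (suc i) j)))
    where
    Y-dy : ∀ j → (Y *₂ dy f) (suc i) j ≡ + 0
    Y-dy zero = Y-zero (dy f) (suc i)
    Y-dy (suc j) = Y-suc (dy f) (suc i) j

  module Distribute (R : CommutativeRing 0ℓ 0ℓ) (hom : ℤ-hom R) where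
    open CommutativeRing R renaming (refl to ≈-refl; trans to ≈-trans)
    open Closed R hom
    open Q using (_⊕_; _⊗_; _⊖_; I)

    dist₃ : ∀ k x y p q g {f} → f ≈ k + x * p + y * q → f * g ≈ k * g + x * (p * g) + y * (q * g)
    dist₃ k x y p q g e = ≈-trans (*-congʳ e)
      (solve 6 (λ k x y p q g → (k ⊕ x ⊗ p ⊕ y ⊗ q) ⊗ g := k ⊗ g ⊕ x ⊗ (p ⊗ g) ⊕ y ⊗ (q ⊗ g)) ≈-refl k x y p q g)

  diag-konst : ∀ k → diag (konst k) ≈₁ konst₁ k
  diag-konst k zero    = refl
  diag-konst k (suc m) = trans (sumTo≡∑ (suc m) _) (trans (PSℤ.∑-head m _) (trans (ℤₚ.+-identityˡ _) (PSℤ.∑-0 m)))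

  diag-split : ∀ f → diag f ≈₁ konst₁ (f 0 0) +₁ t *₁ diag (dx f) +₁ t *₁ diag (dy f)
  diag-split f m = begin
    diag f m
      ≡⟨ diag-cong (split₂ f) m ⟩
    diag (konst (f 0 0) +₂ X *₂ dx f +₂ Y *₂ dy f) m
      ≡⟨ diag-+ (konst (f 0 0) +₂ X *₂ dx f) (Y *₂ dy f) m ⟩
    diag (konst (f 0 0) +₂ X *₂ dx f) m ℤ.+ diag (Y *₂ dy f) m
      ≡⟨ cong₂ ℤ._+_ (diag-+ (konst (f 0 0)) (X *₂ dx f) m) (diag-Y (dy f) m) ⟩
    (diag (konst (f 0 0)) m ℤ.+ diag (X *₂ dx f) m) ℤ.+ (t *₁ diag (dy f)) m
      ≡⟨ cong (ℤ._+ (t *₁ diag (dy f)) m) (cong₂ ℤ._+_ (diag-konst (f 0 0) m) (diag-X (dx f) m)) ⟩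
    (konst₁ (f 0 0) +₁ t *₁ diag (dx f) +₁ t *₁ diag (dy f)) m ∎
    where open ≡-Reasoning

  -- Peeling off one factor x or y of f at a time reduces the product rule to lower degree.
  diag-* : ∀ f g → diag (f *₂ g) ≈₁ diag f *₁ diag g
  diag-* f g m = go m f
    where
    module D₂ = Distribute Ser₂-ring Ser₂-hom
    module D₁ = Distribute Ser-ring Ser-hom
    lhs : ∀ f m → diag (f *₂ g) m ≡ f 0 0 ℤ.* diag g m ℤ.+ (t *₁ diag (dx f *₂ g)) m ℤ.+ (t *₁ diag (dy f *₂ g)) m
    lhs f m = begin
      diag (f *₂ g) m
        ≡⟨ diag-cong (D₂.dist₃ (konst (f 0 0)) X Y (dx f) (dy f) g {f} (split₂ f)) m ⟩
      diag (konst (f 0 0) *₂ g +₂ X *₂ (dx f *₂ g) +₂ Y *₂ (dy f *₂ g)) m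
        ≡⟨ diag-+ (konst (f 0 0) *₂ g +₂ X *₂ (dx f *₂ g)) (Y *₂ (dy f *₂ g)) m ⟩
      diag (konst (f 0 0) *₂ g +₂ X *₂ (dx f *₂ g)) m ℤ.+ diag (Y *₂ (dy f *₂ g)) m
        ≡⟨ cong₂ ℤ._+_ (trans (diag-+ (konst (f 0 0) *₂ g) (X *₂ (dx f *₂ g)) m)
             (cong₂ ℤ._+_ (diag-scale (f 0 0) g m) (diag-X (dx f *₂ g) m))) (diag-Y (dy f *₂ g) m) ⟩
      f 0 0 ℤ.* diag g m ℤ.+ (t *₁ diag (dx f *₂ g)) m ℤ.+ (t *₁ diag (dy f *₂ g)) m ∎
      where open ≡-Reasoning
    rhs : ∀ f m → (diag f *₁ diag g) m ≡ f 0 0 ℤ.* diag g m ℤ.+ (t *₁ (diag (dx f) *₁ diag g)) m ℤ.+ (t *₁ (diag (dy f) *₁ diag g)) m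
    rhs f m = trans (D₁.dist₃ (konst₁ (f 0 0)) t t (diag (dx f)) (diag (dy f)) (diag g) {diag f} (diag-split f) m)
      (cong (λ w → w ℤ.+ (t *₁ (diag (dx f) *₁ diag g)) m ℤ.+ (t *₁ (diag (dy f) *₁ diag g)) m) (konst₁-* (f 0 0) (diag g) m))
    go : ∀ m f → diag (f *₂ g) m ≡ (diag f *₁ diag g) m
    go zero    f = refl
    go (suc m) f = trans (lhs f (suc m)) (trans
      (cong₂ ℤ._+_ (cong (λ w → f 0 0 ℤ.* diag g (suc m) ℤ.+ w) (step (dx f))) (step (dy f)))
      (sym (rhs f (suc m))))
      where
      step : ∀ e → (t *₁ diag (e *₂ g)) (suc m) ≡ (t *₁ (diag e *₁ diag g)) (suc m)
      step e = trans (t-suc (diag (e *₂ g)) m) (trans (go m e) (sym (t-suc (diag e *₁ diag g) m)))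

  diag-X₀ : diag X ≈₁ t
  diag-X₀ m = trans (diag-cong (R₂.sym {X *₂ #₂ 1} {X} (R₂.*-identityʳ X)) m) (trans (diag-X (#₂ 1) m)
    (trans (R₁.*-cong {t} {t} {diag (#₂ 1)} {#₁ 1} (λ _ → refl) (diag-konst (+ 1)) m) (R₁.*-identityʳ t m)))

  diag-Y₀ : diag Y ≈₁ t
  diag-Y₀ m = trans (diag-cong (R₂.sym {Y *₂ #₂ 1} {Y} (R₂.*-identityʳ Y)) m) (trans (diag-Y (#₂ 1) m)
    (trans (R₁.*-cong {t} {t} {diag (#₂ 1)} {#₁ 1} (λ _ → refl) (diag-konst (+ 1)) m) (R₁.*-identityʳ t m)))

  eval₁ : Ser → Ser → Ex → Ser
  eval₁ d P X′ = t
  eval₁ d P Y′ = t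
  eval₁ d P d′ = d
  eval₁ d P P′ = P
  eval₁ d P (con′ k) = konst₁ k
  eval₁ d P (p +′ q) = eval₁ d P p +₁ eval₁ d P q
  eval₁ d P (p *′ q) = eval₁ d P p *₁ eval₁ d P q
  eval₁ d P (p -′ q) = eval₁ d P p -₁ eval₁ d P q

  diag-eval : ∀ d P e → diag (eval₂ d P e) ≈₁ eval₁ (diag d) (diag P) e
  diag-eval d P X′ = diag-X₀
  diag-eval d P Y′ = diag-Y₀
  diag-eval d P d′ m = refl
  diag-eval d P P′ m = refl
  diag-eval d P (con′ k) = diag-konst k
  diag-eval d P (p +′ q) m = trans (diag-+ (eval₂ d P p) (eval₂ d P q) m)
    (cong₂ ℤ._+_ (diag-eval d P p m) (diag-eval d P q m))
  diag-eval d P (p *′ q) m = trans (diag-* (eval₂ d P p) (eval₂ d P q) m)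
    (R₁.*-cong {diag (eval₂ d P p)} {eval₁ (diag d) (diag P) p} {diag (eval₂ d P q)} {eval₁ (diag d) (diag P) q}
      (diag-eval d P p) (diag-eval d P q) m)
  diag-eval d P (p -′ q) m = trans (diag-minus (eval₂ d P p) (eval₂ d P q) m)
    (cong₂ (λ v w → v ℤ.+ (ℤ.- w)) (diag-eval d P p m) (diag-eval d P q m))

  -- If the coefficients of `e` below n vanish, the n-th coefficient of the product is twice e n.
  no-zero-divisor : ∀ (e h : Ser) → h 0 ≡ + 2 → e *₁ h ≈₁ (λ _ → + 0) → ∀ n → e n ≡ + 0
  no-zero-divisor e h h₀ eh = <-rec (λ n → e n ≡ + 0) step
    where
    lead : ∀ n → (∀ {k} → k < n → e k ≡ + 0) → (e *₁ h) n ≡ e n ℤ.* + 2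
    lead zero    ih = cong (e 0 ℤ.*_) h₀
    lead (suc n) ih = trans (cong₂ ℤ._+_
        (trans (sumTo-cong≤ n {g = λ _ → + 0} (λ k k≤n → cong (ℤ._* h (suc n ∸ k)) (ih (s≤s k≤n)))) (trans (sumTo≡∑ n _) (PSℤ.∑-0 n)))
        (cong (e (suc n) ℤ.*_) (trans (cong h (ℕₚ.n∸n≡0 n)) h₀)))
      (ℤₚ.+-identityˡ _)
    step : ∀ n → (∀ {k} → k < n → e k ≡ + 0) → e n ≡ + 0
    step n ih with ℤₚ.i*j≡0⇒i≡0∨j≡0 (e n) (trans (sym (lead n ih)) (eh n))
    ... | inj₁ p = p
    ... | inj₂ ()

  module Univariate (R : CommutativeRing 0ℓ 0ℓ) (hom : ℤ-hom R) where
    open CommutativeRing R renaming (refl to ≈-refl; sym to ≈-sym; trans to ≈-trans)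
    open Closed R hom
    open Q using (_⊕_; _⊗_; _⊖_; I; sq)

    c₂ c₃ c₄ : ∀ {n} → Polynomial n
    c₂ = Sv.con (+ 2)
    c₃ = Sv.con (+ 3)
    c₄ = Sv.con (+ 4)

    root-square : ∀ t d → d ≈ (t + d) * (t + d) →
      (⟦ + 1 ⟧ - ⟦ + 2 ⟧ * t - ⟦ + 2 ⟧ * d) * (⟦ + 1 ⟧ - ⟦ + 2 ⟧ * t - ⟦ + 2 ⟧ * d) ≈ ⟦ + 1 ⟧ - ⟦ + 4 ⟧ * t
    root-square t d e = ≈-trans
      (solve 2 (λ t d → (I ⊖ c₂ ⊗ t ⊖ c₂ ⊗ d) ⊗ (I ⊖ c₂ ⊗ t ⊖ c₂ ⊗ d) := I ⊖ c₄ ⊗ t ⊕ c₄ ⊗ ((t ⊕ d) ⊗ (t ⊕ d) ⊖ d)) ≈-refl t d)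
      (≈-trans (+-congˡ (*-congˡ (≈-trans (+-congʳ (≈-sym e)) (-‿inverseʳ d))))
      (≈-trans (+-congˡ (zeroʳ _)) (+-identityʳ _)))

    difference-of-squares : ∀ s r v → s * s ≈ v → r * r ≈ v → (s - r) * (s + r) ≈ 0#
    difference-of-squares s r v p q = ≈-trans
      (solve 2 (λ s r → (s ⊖ r) ⊗ (s ⊕ r) := s ⊗ s ⊖ r ⊗ r) ≈-refl s r)
      (≈-trans (+-cong p (-‿cong q)) (-‿inverseʳ v))

    -- At x = y = t, Δ becomes 1 - 4t, the factor `K′` splits as (1 - 3t)(1 - t), and 2d = 1 - 2t -
    -- s.
    specialise : ∀ t d s P → s ≈ ⟦ + 1 ⟧ - ⟦ + 2 ⟧ * t - ⟦ + 2 ⟧ * d →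
      P * T.sq (T.Δ′ t t) * T.K′ t t ≈
        ⟦ + 2 ⟧ * T.sq t * T.sq t * d * T.sq (T.u t t)
        + T.Δ′ t t * (t * t * T.sq (T.u t t) * (T.u t t - t * t) - T.sq t * T.sq t * (T.u t t - ⟦ + 3 ⟧ * t * t)) →
      P * T.sq (⟦ + 1 ⟧ - ⟦ + 4 ⟧ * t) * (⟦ + 1 ⟧ - ⟦ + 3 ⟧ * t) * (⟦ + 1 ⟧ - t) ≈
        (t * (t * T.sq t)) * T.sq (⟦ + 1 ⟧ - ⟦ + 2 ⟧ * t) * (⟦ + 1 ⟧ - ⟦ + 2 ⟧ * t - s)
        + T.sq t * (⟦ + 1 ⟧ - ⟦ + 6 ⟧ * t + ⟦ + 10 ⟧ * T.sq t - ⟦ + 2 ⟧ * (t * T.sq t) - t * (t * T.sq t)) * (⟦ + 1 ⟧ - ⟦ + 4 ⟧ * t)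
    specialise t d s P s≈ e = ≈-trans
      (solve 2 (λ t P → P ⊗ sq (I ⊖ c₄ ⊗ t) ⊗ (I ⊖ c₃ ⊗ t) ⊗ (I ⊖ t) := P ⊗ sq (Q.Δ′ t t) ⊗ Q.K′ t t) ≈-refl t P)
      (≈-trans e (≈-trans
        (solve 2 (λ t d → c₂ ⊗ sq t ⊗ sq t ⊗ d ⊗ sq (Q.u t t)
            ⊕ Q.Δ′ t t ⊗ (t ⊗ t ⊗ sq (Q.u t t) ⊗ (Q.u t t ⊖ t ⊗ t) ⊖ sq t ⊗ sq t ⊗ (Q.u t t ⊖ c₃ ⊗ t ⊗ t)) :=
          (t ⊗ (t ⊗ sq t)) ⊗ sq (I ⊖ c₂ ⊗ t) ⊗ (I ⊖ c₂ ⊗ t ⊖ (I ⊖ c₂ ⊗ t ⊖ c₂ ⊗ d))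
            ⊕ sq t ⊗ (I ⊖ Sv.con (+ 6) ⊗ t ⊕ Sv.con (+ 10) ⊗ sq t ⊖ c₂ ⊗ (t ⊗ sq t) ⊖ t ⊗ (t ⊗ sq t)) ⊗ (I ⊖ c₄ ⊗ t)) ≈-refl t d)
        (+-congʳ (*-congˡ (+-congˡ (-‿cong (≈-sym s≈)))))))

  module U = Univariate Ser-ring Ser-hom

  d₁ : Ser
  d₁ = diag (proj₁ d-exists)

  d₁-root : d₁ ≈₁ (t +₁ d₁) *₁ (t +₁ d₁)
  d₁-root m = trans (diag-cong (proj₂ (proj₂ d-exists)) m)
    (diag-eval (proj₁ d-exists) (#₂ 0) ((X′ +′ d′) *′ (Y′ +′ d′)) m)

  s₁ : Ser
  s₁ = #₁ 1 -₁ #₁ 2 *₁ t -₁ #₁ 2 *₁ d₁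

  s₁-square : s₁ *₁ s₁ ≈₁ #₁ 1 -₁ #₁ 4 *₁ t
  s₁-square = U.root-square t d₁ d₁-root

  s-exists : Σ Ser λ s → (s 0 ≡ + 1) × (s *₁ s ≈₁ #₁ 1 -₁ #₁ 4 *₁ t)
  s-exists = s₁ , refl , s₁-square

  -- The product of s - s₁ and s + s₁ is zero, and the second factor has constant term 2.
  s-unique : ∀ s → s 0 ≡ + 1 → s *₁ s ≈₁ #₁ 1 -₁ #₁ 4 *₁ t → s ≈₁ s₁
  s-unique s s₀ e = Scale.sub-zero Ser-ring Ser-hom {s} {s₁}
    (no-zero-divisor (s -₁ s₁) (s +₁ s₁) (cong (ℤ._+ (+ 1)) s₀)
      (U.difference-of-squares s s₁ (#₁ 1 -₁ #₁ 4 *₁ t) e s₁-square))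

  univariate : ∀ {P} → Counted P → ∀ (s : Ser) → s 0 ≡ + 1 → s *₁ s ≈₁ #₁ 1 -₁ #₁ 4 *₁ t →
    diag P *₁ (#₁ 1 -₁ #₁ 4 *₁ t) ^₁ 2 *₁ (#₁ 1 -₁ #₁ 3 *₁ t) *₁ (#₁ 1 -₁ t)
      ≈₁ t ^₁ 4 *₁ (#₁ 1 -₁ #₁ 2 *₁ t) ^₁ 2 *₁ (#₁ 1 -₁ #₁ 2 *₁ t -₁ s)
         +₁ t ^₁ 2 *₁ (#₁ 1 -₁ #₁ 6 *₁ t +₁ #₁ 10 *₁ t ^₁ 2 -₁ #₁ 2 *₁ t ^₁ 3 -₁ t ^₁ 4)
            *₁ (#₁ 1 -₁ #₁ 4 *₁ t)
  univariate {P} cnt s s₀ s² = U.specialise t d₁ s (diag P) (s-unique s s₀ s²) at-diagonal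
    where
    d = proj₁ d-exists
    at-diagonal : eval₁ d₁ (diag P) lhsE ≈₁ eval₁ d₁ (diag P) rhsE
    at-diagonal m = trans (sym (diag-eval d P lhsE m)) (trans
      (diag-cong (bivariate cnt d (proj₁ (proj₂ d-exists)) (proj₂ (proj₂ d-exists))) m)
      (diag-eval d P rhsE m))

-- Stacks and runs, their numbers and their generating functions.

module StacksAndRuns where

  open import Defs hiding (N; S; E; W; step)
  open SeriesRings
  open ClosedForms
  open BivariateSeries
  open GeneratingFunction
  open import Data.Empty using (⊥; ⊥-elim)
  open import Data.Unit using (⊤; tt)
  open import Data.Nat using (ℕ; zero; suc; _∸_; _≤_; z≤n; s≤s; _+_; _*_)
  import Data.Nat.Properties as ℕₚ
  open import Data.Integer using (ℤ; +_)
  import Data.Integer as ℤ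
  import Data.Integer.Properties as ℤₚ
  open import Data.Product using (Σ; _×_; _,_)
  open import Data.Sum using (_⊎_; inj₁; inj₂)
  open import Data.List using (List; []; _∷_; _++_; map; length; cartesianProduct)
  open import Data.List.Properties using (length-++; length-map)
  open import Data.List.Membership.Propositional using (_∈_)
  open import Data.List.Membership.Propositional.Properties using (∈-map⁺; ∈-map⁻; ∈-++⁺ˡ; ∈-++⁺ʳ; ∈-cartesianProduct⁺)
  open import Data.List.Relation.Unary.Any using (here)
  open import Data.List.Relation.Unary.All using ([]; _∷_)
  open import Data.List.Relation.Unary.Unique.Propositional using (Unique)
  open import Data.List.Relation.Unary.AllPairs using ([]; _∷_)
  import Data.List.Relation.Unary.Unique.Propositional.Properties as Uₚ
  open import Relation.Binary.PropositionalEquality using (_≡_; refl; sym; trans; cong; cong₂; subst)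

  private variable
    h c r D : ℕ

  data SPhase : Set where
    whole low high part : SPhase

  -- Stacks of c nested intervals inside h rows, each in the previous one; `part` forbids that
  -- the first interval fills all the rows.  `up` discards the first row, `down` the last one.
  data Stack : SPhase → ℕ → ℕ → Set where
    stop  : Stack whole h 0
    more  : Stack low h c → Stack whole h c
    up    : Stack low h c → Stack low (suc h) c
    turn  : Stack high h c → Stack low h c
    down  : Stack high h c → Stack high (suc h) c
    emit  : Stack whole (suc h) c → Stack high (suc h) (suc c)
    stop′ : Stack part (suc h) 0
    up′   : Stack low h c → Stack part (suc h) c
    down′ : Stack high h c → Stack part (suc h) c

  -- A run reads a polyomino without a full column, in which the last column e touching the bottom row
  -- comes before the first column w touching the top row.  The core consists of the rows common to
  -- e and w.  Steps that read a column: em (w and the columns right of it, left to right), xC and xQ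
  -- (between e and w, right to left), wA (left of e, left to right) and fin (e; the remaining columns
  -- on the right form a stack).  Steps that read a row: nA (below the core, downwards), nB and nC
  -- (above the core, downwards) and ri (inside the core, upwards).  The next column on the left ends
  -- D core rows above the first row of the last column read on the right; ri raises the former and dr
  -- the latter, and Z-convexity says that D never becomes negative.
  data Phase : Set where
    pQ pW pC pA pR : Phase

  data Run : Phase → ℕ → ℕ → ℕ → Set where
    nB  : Run pQ D c r → Run pQ D c (suc r)
    nC  : Run pC D c r → Run pQ D c (suc r)
    wB  : Run pW D c r → Run pQ D c r
    em  : Run pQ D c r → Run pW D (suc c) r
    dr  : Run pW D c r → Run pW (suc D) c r
    xC  : Run pC D c r → Run pC D (suc c) r
    xQ  : Run pQ D c r → Run pC D (suc c) r
    nA  : Run pA D c r → Run pC D c (suc r)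
    cA  : Run pC D c r → Run pA D c r
    wA  : Run pR D c r → Run pA D (suc c) r
    fin : Stack whole (suc D) c → Run pA D (suc c) 0
    st  : Run pA D c r → Run pR D c r
    ri  : Run pR (suc D) c r → Run pR D c (suc r)

  -- An explicit duplicate-free list, because `HasCount` is also stated by such a list and the two
  -- are compared at the end.
  record _has_ (A : Set) (n : ℕ) : Set where
    constructor finite
    field
      list     : List A
      unique   : Unique list
      complete : ∀ x → x ∈ list
      len      : length list ≡ n

  empty-has : ∀ {A} → (A → ⊥) → A has 0
  empty-has f = finite [] [] (λ x → ⊥-elim (f x)) refl

  iso-has : ∀ {A B n} (to : A → B) (from : B → A) → (∀ x → from (to x) ≡ x) → (∀ y → to (from y) ≡ y) →
            A has n → B has n
  iso-has to from ft tf (finite xs u c l) = finite (map to xs)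
    (Uₚ.map⁺ (λ {x} {y} e → trans (sym (ft x)) (trans (cong from e) (ft y))) u)
    (λ y → subst (_∈ map to xs) (tf y) (∈-map⁺ to (c (from y))))
    (trans (length-map to xs) l)

  _⊎-has_ : ∀ {A B m n} → A has m → B has n → (A ⊎ B) has (m + n)
  finite xs u c l ⊎-has finite ys v d k = finite (map inj₁ xs ++ map inj₂ ys)
    (Uₚ.++⁺ (Uₚ.map⁺ (λ { refl → refl }) u) (Uₚ.map⁺ (λ { refl → refl }) v) disj)
    (λ { (inj₁ x) → ∈-++⁺ˡ (∈-map⁺ inj₁ (c x)) ; (inj₂ y) → ∈-++⁺ʳ (map inj₁ xs) (∈-map⁺ inj₂ (d y)) })
    (trans (length-++ (map inj₁ xs)) (cong₂ _+_ (trans (length-map inj₁ xs) l) (trans (length-map inj₂ ys) k)))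
    where
    disj : ∀ {z} → z ∈ map inj₁ xs × z ∈ map inj₂ ys → ⊥
    disj (p , q) with ∈-map⁻ inj₁ p | ∈-map⁻ inj₂ q
    ... | _ , _ , refl | _ , _ , ()

  _×-has_ : ∀ {A B m n} → A has m → B has n → (A × B) has (m * n)
  finite xs u c l ×-has finite ys v d k = finite (cartesianProduct xs ys) (Uₚ.cartesianProduct⁺ u v)
    (λ { (x , y) → ∈-cartesianProduct⁺ (c x) (d y) })
    (trans (go xs) (cong₂ _*_ l k))
    where
    go : ∀ zs → length (cartesianProduct zs ys) ≡ length zs * length ys
    go []       = refl
    go (z ∷ zs) = trans (length-++ (map (z ,_) ys)) (cong₂ _+_ (length-map (z ,_) ys) (go zs))

  sumℕ : ℕ → (ℕ → ℕ) → ℕ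
  sumℕ zero    f = f 0
  sumℕ (suc n) f = sumℕ n f + f (suc n)

  sum-has : ∀ n {A : ℕ → Set} {f : ℕ → ℕ} → (∀ k → A k has f k) → (Σ ℕ λ k → k ≤ n × A k) has sumℕ n f
  sum-has zero p = iso-has (λ x → 0 , z≤n , x) (λ { (zero , z≤n , x) → x }) (λ _ → refl)
    (λ { (zero , z≤n , x) → refl }) (p 0)
  sum-has (suc n) {A} p = iso-has to from from-to to-from (sum-has n p ⊎-has p (suc n))
    where
    to : ((Σ ℕ λ k → k ≤ n × A k) ⊎ A (suc n)) → Σ ℕ λ k → k ≤ suc n × A k
    to (inj₁ (k , k≤n , x)) = k , ℕₚ.m≤n⇒m≤1+n k≤n , x
    to (inj₂ x)             = suc n , ℕₚ.≤-refl , x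
    from : (Σ ℕ λ k → k ≤ suc n × A k) → (Σ ℕ λ k → k ≤ n × A k) ⊎ A (suc n)
    from (k , k≤ , x) with ℕₚ.m≤n⇒m<n∨m≡n k≤
    ... | inj₁ (s≤s k≤n) = inj₁ (k , k≤n , x)
    ... | inj₂ refl      = inj₂ x
    from-to : ∀ z → from (to z) ≡ z
    from-to (inj₁ (k , k≤n , x)) with ℕₚ.m≤n⇒m<n∨m≡n (ℕₚ.m≤n⇒m≤1+n k≤n)
    ... | inj₁ (s≤s k≤n′) = cong (λ q → inj₁ (k , q , x)) (ℕₚ.≤-irrelevant k≤n′ k≤n)
    ... | inj₂ refl       = ⊥-elim (ℕₚ.<-irrefl refl k≤n)
    from-to (inj₂ x) with ℕₚ.m≤n⇒m<n∨m≡n (ℕₚ.≤-refl {suc n})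
    ... | inj₁ l    = ⊥-elim (ℕₚ.<-irrefl refl l)
    ... | inj₂ refl = refl
    to-from : ∀ z → to (from z) ≡ z
    to-from (k , k≤ , x) with ℕₚ.m≤n⇒m<n∨m≡n k≤
    ... | inj₁ (s≤s k≤n) = cong (λ q → k , q , x) (ℕₚ.≤-irrelevant _ _)
    ... | inj₂ refl      = cong (λ q → suc n , q , x) (ℕₚ.≤-irrelevant _ _)

  mutual
    -- There is no low stack with 0 intervals, but the empty summand is kept, so that the
    -- recurrences of the series hold in column degree 0 by the same computation.
    #whole #low #high : ℕ → ℕ → ℕ
    #whole h zero    = suc (#low h 0)
    #whole h (suc c) = #low h (suc c)
    #low zero    c = #high 0 c
    #low (suc h) c = #low h c + #high (suc h) c
    #high zero    c       = 0
    #high (suc h) zero    = #high h 0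
    #high (suc h) (suc c) = #high h (suc c) + #whole (suc h) c

  #part : ℕ → ℕ → ℕ
  #part h zero    = suc (#low h 0 + #high h 0)
  #part h (suc c) = #low h (suc c) + #high h (suc c)

  ⊤-has : ⊤ has 1
  ⊤-has = finite (tt ∷ []) ([] ∷ []) (λ _ → here refl) refl

  mutual
    whole-has : ∀ h c → Stack whole h c has #whole h c
    whole-has h zero = iso-has (λ { (inj₁ _) → stop ; (inj₂ s) → more s })
      (λ { stop → inj₁ tt ; (more s) → inj₂ s })
      (λ { (inj₁ _) → refl ; (inj₂ _) → refl }) (λ { stop → refl ; (more _) → refl })
      (⊤-has ⊎-has low-has h 0)
    whole-has h (suc c) = iso-has more (λ { (more s) → s }) (λ _ → refl) (λ { (more _) → refl }) (low-has h (suc c))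

    low-has : ∀ h c → Stack low h c has #low h c
    low-has zero    c = iso-has turn (λ { (turn s) → s }) (λ _ → refl) (λ { (turn _) → refl }) (high-has 0 c)
    low-has (suc h) c = iso-has (λ { (inj₁ s) → up s ; (inj₂ s) → turn s })
      (λ { (up s) → inj₁ s ; (turn s) → inj₂ s })
      (λ { (inj₁ _) → refl ; (inj₂ _) → refl }) (λ { (up _) → refl ; (turn _) → refl })
      (low-has h c ⊎-has high-has (suc h) c)

    high-has : ∀ h c → Stack high h c has #high h c
    high-has zero    c    = empty-has (λ ())
    high-has (suc h) zero = iso-has down (λ { (down s) → s }) (λ _ → refl) (λ { (down _) → refl }) (high-has h 0)
    high-has (suc h) (suc c) = iso-has (λ { (inj₁ s) → down s ; (inj₂ s) → emit s })
      (λ { (down s) → inj₁ s ; (emit s) → inj₂ s })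
      (λ { (inj₁ _) → refl ; (inj₂ _) → refl }) (λ { (down _) → refl ; (emit _) → refl })
      (high-has h (suc c) ⊎-has whole-has (suc h) c)

  part-has : ∀ h c → Stack part (suc h) c has #part h c
  part-has h zero = iso-has (λ { (inj₁ _) → stop′ ; (inj₂ (inj₁ s)) → up′ s ; (inj₂ (inj₂ s)) → down′ s })
    (λ { stop′ → inj₁ tt ; (up′ s) → inj₂ (inj₁ s) ; (down′ s) → inj₂ (inj₂ s) })
    (λ { (inj₁ _) → refl ; (inj₂ (inj₁ _)) → refl ; (inj₂ (inj₂ _)) → refl })
    (λ { stop′ → refl ; (up′ _) → refl ; (down′ _) → refl })
    (⊤-has ⊎-has (low-has h 0 ⊎-has high-has h 0))
  part-has h (suc c) = iso-has (λ { (inj₁ s) → up′ s ; (inj₂ s) → down′ s })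
    (λ { (up′ s) → inj₁ s ; (down′ s) → inj₂ s })
    (λ { (inj₁ _) → refl ; (inj₂ _) → refl }) (λ { (up′ _) → refl ; (down′ _) → refl })
    (low-has h (suc c) ⊎-has high-has h (suc c))

  mutual
    -- One summand for each constructor that fits the indices. The counter grows only together with
    -- the loss of a row, and in `#W` it falls at constant size; this is why the recursion ends.
    #Q #W #C #A #R : ℕ → ℕ → ℕ → ℕ
    #Q D c zero    = #W D c zero
    #Q D c (suc r) = #Q D c r + (#C D c r + #W D c (suc r))
    #W zero    zero    r = 0
    #W zero    (suc c) r = #Q 0 c r
    #W (suc D) zero    r = #W D zero r
    #W (suc D) (suc c) r = #W D (suc c) r + #Q (suc D) c r
    #C D zero    zero    = 0
    #C D zero    (suc r) = #A D zero r
    #C D (suc c) zero    = #C D c zero + #Q D c zero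
    #C D (suc c) (suc r) = (#C D c (suc r) + #Q D c (suc r)) + #A D (suc c) r
    #A D zero    r       = #C D zero r
    #A D (suc c) zero    = #C D (suc c) zero + (#R D c zero + #whole (suc D) c)
    #A D (suc c) (suc r) = #C D (suc c) (suc r) + #R D c (suc r)
    #R D c zero    = #A D c zero
    #R D c (suc r) = #A D c (suc r) + #R (suc D) c r

  mutual
    Q-has : ∀ D c r → Run pQ D c r has #Q D c r
    Q-has D c zero = iso-has wB (λ { (wB x) → x }) (λ _ → refl) (λ { (wB _) → refl }) (W-has D c zero)
    Q-has D c (suc r) = iso-has (λ { (inj₁ x) → nB x ; (inj₂ (inj₁ x)) → nC x ; (inj₂ (inj₂ x)) → wB x })
      (λ { (nB x) → inj₁ x ; (nC x) → inj₂ (inj₁ x) ; (wB x) → inj₂ (inj₂ x) })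
      (λ { (inj₁ _) → refl ; (inj₂ (inj₁ _)) → refl ; (inj₂ (inj₂ _)) → refl })
      (λ { (nB _) → refl ; (nC _) → refl ; (wB _) → refl })
      (Q-has D c r ⊎-has (C-has D c r ⊎-has W-has D c (suc r)))

    W-has : ∀ D c r → Run pW D c r has #W D c r
    W-has zero zero r = empty-has (λ ())
    W-has zero (suc c) r = iso-has em (λ { (em x) → x }) (λ _ → refl) (λ { (em _) → refl }) (Q-has 0 c r)
    W-has (suc D) zero r = iso-has dr (λ { (dr x) → x }) (λ _ → refl) (λ { (dr _) → refl }) (W-has D zero r)
    W-has (suc D) (suc c) r = iso-has (λ { (inj₁ x) → dr x ; (inj₂ x) → em x })
      (λ { (dr x) → inj₁ x ; (em x) → inj₂ x })
      (λ { (inj₁ _) → refl ; (inj₂ _) → refl }) (λ { (dr _) → refl ; (em _) → refl })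
      (W-has D (suc c) r ⊎-has Q-has (suc D) c r)

    C-has : ∀ D c r → Run pC D c r has #C D c r
    C-has D zero zero = empty-has (λ ())
    C-has D zero (suc r) = iso-has nA (λ { (nA x) → x }) (λ _ → refl) (λ { (nA _) → refl }) (A-has D zero r)
    C-has D (suc c) zero = iso-has (λ { (inj₁ x) → xC x ; (inj₂ x) → xQ x })
      (λ { (xC x) → inj₁ x ; (xQ x) → inj₂ x })
      (λ { (inj₁ _) → refl ; (inj₂ _) → refl }) (λ { (xC _) → refl ; (xQ _) → refl })
      (C-has D c zero ⊎-has Q-has D c zero)
    C-has D (suc c) (suc r) = iso-has (λ { (inj₁ (inj₁ x)) → xC x ; (inj₁ (inj₂ x)) → xQ x ; (inj₂ x) → nA x })
      (λ { (xC x) → inj₁ (inj₁ x) ; (xQ x) → inj₁ (inj₂ x) ; (nA x) → inj₂ x })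
      (λ { (inj₁ (inj₁ _)) → refl ; (inj₁ (inj₂ _)) → refl ; (inj₂ _) → refl })
      (λ { (xC _) → refl ; (xQ _) → refl ; (nA _) → refl })
      ((C-has D c (suc r) ⊎-has Q-has D c (suc r)) ⊎-has A-has D (suc c) r)

    A-has : ∀ D c r → Run pA D c r has #A D c r
    A-has D zero r = iso-has cA (λ { (cA x) → x }) (λ _ → refl) (λ { (cA _) → refl }) (C-has D zero r)
    A-has D (suc c) zero = iso-has (λ { (inj₁ x) → cA x ; (inj₂ (inj₁ x)) → wA x ; (inj₂ (inj₂ s)) → fin s })
      (λ { (cA x) → inj₁ x ; (wA x) → inj₂ (inj₁ x) ; (fin s) → inj₂ (inj₂ s) })
      (λ { (inj₁ _) → refl ; (inj₂ (inj₁ _)) → refl ; (inj₂ (inj₂ _)) → refl })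
      (λ { (cA _) → refl ; (wA _) → refl ; (fin _) → refl })
      (C-has D (suc c) zero ⊎-has (R-has D c zero ⊎-has whole-has (suc D) c))
    A-has D (suc c) (suc r) = iso-has (λ { (inj₁ x) → cA x ; (inj₂ x) → wA x })
      (λ { (cA x) → inj₁ x ; (wA x) → inj₂ x })
      (λ { (inj₁ _) → refl ; (inj₂ _) → refl }) (λ { (cA _) → refl ; (wA _) → refl })
      (C-has D (suc c) (suc r) ⊎-has R-has D c (suc r))

    R-has : ∀ D c r → Run pR D c r has #R D c r
    R-has D c zero = iso-has st (λ { (st x) → x }) (λ _ → refl) (λ { (st _) → refl }) (A-has D c zero)
    R-has D c (suc r) = iso-has (λ { (inj₁ x) → st x ; (inj₂ x) → ri x })
      (λ { (st x) → inj₁ x ; (ri x) → inj₂ x })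
      (λ { (inj₁ _) → refl ; (inj₂ _) → refl }) (λ { (st _) → refl ; (ri _) → refl })
      (A-has D c (suc r) ⊎-has R-has (suc D) c r)

  -- With c + 1 columns and r + 1 rows: in a VObj the last full column separates two stacks; in a GObj
  -- the stack consists of the left columns that do not reach below the core.
  VObj GObj : ℕ → ℕ → Set
  VObj c r = Σ ℕ λ a → a ≤ c × (Stack whole (suc r) a × Stack part (suc r) (c ∸ a))
  GObj c r = Σ ℕ λ D → D ≤ r × (Σ ℕ λ a → a ≤ c × (Stack whole (suc D) a × Run pQ D (c ∸ a) (r ∸ D)))

  #V #G : ℕ → ℕ → ℕ
  #V c r = sumℕ c (λ a → #whole (suc r) a * #part r (c ∸ a))
  #G c r = sumℕ r (λ D → sumℕ c (λ a → #whole (suc D) a * #Q D (c ∸ a) (r ∸ D)))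

  V-has : ∀ c r → VObj c r has #V c r
  V-has c r = sum-has c (λ a → whole-has (suc r) a ×-has part-has r (c ∸ a))

  G-has : ∀ c r → GObj c r has #G c r
  G-has c r = sum-has r (λ D → sum-has c (λ a → whole-has (suc D) a ×-has Q-has D (c ∸ a) (r ∸ D)))

  -- `#G` occurs twice, for the polyominoes in which the bottom is left before the top is reached
  -- and for their reflections.
  #Z : ℕ → ℕ → ℕ
  #Z (suc c) (suc r) = #V c r + (#G c r + #G c r)
  #Z _       _       = 0

  row : (ℕ → ℕ) → Ser₂
  row f c zero    = + f c
  row f c (suc _) = + 0

  -- Series of stacks involve x alone: the rows of a stack are paid for elsewhere, namely by y^(D +
  -- 1) in the total sum.
  fS gS nfS QBS CS QAS WAS TS : ℕ → Ser₂
  fS h = row (#whole h)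
  gS h = row (#high h)
  nfS h = row (#part h)
  QBS D c r = + #Q D c r
  CS D c r = + #C D c r
  QAS D c r = + #A D c r
  WAS D c r = + #R D c r
  TS zero c r = + 0
  TS (suc D) c r = + #W D c r

  +-zeros : ∀ {a b : ℤ} {n : ℤ} → a ≡ + 0 → b ≡ + 0 → n ≡ a ℤ.+ b ℤ.+ n
  +-zeros {n = n} refl refl = sym (ℤₚ.+-identityˡ n)

  #-system : System (λ D → X *₂ fS (suc D)) QBS CS QAS WAS TS
  #-system = record
    { QB-eq = qb ; C-eq = ce ; QA-eq = qa ; WA-eq = wa ; T-suc = ts ; T-0 = λ _ _ → refl }
    where
    assocˡ : ∀ a b c → + (a + (b + c)) ≡ + (a + b + c)
    assocˡ a b c = cong +_ (sym (ℕₚ.+-assoc a b c))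

    qb : ∀ D → QBS D ≈₂ Y *₂ QBS D +₂ Y *₂ CS D +₂ TS (suc D)
    qb D c zero    = +-zeros (Y-zero (QBS D) c) (Y-zero (CS D) c)
    qb D c (suc r) = trans (assocˡ (#Q D c r) _ _)
      (sym (cong (ℤ._+ (+ #W D c (suc r))) (cong₂ ℤ._+_ (Y-suc (QBS D) c r) (Y-suc (CS D) c r))))

    xs : ∀ D c r → (X *₂ CS D +₂ X *₂ QBS D) (suc c) r ≡ + (#C D c r + #Q D c r)
    xs D c r = cong₂ ℤ._+_ (X-suc (CS D) c r) (X-suc (QBS D) c r)
    xs₀ : ∀ D r → (X *₂ CS D +₂ X *₂ QBS D) 0 r ≡ + 0
    xs₀ D r = cong₂ ℤ._+_ (X-zero (CS D) r) (X-zero (QBS D) r)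

    ce : ∀ D → CS D ≈₂ X *₂ CS D +₂ X *₂ QBS D +₂ Y *₂ QAS D
    ce D zero    zero    = sym (cong₂ ℤ._+_ (xs₀ D 0) (Y-zero (QAS D) 0))
    ce D zero    (suc r) = sym (cong₂ ℤ._+_ (xs₀ D (suc r)) (Y-suc (QAS D) 0 r))
    ce D (suc c) zero    = sym (trans (cong₂ ℤ._+_ (xs D c 0) (Y-zero (QAS D) (suc c))) (ℤₚ.+-identityʳ _))
    ce D (suc c) (suc r) = sym (cong₂ ℤ._+_ (xs D c (suc r)) (Y-suc (QAS D) (suc c) r))

    qa : ∀ D → QAS D ≈₂ CS D +₂ X *₂ WAS D +₂ X *₂ fS (suc D)
    qa D zero    r       = sym (trans (cong₂ ℤ._+_ (cong (λ w → CS D 0 r ℤ.+ w) (X-zero (WAS D) r)) (X-zero (fS (suc D)) r))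
                                (trans (ℤₚ.+-identityʳ _) (ℤₚ.+-identityʳ _)))
    qa D (suc c) zero    = trans (assocˡ (#C D (suc c) 0) _ _)
      (sym (cong₂ ℤ._+_ (cong (λ w → CS D (suc c) 0 ℤ.+ w) (X-suc (WAS D) c 0)) (X-suc (fS (suc D)) c 0)))
    qa D (suc c) (suc r) = sym (trans (cong₂ ℤ._+_ (cong (λ w → CS D (suc c) (suc r) ℤ.+ w) (X-suc (WAS D) c (suc r))) (X-suc (fS (suc D)) c (suc r)))
                                (ℤₚ.+-identityʳ _))

    wa : ∀ D → WAS D ≈₂ QAS D +₂ Y *₂ WAS (suc D)
    wa D c zero    = sym (trans (cong (λ w → QAS D c 0 ℤ.+ w) (Y-zero (WAS (suc D)) c)) (ℤₚ.+-identityʳ _))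
    wa D c (suc r) = sym (cong (λ w → QAS D c (suc r) ℤ.+ w) (Y-suc (WAS (suc D)) c r))

    ts : ∀ D → TS (suc D) ≈₂ TS D +₂ X *₂ QBS D
    ts zero    zero    r = sym (cong (λ w → + 0 ℤ.+ w) (X-zero (QBS 0) r))
    ts zero    (suc c) r = sym (trans (cong (λ w → + 0 ℤ.+ w) (X-suc (QBS 0) c r)) (ℤₚ.+-identityˡ _))
    ts (suc D) zero    r = sym (trans (cong (λ w → + #W D 0 r ℤ.+ w) (X-zero (QBS (suc D)) r)) (ℤₚ.+-identityʳ _))
    ts (suc D) (suc c) r = sym (cong (λ w → + #W D (suc c) r ℤ.+ w) (X-suc (QBS (suc D)) c r))

  fS-0 : fS 0 ≈₂ #₂ 1
  fS-0 zero    zero    = refl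
  fS-0 zero    (suc j) = refl
  fS-0 (suc i) zero    = refl
  fS-0 (suc i) (suc j) = refl

  gS-0 : gS 0 ≈₂ #₂ 0
  gS-0 zero    zero    = refl
  gS-0 zero    (suc j) = refl
  gS-0 (suc i) zero    = refl
  gS-0 (suc i) (suc j) = refl

  fS-suc : ∀ h → fS (suc h) ≈₂ fS h +₂ gS (suc h)
  fS-suc h zero    zero    = refl
  fS-suc h (suc i) zero    = refl
  fS-suc h i       (suc j) = refl

  gS-suc : ∀ h → gS (suc h) ≈₂ gS h +₂ X *₂ fS (suc h)
  gS-suc h zero    zero    = sym (trans (cong (λ w → + #high h 0 ℤ.+ w) (X-zero (fS (suc h)) 0)) (ℤₚ.+-identityʳ _))
  gS-suc h zero    (suc j) = sym (cong (λ w → + 0 ℤ.+ w) (X-zero (fS (suc h)) (suc j)))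
  gS-suc h (suc i) zero    = sym (cong (λ w → + #high h (suc i) ℤ.+ w) (X-suc (fS (suc h)) i 0))
  gS-suc h (suc i) (suc j) = sym (cong (λ w → + 0 ℤ.+ w) (X-suc (fS (suc h)) i (suc j)))

  -- A stack inside D + 1 rows either belongs to `part` or begins with an interval filling all rows,
  -- which may be followed by any stack inside the same rows.
  nfS-eq : ∀ D → nfS D +₂ X *₂ fS (suc D) ≈₂ fS (suc D)
  nfS-eq D zero    zero    = trans (cong (λ w → + #part D 0 ℤ.+ w) (X-zero (fS (suc D)) 0)) (ℤₚ.+-identityʳ _)
  nfS-eq D zero    (suc j) = cong (λ w → + 0 ℤ.+ w) (X-zero (fS (suc D)) (suc j))
  nfS-eq D (suc i) zero    = trans (cong (λ w → + #part D (suc i) ℤ.+ w) (X-suc (fS (suc D)) i 0))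
    (cong +_ (ℕₚ.+-assoc (#low D (suc i)) (#high D (suc i)) (#whole (suc D) i)))
  nfS-eq D (suc i) (suc j) = cong (λ w → + 0 ℤ.+ w) (X-suc (fS (suc D)) i (suc j))

  sumTo-pos : ∀ n f → sumTo n (λ k → + f k) ≡ + sumℕ n f
  sumTo-pos zero    f = refl
  sumTo-pos (suc n) f = cong (ℤ._+ (+ f (suc n))) (sumTo-pos n f)

  sumTo-0 : ∀ n → sumTo n (λ _ → + 0) ≡ + 0
  sumTo-0 zero    = refl
  sumTo-0 (suc n) = trans (ℤₚ.+-identityʳ _) (sumTo-0 n)

  row-* : ∀ f g i j → (row f *₂ g) i j ≡ sumTo i (λ a → + f a ℤ.* g (i ∸ a) j)
  row-* f g i j = sumTo-cong≤ i (λ a _ → inner a j)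
    where
    inner : ∀ a j → sumTo j (λ b → row f a b ℤ.* g (i ∸ a) (j ∸ b)) ≡ + f a ℤ.* g (i ∸ a) j
    inner a zero    = refl
    inner a (suc j) = trans (sumTo≡∑ (suc j) _) (trans (PSℤ.∑-head j _)
      (trans (cong (λ w → + f a ℤ.* g (i ∸ a) (suc j) ℤ.+ w) (PSℤ.∑-0 j)) (ℤₚ.+-identityʳ _)))

  X-through : ∀ f g i j → (f *₂ (X *₂ g)) (suc i) j ≡ (f *₂ g) i j
  X-through f g i j = trans (R₂.*-cong {f} {f} {X *₂ g} {g *₂ X} (λ _ _ → refl) (R₂.*-comm X g) (suc i) j)
    (trans (sym (R₂.*-assoc f g X (suc i) j)) (trans (R₂.*-comm (f *₂ g) X (suc i) j) (X-suc (f *₂ g) i j)))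

  X-through-zero : ∀ f g j → (f *₂ (X *₂ g)) 0 j ≡ + 0
  X-through-zero f g j = trans (R₂.*-cong {f} {f} {X *₂ g} {g *₂ X} (λ _ _ → refl) (R₂.*-comm X g) 0 j)
    (trans (sym (R₂.*-assoc f g X 0 j)) (trans (R₂.*-comm (f *₂ g) X 0 j) (X-zero (f *₂ g) j)))

  termS : ℕ → Ser₂
  termS D = fS (suc D) *₂ (X *₂ nfS D) +₂ #₂ 2 *₂ (fS (suc D) *₂ (X *₂ QBS D))

  termS-zero : ∀ D j → termS D 0 j ≡ + 0
  termS-zero D j = cong₂ ℤ._+_ (X-through-zero (fS (suc D)) (nfS D) j)
    (trans (konst-* (+ 2) (fS (suc D) *₂ (X *₂ QBS D)) 0 j) (cong (λ w → + 2 ℤ.* w) (X-through-zero (fS (suc D)) (QBS D) j)))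

  -- With a full column nothing is left to be read outside the stacks, so of the sum over `D` only
  -- the term D = r survives.
  vTerm : ℕ → ℕ → ℕ → ℤ
  vTerm D c zero    = + #V c D
  vTerm D c (suc _) = + 0

  gTerm : ℕ → ℕ → ℕ → ℕ
  gTerm D c j = sumℕ c (λ a → #whole (suc D) a * #Q D (c ∸ a) j)

  termS-suc : ∀ D c j → termS D (suc c) j ≡ vTerm D c j ℤ.+ (+ gTerm D c j ℤ.+ + gTerm D c j)
  termS-suc D c j = cong₂ ℤ._+_
    (trans (X-through (fS (suc D)) (nfS D) c j) (trans (row-* (#whole (suc D)) (nfS D) c j) (vpart j)))
    (trans (konst-* (+ 2) (fS (suc D) *₂ (X *₂ QBS D)) (suc c) j)
      (trans (cong (λ w → + 2 ℤ.* w) gpart) (double (gTerm D c j))))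
    where
    double : ∀ n → + 2 ℤ.* + n ≡ + n ℤ.+ + n
    double n = trans (sym (ℤₚ.pos-* 2 n)) (cong (λ w → + (n + w)) (ℕₚ.+-identityʳ n))
    vpart : ∀ j → sumTo c (λ a → + #whole (suc D) a ℤ.* nfS D (c ∸ a) j) ≡ vTerm D c j
    vpart zero    = trans (sumTo-cong≤ c (λ a _ → sym (ℤₚ.pos-* (#whole (suc D) a) _))) (sumTo-pos c _)
    vpart (suc j) = trans (sumTo-cong≤ c (λ a _ → ℤₚ.*-zeroʳ (+ #whole (suc D) a))) (sumTo-0 c)
    gpart : (fS (suc D) *₂ (X *₂ QBS D)) (suc c) j ≡ + gTerm D c j
    gpart = trans (X-through (fS (suc D)) (QBS D) c j) (trans (row-* (#whole (suc D)) (QBS D) c j)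
      (trans (sumTo-cong≤ c (λ a _ → sym (ℤₚ.pos-* (#whole (suc D) a) _))) (sumTo-pos c _)))

  vTerm-sum : ∀ c r → sumTo r (λ D → vTerm D c (r ∸ D)) ≡ + #V c r
  vTerm-sum c zero    = refl
  vTerm-sum c (suc r) = trans (cong₂ ℤ._+_
      (trans (sumTo-cong≤ r (λ D D≤r → cong (vTerm D c) (ℕₚ.+-∸-assoc 1 D≤r))) (sumTo-0 r))
      (cong (vTerm (suc r) c) (ℕₚ.n∸n≡0 r)))
    (ℤₚ.+-identityˡ _)

  #Z-eq : ∀ c r → + #Z c r ≡ (Y *₂ Σʸ termS) c r
  #Z-eq zero    zero    = sym (Y-zero (Σʸ termS) 0)
  #Z-eq (suc c) zero    = sym (Y-zero (Σʸ termS) (suc c))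
  #Z-eq zero    (suc r) = sym (trans (Y-suc (Σʸ termS) 0 r)
    (trans (sumTo-cong≤ r (λ D _ → termS-zero D (r ∸ D))) (sumTo-0 r)))
  #Z-eq (suc c) (suc r) = sym (trans (Y-suc (Σʸ termS) (suc c) r)
    (trans (sumTo-cong≤ r (λ D _ → termS-suc D c (r ∸ D)))
    (trans (sum-+ r _ _) (cong₂ ℤ._+_ (vTerm-sum c r) (trans (sum-+ r _ _) (cong₂ ℤ._+_ (sumTo-pos r _) (sumTo-pos r _)))))))
    where
    sum-+ : ∀ n (f g : ℕ → ℤ) → sumTo n (λ k → f k ℤ.+ g k) ≡ sumTo n f ℤ.+ sumTo n g
    sum-+ n f g = trans (sumTo≡∑ n _) (trans (PSℤ.∑-+ n f g) (sym (cong₂ ℤ._+_ (sumTo≡∑ n f) (sumTo≡∑ n g))))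

  counted : ∀ cnt → (∀ c r → cnt c r ≡ #Z c r) → Counted (P₂ cnt)
  counted cnt e = record
    { f = fS ; g = gS ; nf = nfS ; QB = QBS ; C = CS ; QA = QAS ; WA = WAS ; T = TS
    ; f-0 = fS-0 ; g-0 = gS-0 ; f-suc = fS-suc ; g-suc = gS-suc ; nf-eq = nfS-eq ; system = #-system
    ; P-eq = λ c r → trans (cong +_ (e c r)) (#Z-eq c r) }

-- Stacks correspond to nested lists of intervals.

module StackColumns where

  open StacksAndRuns
  open import Data.Empty using (⊥-elim)
  open import Data.Nat using (ℕ; zero; suc; _≤_; _<_; z≤n; s≤s; _+_)
  import Data.Nat.Properties as ℕₚ
  open import Data.Product using (Σ; _×_; _,_; proj₂)
  open import Data.Sum using (_⊎_; inj₁; inj₂)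
  open import Data.List using (List; []; _∷_; length)
  open import Data.List.Properties using (∷-injective)
  open import Relation.Binary.PropositionalEquality using (_≡_; _≢_; refl; sym; trans; cong; subst)
  open import Data.Nat.Solver using (module +-*-Solver)

  Ivs : Set
  Ivs = List (ℕ × ℕ)

  private variable
    h c r D b k a g p q s k′ a′ g′ : ℕ
    L M R Z : Ivs
    ph : Phase
    sp : SPhase

  -- Stacks as lists: (p , q) stands for the rows from q to p.

  stack : Stack sp h c → ℕ → Ivs
  stack stop         q = []
  stack (more s)     q = stack s q
  stack (up s)       q = stack s (suc q)
  stack (turn s)     q = stack s q
  stack (down s)     q = stack s q
  stack (emit {h} s) q = (q + h , q) ∷ stack s q
  stack stop′        q = []
  stack (up′ s)      q = stack s (suc q)
  stack (down′ s)    q = stack s q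

  data Nested : ℕ → ℕ → Ivs → Set where
    []  : Nested p q []
    add : ∀ {p′ q′} → q ≤ q′ → q′ ≤ p′ → p′ ≤ p → Nested p′ q′ Z → Nested p q ((p′ , q′) ∷ Z)

  LowSpec HighSpec : ℕ → ℕ → Ivs → Set
  LowSpec  h q zs = Σ ℕ λ p′ → Σ ℕ λ q′ → Σ Ivs λ Z → zs ≡ (p′ , q′) ∷ Z × q ≤ q′ × q′ ≤ p′ × p′ < q + h × Nested p′ q′ Z
  HighSpec h q zs = Σ ℕ λ p′ → Σ Ivs λ Z → zs ≡ (p′ , q) ∷ Z × q ≤ p′ × p′ < q + h × Nested p′ q Z

  mutual
    whole-nested : (s : Stack whole (suc h) c) → ∀ q → Nested (q + h) q (stack s q)
    whole-nested stop q = []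
    whole-nested {h} (more s) q with stack s q | low-spec s q
    ... | _ | p′ , q′ , Z , refl , l₁ , l₂ , l₃ , n =
      add l₁ l₂ (ℕₚ.≤-pred (subst (p′ <_) (ℕₚ.+-suc q h) l₃)) n

    low-spec : (s : Stack low h c) → ∀ q → LowSpec h q (stack s q)
    low-spec {suc h} (up s) q with low-spec s (suc q)
    ... | p′ , q′ , Z , e , l₁ , l₂ , l₃ , n =
      p′ , q′ , Z , e , ℕₚ.≤-trans (ℕₚ.n≤1+n q) l₁ , l₂ , subst (p′ <_) (sym (ℕₚ.+-suc q h)) l₃ , n
    low-spec (turn s) q with high-spec s q
    ... | p′ , Z , e , l₁ , l₂ , n = p′ , q , Z , e , ℕₚ.≤-refl , l₁ , l₂ , n

    high-spec : (s : Stack high h c) → ∀ q → HighSpec h q (stack s q)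
    high-spec {suc h} (down s) q with high-spec s q
    ... | p′ , Z , e , l₁ , l₂ , n = p′ , Z , e , l₁ , subst (p′ <_) (sym (ℕₚ.+-suc q h)) (ℕₚ.m≤n⇒m≤1+n l₂) , n
    high-spec {suc h} (emit s) q =
      q + h , stack s q , refl , ℕₚ.m≤m+n q h , subst (q + h <_) (sym (ℕₚ.+-suc q h)) ℕₚ.≤-refl , whole-nested s q

  part-nested : (s : Stack part (suc h) c) → ∀ q → Nested (q + h) q (stack s q)
  part-nested stop′ q = []
  part-nested {h} (up′ s) q with stack s (suc q) | low-spec s (suc q)
  ... | _ | p′ , q′ , Z , refl , l₁ , l₂ , l₃ , n = add (ℕₚ.≤-trans (ℕₚ.n≤1+n q) l₁) l₂ (ℕₚ.≤-pred l₃) n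
  part-nested {h} (down′ s) q with stack s q | high-spec s q
  ... | _ | p′ , Z , refl , l₂ , l₃ , n = add ℕₚ.≤-refl l₂ (ℕₚ.<⇒≤ l₃) n

  NotFull : ℕ → ℕ → Ivs → Set
  NotFull p q Z = ∀ {Z′} → Z ≢ (p , q) ∷ Z′

  part-notfull : (s : Stack part (suc h) c) → ∀ q → NotFull (q + h) q (stack s q)
  part-notfull stop′ q ()
  part-notfull (up′ s) q e with stack s (suc q) | low-spec s (suc q)
  part-notfull (up′ s) q refl | _ | p′ , q′ , Z , refl , l₁ , l₂ , l₃ , n = ℕₚ.<-irrefl refl l₁
  part-notfull (down′ s) q e with stack s q | high-spec s q
  part-notfull (down′ s) q refl | _ | p′ , Z , refl , l₂ , l₃ , n = ℕₚ.<-irrefl refl l₃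

  ups : ∀ m → Stack low h c → Stack low (m + h) c
  ups zero    s = s
  ups (suc m) s = up (ups m s)

  stack-ups : ∀ m (s : Stack low h c) q → stack (ups m s) q ≡ stack s (m + q)
  stack-ups zero    s q = refl
  stack-ups (suc m) s q = trans (stack-ups m s (suc q)) (cong (stack s) (ℕₚ.+-suc m q))

  downs : ∀ m → Stack high h c → Stack high (m + h) c
  downs zero    s = s
  downs (suc m) s = down (downs m s)

  stack-downs : ∀ m (s : Stack high h c) q → stack (downs m s) q ≡ stack s q
  stack-downs zero    s q = refl
  stack-downs (suc m) s q = stack-downs m s q

  -- The first interval is reached by as many steps `up` as there are rows below it, then as many
  -- `down` as there are rows above it. The treatment of the rest is the argument `rec`, so that the
  -- recursion of `whole-complete` remains structural.
  low-complete : ∀ {p′ q′} → q ≤ q′ → q′ ≤ p′ → p′ < q + h →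
    (∀ e → p′ ≡ q′ + e → Σ ℕ λ c → Σ (Stack whole (suc e) c) λ s → stack s q′ ≡ Z) →
    Σ ℕ λ c → Σ (Stack low h c) λ s → stack s q ≡ (p′ , q′) ∷ Z
  low-complete {q} {h} {Z} l₁ l₂ l₃ rec with ℕₚ.m≤n⇒∃[o]m+o≡n l₁ | ℕₚ.m≤n⇒∃[o]m+o≡n l₂
  ... | m , refl | e , refl with rec e refl | ℕₚ.m≤n⇒∃[o]m+o≡n l₃
  ... | c , s , es | d , ed = suc c , subst (λ h → Stack low h (suc c)) h≡ low′ ,
        trans (stack-subst h≡ low′) (trans (stack-ups m _ q) (trans (stack-downs d (emit s) (m + q))
          (trans (cong (λ v → (v + e , v) ∷ stack s v) (ℕₚ.+-comm m q)) (cong ((q + m + e , q + m) ∷_) es))))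
    where
    low′ : Stack low (m + (d + suc e)) (suc c)
    low′ = ups m (turn (downs d (emit s)))
    h≡ : m + (d + suc e) ≡ h
    h≡ = ℕₚ.+-cancelˡ-≡ q _ _ (trans (arith q m d e) ed)
      where
      open +-*-Solver
      arith : ∀ q m d e → q + (m + (d + suc e)) ≡ suc (q + m + e) + d
      arith = solve 4 (λ q m d e → q :+ (m :+ (d :+ (con 1 :+ e))) := con 1 :+ (q :+ m :+ e) :+ d) refl
    stack-subst : ∀ {h h′} (e : h ≡ h′) (s : Stack low h (suc c)) → stack (subst (λ h → Stack low h (suc c)) e s) q ≡ stack s q
    stack-subst refl s = refl

  whole-complete : Nested (q + h) q Z → Σ ℕ λ c → Σ (Stack whole (suc h) c) λ s → stack s q ≡ Z
  whole-complete [] = 0 , stop , refl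
  whole-complete {q} {h} (add {p′ = p′} {q′} l₁ l₂ l₃ n)
    with low-complete l₁ l₂ (subst (p′ <_) (sym (ℕₚ.+-suc q h)) (s≤s l₃)) (λ { e refl → whole-complete n })
  ... | c , s , e = c , more s , e

  part-complete : Nested h 0 Z → NotFull h 0 Z → Σ ℕ λ c → Σ (Stack part (suc h) c) λ s → stack s 0 ≡ Z
  part-complete [] _ = 0 , stop′ , refl
  part-complete {h} (add {p′ = p′} {zero} l₁ l₂ l₃ n) nf = down-case (ℕₚ.m≤n⇒m<n∨m≡n l₃)
    where
    down-case : p′ < h ⊎ p′ ≡ h → _
    down-case (inj₂ refl) = ⊥-elim (nf refl)
    down-case (inj₁ l) with whole-complete {0} {p′} n | ℕₚ.m≤n⇒∃[o]m+o≡n l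
    ... | c , s , e | d , refl = suc c , down′ (subst (λ h → Stack high h (suc c)) eq (downs d (emit s))) ,
          trans (st-subst eq (downs d (emit s))) (trans (stack-downs d (emit s) 0) (cong ((p′ , 0) ∷_) e))
      where
      eq : d + suc p′ ≡ suc p′ + d
      eq = ℕₚ.+-comm d (suc p′)
      st-subst : ∀ {h h′} (e : h ≡ h′) (s : Stack high h (suc c)) → stack (subst (λ h → Stack high h (suc c)) e s) 0 ≡ stack s 0
      st-subst refl s = refl
  part-complete {h} (add {p′ = p′} {suc q′} l₁ l₂ l₃ n) nf
    with low-complete {1} {h} {p′ = p′} {suc q′} (s≤s z≤n) l₂ (s≤s l₃) (λ { e refl → whole-complete n })
  ... | c , s , e = c , up′ s , e

  mutual
    -- The first interval decides each choice: its lower end separates `up` from `turn`, its upper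
    -- end `down` from `emit`.
    whole-injective : ∀ (s s′ : Stack whole h c) q → stack s q ≡ stack s′ q → s ≡ s′
    whole-injective stop stop q e = refl
    whole-injective stop (more s) q e with stack s q | low-spec s q
    whole-injective stop (more s) q () | _ | _ , _ , _ , refl , _
    whole-injective (more s) stop q e with stack s q | low-spec s q
    whole-injective (more s) stop q () | _ | _ , _ , _ , refl , _
    whole-injective (more s) (more s′) q e = cong more (low-injective s s′ q e)

    low-injective : ∀ (s s′ : Stack low h c) q → stack s q ≡ stack s′ q → s ≡ s′
    low-injective (up s) (up s′) q e = cong up (low-injective s s′ (suc q) e)
    low-injective (up s) (turn s′) q e = ⊥-elim (low≢high s s′ q e)
    low-injective (turn s) (up s′) q e = ⊥-elim (low≢high s′ s q (sym e))
    low-injective (turn s) (turn s′) q e = cong turn (high-injective s s′ q e)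

    low≢high : ∀ {h′} (s : Stack low h c) (s′ : Stack high h′ c) q → stack s (suc q) ≢ stack s′ q
    low≢high s s′ q e with stack s (suc q) | low-spec s (suc q) | stack s′ q | high-spec s′ q
    low≢high s s′ q refl | _ | _ , _ , _ , refl , l , _ | _ | _ , _ , refl , _ = ℕₚ.<-irrefl refl l

    high-injective : ∀ (s s′ : Stack high h c) q → stack s q ≡ stack s′ q → s ≡ s′
    high-injective (down s) (down s′) q e = cong down (high-injective s s′ q e)
    high-injective (down s) (emit s′) q e = ⊥-elim (down≢emit s s′ q e)
    high-injective (emit s) (down s′) q e = ⊥-elim (down≢emit s′ s q (sym e))
    high-injective (emit s) (emit s′) q e = cong emit (whole-injective s s′ q (proj₂ (∷-injective e)))

    down≢emit : ∀ (s : Stack high h (suc c)) (s′ : Stack whole (suc h) c) q → stack s q ≢ (q + h , q) ∷ stack s′ q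
    down≢emit s s′ q e with stack s q | high-spec s q
    down≢emit s s′ q refl | _ | _ , _ , refl , _ , l , _ = ℕₚ.<-irrefl refl l

  part-injective : ∀ (s s′ : Stack part (suc h) c) q → stack s q ≡ stack s′ q → s ≡ s′
  part-injective stop′ stop′ q e = refl
  part-injective stop′ (up′ s) q e with stack s (suc q) | low-spec s (suc q)
  part-injective stop′ (up′ s) q () | _ | _ , _ , _ , refl , _
  part-injective stop′ (down′ s) q e with stack s q | high-spec s q
  part-injective stop′ (down′ s) q () | _ | _ , _ , refl , _
  part-injective (up′ s) stop′ q e with stack s (suc q) | low-spec s (suc q)
  part-injective (up′ s) stop′ q () | _ | _ , _ , _ , refl , _
  part-injective (down′ s) stop′ q e with stack s q | high-spec s q
  part-injective (down′ s) stop′ q () | _ | _ , _ , refl , _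
  part-injective (up′ s) (up′ s′) q e = cong up′ (low-injective s s′ (suc q) e)
  part-injective (up′ s) (down′ s′) q e = ⊥-elim (low≢high s s′ q e)
  part-injective (down′ s) (up′ s′) q e = ⊥-elim (low≢high s′ s q (sym e))
  part-injective (down′ s) (down′ s′) q e = cong down′ (high-injective s s′ q e)

  stack-length : (s : Stack sp h c) → ∀ q → length (stack s q) ≡ c
  stack-length stop q = refl
  stack-length (more s) q = stack-length s q
  stack-length (up s) q = stack-length s (suc q)
  stack-length (turn s) q = stack-length s q
  stack-length (down s) q = stack-length s q
  stack-length (emit s) q = cong suc (stack-length s q)
  stack-length stop′ q = refl
  stack-length (up′ s) q = stack-length s (suc q)
  stack-length (down′ s) q = stack-length s q

-- Runs produce exactly the admissible shapes.

module RunShapes where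

  open StacksAndRuns
  open StackColumns
  open import Data.Empty using (⊥-elim)
  open import Data.Nat using (ℕ; zero; suc; _≤_; z≤n; s≤s; _+_; pred; _≟_)
  import Data.Nat.Properties as ℕₚ
  open import Data.Product using (Σ; _×_; _,_; proj₁; proj₂)
  open import Data.Sum using (_⊎_; inj₁; inj₂)
  open import Data.List using ([]; _∷_)
  open import Data.List.Membership.Propositional using (_∈_)
  open import Data.List.Relation.Unary.Any using (here; there)
  open import Relation.Nullary using (yes; no)
  open import Relation.Binary.PropositionalEquality using (_≡_; _≢_; refl; sym; trans; cong; subst)

  private variable
    h c r D b k a g p q s k′ a′ g′ : ℕ
    L M R Z : Ivs
    ph : Phase
    sp : SPhase

  -- What remains to be read: b, k and a rows below, inside and above the core, and lists of columns.
  -- (s , k) in L reaches from row s to k rows below the top row of the core, (s , a) in M from row s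
  -- to a rows above it, (g , a) in R from g rows below it to a rows above it, and (p , q) in Z from p
  -- to q rows below it.
  record Shape : Set where
    constructor shape
    field
      bʳ kʳ aʳ    : ℕ
      Lʳ Mʳ Rʳ Zʳ : Ivs
  open Shape public

  add-a add-b add-k add-L add-M : Shape → Shape
  add-a d = record d { aʳ = suc (aʳ d) }
  add-b d = record d { bʳ = suc (bʳ d) }
  add-k d = record d { kʳ = suc (kʳ d) }
  add-L d = record d { Lʳ = (bʳ d , kʳ d) ∷ Lʳ d }
  add-M d = record d { Mʳ = (bʳ d , aʳ d) ∷ Mʳ d }

  add-R : ℕ → Shape → Shape
  add-R D d = record d { Rʳ = (D + kʳ d , aʳ d) ∷ Rʳ d }

  -- A column is recorded by the numbers of rows still unread when its turn comes: these numbers are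
  -- its ends.
  decode : Run ph D c r → Shape
  decode (nB x) = add-a (decode x)
  decode (nC x) = add-a (decode x)
  decode (wB x) = decode x
  decode (em {D} x) = add-R D (decode x)
  decode (dr x) = decode x
  decode (xC x) = add-M (decode x)
  decode (xQ x) = add-M (decode x)
  decode (nA x) = add-b (decode x)
  decode (cA x) = decode x
  decode (wA x) = add-L (decode x)
  decode (fin s) = shape 0 0 0 [] [] [] (stack s 0)
  decode (st x) = decode x
  decode (ri x) = add-k (decode x)

  -- The index k is not merely a bound: it equals the value of the first column, and is 0 if there
  -- is none. Thus the list determines it.
  data LChain : ℕ → ℕ → Ivs → Set where
    []  : LChain b 0 []
    add : s ≤ b → k′ ≤ k → LChain s k′ L → LChain b k ((s , k) ∷ L)

  data MChain : ℕ → ℕ → Ivs → Set where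
    []  : MChain b a []
    add : s ≤ b → a′ ≤ a → 1 ≤ s → MChain s a′ M → MChain b a ((s , a′) ∷ M)

  -- The next middle column ends exactly at the current top. If none is left, its place is taken by
  -- `e`, which has no rows above the core, whence a = 0.
  data MHead : ℕ → ℕ → Ivs → Set where
    []  : MHead b 0 []
    add : s ≤ b → 1 ≤ s → MChain s a M → MHead b a ((s , a) ∷ M)

  -- `R` holds the right columns that rise above the core, hence `1 ≤ a′`; the remaining ones end
  -- inside the core and form the nested list `Z`.
  data RChain : ℕ → ℕ → Ivs → Ivs → Set where
    []  : Nested g 0 Z → RChain g a [] Z
    add : g′ ≤ g → a′ ≤ a → 1 ≤ a′ → RChain g′ a′ R Z → RChain g a ((g′ , a′) ∷ R) Z

  -- Z-convexity for a column on the left and one on the right: they overlap or some column of M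
  -- contains both.
  Linked : Ivs → Ivs → Ivs → Set
  Linked L M R = ∀ {l ρ} → l ∈ L → ρ ∈ R →
    proj₂ l ≤ proj₁ ρ ⊎ Σ (ℕ × ℕ) λ m → m ∈ M × proj₁ m ≤ proj₁ l × proj₂ ρ ≤ proj₂ m

  LChain-weaken : b ≤ s → LChain b k L → LChain s k L
  LChain-weaken l []           = []
  LChain-weaken l (add l₁ l₂ c) = add (ℕₚ.≤-trans l₁ l) l₂ c

  MChain-weaken : b ≤ s → a ≤ a′ → MChain b a M → MChain s a′ M
  MChain-weaken l l′ []               = []
  MChain-weaken l l′ (add l₁ l₂ l₃ c) = add (ℕₚ.≤-trans l₁ l) (ℕₚ.≤-trans l₂ l′) l₃ c

  MHead-weaken : b ≤ s → MHead b a M → MHead s a M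
  MHead-weaken l []            = []
  MHead-weaken l (add l₁ l₂ c) = add (ℕₚ.≤-trans l₁ l) l₂ c

  MHead⇒MChain : MHead b a M → MChain b a M
  MHead⇒MChain []            = []
  MHead⇒MChain (add l₁ l₂ c) = add l₁ ℕₚ.≤-refl l₂ c

  RChain-weaken : g ≤ g′ → a ≤ a′ → RChain g a R Z → RChain g′ a′ R Z
  RChain-weaken l l′ ([] n)           = [] (Nested-weaken l n)
    where
    Nested-weaken : p ≤ s → Nested p q Z → Nested s q Z
    Nested-weaken l []              = []
    Nested-weaken l (add l₁ l₂ l₃ n) = add l₁ l₂ (ℕₚ.≤-trans l₃ l) n
  RChain-weaken l l′ (add l₁ l₂ l₃ c) = add (ℕₚ.≤-trans l₁ l) (ℕₚ.≤-trans l₂ l′) l₃ c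

  RChain-≡ : g ≡ g′ → RChain g a R Z → RChain g′ a R Z
  RChain-≡ refl c = c

  LChain-k : LChain b k L → ∀ {l} → l ∈ L → proj₂ l ≤ k
  LChain-k (add l₁ l₂ c) (here refl) = ℕₚ.≤-refl
  LChain-k (add l₁ l₂ c) (there i)   = ℕₚ.≤-trans (LChain-k c i) l₂

  LChain-s : LChain b k L → ∀ {l} → l ∈ L → proj₁ l ≤ b
  LChain-s (add l₁ l₂ c) (here refl) = l₁
  LChain-s (add l₁ l₂ c) (there i)   = ℕₚ.≤-trans (LChain-s c i) l₁

  MChain-a : MChain b a M → ∀ {m} → m ∈ M → proj₂ m ≤ a
  MChain-a (add l₁ l₂ l₃ c) (here refl) = l₂
  MChain-a (add l₁ l₂ l₃ c) (there i)   = ℕₚ.≤-trans (MChain-a c i) l₂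

  RChain-a : RChain g a R Z → ∀ {ρ} → ρ ∈ R → proj₂ ρ ≤ a × 1 ≤ proj₂ ρ
  RChain-a (add l₁ l₂ l₃ c) (here refl) = l₂ , l₃
  RChain-a (add l₁ l₂ l₃ c) (there i)   = ℕₚ.≤-trans (proj₁ (RChain-a c i)) l₂ , proj₂ (RChain-a c i)

  Linked-cons : ∀ {m} → Linked L M R → Linked L (m ∷ M) R
  Linked-cons lk i j with lk i j
  ... | inj₁ l           = inj₁ l
  ... | inj₂ (m , i , l) = inj₂ (m , there i , l)

  -- In `pQ` and `pC` the left columns that start at row b have been read, hence `pred b`. The next
  -- middle column ends at the current top in `pC` and below it in `pQ`. `pW` announces a right
  -- column reaching the current top. In `pR` the value k may still exceed that of the next left
  -- column. Throughout, D + k bounds the depth of the unread right columns.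
  Spec : Phase → ℕ → Shape → Set
  Spec pQ D (shape b k a L M R Z) = 1 ≤ b × 1 ≤ a × LChain (pred b) k L × MChain b (pred a) M × RChain (D + k) a R Z × Linked L M R
  Spec pW D (shape b k a L M R Z) = Spec pQ D (shape b k a L M R Z) ×
    Σ ℕ λ g → Σ Ivs λ R′ → R ≡ (g , a) ∷ R′ × g ≤ D + k
  Spec pC D (shape b k a L M R Z) = 1 ≤ b × LChain (pred b) k L × MHead b a M × RChain (D + k) a R Z × Linked L M R
  Spec pA D (shape b k a L M R Z) = LChain b k L × MHead b a M × RChain (D + k) a R Z × Linked L M R
  Spec pR D (shape b k a L M R Z) = Σ ℕ λ k′ → k′ ≤ k × LChain b k′ L × MHead b a M × RChain (D + k) a R Z × Linked L M R

  -- Links have to be checked at two steps only. At `em` every unread left column ends at most k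
  -- rows below the top of the core, and the right column reaches down D + k rows, so they overlap.
  -- At `wA` the next middle column contains the left column and all unread right ones.
  decode-spec : (x : Run ph D c r) → Spec ph D (decode x)
  decode-spec (nB x) with decode-spec x
  ... | 1≤b , 1≤a , lc , mc , rc , lk =
    1≤b , s≤s z≤n , lc , MChain-weaken ℕₚ.≤-refl ℕₚ.pred[n]≤n mc , RChain-weaken ℕₚ.≤-refl (ℕₚ.n≤1+n _) rc , lk
  decode-spec (nC x) with decode-spec x
  ... | 1≤b , lc , mh , rc , lk =
    1≤b , s≤s z≤n , lc , MHead⇒MChain mh , RChain-weaken ℕₚ.≤-refl (ℕₚ.n≤1+n _) rc , lk
  decode-spec (wB x) = proj₁ (decode-spec x)
  decode-spec (em {D} x) with decode-spec x
  ... | 1≤b , 1≤a , lc , mc , rc , lk =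
    (1≤b , 1≤a , lc , mc , add ℕₚ.≤-refl ℕₚ.≤-refl 1≤a rc ,
      λ { l∈ (here refl) → inj₁ (ℕₚ.≤-trans (LChain-k lc l∈) (ℕₚ.m≤n+m _ D)) ; l∈ (there ρ∈) → lk l∈ ρ∈ }) ,
    _ , _ , refl , ℕₚ.≤-refl
  decode-spec (dr x) with decode-spec x
  ... | (1≤b , 1≤a , lc , mc , rc , lk) , g , R′ , e , l =
    (1≤b , 1≤a , lc , mc , RChain-weaken (ℕₚ.n≤1+n _) ℕₚ.≤-refl rc , lk) , g , R′ , e , ℕₚ.m≤n⇒m≤1+n l
  decode-spec (xC x) with decode-spec x
  ... | 1≤b , lc , mh , rc , lk =
    1≤b , lc , add ℕₚ.≤-refl 1≤b (MHead⇒MChain mh) , rc , Linked-cons lk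
  decode-spec (xQ x) with decode-spec x
  ... | 1≤b , 1≤a , lc , mc , rc , lk =
    1≤b , lc , add ℕₚ.≤-refl 1≤b (MChain-weaken ℕₚ.≤-refl ℕₚ.pred[n]≤n mc) , rc , Linked-cons lk
  decode-spec (nA x) with decode-spec x
  ... | lc , mh , rc , lk = s≤s z≤n , lc , MHead-weaken (ℕₚ.n≤1+n _) mh , rc , lk
  decode-spec (cA x) with decode-spec x
  ... | 1≤b , lc , mh , rc , lk = LChain-weaken ℕₚ.pred[n]≤n lc , mh , rc , lk
  decode-spec (wA x) with decode-spec x
  ... | k′ , k′≤k , lc , mh , rc , lk = add ℕₚ.≤-refl k′≤k lc , mh , rc ,
    λ { (here refl) ρ∈ → inj₂ (head-link mh (RChain-a rc ρ∈)) ; (there l∈) ρ∈ → lk l∈ ρ∈ }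
    where
    head-link : ∀ {b a M v} → MHead b a M → v ≤ a × 1 ≤ v → Σ (ℕ × ℕ) λ m → m ∈ M × proj₁ m ≤ b × v ≤ proj₂ m
    -- An unread right column rises above the core, so rows above it remain and a middle column must
    -- still be unread.
    head-link [] (v≤0 , 1≤v)       = ⊥-elim (ℕₚ.<-irrefl refl (ℕₚ.≤-trans 1≤v v≤0))
    head-link (add l₁ l₂ c) (v≤a , _) = _ , here refl , l₁ , v≤a
  decode-spec (fin {D} s) = [] , [] , [] (subst (λ v → Nested v 0 (stack s 0)) (sym (ℕₚ.+-identityʳ D)) (whole-nested s 0)) , λ ()
  decode-spec (st x) with decode-spec x
  ... | lc , mh , rc , lk = _ , ℕₚ.≤-refl , lc , mh , rc , lk
  decode-spec (ri {D} x) with decode-spec x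
  ... | k′ , k′≤k , lc , mh , rc , lk = k′ , ℕₚ.m≤n⇒m≤1+n k′≤k , lc , mh ,
    RChain-≡ (sym (ℕₚ.+-suc D _)) rc , lk

  Parsed : Phase → ℕ → Shape → Set
  Parsed ph D d = Σ ℕ λ c → Σ ℕ λ r → Σ (Run ph D c r) λ x → decode x ≡ d

  Parsed-≡ : ∀ {D′ d} → D ≡ D′ → Parsed ph D d → Parsed ph D′ d
  Parsed-≡ refl p = p

  drops : ∀ n {d} → Parsed pW D d → Parsed pW (n + D) d
  drops zero    p = p
  drops (suc n) p with drops n p
  ... | c , r , x , e = c , r , dr x , e

  rises : ∀ n {b k a L M R Z} → Parsed pR (n + D) (shape b k a L M R Z) → Parsed pR D (shape b (n + k) a L M R Z)
  rises zero    p = p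
  rises {D} (suc n) {k = k} p with rises n {k = k} (Parsed-≡ (sym (ℕₚ.+-suc n D)) p)
  ... | c , r , x , e = c , suc r , ri x , cong add-k e

  split-head : MChain b a M → MHead b a M ⊎ (1 ≤ a × MChain b (pred a) M)
  split-head {a = zero}  []                = inj₁ []
  split-head {a = suc a} []                = inj₂ (s≤s z≤n , [])
  split-head {a = a} (add l₁ l₂ l₃ c) with ℕₚ.m≤n⇒m<n∨m≡n l₂
  ... | inj₁ (s≤s l) = inj₂ (s≤s z≤n , add l₁ l l₃ c)
  ... | inj₂ refl    = inj₁ (add l₁ l₃ c)

  -- The unread middle columns all end below the top of this right column, so none contains it and
  -- its link to the first left column is an overlap.
  first-bound : LChain b k L → MChain s (pred a) M → 1 ≤ a → Linked L M ((g , a) ∷ R) → k ≤ g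
  first-bound [] mc 1≤a lk = z≤n
  first-bound (add l₁ l₂ c) mc (s≤s l) lk with lk (here refl) (here refl)
  ... | inj₁ k≤g = k≤g
  ... | inj₂ (m , m∈ , _ , a≤) = ⊥-elim (ℕₚ.<-irrefl refl (ℕₚ.≤-trans a≤ (MChain-a mc m∈)))

  lower-a : RChain g (suc a) R Z → (∀ {g′ R′} → R ≢ (g′ , suc a) ∷ R′) → RChain g a R Z
  lower-a ([] n) ne = [] n
  lower-a (add l₁ l₂ l₃ c) ne with ℕₚ.m≤n⇒m<n∨m≡n l₂
  ... | inj₁ (s≤s l) = add l₁ l l₃ c
  ... | inj₂ refl    = ⊥-elim (ne refl)

  mutual
    -- The order is forced: a right column reaching the current top is read before that row is
    -- discarded, and a left column starting at the current bottom before the middle column that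
    -- starts there.
    parse-Q : ∀ b a L M R → LChain b k L → MChain (suc b) a M → RChain (D + k) (suc a) R Z → Linked L M R →
              Parsed pQ D (shape (suc b) k (suc a) L M R Z)
    parse-Q b a L M [] lc mc rc lk = parse-Q′ b a L M [] lc mc (lower-a rc λ ()) lk
    parse-Q {k} {D} {Z} b a L M ((g , a₁) ∷ R) lc mc rc@(add l₁ l₂ l₃ rc′) lk with a₁ ≟ suc a
    ... | no ne = parse-Q′ b a L M ((g , a₁) ∷ R) lc mc (lower-a rc λ { refl → ne refl }) lk
    -- The counter after this column is `D₁` = g - k, which exists by `first-bound`; it is reached
    -- from `D` by D - D₁ steps `dr`.
    ... | yes refl with ℕₚ.m≤n⇒∃[o]m+o≡n (first-bound lc mc (s≤s z≤n) lk)
    ...   | D₁ , refl with parse-Q {D = D₁} b a L M R lc mc (RChain-≡ (ℕₚ.+-comm k D₁) rc′) (λ i j → lk i (there j))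
    ...     | c , r , x , ex with ℕₚ.m≤n⇒∃[o]m+o≡n D₁≤D
      where
      D₁≤D : D₁ ≤ D
      D₁≤D = ℕₚ.+-cancelˡ-≤ k D₁ D (subst (k + D₁ ≤_) (ℕₚ.+-comm D k) l₁)
    ...       | n , refl with drops n (_ , _ , em x , cong (add-R D₁) ex)
    ...         | c′ , r′ , y , e = c′ , r′ , wB (subst (λ v → Run pW v c′ r′) (ℕₚ.+-comm n D₁) y) ,
                  trans (decode-subst (ℕₚ.+-comm n D₁) y) (trans e (cong (λ v → shape (suc b) k (suc a) L M ((v , suc a) ∷ R) Z) (ℕₚ.+-comm D₁ k)))
      where
      decode-subst : ∀ {D D′} (e : D ≡ D′) (y : Run pW D c′ r′) → decode (subst (λ v → Run pW v c′ r′) e y) ≡ decode y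
      decode-subst refl y = refl

    parse-Q′ : ∀ b a L M R → LChain b k L → MChain (suc b) a M → RChain (D + k) a R Z → Linked L M R →
               Parsed pQ D (shape (suc b) k (suc a) L M R Z)
    parse-Q′ b a L M R lc mc rc lk with split-head mc
    ... | inj₁ mh with parse-C b a L M R lc mh rc lk
    ...   | c , r , x , e = c , suc r , nC x , cong add-a e
    parse-Q′ b (suc a) L M R lc mc rc lk | inj₂ (_ , mc′) with parse-Q b a L M R lc mc′ rc lk
    ...   | c , r , x , e = c , suc r , nB x , cong add-a e

    parse-C : ∀ b a L M R → LChain b k L → MHead (suc b) a M → RChain (D + k) a R Z → Linked L M R →
              Parsed pC D (shape (suc b) k a L M R Z)
    parse-C b a L [] R lc [] rc lk with parse-A b a L [] R lc [] rc lk
    ... | c , r , x , e = c , suc r , nA x , cong add-b e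
    parse-C b a L ((s , _) ∷ M) R lc (add l₁ l₂ mc) rc lk with ℕₚ.m≤n⇒m<n∨m≡n l₁
    ... | inj₁ (s≤s l) with parse-A b a L ((s , a) ∷ M) R lc (add l l₂ mc) rc lk
    ...   | c , r , x , e = c , suc r , nA x , cong add-b e
    parse-C {D = D} b a L ((s , _) ∷ M) R lc (add l₁ l₂ mc) rc lk | inj₂ refl with split-head mc
    ... | inj₁ mh with parse-C b a L M R lc mh rc (shrink lc lk)
    ...   | c , r , x , e = suc c , r , xC x , cong add-M e
    parse-C {D = D} b (suc a) L ((s , _) ∷ M) R lc (add l₁ l₂ mc) rc lk | inj₂ refl | inj₂ (_ , mc′)
      with parse-Q b a L M R lc mc′ rc (shrink lc lk)
    ... | c , r , x , e = suc c , r , xQ x , cong add-M e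

    parse-A : ∀ b a L M R → LChain b k L → MHead b a M → RChain (D + k) a R Z → Linked L M R →
              Parsed pA D (shape b k a L M R Z)
    parse-A zero a [] [] [] [] [] ([] n) lk with whole-complete {0} (subst (λ v → Nested v 0 _) (ℕₚ.+-identityʳ _) n)
    ... | c , s , e = suc c , 0 , fin s , cong (shape 0 0 0 [] [] []) e
    parse-A zero a [] [] (_ ∷ R) [] [] (add _ l₂ l₃ _) lk = ⊥-elim (ℕₚ.<-irrefl refl (ℕₚ.≤-trans l₃ l₂))
    parse-A zero a L (_ ∷ M) R lc (add l₁ l₂ _) rc lk = ⊥-elim (ℕₚ.<-irrefl refl (ℕₚ.≤-trans l₂ l₁))
    parse-A (suc b) a [] M R [] mh rc lk with parse-C b a [] M R [] mh rc lk
    ... | c , r , x , e = c , r , cA x , e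
    parse-A b a ((s , k) ∷ L) M R (add l₁ l₂ lc) mh rc lk with ℕₚ.m≤n⇒m<n∨m≡n l₁
    parse-A (suc b) a ((s , k) ∷ L) M R (add l₁ l₂ lc) mh rc lk | inj₁ (s≤s l)
      with parse-C b a ((s , k) ∷ L) M R (add l l₂ lc) mh rc lk
    ... | c , r , x , e = c , r , cA x , e
    parse-A {D = D} {Z = Z} b a ((s , k) ∷ L) M R (add {k′ = k′} l₁ l₂ lc) mh rc lk | inj₂ refl with ℕₚ.m≤n⇒∃[o]m+o≡n l₂
    ... | n , refl with parse-A {D = n + D} b a L M R lc mh (RChain-≡ (regroup D k′ n) rc) (λ i j → lk (there i) j)
      where
      regroup : ∀ D k′ n → D + (k′ + n) ≡ n + D + k′
      regroup D k′ n = trans (cong (λ v → D + v) (ℕₚ.+-comm k′ n)) (trans (sym (ℕₚ.+-assoc D n k′)) (cong (_+ k′) (ℕₚ.+-comm D n)))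
    ...   | c , r , x , ex with rises n {k = k′} (_ , _ , st x , ex)
    ...     | c′ , r′ , y , e = suc c′ , r′ , wA y ,
              trans (cong add-L e) (cong (λ v → shape b v a ((b , v) ∷ L) M R Z) (ℕₚ.+-comm n k′))

    -- The middle column just read starts above the first row of each unread left column, so it
    -- contains none of them and serves no remaining link.
    shrink : ∀ {b a L M R} → LChain b k L → Linked L ((suc b , a) ∷ M) R → Linked L M R
    shrink lc lk i j with lk i j
    ... | inj₁ l = inj₁ l
    ... | inj₂ (m , here refl , l , _) = ⊥-elim (ℕₚ.<-irrefl refl (ℕₚ.≤-trans l (LChain-s lc i)))
    ... | inj₂ (m , there m∈ , l)      = inj₂ (m , m∈ , l)

-- A run is determined by its shape; sizes of shapes.

module RunInjectivity where

  open StacksAndRuns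
  open StackColumns
  open RunShapes
  open import Data.Empty using (⊥; ⊥-elim)
  open import Data.Nat using (ℕ; suc; _≤_; s≤s; _+_; pred)
  import Data.Nat.Properties as ℕₚ
  open import Data.Product using (_,_)
  open import Data.List using ([]; length; drop)
  open import Relation.Binary.PropositionalEquality using (_≡_; _≢_; refl; sym; trans; cong; subst)

  private variable
    h c r D b k a g p q s k′ a′ g′ : ℕ
    L M R Z : Ivs
    ph : Phase

  sub-a sub-b sub-k tail-L tail-M tail-R : Shape → Shape
  sub-a d = record d { aʳ = pred (aʳ d) }
  sub-b d = record d { bʳ = pred (bʳ d) }
  sub-k d = record d { kʳ = pred (kʳ d) }
  tail-L d = record d { Lʳ = drop 1 (Lʳ d) }
  tail-M d = record d { Mʳ = drop 1 (Mʳ d) }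
  tail-R d = record d { Rʳ = drop 1 (Rʳ d) }

  -- The next middle column ends below the current top in one phase and at it in the other; if there
  -- is none, a is positive in one and zero in the other.
  Q≢C : (x : Run pQ D c r) (y : Run pC D c r) → decode x ≢ decode y
  Q≢C {D} x y e with decode-spec x | subst (Spec pC D) (sym e) (decode-spec y)
  ... | _ , 1≤a , _ , mc , _ | _ , _ , mh , _ = clash 1≤a mc mh
    where
    clash : ∀ {b a M} → 1 ≤ a → MChain b (pred a) M → MHead b a M → ⊥
    clash (s≤s _) (add _ l _ _) (add _ _ _) = ℕₚ.<-irrefl refl l

  W-head : (y : Run pW D c r) → ∀ {b k a L M R Z g} → decode y ≡ shape b k (suc a) L M R Z → RChain g a R Z → ⊥
  W-head {D} y e rc with subst (Spec pW D) e (decode-spec y)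
  W-head y e (add _ l _ _) | _ , _ , _ , refl , _ = ℕₚ.<-irrefl refl l

  Q≢W : (x : Run pQ D c r) (y : Run pW D c (suc r)) → add-a (decode x) ≢ decode y
  Q≢W x y e with decode-spec x
  ... | _ , _ , _ , _ , rc , _ = W-head y (sym e) rc

  C≢W : (x : Run pC D c r) (y : Run pW D c (suc r)) → add-a (decode x) ≢ decode y
  C≢W x y e with decode-spec x
  ... | _ , _ , _ , rc , _ = W-head y (sym e) rc

  emit≢drop : (x : Run pQ (suc D) c r) (y : Run pW D (suc c) r) → add-R (suc D) (decode x) ≢ decode y
  emit≢drop {D} x y e with subst (Spec pW D) (sym e) (decode-spec y)
  ... | _ , _ , _ , refl , l = ℕₚ.<-irrefl refl l

  C-head : ∀ {d} (y : Run pA D c r) → add-M d ≢ add-b (decode y)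
  C-head {D} {d = d} y e with subst (Spec pA D) (sym (cong sub-b e)) (decode-spec y)
  ... | _ , add l _ _ , _ = ℕₚ.<-irrefl refl (ℕₚ.≤-trans (ℕₚ.≤-reflexive (sym (cong bʳ e))) (ℕₚ.≤-trans l (ℕₚ.≤-reflexive (cong (λ v → pred (bʳ v)) e))))

  A-head : ∀ {d} (x : Run pC D c r) → decode x ≢ add-L d
  A-head {D} x e with subst (Spec pC D) e (decode-spec x)
  ... | s≤s _ , add l _ _ , _ = ℕₚ.<-irrefl refl l

  C≢fin : ∀ {Z} (x : Run pC D c r) → decode x ≢ shape 0 0 0 [] [] [] Z
  C≢fin {D} x e with subst (Spec pC D) e (decode-spec x)
  ... | () , _

  stop≢rise : (x : Run pA D c (suc r)) (y : Run pR (suc D) c r) → decode x ≢ add-k (decode y)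
  stop≢rise {D} x y e with subst (Spec pA D) e (decode-spec x) | decode-spec y
  ... | lc , _ | k′ , k′≤k , lc′ , _ = clash lc k′≤k lc′
    where
    clash : ∀ {b k k′ L} → LChain b (suc k) L → k′ ≤ k → LChain b k′ L → ⊥
    clash (add _ _ _) l (add _ _ _) = ℕₚ.<-irrefl refl l

  -- Phase, counter and sizes agree on both sides, so only alternatives within one phase have to be
  -- told apart. The first unread column or the numbers of unread rows do this.
  decode-injective : (x y : Run ph D c r) → decode x ≡ decode y → x ≡ y
  decode-injective (nB x) (nB y) e = cong nB (decode-injective x y (cong sub-a e))
  decode-injective (nC x) (nC y) e = cong nC (decode-injective x y (cong sub-a e))
  decode-injective (wB x) (wB y) e = cong wB (decode-injective x y e)
  decode-injective (nB x) (nC y) e = ⊥-elim (Q≢C x y (cong sub-a e))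
  decode-injective (nC x) (nB y) e = ⊥-elim (Q≢C y x (cong sub-a (sym e)))
  decode-injective (nB x) (wB y) e = ⊥-elim (Q≢W x y e)
  decode-injective (wB x) (nB y) e = ⊥-elim (Q≢W y x (sym e))
  decode-injective (nC x) (wB y) e = ⊥-elim (C≢W x y e)
  decode-injective (wB x) (nC y) e = ⊥-elim (C≢W y x (sym e))
  decode-injective (em x) (em y) e = cong em (decode-injective x y (cong tail-R e))
  decode-injective (dr x) (dr y) e = cong dr (decode-injective x y e)
  decode-injective (em x) (dr y) e = ⊥-elim (emit≢drop x y e)
  decode-injective (dr x) (em y) e = ⊥-elim (emit≢drop y x (sym e))
  decode-injective (xC x) (xC y) e = cong xC (decode-injective x y (cong tail-M e))
  decode-injective (xQ x) (xQ y) e = cong xQ (decode-injective x y (cong tail-M e))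
  decode-injective (nA x) (nA y) e = cong nA (decode-injective x y (cong sub-b e))
  decode-injective (xC x) (xQ y) e = ⊥-elim (Q≢C y x (cong tail-M (sym e)))
  decode-injective (xQ x) (xC y) e = ⊥-elim (Q≢C x y (cong tail-M e))
  decode-injective (xC x) (nA y) e = ⊥-elim (C-head {d = decode x} y e)
  decode-injective (xQ x) (nA y) e = ⊥-elim (C-head {d = decode x} y e)
  decode-injective (nA x) (xC y) e = ⊥-elim (C-head {d = decode y} x (sym e))
  decode-injective (nA x) (xQ y) e = ⊥-elim (C-head {d = decode y} x (sym e))
  decode-injective (cA x) (cA y) e = cong cA (decode-injective x y e)
  decode-injective (wA x) (wA y) e = cong wA (decode-injective x y (cong tail-L e))
  decode-injective (fin s) (fin s′) e = cong fin (whole-injective s s′ 0 (cong Zʳ e))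
  decode-injective (cA x) (wA y) e = ⊥-elim (A-head {d = decode y} x e)
  decode-injective (wA x) (cA y) e = ⊥-elim (A-head {d = decode x} y (sym e))
  decode-injective (cA x) (fin s) e = ⊥-elim (C≢fin x e)
  decode-injective (fin s) (cA y) e = ⊥-elim (C≢fin y (sym e))
  decode-injective (wA x) (fin s) e with cong Lʳ e
  ... | ()
  decode-injective (fin s) (wA y) e with cong Lʳ e
  ... | ()
  decode-injective (st x) (st y) e = cong st (decode-injective x y e)
  decode-injective (ri x) (ri y) e = cong ri (decode-injective x y (cong sub-k e))
  decode-injective (st x) (ri y) e = ⊥-elim (stop≢rise x y e)
  decode-injective (ri x) (st y) e = ⊥-elim (stop≢rise y x (sym e))

  -- The column `e` is counted by the `suc`, whereas `w` is not counted. Neither are D + 1 of the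
  -- rows of the core.
  rows columns : Shape → ℕ
  rows d = bʳ d + (kʳ d + aʳ d)
  columns d = suc (length (Lʳ d) + (length (Mʳ d) + (length (Rʳ d) + length (Zʳ d))))

  +-suc₂ : ∀ m n o → m + (n + suc o) ≡ suc (m + (n + o))
  +-suc₂ m n o = trans (cong (λ v → m + v) (ℕₚ.+-suc n o)) (ℕₚ.+-suc m (n + o))

  decode-rows : (x : Run ph D c r) → rows (decode x) ≡ r
  decode-rows (nB x) = trans (+-suc₂ (bʳ (decode x)) (kʳ (decode x)) _) (cong suc (decode-rows x))
  decode-rows (nC x) = trans (+-suc₂ (bʳ (decode x)) (kʳ (decode x)) _) (cong suc (decode-rows x))
  decode-rows (wB x) = decode-rows x
  decode-rows (em x) = decode-rows x
  decode-rows (dr x) = decode-rows x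
  decode-rows (xC x) = decode-rows x
  decode-rows (xQ x) = decode-rows x
  decode-rows (nA x) = cong suc (decode-rows x)
  decode-rows (cA x) = decode-rows x
  decode-rows (wA x) = decode-rows x
  decode-rows (fin s) = refl
  decode-rows (st x) = decode-rows x
  decode-rows (ri x) = trans (ℕₚ.+-suc (bʳ (decode x)) _) (cong suc (decode-rows x))

  decode-columns : (x : Run ph D c r) → columns (decode x) ≡ c
  decode-columns (nB x) = decode-columns x
  decode-columns (nC x) = decode-columns x
  decode-columns (wB x) = decode-columns x
  decode-columns (em x) = trans (cong suc (+-suc₂ (length (Lʳ (decode x))) (length (Mʳ (decode x))) _)) (cong suc (decode-columns x))
  decode-columns (dr x) = decode-columns x
  decode-columns (xC x) = trans (cong suc (ℕₚ.+-suc (length (Lʳ (decode x))) _)) (cong suc (decode-columns x))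
  decode-columns (xQ x) = trans (cong suc (ℕₚ.+-suc (length (Lʳ (decode x))) _)) (cong suc (decode-columns x))
  decode-columns (nA x) = decode-columns x
  decode-columns (cA x) = decode-columns x
  decode-columns (wA x) = cong suc (decode-columns x)
  decode-columns (fin s) = cong suc (stack-length s 0)
  decode-columns (st x) = decode-columns x
  decode-columns (ri x) = decode-columns x

-- Z-convexity as a property of sequences of intervals.

module ColumnSequences where

  open StackColumns using (Ivs)
  open import Data.Empty using (⊥; ⊥-elim)
  open import Data.Nat using (ℕ; zero; suc; _≤_; _<_; z≤n; s≤s; _+_)
  import Data.Nat.Properties as ℕₚ
  open import Data.Product using (Σ; _×_; _,_; proj₁; proj₂)
  open import Data.Sum using (_⊎_; inj₁; inj₂)
  open import Data.List using (List; []; _∷_; _++_; map; length; reverse)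
  open import Data.List.Properties using (length-map; unfold-reverse)
  open import Data.List.Membership.Propositional using (_∈_)
  open import Data.List.Relation.Unary.Any using (here; there)
  open import Data.List.Relation.Unary.All using (All; []; _∷_)
  import Data.List.Relation.Unary.All as All
  import Data.List.Relation.Unary.All.Properties as Allₚ
  open import Data.List.Relation.Unary.AllPairs using (AllPairs; []; _∷_)
  import Data.List.Relation.Unary.AllPairs.Properties as APₚ
  open import Relation.Binary.Definitions using (tri<; tri≈; tri>)
  open import Relation.Binary.PropositionalEquality using (_≡_; _≢_; refl; sym; trans; cong; subst; subst₂)
  open import Function using (flip)

  Iv : Set
  Iv = ℕ × ℕ

  lo hi : Iv → ℕ
  lo = proj₁
  hi = proj₂

  In : ℕ → Iv → Set
  In y I = lo I ≤ y × y ≤ hi I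

  Within Overlap : Iv → Iv → Set
  Within I J = lo J ≤ lo I × hi I ≤ hi J
  Overlap I J = lo I ≤ hi J × lo J ≤ hi I

  module _ {A : Set} (default : A) where

    at : List A → ℕ → A
    at []       _       = default
    at (x ∷ xs) zero    = x
    at (x ∷ xs) (suc i) = at xs i

    at-++ˡ : ∀ xs ys {i} → i < length xs → at (xs ++ ys) i ≡ at xs i
    at-++ˡ (x ∷ xs) ys {zero}  l       = refl
    at-++ˡ (x ∷ xs) ys {suc i} (s≤s l) = at-++ˡ xs ys l

    at-++ʳ : ∀ xs ys i → at (xs ++ ys) (length xs + i) ≡ at ys i
    at-++ʳ []       ys i = refl
    at-++ʳ (x ∷ xs) ys i = at-++ʳ xs ys i

    at-∈ : ∀ xs {i} → i < length xs → at xs i ∈ xs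
    at-∈ (x ∷ xs) {zero}  l       = here refl
    at-∈ (x ∷ xs) {suc i} (s≤s l) = there (at-∈ xs l)

    ∈-at : ∀ {xs x} → x ∈ xs → Σ ℕ λ i → i < length xs × at xs i ≡ x
    ∈-at (here refl) = 0 , s≤s z≤n , refl
    ∈-at (there p) with ∈-at p
    ... | i , l , e = suc i , s≤s l , e

    AllPairs-at : ∀ {R : A → A → Set} {xs} → AllPairs R xs → ∀ {i j} → i < j → j < length xs → R (at xs i) (at xs j)
    AllPairs-at {xs = x ∷ xs} (px ∷ pxs) {zero}  {suc j} l       (s≤s m) = All.lookup px (at-∈ xs m)
    AllPairs-at {xs = x ∷ xs} (px ∷ pxs) {suc i} {suc j} (s≤s l) (s≤s m) = AllPairs-at pxs l m

    at-AllPairs : ∀ {R : A → A → Set} xs → (∀ {i j} → i < j → j < length xs → R (at xs i) (at xs j)) → AllPairs R xs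
    at-AllPairs []       f = []
    at-AllPairs {R} (x ∷ xs) f = All.tabulate head ∷ at-AllPairs xs (λ l m → f (s≤s l) (s≤s m))
      where
      head : ∀ {y} → y ∈ xs → R x y
      head y∈ with ∈-at y∈
      ... | i , l , refl = f (s≤s z≤n) (s≤s l)

  at-map : ∀ {A B : Set} (f : A → B) (d : A) xs i → i < length xs → at (f d) (map f xs) i ≡ f (at d xs i)
  at-map f d (x ∷ xs) zero    l       = refl
  at-map f d (x ∷ xs) (suc i) (s≤s l) = at-map f d xs i l

  All-reverse : ∀ {A : Set} {P : A → Set} {xs : List A} → All P xs → All P (reverse xs)
  All-reverse {xs = []} [] = []
  All-reverse {P = P} {y ∷ ys} (p ∷ ps) = subst (All P) (sym (unfold-reverse y ys)) (Allₚ.++⁺ (All-reverse ps) (p ∷ []))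

  AllPairs-reverse : ∀ {A : Set} {R : A → A → Set} {xs : List A} → AllPairs R xs → AllPairs (flip R) (reverse xs)
  AllPairs-reverse [] = []
  AllPairs-reverse {R = R} {x ∷ xs} (px ∷ pxs) = subst (AllPairs (flip R)) (sym (unfold-reverse x xs))
    (APₚ.++⁺ (AllPairs-reverse pxs) ([] ∷ []) (All.map (λ r → r ∷ []) (All-reverse px)))

  nth : Ivs → ℕ → Iv
  nth = at (1 , 0)

  -- The sequences of columns of Z-convex polyominoes with r rows.
  record ZSeq (r : ℕ) (cs : Ivs) : Set where
    field
      valid : ∀ {i} → i < length cs → lo (nth cs i) ≤ hi (nth cs i) × hi (nth cs i) < r
      cover : ∀ {y} → y < r → Σ ℕ λ i → i < length cs × In y (nth cs i)
      conv  : ∀ {i k j y} → i < k → k < j → j < length cs → In y (nth cs i) → In y (nth cs j) → In y (nth cs k)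
      link  : ∀ {i j} → i < j → j < length cs → Overlap (nth cs i) (nth cs j) ⊎
              Σ ℕ λ k → i < k × k < j × Within (nth cs i) (nth cs k) × Within (nth cs j) (nth cs k)

  -- Columns tagged by their side: growing on the left, shrinking on the right.
  data Tag : Set where
    ˡ ᵐ ʳ : Tag

  TIv : Set
  TIv = Tag × Iv

  -- All clauses of `ZSeq` but `valid` and `cover` follow from these relations between pairs. The
  -- list itself enters only through the third column of a left-right pair.
  Side : List TIv → TIv → TIv → Set
  Side ts (ˡ , I) (ˡ , J) = Within I J
  Side ts (ˡ , I) (ᵐ , J) = hi I ≤ hi J × Overlap I J
  Side ts (ˡ , I) (ʳ , J) = Overlap I J ⊎ Σ Iv λ K → (ᵐ , K) ∈ ts × Within I K × Within J K
  Side ts (ᵐ , I) (ˡ , J) = ⊥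
  Side ts (ᵐ , I) (ᵐ , J) = (lo I ≤ lo J × hi I ≤ hi J) × Overlap I J
  Side ts (ᵐ , I) (ʳ , J) = lo I ≤ lo J × Overlap I J
  Side ts (ʳ , I) (ˡ , J) = ⊥
  Side ts (ʳ , I) (ᵐ , J) = ⊥
  Side ts (ʳ , I) (ʳ , J) = Within J I

  arch : ∀ {r} ts → AllPairs (Side ts) ts → All (λ t → lo (proj₂ t) ≤ hi (proj₂ t) × hi (proj₂ t) < r) ts →
         (∀ {y} → y < r → Σ TIv λ t → t ∈ ts × In y (proj₂ t)) → ZSeq r (map proj₂ ts)
  arch {r} ts side val cov = record { valid = valid ; cover = cover ; conv = conv ; link = link }
    where
    T : ℕ → TIv
    T = at (ˡ , 1 , 0) ts
    len : length (map proj₂ ts) ≡ length ts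
    len = length-map proj₂ ts
    col : ∀ {i} → i < length (map proj₂ ts) → nth (map proj₂ ts) i ≡ proj₂ (T i)
    col {i} l = at-map proj₂ (ˡ , 1 , 0) ts i (subst (i <_) len l)
    cs = map proj₂ ts
    Valid : Iv → Set
    Valid K = lo K ≤ hi K × hi K < r
    valid′ : ∀ {i} → i < length cs → Valid (proj₂ (T i))
    valid′ {i} l = All.lookup val (at-∈ (ˡ , 1 , 0) ts (subst (i <_) len l))
    valid : ∀ {i} → i < length cs → Valid (nth cs i)
    valid l = subst Valid (sym (col l)) (valid′ l)
    cover : ∀ {y} → y < r → Σ ℕ λ i → i < length cs × In y (nth cs i)
    cover y<r with cov y<r
    ... | t , t∈ , in-t with ∈-at (ˡ , 1 , 0) t∈
    ...   | i , l , refl = i , l′ , subst (In _) (sym (col l′)) in-t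
      where l′ = subst (i <_) (sym len) l
    pair : ∀ {i j} → i < j → j < length (map proj₂ ts) → Side ts (T i) (T j)
    pair i<j l = AllPairs-at (ˡ , 1 , 0) side i<j (subst (_ <_) len l)
    overlap-of : ∀ s t → Side ts s t → lo (proj₂ s) ≤ hi (proj₂ s) → lo (proj₂ t) ≤ hi (proj₂ t) →
                 Overlap (proj₂ s) (proj₂ t) ⊎ (proj₁ s ≡ ˡ × proj₁ t ≡ ʳ × Σ Iv λ K → (ᵐ , K) ∈ ts × Within (proj₂ s) K × Within (proj₂ t) K)
    overlap-of (ˡ , I) (ˡ , J) (p , q) v w = inj₁ (ℕₚ.≤-trans v q , ℕₚ.≤-trans p v)
    overlap-of (ˡ , I) (ᵐ , J) (_ , o) v w = inj₁ o
    overlap-of (ˡ , I) (ʳ , J) (inj₁ o) v w = inj₁ o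
    overlap-of (ˡ , I) (ʳ , J) (inj₂ p) v w = inj₂ (refl , refl , p)
    overlap-of (ᵐ , I) (ᵐ , J) (_ , o) v w = inj₁ o
    overlap-of (ᵐ , I) (ʳ , J) (_ , o) v w = inj₁ o
    overlap-of (ʳ , I) (ʳ , J) (p , q) v w = inj₁ (ℕₚ.≤-trans p w , ℕₚ.≤-trans w q)
    link : ∀ {i j} → i < j → j < length cs → Overlap (nth cs i) (nth cs j) ⊎
           Σ ℕ λ k → i < k × k < j × Within (nth cs i) (nth cs k) × Within (nth cs j) (nth cs k)
    link {i} {j} i<j l with overlap-of (T i) (T j) (pair i<j l) (proj₁ (valid′ (ℕₚ.<-trans i<j l))) (proj₁ (valid′ l))
    ... | inj₁ o = inj₁ (subst₂ Overlap (sym (col (ℕₚ.<-trans i<j l))) (sym (col l)) o)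
    ... | inj₂ (ti , tj , K , K∈ , w₁ , w₂) with ∈-at (ˡ , 1 , 0) K∈
    ...   | k , k<′ , e = inj₂ (k , i<k , k<j ,
              subst₂ Within (sym (col (ℕₚ.<-trans i<j l))) (sym (trans (col k<) (cong proj₂ e))) w₁ ,
              subst₂ Within (sym (col l)) (sym (trans (col k<) (cong proj₂ e))) w₂)
      where
      k< : k < length (map proj₂ ts)
      k< = subst (k <_) (sym len) k<′
      no-ml : ∀ {s t} → Side ts s t → proj₁ s ≡ ᵐ → proj₁ t ≡ ˡ → ⊥
      no-ml {ᵐ , _} {ˡ , _} () refl refl
      no-rm : ∀ {s t} → Side ts s t → proj₁ s ≡ ʳ → proj₁ t ≡ ᵐ → ⊥
      no-rm {ʳ , _} {ᵐ , _} () refl refl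
      l≢m : ˡ ≢ ᵐ
      l≢m ()
      r≢m : ʳ ≢ ᵐ
      r≢m ()
      -- The tags occur in the order left, middle, right, so a middle column lies strictly between a
      -- left and a right one.
      i<k : i < k
      i<k with ℕₚ.<-cmp i k
      ... | tri< p _ _ = p
      ... | tri≈ _ refl _ = ⊥-elim (l≢m (trans (sym ti) (cong proj₁ e)))
      ... | tri> _ _ p = ⊥-elim (no-ml (pair p (ℕₚ.<-trans i<j l)) (cong proj₁ e) ti)
      k<j : k < j
      k<j with ℕₚ.<-cmp k j
      ... | tri< p _ _ = p
      ... | tri≈ _ refl _ = ⊥-elim (r≢m (trans (sym tj) (cong proj₁ e)))
      ... | tri> _ _ p = ⊥-elim (no-rm (pair p k<) tj (cong proj₁ e))
    -- A left column inherits the row from the column before it, a right column from the one after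
    -- it. A middle column takes its upper bound from the former and its lower bound from the
    -- latter.
    betw : ∀ s t v {y} → Side ts s t → Side ts t v → In y (proj₂ s) → In y (proj₂ v) → In y (proj₂ t)
    betw (ˡ , _) (ˡ , _) v (p , q) _ (a , b) _ = ℕₚ.≤-trans p a , ℕₚ.≤-trans b q
    betw (ˡ , _) (ᵐ , _) (ᵐ , _) (p , _) ((q , _) , _) (_ , b) (c , _) = ℕₚ.≤-trans q c , ℕₚ.≤-trans b p
    betw (ˡ , _) (ᵐ , _) (ʳ , _) (p , _) (q , _) (_ , b) (c , _) = ℕₚ.≤-trans q c , ℕₚ.≤-trans b p
    betw (ᵐ , _) (ᵐ , _) (ᵐ , _) ((_ , p) , _) ((q , _) , _) (_ , b) (c , _) = ℕₚ.≤-trans q c , ℕₚ.≤-trans b p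
    betw (ᵐ , _) (ᵐ , _) (ʳ , _) ((_ , p) , _) (q , _) (_ , b) (c , _) = ℕₚ.≤-trans q c , ℕₚ.≤-trans b p
    betw s (ʳ , _) (ʳ , _) _ (p , q) _ (a , b) = ℕₚ.≤-trans p a , ℕₚ.≤-trans b q
    conv : ∀ {i k j y} → i < k → k < j → j < length cs → In y (nth cs i) → In y (nth cs j) → In y (nth cs k)
    conv {i} {k} {j} i<k k<j l y∈i y∈j =
      subst (In _) (sym (col lk)) (betw (T i) (T k) (T j) (pair i<k lk) (pair k<j l)
        (subst (In _) (col (ℕₚ.<-trans i<k lk)) y∈i) (subst (In _) (col l) y∈j))
      where lk = ℕₚ.<-trans k<j l

-- From shapes and stacks to sequences of columns.

module Assembly where

  open StackColumns using (Ivs; Nested; []; add)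
  open RunShapes
  open ColumnSequences
  open import Data.Empty using (⊥)
  open import Data.Nat using (ℕ; suc; _∸_; _≤_; _<_; z≤n; s≤s; _+_; pred; _≤?_)
  import Data.Nat.Properties as ℕₚ
  open import Data.Product using (Σ; _×_; _,_; proj₁; proj₂; swap)
  open import Data.Sum using (_⊎_; inj₁; inj₂)
  open import Data.List using (List; []; _∷_; _++_; map; reverse)
  open import Data.List.Properties using (map-++; map-∘; map-id)
  open import Data.List.Membership.Propositional using (_∈_)
  open import Data.List.Membership.Propositional.Properties using (∈-map⁺; ∈-map⁻; ∈-++⁺ˡ; ∈-++⁺ʳ; ∈-++⁻)
  open import Data.List.Relation.Unary.Any.Properties using (reverse⁺; reverse⁻)
  open import Data.List.Relation.Unary.Any using (here; there)
  open import Data.List.Relation.Unary.All using (All; []; _∷_)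
  import Data.List.Relation.Unary.All as All
  import Data.List.Relation.Unary.All.Properties as Allₚ
  open import Data.List.Relation.Unary.AllPairs using (AllPairs; []; _∷_)
  import Data.List.Relation.Unary.AllPairs as AllPairs
  import Data.List.Relation.Unary.AllPairs.Properties as APₚ
  open import Relation.Nullary using (yes; no)
  open import Relation.Binary.PropositionalEquality using (_≡_; _≢_; refl; sym; trans; cong; cong₂; subst)
  open import Function using (_∘_; flip)

  Rising : Iv → Iv → Set
  Rising I J = (lo I ≤ lo J × hi I ≤ hi J) × Overlap I J

  arch-of : ∀ {r} As Bs Cs →
    AllPairs Within As → AllPairs Rising Bs → AllPairs (flip Within) Cs →
    (∀ {I J} → I ∈ As → J ∈ Bs → hi I ≤ hi J × Overlap I J) →
    (∀ {I J} → I ∈ Bs → J ∈ Cs → lo I ≤ lo J × Overlap I J) →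
    (∀ {I J} → I ∈ As → J ∈ Cs → Overlap I J ⊎ Σ Iv λ K → K ∈ Bs × Within I K × Within J K) →
    (∀ {I} → I ∈ As ++ Bs ++ Cs → lo I ≤ hi I × hi I < r) →
    (∀ {y} → y < r → Σ Iv λ I → I ∈ Bs × In y I) →
    ZSeq r (As ++ Bs ++ Cs)
  arch-of {r} As Bs Cs pa pb pc ab bc ac val cov = subst (ZSeq r) untag (arch ts sides valid cover)
    where
    ts : List TIv
    ts = map (ˡ ,_) As ++ map (ᵐ ,_) Bs ++ map (ʳ ,_) Cs
    strip : ∀ (t : Tag) (xs : Ivs) → map proj₂ (map {B = TIv} (t ,_) xs) ≡ xs
    strip t xs = trans (sym (map-∘ xs)) (map-id xs)
    untag : map proj₂ ts ≡ As ++ Bs ++ Cs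
    untag = trans (map-++ proj₂ (map (ˡ ,_) As) (map (ᵐ ,_) Bs ++ map (ʳ ,_) Cs)) (cong₂ _++_ (strip ˡ As)
      (trans (map-++ proj₂ (map (ᵐ ,_) Bs) (map (ʳ ,_) Cs)) (cong₂ _++_ (strip ᵐ Bs) (strip ʳ Cs))))
    cross : ∀ {S : TIv → TIv → Set} {s t xs ys} → (∀ {I J} → I ∈ xs → J ∈ ys → S (s , I) (t , J)) →
            All (λ x → All (S x) (map (t ,_) ys)) (map (s ,_) xs)
    cross f = Allₚ.map⁺ (All.tabulate λ i → Allₚ.map⁺ (All.tabulate λ j → f i j))
    join : ∀ {S : TIv → TIv → Set} {xs ys zs} → All (λ x → All (S x) ys) xs → All (λ x → All (S x) zs) xs →
           All (λ x → All (S x) (ys ++ zs)) xs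
    join p q = All.zipWith (λ { (a , b) → Allₚ.++⁺ a b }) (p , q)
    S : TIv → TIv → Set
    S = Side ts
    sides : AllPairs S ts
    sides = APₚ.++⁺ (APₚ.map⁺ pa) (APₚ.++⁺ (APₚ.map⁺ pb) (APₚ.map⁺ pc) (cross {S} bc))
      (join {S} {map (ˡ ,_) As} {map (ᵐ ,_) Bs} (cross {S} ab) (cross {S} lr))
      where
      lr : ∀ {I J} → I ∈ As → J ∈ Cs → S (ˡ , I) (ʳ , J)
      lr i j with ac i j
      ... | inj₁ o = inj₁ o
      ... | inj₂ (K , k , w) = inj₂ (K , ∈-++⁺ʳ (map (ˡ ,_) As) (∈-++⁺ˡ (∈-map⁺ (ᵐ ,_) k)) , w)
    valid : All (λ t → lo (proj₂ t) ≤ hi (proj₂ t) × hi (proj₂ t) < r) ts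
    valid = Allₚ.map⁻ (subst (All (λ I → lo I ≤ hi I × hi I < r)) (sym untag) (All.tabulate val))
    cover : ∀ {y} → y < r → Σ TIv λ t → t ∈ ts × In y (proj₂ t)
    cover y<r with cov y<r
    ... | I , i , p = (ᵐ , I) , ∈-++⁺ʳ (map (ˡ ,_) As) (∈-++⁺ˡ (∈-map⁺ (ᵐ ,_) i)) , p

  -- The passage from relative to absolute rows: `ivS` measures upwards from the bottom row of the
  -- core, the others measure from its top row.
  ivS ivL ivM ivR ivZ : ℕ → Iv → Iv
  ivS β (p , q) = β + q , β + p
  ivL T (s , k) = s , T ∸ k
  ivM T (s , a) = s , T + a
  ivR T (g , a) = T ∸ g , T + a
  ivZ T (p , q) = T ∸ p , T ∸ q

  -- T is the top row of the core; the top row of the polyomino is T + a.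
  leftC midC rightC : ℕ → Shape → Ivs → Ivs
  leftC  T (shape b k a L M R Z) S = reverse (map (ivS b) S) ++ map (ivL T) L
  midC   T (shape b k a L M R Z) S = (0 , T) ∷ reverse (map (ivM T) M) ++ (b , T + a) ∷ []
  rightC T (shape b k a L M R Z) S = map (ivR T) R ++ map (ivZ T) Z

  -- Above the b rows below the core come the D + 1 rows of the stack and k more, so this is the top
  -- row of the core.
  base : ℕ → Shape → ℕ
  base D d = bʳ d + (D + kʳ d)

  gcols : ℕ → Shape → Ivs → Ivs
  gcols D d S = leftC (base D d) d S ++ midC (base D d) d S ++ rightC (base D d) d S

  Descending Shrinking : Iv → Iv → Set
  Descending x y = proj₁ y ≤ proj₁ x × proj₂ y ≤ proj₂ x
  Shrinking x y = proj₁ y ≤ proj₁ x × proj₂ x ≤ proj₂ y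

  Nested-bounds : ∀ {p q Z} → Nested p q Z → ∀ {z} → z ∈ Z → q ≤ proj₂ z × proj₂ z ≤ proj₁ z × proj₁ z ≤ p
  Nested-bounds (add l₁ l₂ l₃ n) (here refl) = l₁ , l₂ , l₃
  Nested-bounds (add l₁ l₂ l₃ n) (there i) with Nested-bounds n i
  ... | m₁ , m₂ , m₃ = ℕₚ.≤-trans l₁ m₁ , m₂ , ℕₚ.≤-trans m₃ l₃

  Nested-pairs : ∀ {p q Z} → Nested p q Z → AllPairs Shrinking Z
  Nested-pairs [] = []
  Nested-pairs (add l₁ l₂ l₃ n) =
    All.tabulate (λ i → let m₁ , _ , m₃ = Nested-bounds n i in m₃ , m₁) ∷ Nested-pairs n

  LChain-pairs : ∀ {b k L} → LChain b k L → AllPairs Descending L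
  LChain-pairs [] = []
  LChain-pairs (add l₁ l₂ c) = All.tabulate (λ i → LChain-s c i , ℕₚ.≤-trans (LChain-k c i) l₂) ∷ LChain-pairs c

  MChain-s : ∀ {b a M} → MChain b a M → ∀ {m} → m ∈ M → proj₁ m ≤ b × 1 ≤ proj₁ m
  MChain-s (add l₁ l₂ l₃ c) (here refl) = l₁ , l₃
  MChain-s (add l₁ l₂ l₃ c) (there i)   = ℕₚ.≤-trans (proj₁ (MChain-s c i)) l₁ , proj₂ (MChain-s c i)

  MChain-pairs : ∀ {b a M} → MChain b a M → AllPairs Descending M
  MChain-pairs [] = []
  MChain-pairs (add l₁ l₂ l₃ c) = All.tabulate (λ i → proj₁ (MChain-s c i) , MChain-a c i) ∷ MChain-pairs c

  RChain-g : ∀ {g a R Z} → RChain g a R Z → ∀ {ρ} → ρ ∈ R → proj₁ ρ ≤ g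
  RChain-g (add l₁ l₂ l₃ c) (here refl) = l₁
  RChain-g (add l₁ l₂ l₃ c) (there i)   = ℕₚ.≤-trans (RChain-g c i) l₁

  RChain-pairs : ∀ {g a R Z} → RChain g a R Z → AllPairs Descending R
  RChain-pairs ([] n) = []
  RChain-pairs (add l₁ l₂ l₃ c) = All.tabulate (λ i → RChain-g c i , proj₁ (RChain-a c i)) ∷ RChain-pairs c

  RChain-Z : ∀ {g a R Z} → RChain g a R Z → ∀ {z} → z ∈ Z → proj₂ z ≤ proj₁ z × proj₁ z ≤ g
  RChain-Z ([] n) i = proj₂ (Nested-bounds n i)
  RChain-Z (add l₁ l₂ l₃ c) i = proj₁ (RChain-Z c i) , ℕₚ.≤-trans (proj₂ (RChain-Z c i)) l₁

  RChain-RZ : ∀ {g a R Z} → RChain g a R Z → ∀ {ρ z} → ρ ∈ R → z ∈ Z → proj₁ z ≤ proj₁ ρ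
  RChain-RZ (add l₁ l₂ l₃ c) (here refl) j = proj₂ (RChain-Z c j)
  RChain-RZ (add l₁ l₂ l₃ c) (there i)   j = RChain-RZ c i j

  RChain-nested : ∀ {g a R Z} → RChain g a R Z → AllPairs Shrinking Z
  RChain-nested ([] n) = Nested-pairs n
  RChain-nested (add _ _ _ c) = RChain-nested c

  map-pairs : ∀ {A : Set} {P Q : A → A → Set} {f : A → Iv} {R : Iv → Iv → Set} {xs} →
    (∀ {x y} → P x y → R (f x) (f y)) → AllPairs P xs → AllPairs R (map f xs)
  map-pairs h ps = APₚ.map⁺ (AllPairs.map h ps)

  module Columns (D : ℕ) {b k a : ℕ} {L M R Z S : Ivs}
    (1≤b : 1 ≤ b) (1≤a : 1 ≤ a) (lc : LChain (pred b) k L) (mc : MChain b (pred a) M)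
    (rc : RChain (D + k) a R Z) (lk : Linked L M R) (ns : Nested D 0 S) where

    T : ℕ
    T = b + (D + k)

    d : Shape
    d = shape b k a L M R Z

    T∸k : T ∸ k ≡ b + D
    T∸k = trans (cong (_∸ k) (sym (ℕₚ.+-assoc b D k))) (ℕₚ.m+n∸n≡m (b + D) k)

    b≤T : b ≤ T
    b≤T = ℕₚ.m≤m+n b _

    b+D≤T : b + D ≤ T
    b+D≤T = ℕₚ.+-monoʳ-≤ b (ℕₚ.m≤m+n D k)

    pred-lt : ∀ {s b} → 1 ≤ b → s ≤ pred b → s < b
    pred-lt (s≤s _) l = s≤s l

    -- Positions relative to the bottom b and the top T of the core. They alone yield all relations
    -- between different groups, except the links between `L` and `R`.
    IsS IsL IsM IsR IsZ : Iv → Set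
    IsS I = b ≤ lo I × lo I ≤ hi I × hi I ≤ b + D
    IsL I = lo I < b × b + D ≤ hi I × hi I ≤ T
    IsM I = lo I ≤ b × T ≤ hi I × hi I ≤ T + a
    IsR I = b ≤ lo I × lo I ≤ T × T < hi I × hi I ≤ T + a
    IsZ I = b ≤ lo I × lo I ≤ hi I × hi I ≤ T

    isS : ∀ {I} → I ∈ reverse (map (ivS b) S) → IsS I
    isS i with ∈-map⁻ (ivS b) (reverse⁻ {xs = map (ivS b) S} i)
    ... | z , z∈ , refl with Nested-bounds ns z∈
    ...   | _ , l₂ , l₃ = ℕₚ.m≤m+n b _ , ℕₚ.+-monoʳ-≤ b l₂ , ℕₚ.+-monoʳ-≤ b l₃

    isL : ∀ {I} → I ∈ map (ivL T) L → IsL I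
    isL i with ∈-map⁻ (ivL T) i
    ... | l , l∈ , refl = pred-lt 1≤b (LChain-s lc l∈) ,
          ℕₚ.≤-trans (ℕₚ.≤-reflexive (sym T∸k)) (ℕₚ.∸-monoʳ-≤ T (LChain-k lc l∈)) , ℕₚ.m∸n≤m T (proj₂ l)

    isM₀ : ∀ {I} → I ∈ reverse (map (ivM T) M) → IsM I × 1 ≤ lo I × hi I < T + a
    isM₀ i with ∈-map⁻ (ivM T) (reverse⁻ {xs = map (ivM T) M} i)
    ... | m , m∈ , refl with MChain-s mc m∈ | pred-lt 1≤a (MChain-a mc m∈)
    ...   | l₁ , l₂ | l₃ = (l₁ , ℕₚ.m≤m+n T _ , ℕₚ.+-monoʳ-≤ T (ℕₚ.<⇒≤ l₃)) , l₂ , ℕₚ.+-monoʳ-< T l₃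

    isM : ∀ {I} → I ∈ midC T d S → IsM I
    isM (here refl) = z≤n , ℕₚ.≤-refl , ℕₚ.m≤m+n T a
    isM (there i) with ∈-++⁻ (reverse (map (ivM T) M)) i
    ... | inj₁ j = proj₁ (isM₀ j)
    ... | inj₂ (here refl) = ℕₚ.≤-refl , ℕₚ.m≤m+n T a , ℕₚ.≤-refl

    g-low : ∀ {g} → g ≤ D + k → b ≤ T ∸ g
    g-low l = ℕₚ.≤-trans (ℕₚ.≤-reflexive (sym (ℕₚ.m+n∸n≡m b (D + k)))) (ℕₚ.∸-monoʳ-≤ T l)

    isR : ∀ {I} → I ∈ map (ivR T) R → IsR I
    isR i with ∈-map⁻ (ivR T) i
    ... | ρ , ρ∈ , refl with RChain-a rc ρ∈
    ...   | l₁ , l₂ = g-low (RChain-g rc ρ∈) , ℕₚ.m∸n≤m T (proj₁ ρ) ,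
            ℕₚ.≤-trans (ℕₚ.≤-reflexive (ℕₚ.+-comm 1 T)) (ℕₚ.+-monoʳ-≤ T l₂) , ℕₚ.+-monoʳ-≤ T l₁

    isZ : ∀ {I} → I ∈ map (ivZ T) Z → IsZ I
    isZ i with ∈-map⁻ (ivZ T) i
    ... | z , z∈ , refl with RChain-Z rc z∈
    ...   | l₁ , l₂ = g-low l₂ , ℕₚ.∸-monoʳ-≤ T l₁ , ℕₚ.m∸n≤m T (proj₂ z)

    left-pairs : AllPairs Within (leftC T d S)
    left-pairs = APₚ.++⁺
      (AllPairs-reverse (map-pairs {P = Shrinking} {Q = Shrinking} {R = flip Within}
        (λ { (p , q) → ℕₚ.+-monoʳ-≤ b q , ℕₚ.+-monoʳ-≤ b p }) (Nested-pairs ns)))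
      (map-pairs {P = Descending} {Q = Shrinking} (λ { (p , q) → p , ℕₚ.∸-monoʳ-≤ T q }) (LChain-pairs lc))
      (All.tabulate λ i → All.tabulate λ j → sl (isS i) (isL j))
      where
      sl : ∀ {I J} → IsS I → IsL J → Within I J
      sl (p , _ , q) (p′ , q′ , _) = ℕₚ.≤-trans (ℕₚ.<⇒≤ p′) p , ℕₚ.≤-trans q q′

    mid-overlap : ∀ {I J} → IsM I → IsM J → Overlap I J
    mid-overlap (p , q , _) (p′ , q′ , _) = ℕₚ.≤-trans p (ℕₚ.≤-trans b≤T q′) , ℕₚ.≤-trans p′ (ℕₚ.≤-trans b≤T q)

    mid-pairs : AllPairs Rising (midC T d S)
    mid-pairs =
      All.tabulate (λ i → (z≤n , proj₁ (proj₂ (isM (there i)))) , mid-overlap (isM (here refl)) (isM (there i))) ∷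
      APₚ.++⁺ (add-overlap (AllPairs-reverse (map-pairs {P = Descending} {Q = Shrinking} {R = Descending}
          (λ { (p , q) → p , ℕₚ.+-monoʳ-≤ T q }) (MChain-pairs mc)))
          (All.tabulate (proj₁ ∘ isM₀))) ([] ∷ [])
        (All.tabulate λ i → ((proj₁ (proj₁ (isM₀ i)) , proj₂ (proj₂ (proj₁ (isM₀ i)))) ,
          mid-overlap (proj₁ (isM₀ i)) (isM (there (∈-++⁺ʳ (reverse (map (ivM T) M)) (here refl))))) ∷ [])
      where
      add-overlap : ∀ {xs} → AllPairs (flip Descending) xs → All IsM xs → AllPairs Rising xs
      add-overlap [] [] = []
      add-overlap (p ∷ ps) (m ∷ ms) = All.zipWith (λ { (q , m′) → q , mid-overlap m m′ }) (p , ms) ∷ add-overlap ps ms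

    right-pairs : AllPairs (flip Within) (rightC T d S)
    right-pairs = APₚ.++⁺
      (map-pairs {P = Descending} {Q = Shrinking} {R = flip Within} (λ { (p , q) → ℕₚ.∸-monoʳ-≤ T p , ℕₚ.+-monoʳ-≤ T q }) (RChain-pairs rc))
      (map-pairs {P = Shrinking} {Q = Shrinking} {R = flip Within} (λ { (p , q) → ℕₚ.∸-monoʳ-≤ T p , ℕₚ.∸-monoʳ-≤ T q }) (RChain-nested rc))
      (All.tabulate λ i → All.tabulate λ j → rz i j)
      where
      rz : ∀ {I J} → I ∈ map (ivR T) R → J ∈ map (ivZ T) Z → Within J I
      rz i j with ∈-map⁻ (ivR T) i | ∈-map⁻ (ivZ T) j
      ... | ρ , ρ∈ , refl | z , z∈ , refl =
        ℕₚ.∸-monoʳ-≤ T (RChain-RZ rc ρ∈ z∈) , ℕₚ.≤-trans (ℕₚ.m∸n≤m T (proj₂ z)) (ℕₚ.m≤m+n T _)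

    IsLeft IsRight : Iv → Set
    IsLeft I = b ≤ hi I × lo I ≤ hi I × hi I ≤ T
    IsRight I = b ≤ lo I × lo I ≤ T × lo I ≤ hi I × hi I ≤ T + a

    isLeft : ∀ {I} → I ∈ leftC T d S → IsLeft I
    isLeft i with ∈-++⁻ (reverse (map (ivS b) S)) i
    ... | inj₁ j with isS j
    ...   | p , q , r = ℕₚ.≤-trans p q , q , ℕₚ.≤-trans r b+D≤T
    isLeft i | inj₂ j with isL j
    ...   | p , q , r = b≤hi , ℕₚ.≤-trans (ℕₚ.<⇒≤ p) b≤hi , r
      where b≤hi = ℕₚ.≤-trans (ℕₚ.m≤m+n b D) q

    isRight : ∀ {I} → I ∈ rightC T d S → IsRight I
    isRight i with ∈-++⁻ (map (ivR T) R) i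
    ... | inj₁ j with isR j
    ...   | p , q , r , t = p , q , ℕₚ.≤-trans q (ℕₚ.<⇒≤ r) , t
    isRight i | inj₂ j with isZ j
    ...   | p , q , r = p , ℕₚ.≤-trans q r , q , ℕₚ.≤-trans r (ℕₚ.m≤m+n T a)

    -- Left columns of `S` do not reach below the core, so `w` contains them and every right column;
    -- right columns of `Z` do not reach above it, so `e` contains them and every left column. Only
    -- `L` against `R` needs `Linked`.
    link-lr : ∀ {I J} → I ∈ leftC T d S → J ∈ rightC T d S →
              Overlap I J ⊎ Σ Iv λ K → K ∈ midC T d S × Within I K × Within J K
    link-lr i j with ∈-++⁻ (reverse (map (ivS b) S)) i | ∈-++⁻ (map (ivR T) R) j
    ... | inj₁ i′ | _ with isS i′ | isLeft i | isRight j
    ...   | p , _ | _ , _ , l | p′ , _ , _ , q′ =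
            inj₂ ((b , T + a) , there (∈-++⁺ʳ (reverse (map (ivM T) M)) (here refl)) , (p , ℕₚ.≤-trans l (ℕₚ.m≤m+n T a)) , (p′ , q′))
    link-lr i j | inj₂ i′ | inj₂ j′ with isL i′ | isZ j′
    ...   | _ , _ , q | _ , _ , q′ = inj₂ ((0 , T) , here refl , (z≤n , q) , (z≤n , q′))
    link-lr i j | inj₂ i′ | inj₁ j′ with ∈-map⁻ (ivL T) i′ | ∈-map⁻ (ivR T) j′
    ...   | l , l∈ , refl | ρ , ρ∈ , refl with lk l∈ ρ∈ | isL i′ | isR j′
    ...     | inj₁ k≤g | p , _ | _ , _ , q , _ =
              inj₁ (ℕₚ.≤-trans (ℕₚ.<⇒≤ p) (ℕₚ.≤-trans b≤T (ℕₚ.<⇒≤ q)) , ℕₚ.∸-monoʳ-≤ T k≤g)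
    ...     | inj₂ (m , m∈ , u , v) | _ , _ , p | q , _ =
              inj₂ (ivM T m , there (∈-++⁺ˡ (reverse⁺ {xs = map (ivM T) M} (∈-map⁺ (ivM T) m∈))) ,
                (u , ℕₚ.≤-trans p (ℕₚ.m≤m+n T _)) , (ℕₚ.≤-trans (proj₁ (MChain-s mc m∈)) q , ℕₚ.+-monoʳ-≤ T v))

    zseq : ZSeq (suc (T + a)) (gcols D d S)
    zseq = arch-of (leftC T d S) (midC T d S) (rightC T d S) left-pairs mid-pairs right-pairs
      (λ i j → lm (isLeft i) (isM j)) (λ i j → mr (isM i) (isRight j)) link-lr val cov
      where
      lm : ∀ {I J} → IsLeft I → IsM J → hi I ≤ hi J × Overlap I J
      lm (p , q , r) (p′ , q′ , _) = ℕₚ.≤-trans r q′ , ℕₚ.≤-trans q (ℕₚ.≤-trans r q′) , ℕₚ.≤-trans p′ p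
      mr : ∀ {I J} → IsM I → IsRight J → lo I ≤ lo J × Overlap I J
      mr (p , q , _) (p′ , q′ , r′ , _) = ℕₚ.≤-trans p p′ , ℕₚ.≤-trans (ℕₚ.≤-trans p p′) r′ , ℕₚ.≤-trans q′ q
      val : ∀ {I} → I ∈ gcols D d S → lo I ≤ hi I × hi I < suc (T + a)
      val i with ∈-++⁻ (leftC T d S) i
      ... | inj₁ j with isLeft j
      ...   | _ , q , r = q , s≤s (ℕₚ.≤-trans r (ℕₚ.m≤m+n T a))
      val i | inj₂ i′ with ∈-++⁻ (midC T d S) i′
      ... | inj₁ j with isM j
      ...   | p , q , r = ℕₚ.≤-trans p (ℕₚ.≤-trans b≤T q) , s≤s r
      val i | inj₂ i′ | inj₂ j with isRight j
      ...   | _ , _ , q , r = q , s≤s r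
      cov : ∀ {y} → y < suc (T + a) → Σ Iv λ I → I ∈ midC T d S × In y I
      cov {y} (s≤s l) with y ≤? T
      ... | yes y≤T = (0 , T) , here refl , z≤n , y≤T
      ... | no y≰T = (b , T + a) , there (∈-++⁺ʳ (reverse (map (ivM T) M)) (here refl)) ,
                     ℕₚ.≤-trans b≤T (ℕₚ.<⇒≤ (ℕₚ.≰⇒> y≰T)) , l

    not-full : ∀ {I} → I ∈ gcols D d S → lo I ≡ 0 → hi I ≢ T + a
    not-full i e f with ∈-++⁻ (leftC T d S) i
    ... | inj₁ j with isLeft j
    ...   | _ , _ , r = T≢ (ℕₚ.≤-trans (ℕₚ.≤-reflexive (sym f)) r)
      where
      T≢ : T + a ≤ T → ⊥
      T≢ l = ℕₚ.<-irrefl refl (ℕₚ.<-≤-trans (ℕₚ.m<m+n T 1≤a) l)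
    not-full i e f | inj₂ i′ with ∈-++⁻ (midC T d S) i′
    ... | inj₂ j with isRight j
    ...   | p , _ = ℕₚ.<-irrefl refl (ℕₚ.≤-trans 1≤b (ℕₚ.≤-trans p (ℕₚ.≤-reflexive e)))
    not-full i e f | inj₂ i′ | inj₁ (here refl) = ℕₚ.<-irrefl f (ℕₚ.m<m+n T 1≤a)
    not-full i e f | inj₂ i′ | inj₁ (there j) with ∈-++⁻ (reverse (map (ivM T) M)) j
    ... | inj₁ j′ = ℕₚ.<-irrefl f (proj₂ (proj₂ (isM₀ j′)))
    ... | inj₂ (here refl) = ℕₚ.<-irrefl refl (ℕₚ.≤-trans 1≤b (ℕₚ.≤-reflexive e))

  vcols : ℕ → Ivs → Ivs → Ivs
  vcols r S S′ = reverse (map swap S) ++ ((0 , r) ∷ []) ++ map swap S′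

  vcols-zseq : ∀ {r S S′} → Nested r 0 S → Nested r 0 S′ → ZSeq (suc r) (vcols r S S′)
  vcols-zseq {r} {S} {S′} n n′ = arch-of (reverse (map swap S)) ((0 , r) ∷ []) (map swap S′)
    (AllPairs-reverse (map-pairs {P = Shrinking} {Q = Shrinking} {R = flip Within} (λ { (p , q) → q , p }) (Nested-pairs n)))
    ([] ∷ [])
    (map-pairs {P = Shrinking} {Q = Shrinking} {R = flip Within} (λ { (p , q) → q , p }) (Nested-pairs n′))
    (λ { i (here refl) → let p , q = inL i in q , ℕₚ.≤-trans p q , z≤n })
    (λ { (here refl) j → let p , q = inR j in z≤n , z≤n , ℕₚ.≤-trans p q })
    (λ i j → inj₂ ((0 , r) , here refl , (z≤n , proj₂ (inL i)) , (z≤n , proj₂ (inR j))))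
    val (λ { (s≤s l) → (0 , r) , here refl , z≤n , l })
    where
    bound : ∀ {S I} → Nested r 0 S → I ∈ map swap S → lo I ≤ hi I × hi I ≤ r
    bound n i with ∈-map⁻ swap i
    ... | z , z∈ , refl = proj₂ (Nested-bounds n z∈)
    inL : ∀ {I} → I ∈ reverse (map swap S) → lo I ≤ hi I × hi I ≤ r
    inL i = bound n (reverse⁻ {xs = map swap S} i)
    inR : ∀ {I} → I ∈ map swap S′ → lo I ≤ hi I × hi I ≤ r
    inR i = bound n′ i
    val : ∀ {I} → I ∈ vcols r S S′ → lo I ≤ hi I × hi I < suc r
    val i with ∈-++⁻ (reverse (map swap S)) i
    ... | inj₁ j = let p , q = inL j in p , s≤s q
    ... | inj₂ (here refl) = z≤n , ℕₚ.≤-refl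
    ... | inj₂ (there j) = let p , q = inR j in p , s≤s q

-- Unimodality of the boundary; polyominoes with a full column.

module WithFullColumn where

  open StacksAndRuns
  open StackColumns
  open RunShapes
  open RunInjectivity
  open ColumnSequences
  open Assembly
  open import Data.Empty using (⊥-elim)
  open import Data.Nat using (ℕ; suc; _∸_; _≤_; _<_; z≤n; s≤s; _+_; _≟_)
  import Data.Nat.Properties as ℕₚ
  open import Data.Product using (Σ; _×_; _,_; proj₁; proj₂; swap)
  open import Data.Sum using (_⊎_; inj₁; inj₂)
  open import Data.List using (List; []; _∷_; _++_; map; length; reverse)
  open import Data.List.Properties using (map-∘; map-id-local; length-++; length-map; length-reverse; reverse-involutive; ∷-injective)
  open import Data.List.Membership.Propositional using (_∈_)
  open import Data.List.Membership.Propositional.Properties using (∈-++⁺ˡ; ∈-++⁺ʳ)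
  open import Data.List.Relation.Unary.Any using (here; there)
  open import Data.List.Relation.Unary.All using (All; []; _∷_)
  import Data.List.Relation.Unary.All as All
  import Data.List.Relation.Unary.All.Properties as Allₚ
  open import Data.List.Relation.Unary.AllPairs using (AllPairs; []; _∷_)
  open import Relation.Nullary using (yes; no; ¬_)
  open import Relation.Unary using (Decidable)
  open import Relation.Binary.Definitions using (tri<; tri≈; tri>)
  open import Relation.Binary.PropositionalEquality using (_≡_; refl; sym; trans; cong; cong₂; subst; subst₂)
  open import Function using (_∘_; flip)

  module _ {A : Set} {P : A → Set} where

    last-split : Decidable P → ∀ xs → All (¬_ ∘ P) xs ⊎
      Σ (List A) λ as → Σ A λ e → Σ (List A) λ bs → xs ≡ as ++ e ∷ bs × P e × All (¬_ ∘ P) bs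
    last-split P? [] = inj₁ []
    last-split P? (x ∷ xs) with last-split P? xs
    ... | inj₂ (as , e , bs , refl , p , q) = inj₂ (x ∷ as , e , bs , refl , p , q)
    ... | inj₁ q with P? x
    ...   | yes p = inj₂ ([] , x , xs , refl , p , q)
    ...   | no p  = inj₁ (p ∷ q)

    first-split : Decidable P → ∀ xs → All (¬_ ∘ P) xs ⊎
      Σ (List A) λ as → Σ A λ e → Σ (List A) λ bs → xs ≡ as ++ e ∷ bs × P e × All (¬_ ∘ P) as
    first-split P? [] = inj₁ []
    first-split P? (x ∷ xs) with P? x
    ... | yes p = inj₂ ([] , x , xs , refl , p , [])
    ... | no p with first-split P? xs
    ...   | inj₁ q = inj₁ (p ∷ q)
    ...   | inj₂ (as , e , bs , refl , r , q) = inj₂ (x ∷ as , e , bs , refl , r , p ∷ q)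

    last-unique : ∀ as as′ {e e′ bs bs′} → as ++ e ∷ bs ≡ as′ ++ e′ ∷ bs′ → P e → P e′ →
      All (¬_ ∘ P) bs → All (¬_ ∘ P) bs′ → as ≡ as′ × e ≡ e′ × bs ≡ bs′
    last-unique [] [] refl p p′ q q′ = refl , refl , refl
    last-unique [] (x ∷ as′) refl p p′ q q′ = ⊥-elim (All.lookup q (∈-++⁺ʳ as′ (here refl)) p′)
    last-unique (x ∷ as) [] refl p p′ q q′ = ⊥-elim (All.lookup q′ (∈-++⁺ʳ as (here refl)) p)
    last-unique (x ∷ as) (x′ ∷ as′) e p p′ q q′ with ∷-injective e
    ... | refl , e′ with last-unique as as′ e′ p p′ q q′
    ...   | refl , r = refl , r

    first-unique : ∀ as as′ {e e′ bs bs′} → as ++ e ∷ bs ≡ as′ ++ e′ ∷ bs′ → P e → P e′ →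
      All (¬_ ∘ P) as → All (¬_ ∘ P) as′ → as ≡ as′ × e ≡ e′ × bs ≡ bs′
    first-unique [] [] refl p p′ q q′ = refl , refl , refl
    first-unique [] (x ∷ as′) refl p p′ q (r ∷ _) = ⊥-elim (r p)
    first-unique (x ∷ as) [] refl p p′ (r ∷ _) q′ = ⊥-elim (r p′)
    first-unique (x ∷ as) (x′ ∷ as′) e p p′ (_ ∷ q) (_ ∷ q′) with ∷-injective e
    ... | refl , e′ with first-unique as as′ e′ p p′ q q′
    ...   | refl , r = refl , r

    prefix-unique : ∀ as as′ {bs bs′} → as ++ bs ≡ as′ ++ bs′ → All P as → All P as′ →
      All (¬_ ∘ P) bs → All (¬_ ∘ P) bs′ → as ≡ as′ × bs ≡ bs′
    prefix-unique [] [] e _ _ _ _ = refl , e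
    prefix-unique [] (x ∷ as′) refl _ (p ∷ _) (q ∷ _) _ = ⊥-elim (q p)
    prefix-unique (x ∷ as) [] refl (p ∷ _) _ _ (q ∷ _) = ⊥-elim (q p)
    prefix-unique (x ∷ as) (x′ ∷ as′) e (_ ∷ p) (_ ∷ p′) q q′ with ∷-injective e
    ... | refl , e′ with prefix-unique as as′ e′ p p′ q q′
    ...   | refl , r = refl , r

    span-by : {R : A → A → Set} → Decidable P → (∀ {x y} → R x y → P y → P x) → ∀ {xs} → AllPairs R xs →
      Σ (List A) λ as → Σ (List A) λ bs → xs ≡ as ++ bs × All P as × All (¬_ ∘ P) bs × AllPairs R as × AllPairs R bs
    span-by P? mono [] = [] , [] , refl , [] , [] , [] , []
    span-by P? mono {x ∷ xs} (r ∷ rs) with P? x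
    ... | no p = [] , x ∷ xs , refl , [] , p ∷ All.map (λ s q → p (mono s q)) r , [] , r ∷ rs
    ... | yes p with span-by P? mono rs
    ...   | as , bs , refl , q , q′ , s , s′ = x ∷ as , bs , refl , p ∷ q , q′ , Allₚ.++⁻ˡ as r ∷ s , s′

  module Uni {r cs} (z : ZSeq r cs) where

    open ZSeq z public

    I : ℕ → Iv
    I = nth cs

    valid< : ∀ {i} → i < length cs → lo (I i) ≤ hi (I i)
    valid< l = proj₁ (valid l)

    top-in : ∀ {i} → i < length cs → In (hi (I i)) (I i)
    top-in l = valid< l , ℕₚ.≤-refl

    bot-in : ∀ {i} → i < length cs → In (lo (I i)) (I i)
    bot-in l = ℕₚ.≤-refl , valid< l

    within-in : ∀ {A B y} → Within A B → In y A → In y B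
    within-in (p , q) (s , t) = ℕₚ.≤-trans p s , ℕₚ.≤-trans t q

    -- The upper boundary has no dip. If the outer columns overlap, the lower of their tops is a row
    -- of both, hence of the column between; otherwise the argument is applied to one of them and a
    -- column containing both.
    uni-hi : ∀ {i k j} → i < k → k < j → j < length cs → hi (I i) ≤ hi (I k) ⊎ hi (I j) ≤ hi (I k)
    uni-hi {i} {k} {j} i<k k<j l with link (ℕₚ.<-trans i<k k<j) l
    ... | inj₁ (p , q) with ℕₚ.≤-total (hi (I i)) (hi (I j))
    ...   | inj₁ s = inj₁ (proj₂ (conv i<k k<j l (top-in (ℕₚ.<-trans i<k (ℕₚ.<-trans k<j l))) (q , s)))
    ...   | inj₂ s = inj₂ (proj₂ (conv i<k k<j l (p , s) (top-in l)))
    uni-hi {i} {k} {j} i<k k<j l | inj₂ (m , i<m , m<j , w , w′) with ℕₚ.<-cmp k m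
    ... | tri< k<m _ _ = inj₁ (proj₂ (conv i<k k<m (ℕₚ.<-trans m<j l) ti (within-in w ti)))
      where ti = top-in (ℕₚ.<-trans i<k (ℕₚ.<-trans k<j l))
    ... | tri≈ _ refl _ = inj₁ (proj₂ w)
    ... | tri> _ _ m<k = inj₂ (proj₂ (conv m<k k<j l (within-in w′ (top-in l)) (top-in l)))

    uni-lo : ∀ {i k j} → i < k → k < j → j < length cs → lo (I k) ≤ lo (I i) ⊎ lo (I k) ≤ lo (I j)
    uni-lo {i} {k} {j} i<k k<j l with link (ℕₚ.<-trans i<k k<j) l
    ... | inj₁ (p , q) with ℕₚ.≤-total (lo (I j)) (lo (I i))
    ...   | inj₁ s = inj₁ (proj₁ (conv i<k k<j l (bot-in (ℕₚ.<-trans i<k (ℕₚ.<-trans k<j l))) (s , p)))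
    ...   | inj₂ s = inj₂ (proj₁ (conv i<k k<j l (s , q) (bot-in l)))
    uni-lo {i} {k} {j} i<k k<j l | inj₂ (m , i<m , m<j , w , w′) with ℕₚ.<-cmp k m
    ... | tri< k<m _ _ = inj₁ (proj₁ (conv i<k k<m (ℕₚ.<-trans m<j l) bi (within-in w bi)))
      where bi = bot-in (ℕₚ.<-trans i<k (ℕₚ.<-trans k<j l))
    ... | tri≈ _ refl _ = inj₁ (proj₁ w)
    ... | tri> _ _ m<k = inj₂ (proj₁ (conv m<k k<j l (within-in w′ (bot-in l)) (bot-in l)))

  Full : ℕ → Iv → Set
  Full r I = lo I ≡ 0 × hi I ≡ r

  Full? : ∀ r → Decidable (Full r)
  Full? r I with lo I ≟ 0 | hi I ≟ r
  ... | yes p | yes q = yes (p , q)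
  ... | no p | _ = no (p ∘ proj₁)
  ... | _ | no q = no (q ∘ proj₂)

  to-nested : ∀ {p q} zs → All (λ I → q ≤ lo I × lo I ≤ hi I × hi I ≤ p) zs → AllPairs (flip Within) zs → Nested p q (map swap zs)
  to-nested [] [] [] = []
  to-nested (I ∷ zs) ((l₁ , l₂ , l₃) ∷ ls) (r ∷ rs) =
    add l₁ l₂ l₃ (to-nested zs (All.zipWith (λ { ((_ , b , _) , (p , q)) → p , b , q }) (ls , r)) rs)

  map-inverse : ∀ {f g : Iv → Iv} xs → (∀ {x} → x ∈ xs → f (g x) ≡ x) → map f (map g xs) ≡ xs
  map-inverse xs e = trans (sym (map-∘ xs)) (map-id-local (All.tabulate e))

  vdec : ∀ {c r} → VObj c r → Ivs
  vdec {c} {r} (a , _ , s , s′) = vcols r (stack s 0) (stack s′ 0)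

  vdec-zseq : ∀ {c r} (o : VObj c r) → ZSeq (suc r) (vdec o)
  vdec-zseq (a , _ , s , s′) = vcols-zseq (whole-nested s 0) (part-nested s′ 0)

  vdec-full : ∀ {c r} (o : VObj c r) → Σ Iv λ I → I ∈ vdec o × Full r I
  vdec-full (a , _ , s , s′) = _ , ∈-++⁺ʳ (reverse (map swap (stack s 0))) (here refl) , refl , refl

  vcols-length : ∀ r S S′ → length (vcols r S S′) ≡ suc (length S + length S′)
  vcols-length r S S′ = trans (length-++ (reverse (map swap S)))
    (trans (cong₂ _+_ (trans (length-reverse (map swap S)) (length-map swap S)) (cong suc (length-map swap S′))) (ℕₚ.+-suc (length S) (length S′)))

  vdec-length : ∀ {c r} (o : VObj c r) → length (vdec o) ≡ suc c
  vdec-length {c} {r} (a , a≤c , s , s′) = trans (vcols-length r (stack s 0) (stack s′ 0))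
    (cong suc (trans (cong₂ _+_ (stack-length s 0) (stack-length s′ 0)) (ℕₚ.m+[n∸m]≡n a≤c)))

  part-all-notfull : ∀ {r Z} → Nested r 0 Z → NotFull r 0 Z → All (¬_ ∘ Full r) (map swap Z)
  part-all-notfull [] nf = []
  part-all-notfull {r} (add {p′ = p′} {q′} l₁ l₂ l₃ n) nf = hd ∷ Allₚ.map⁺ (All.tabulate tl)
    where
    hd : ¬ Full r (q′ , p′)
    hd (refl , refl) = nf refl
    tl : ∀ {z} → z ∈ _ → ¬ Full r (swap z)
    tl i (refl , refl) with Nested-bounds n i
    ... | z≤n , _ , m = hd (refl , ℕₚ.≤-antisym l₃ m)

  swap-injective : ∀ {xs ys : Ivs} → map swap xs ≡ map swap ys → xs ≡ ys
  swap-injective {xs} {ys} e = trans (sym (map-inverse xs (λ _ → refl))) (trans (cong (map swap) e) (map-inverse ys (λ _ → refl)))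

  reverse-injective : ∀ {xs ys : Ivs} → reverse xs ≡ reverse ys → xs ≡ ys
  reverse-injective {xs} {ys} e = trans (sym (reverse-involutive xs)) (trans (cong reverse e) (reverse-involutive ys))

  vdec-injective : ∀ {c r} (o o′ : VObj c r) → vdec o ≡ vdec o′ → o ≡ o′
  vdec-injective {c} {r} (a , l , s , t) (a′ , l′ , s′ , t′) e
    with last-unique {P = Full r} (reverse (map swap (stack s 0))) (reverse (map swap (stack s′ 0))) e (refl , refl) (refl , refl)
           (part-all-notfull (part-nested t 0) (part-notfull t 0)) (part-all-notfull (part-nested t′ 0) (part-notfull t′ 0))
  ... | e₁ , _ , e₂ = final l l′ s s′ t t′ s≡ (swap-injective e₂) a≡
    where
    s≡ : stack s 0 ≡ stack s′ 0
    s≡ = swap-injective (reverse-injective e₁)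
    a≡ : a ≡ a′
    a≡ = trans (sym (stack-length s 0)) (trans (cong length s≡) (stack-length s′ 0))
    final : ∀ {a a′} (l : a ≤ c) (l′ : a′ ≤ c) (s : Stack whole (suc r) a) (s′ : Stack whole (suc r) a′)
      (t : Stack part (suc r) (c ∸ a)) (t′ : Stack part (suc r) (c ∸ a′)) →
      stack s 0 ≡ stack s′ 0 → stack t 0 ≡ stack t′ 0 → a ≡ a′ → _≡_ {A = VObj c r} (a , l , s , t) (a′ , l′ , s′ , t′)
    final l l′ s s′ t t′ p q refl with ℕₚ.≤-irrelevant l l′ | whole-injective s s′ 0 p | part-injective t t′ 0 q
    ... | refl | refl | refl = refl

  -- Every row of a column is also a row of the full column, so convexity passes it on to all
  -- columns between the two: on either side the columns are nested.
  vdec-complete : ∀ {c r cs} → length cs ≡ suc c → ZSeq (suc r) cs → ∀ as e bs → cs ≡ as ++ e ∷ bs → Full r e →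
    All (¬_ ∘ Full r) bs → Σ (VObj c r) λ o → vdec o ≡ cs
  vdec-complete {c} {r} {cs} len z as (.0 , .r) bs refl (refl , refl) nf =
    build (whole-complete nested-l) (part-complete nested-r notfull)
    where
    open Uni z
    f = length as
    len′ : length cs ≡ f + suc (length bs)
    len′ = length-++ as
    f< : f < length cs
    f< = subst (f <_) (sym len′) (ℕₚ.m<m+n f (s≤s z≤n))
    pos : ℕ → ℕ
    pos j = f + suc j
    pos< : ∀ {j} → j < length bs → pos j < length cs
    pos< l = subst (_ <_) (sym len′) (ℕₚ.+-monoʳ-< f (s≤s l))
    at-a : ∀ {i} → i < f → I i ≡ nth as i
    at-a l = at-++ˡ _ as _ l
    at-e : I f ≡ (0 , r)
    at-e = trans (cong I (sym (ℕₚ.+-identityʳ f))) (at-++ʳ _ as _ 0)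
    at-b : ∀ j → I (pos j) ≡ nth bs j
    at-b j = at-++ʳ _ as _ (suc j)
    in-f : ∀ {i y} → i < length cs → In y (I i) → In y (I f)
    in-f l (p , q) = subst (In _) (sym at-e) (z≤n , ℕₚ.≤-trans q (ℕₚ.≤-pred (proj₂ (valid l))))
    left : ∀ {i j} → i < j → j < f → Within (I i) (I j)
    left i<j j<f = proj₁ (conv i<j j<f f< (bot-in li) (in-f li (bot-in li))) , proj₂ (conv i<j j<f f< (top-in li) (in-f li (top-in li)))
      where li = ℕₚ.<-trans i<j (ℕₚ.<-trans j<f f<)
    right : ∀ {i j} → f < i → i < j → j < length cs → Within (I j) (I i)
    right f<i i<j lj = proj₁ (conv f<i i<j lj (in-f lj (bot-in lj)) (bot-in lj)) , proj₂ (conv f<i i<j lj (in-f lj (top-in lj)) (top-in lj))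
    bounds : ∀ {J} → J ∈ cs → 0 ≤ lo J × lo J ≤ hi J × hi J ≤ r
    bounds J∈ with ∈-at (1 , 0) J∈
    ... | i , l , refl = z≤n , valid< l , ℕₚ.≤-pred (proj₂ (valid l))
    pairs-a : AllPairs Within as
    pairs-a = at-AllPairs (1 , 0) as λ i<j l → subst₂ Within (at-a (ℕₚ.<-trans i<j l)) (at-a l) (left i<j l)
    pairs-b : AllPairs (flip Within) bs
    pairs-b = at-AllPairs (1 , 0) bs λ {i} {j} i<j l → subst₂ Within (at-b j) (at-b i)
      (right (ℕₚ.m<m+n f (s≤s z≤n)) (ℕₚ.+-monoʳ-< f (s≤s i<j)) (pos< l))
    nested-l : Nested (0 + r) 0 (map swap (reverse as))
    nested-l = to-nested (reverse as) (All-reverse {xs = as} (All.tabulate λ i → bounds (∈-++⁺ˡ {xs = as} i))) (AllPairs-reverse pairs-a)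
    nested-r : Nested r 0 (map swap bs)
    nested-r = to-nested bs (All.tabulate λ i → bounds (∈-++⁺ʳ as (there i))) pairs-b
    notfull : NotFull r 0 (map swap bs)
    notfull = nf-head nf
      where
      nf-head : ∀ {bs} → All (¬_ ∘ Full r) bs → NotFull r 0 (map swap bs)
      nf-head [] ()
      nf-head (n ∷ _) refl = n (refl , refl)
    build : (Σ ℕ λ a → Σ (Stack whole (suc r) a) λ s → stack s 0 ≡ map swap (reverse as)) →
            (Σ ℕ λ a → Σ (Stack part (suc r) a) λ s → stack s 0 ≡ map swap bs) → Σ (VObj c r) λ o → vdec o ≡ cs
    build (a , s , es) (a′ , t , et) = (a , subst (a ≤_) (sym c≡) (ℕₚ.m≤m+n a a′) , s , subst (Stack part (suc r)) (sym c∸a) t) ,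
      cong₂ (λ u v → u ++ (0 , r) ∷ v)
        (trans (cong (reverse ∘ map swap) es) (trans (cong reverse (map-inverse (reverse as) (λ _ → refl))) (reverse-involutive as)))
        (trans (cong (map swap) (trans (stack-cast (sym c∸a) t) et)) (map-inverse bs (λ _ → refl)))
      where
      a≡ : a ≡ length as
      a≡ = trans (sym (stack-length s 0)) (trans (cong length es) (trans (length-map swap (reverse as)) (length-reverse as)))
      a′≡ : a′ ≡ length bs
      a′≡ = trans (sym (stack-length t 0)) (trans (cong length et) (length-map swap bs))
      c≡ : c ≡ a + a′
      c≡ = ℕₚ.suc-injective (trans (sym len) (trans len′ (trans (ℕₚ.+-suc f (length bs)) (cong suc (cong₂ _+_ (sym a≡) (sym a′≡))))))
      c∸a : c ∸ a ≡ a′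
      c∸a = trans (cong (_∸ a) c≡) (ℕₚ.m+n∸m≡n a a′)
      stack-cast : ∀ {m m′} (e : m ≡ m′) (t : Stack part (suc r) m) → stack (subst (Stack part (suc r)) e t) 0 ≡ stack t 0
      stack-cast refl t = refl

-- The columns of a run: validity and injectivity.

module WithoutFullColumn where

  open StacksAndRuns
  open StackColumns
  open RunShapes
  open RunInjectivity
  open ColumnSequences
  open Assembly
  open WithFullColumn
  open import Data.Nat using (ℕ; suc; _∸_; _≤_; _<_; z≤n; s≤s; _+_; pred)
  import Data.Nat.Properties as ℕₚ
  open import Data.Product using (Σ; _×_; _,_; proj₁; proj₂)
  open import Data.List using ([]; _∷_; _++_; map; length; reverse)
  open import Data.List.Properties using (++-assoc; length-++; length-map; length-reverse)
  open import Data.List.Membership.Propositional using (_∈_)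
  open import Data.List.Relation.Unary.All using (All; []; _∷_)
  import Data.List.Relation.Unary.All as All
  import Data.List.Relation.Unary.All.Properties as Allₚ
  open import Data.List.Relation.Unary.AllPairs using ([]; _∷_)
  open import Relation.Nullary using (¬_)
  open import Relation.Binary.PropositionalEquality using (_≡_; _≢_; refl; sym; trans; cong; cong₂; subst)
  open import Data.Nat.Solver using (module +-*-Solver)
  open import Function using (_∘_)

  gdec : ∀ {c r} → GObj c r → Ivs
  gdec (D , _ , a , _ , s , x) = gcols D (decode x) (stack s 0)

  gcols-shape : ∀ D d S → let T = base D d in gcols D d S ≡
    leftC T d S ++ (0 , T) ∷ (reverse (map (ivM T) (Mʳ d)) ++ (bʳ d , T + aʳ d) ∷ rightC T d S)
  gcols-shape D d S = cong (λ v → leftC (base D d) d S ++ (0 , base D d) ∷ v) (++-assoc (reverse (map (ivM (base D d)) (Mʳ d))) _ _)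

  regroup : ∀ b D k a → b + (D + k) + a ≡ D + (b + (k + a))
  regroup = solve 4 (λ b D k a → b :+ (D :+ k) :+ a := D :+ (b :+ (k :+ a))) refl
    where open +-*-Solver

  base-top : ∀ {D r} d → D ≤ r → rows d ≡ r ∸ D → base D d + aʳ d ≡ r
  base-top {D} {r} d D≤r e = trans (regroup (bʳ d) D (kʳ d) (aʳ d)) (trans (cong (λ v → D + v) e) (ℕₚ.m+[n∸m]≡n D≤r))

  gcols-length : ∀ D d S → length (gcols D d S) ≡ suc (length S + columns d)
  gcols-length D d S = begin
    length (gcols D d S)
      ≡⟨ length-++ (leftC T d S) ⟩
    length (leftC T d S) + suc (length ((reverse (map (ivM T) (Mʳ d)) ++ (bʳ d , T + aʳ d) ∷ []) ++ rightC T d S))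
      ≡⟨ cong₂ (λ u v → u + suc v)
           (trans (length-++ (reverse (map (ivS (bʳ d)) S))) (cong₂ _+_ (len-rev (ivS (bʳ d)) S) (length-map (ivL T) (Lʳ d))))
           (trans (length-++ (reverse (map (ivM T) (Mʳ d)) ++ _ ∷ [])) (cong₂ _+_
             (trans (length-++ (reverse (map (ivM T) (Mʳ d)))) (cong (_+ 1) (len-rev (ivM T) (Mʳ d))))
             (trans (length-++ (map (ivR T) (Rʳ d))) (cong₂ _+_ (length-map (ivR T) (Rʳ d)) (length-map (ivZ T) (Zʳ d)))))) ⟩
    (length S + length (Lʳ d)) + suc ((length (Mʳ d) + 1) + (length (Rʳ d) + length (Zʳ d)))
      ≡⟨ arith (length S) (length (Lʳ d)) (length (Mʳ d)) (length (Rʳ d) + length (Zʳ d)) ⟩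
    suc (length S + columns d) ∎
    where
    open Relation.Binary.PropositionalEquality.≡-Reasoning
    T = base D d
    len-rev : ∀ (f : Iv → Iv) xs → length (reverse (map f xs)) ≡ length xs
    len-rev f xs = trans (length-reverse (map f xs)) (length-map f xs)
    open +-*-Solver
    arith : ∀ s l m n → (s + l) + suc ((m + 1) + n) ≡ suc (s + suc (l + (m + n)))
    arith = solve 4 (λ s l m n → (s :+ l) :+ (con 1 :+ ((m :+ con 1) :+ n)) := con 1 :+ (s :+ (con 1 :+ (l :+ (m :+ n))))) refl

  gdec-length : ∀ {c r} (o : GObj c r) → length (gdec o) ≡ suc c
  gdec-length (D , _ , a , a≤c , s , x) = trans (gcols-length D (decode x) (stack s 0))
    (cong suc (trans (cong₂ _+_ (stack-length s 0) (decode-columns x)) (ℕₚ.m+[n∸m]≡n a≤c)))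

  module Obj {D c′ r′ a : ℕ} (x : Run pQ D c′ r′) (s : Stack whole (suc D) a) where

    d : Shape
    d = decode x

    spec : Spec pQ D d
    spec = decode-spec x

    1≤b : 1 ≤ bʳ d
    1≤b = proj₁ spec
    1≤a : 1 ≤ aʳ d
    1≤a = proj₁ (proj₂ spec)
    lc : LChain (pred (bʳ d)) (kʳ d) (Lʳ d)
    lc = proj₁ (proj₂ (proj₂ spec))

    open Columns D {bʳ d} {kʳ d} {aʳ d} {Lʳ d} {Mʳ d} {Rʳ d} {Zʳ d} {stack s 0} 1≤b 1≤a lc
      (proj₁ (proj₂ (proj₂ (proj₂ spec)))) (proj₁ (proj₂ (proj₂ (proj₂ (proj₂ spec)))))
      (proj₂ (proj₂ (proj₂ (proj₂ (proj₂ spec))))) (whole-nested s 0) hiding (d) public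

    lo≢0 : All (λ I → lo I ≢ 0) (reverse (map (ivM T) (Mʳ d)) ++ (bʳ d , T + aʳ d) ∷ rightC T d (stack s 0))
    lo≢0 = Allₚ.++⁺ (All.tabulate λ i e → ℕₚ.<-irrefl (sym e) (proj₁ (proj₂ (isM₀ i))))
      ((λ e → ℕₚ.<-irrefl (sym e) 1≤b) ∷ All.tabulate λ i e → ℕₚ.<-irrefl (sym e) (ℕₚ.≤-trans 1≤b (proj₁ (isRight i))))

    hi≢top : All (λ I → hi I ≢ T + aʳ d) (reverse (map (ivM T) (Mʳ d)))
    hi≢top = All.tabulate λ i e → ℕₚ.<-irrefl e (proj₂ (proj₂ (isM₀ i)))

  gdec-zseq : ∀ {c r} (o : GObj c r) → ZSeq (suc r) (gdec o)
  gdec-zseq (D , D≤r , a , a≤c , s , x) = subst (λ v → ZSeq (suc v) (gcols D (decode x) (stack s 0))) (base-top (decode x) D≤r (decode-rows x)) (Obj.zseq x s)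

  gdec-notfull : ∀ {c r} (o : GObj c r) → ∀ {I} → I ∈ gdec o → ¬ Full r I
  gdec-notfull (D , D≤r , a , _ , s , x) i (p , q) =
    Obj.not-full x s i p (trans q (sym (base-top (decode x) D≤r (decode-rows x))))

  -- In the absence of a full column this separates a sequence from its reflection.
  Ascending : ℕ → Ivs → Set
  Ascending r cs = Σ ℕ λ i → Σ ℕ λ j → i < j × j < length cs × lo (nth cs i) ≡ 0 × hi (nth cs j) ≡ r

  gdec-ascending : ∀ {c r} (o : GObj c r) → Ascending r (gdec o)
  gdec-ascending {c} {r} (D , D≤r , a , _ , s , x) = subst (Ascending r) (sym (gcols-shape D d (stack s 0)))
    (asc (leftC T d (stack s 0)) (reverse (map (ivM T) (Mʳ d))) (rightC T d (stack s 0)) refl (base-top d D≤r (decode-rows x)))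
    where
    open Obj x s using (d; T)
    asc : ∀ As Bs Cs {e w} → lo e ≡ 0 → hi w ≡ r → Ascending r (As ++ e ∷ (Bs ++ w ∷ Cs))
    asc As Bs Cs {e} {w} p q = length As , length As + suc (length Bs) , ℕₚ.m<m+n _ (s≤s z≤n) ,
      subst (length As + suc (length Bs) <_) (sym (trans (length-++ As) (cong (λ v → length As + suc v) (length-++ Bs))))
        (ℕₚ.+-monoʳ-< (length As) (s≤s (ℕₚ.m<m+n (length Bs) (s≤s z≤n)))) ,
      trans (cong lo (trans (cong (nth (As ++ e ∷ (Bs ++ w ∷ Cs))) (sym (ℕₚ.+-identityʳ _))) (at-++ʳ _ As _ 0))) p ,
      trans (cong hi (trans (at-++ʳ _ As _ (suc (length Bs)))
        (trans (cong (nth (Bs ++ w ∷ Cs)) (sym (ℕₚ.+-identityʳ _))) (at-++ʳ _ Bs _ 0)))) q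

  relL relM relR relS : ℕ → Iv → Iv
  relL T (s , n) = s , T ∸ n
  relM T (s , n) = s , n ∸ T
  relR T (s , n) = T ∸ s , n ∸ T
  relS β (s , n) = n ∸ β , s ∸ β

  relL-ivL : ∀ {T I} → hi I ≤ T → relL T (ivL T I) ≡ I
  relL-ivL {T} {I} l = cong (lo I ,_) (ℕₚ.m∸[m∸n]≡n l)

  relM-ivM : ∀ {T I} → relM T (ivM T I) ≡ I
  relM-ivM {T} {I} = cong (lo I ,_) (ℕₚ.m+n∸m≡n T (hi I))

  relR-ivR : ∀ {T I} → lo I ≤ T → relR T (ivR T I) ≡ I
  relR-ivR {T} {I} l = cong₂ _,_ (ℕₚ.m∸[m∸n]≡n l) (ℕₚ.m+n∸m≡n T (hi I))

  ivZ-ivZ : ∀ {T I} → lo I ≤ T → hi I ≤ T → ivZ T (ivZ T I) ≡ I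
  ivZ-ivZ l m = cong₂ _,_ (ℕₚ.m∸[m∸n]≡n l) (ℕₚ.m∸[m∸n]≡n m)

  relS-ivS : ∀ {β I} → relS β (ivS β I) ≡ I
  relS-ivS {β} {I} = cong₂ _,_ (ℕₚ.m+n∸m≡n β (lo I)) (ℕₚ.m+n∸m≡n β (hi I))

  map-cancel : ∀ {f g : Iv → Iv} {xs ys} → (∀ {x} → x ∈ xs → f (g x) ≡ x) → (∀ {y} → y ∈ ys → f (g y) ≡ y) →
    map g xs ≡ map g ys → xs ≡ ys
  map-cancel {f} {g} {xs} {ys} p q e = trans (sym (map-inverse xs p)) (trans (cong (map f) e) (map-inverse ys q))

  LChain-unique : ∀ {b b′ k k′ L} → LChain b k L → LChain b′ k′ L → k ≡ k′
  LChain-unique [] [] = refl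
  LChain-unique (add _ _ _) (add _ _ _) = refl

  shape-cong : ∀ {d d′ : Shape} → bʳ d ≡ bʳ d′ → kʳ d ≡ kʳ d′ → aʳ d ≡ aʳ d′ → Lʳ d ≡ Lʳ d′ → Mʳ d ≡ Mʳ d′ → Rʳ d ≡ Rʳ d′ → Zʳ d ≡ Zʳ d′ → d ≡ d′
  shape-cong refl refl refl refl refl refl refl = refl

  move : ∀ (P : ℕ → Iv → Set) {u v xs} → u ≡ v → All (P u) xs → All (P v) xs
  move P refl p = p

  -- `e` is the last column touching row 0 and `w` the first one after it touching row r; they give
  -- T, b and a. `S` consists of the leading left columns not below row b, `R` of the leading right
  -- columns above T. Finally `L` determines k, and T = b + (D + k) determines `D`.
  gdec-injective : ∀ {c r} (o o′ : GObj c r) → gdec o ≡ gdec o′ → o ≡ o′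
  gdec-injective {c} {r} (D , l , a , m , s , x) (D′ , l′ , a′ , m′ , s′ , x′) eq =
    final l l′ m m′ s s′ x x′ D≡ S≡ d≡ a≡
    where
    module O = Obj x s
    module O′ = Obj x′ s′
    S = stack s 0
    S′ = stack s′ 0
    top≡ : O.T + aʳ O.d ≡ r
    top≡ = base-top O.d l (decode-rows x)
    top≡′ : O′.T + aʳ O′.d ≡ r
    top≡′ = base-top O′.d l′ (decode-rows x′)
    split₁ = last-unique {P = λ I → lo I ≡ 0} (leftC O.T O.d S) (leftC O′.T O′.d S′)
      (trans (sym (gcols-shape D O.d S)) (trans eq (gcols-shape D′ O′.d S′))) refl refl O.lo≢0 O′.lo≢0
    T≡ : O.T ≡ O′.T
    T≡ = cong hi (proj₁ (proj₂ split₁))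
    split₂ = first-unique {P = λ I → hi I ≡ r} (reverse (map (ivM O.T) (Mʳ O.d))) (reverse (map (ivM O′.T) (Mʳ O′.d)))
      (proj₂ (proj₂ split₁)) top≡ top≡′ (move (λ v I → hi I ≢ v) top≡ O.hi≢top) (move (λ v I → hi I ≢ v) top≡′ O′.hi≢top)
    b≡ : bʳ O.d ≡ bʳ O′.d
    b≡ = cong lo (proj₁ (proj₂ split₂))
    a-eq : aʳ O.d ≡ aʳ O′.d
    a-eq = ℕₚ.+-cancelˡ-≡ O.T _ _ (trans top≡ (trans (sym top≡′) (cong (_+ aʳ O′.d) (sym T≡))))
    split₃ = prefix-unique {P = λ I → bʳ O.d ≤ lo I} (reverse (map (ivS (bʳ O.d)) S)) (reverse (map (ivS (bʳ O′.d)) S′))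
      (proj₁ split₁) (All.tabulate (proj₁ ∘ O.isS)) (move (λ v I → v ≤ lo I) (sym b≡) (All.tabulate (proj₁ ∘ O′.isS)))
      (All.tabulate (ℕₚ.<⇒≱ ∘ proj₁ ∘ O.isL)) (move (λ v I → ¬ (v ≤ lo I)) (sym b≡) (All.tabulate (ℕₚ.<⇒≱ ∘ proj₁ ∘ O′.isL)))
    split₄ = prefix-unique {P = λ I → O.T < hi I} (map (ivR O.T) (Rʳ O.d)) (map (ivR O′.T) (Rʳ O′.d))
      (proj₂ (proj₂ split₂)) (All.tabulate (proj₁ ∘ proj₂ ∘ proj₂ ∘ O.isR)) (move (λ v I → v < hi I) (sym T≡) (All.tabulate (proj₁ ∘ proj₂ ∘ proj₂ ∘ O′.isR)))
      (All.tabulate (ℕₚ.≤⇒≯ ∘ proj₂ ∘ proj₂ ∘ O.isZ)) (move (λ v I → ¬ (v < hi I)) (sym T≡) (All.tabulate (ℕₚ.≤⇒≯ ∘ proj₂ ∘ proj₂ ∘ O′.isZ)))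
    S≡ : S ≡ S′
    S≡ = map-cancel {relS (bʳ O.d)} {ivS (bʳ O.d)} (λ _ → relS-ivS {bʳ O.d}) (λ _ → relS-ivS {bʳ O.d})
      (trans (reverse-injective (proj₁ split₃)) (cong (λ v → map (ivS v) S′) (sym b≡)))
    k≤T : ∀ {b D k} → k ≤ b + (D + k)
    k≤T {b} {D} {k} = ℕₚ.≤-trans (ℕₚ.m≤n+m k D) (ℕₚ.m≤n+m _ b)
    L≡ : Lʳ O.d ≡ Lʳ O′.d
    L≡ = map-cancel {relL O.T} {ivL O.T}
      (λ i → relL-ivL (ℕₚ.≤-trans (LChain-k O.lc i) (k≤T {bʳ O.d} {D})))
      (λ i → relL-ivL (ℕₚ.≤-trans (LChain-k O′.lc i) (subst (kʳ O′.d ≤_) (sym T≡) (k≤T {bʳ O′.d} {D′}))))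
      (trans (proj₂ split₃) (cong (λ v → map (ivL v) (Lʳ O′.d)) (sym T≡)))
    M≡ : Mʳ O.d ≡ Mʳ O′.d
    M≡ = map-cancel {relM O.T} {ivM O.T} (λ _ → relM-ivM {O.T}) (λ _ → relM-ivM {O.T})
      (trans (reverse-injective (proj₁ split₂)) (cong (λ v → map (ivM v) (Mʳ O′.d)) (sym T≡)))
    rc : RChain (D + kʳ O.d) (aʳ O.d) (Rʳ O.d) (Zʳ O.d)
    rc = proj₁ (proj₂ (proj₂ (proj₂ (proj₂ O.spec))))
    rc′ : RChain (D′ + kʳ O′.d) (aʳ O′.d) (Rʳ O′.d) (Zʳ O′.d)
    rc′ = proj₁ (proj₂ (proj₂ (proj₂ (proj₂ O′.spec))))
    g≤T : ∀ {g} → g ≤ D + kʳ O.d → g ≤ O.T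
    g≤T p = ℕₚ.≤-trans p (ℕₚ.m≤n+m _ (bʳ O.d))
    g≤T′ : ∀ {g} → g ≤ D′ + kʳ O′.d → g ≤ O.T
    g≤T′ {g} p = subst (g ≤_) (sym T≡) (ℕₚ.≤-trans p (ℕₚ.m≤n+m _ (bʳ O′.d)))
    R≡ : Rʳ O.d ≡ Rʳ O′.d
    R≡ = map-cancel {relR O.T} {ivR O.T} (λ i → relR-ivR (g≤T (RChain-g rc i))) (λ i → relR-ivR (g≤T′ (RChain-g rc′ i)))
      (trans (proj₁ split₄) (cong (λ v → map (ivR v) (Rʳ O′.d)) (sym T≡)))
    Z≡ : Zʳ O.d ≡ Zʳ O′.d
    Z≡ = map-cancel {ivZ O.T} {ivZ O.T}
      (λ i → let p , q = RChain-Z rc i in ivZ-ivZ (g≤T q) (g≤T (ℕₚ.≤-trans p q)))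
      (λ i → let p , q = RChain-Z rc′ i in ivZ-ivZ (g≤T′ q) (g≤T′ (ℕₚ.≤-trans p q)))
      (trans (proj₂ split₄) (cong (λ v → map (ivZ v) (Zʳ O′.d)) (sym T≡)))
    k≡ : kʳ O.d ≡ kʳ O′.d
    k≡ = LChain-unique O.lc (subst (LChain _ _) (sym L≡) O′.lc)
    D≡ : D ≡ D′
    D≡ = ℕₚ.+-cancelʳ-≡ (kʳ O.d) _ _ (ℕₚ.+-cancelˡ-≡ (bʳ O.d) _ _
      (trans T≡ (cong₂ (λ u v → u + (D′ + v)) (sym b≡) (sym k≡))))
    d≡ : decode x ≡ decode x′
    d≡ = shape-cong b≡ k≡ a-eq L≡ M≡ R≡ Z≡
    a≡ : a ≡ a′
    a≡ = trans (sym (stack-length s 0)) (trans (cong length S≡) (stack-length s′ 0))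
    final : ∀ {D D′ a a′} (l : D ≤ r) (l′ : D′ ≤ r) (m : a ≤ c) (m′ : a′ ≤ c)
      (s : Stack whole (suc D) a) (s′ : Stack whole (suc D′) a′) (x : Run pQ D (c ∸ a) (r ∸ D)) (x′ : Run pQ D′ (c ∸ a′) (r ∸ D′)) →
      D ≡ D′ → stack s 0 ≡ stack s′ 0 → decode x ≡ decode x′ → a ≡ a′ →
      _≡_ {A = GObj c r} (D , l , a , m , s , x) (D′ , l′ , a′ , m′ , s′ , x′)
    final l l′ m m′ s s′ x x′ refl p q refl with ℕₚ.≤-irrelevant l l′ | ℕₚ.≤-irrelevant m m′ | whole-injective s s′ 0 p | decode-injective x x′ q
    ... | refl | refl | refl | refl = refl

-- Every ascending sequence without a full column comes from a run.

module Parsing where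

  open StacksAndRuns
  open StackColumns
  open RunShapes
  open RunInjectivity
  open ColumnSequences
  open Assembly
  open WithFullColumn
  open WithoutFullColumn
  open import Data.Empty using (⊥; ⊥-elim)
  open import Data.Nat using (ℕ; suc; _∸_; _≤_; _<_; z≤n; s≤s; _+_; pred; _≤?_)
  import Data.Nat.Properties as ℕₚ
  open import Data.Product using (Σ; _×_; _,_; proj₁; proj₂)
  open import Data.Sum using (_⊎_; inj₁; inj₂)
  open import Data.List using ([]; _∷_; _++_; map; length; reverse)
  open import Data.List.Properties using (++-assoc; length-++; reverse-involutive)
  open import Data.List.Membership.Propositional using (_∈_)
  open import Data.List.Membership.Propositional.Properties using (∈-map⁺; ∈-map⁻; ∈-++⁺ˡ; ∈-++⁺ʳ)
  open import Data.List.Relation.Unary.Any.Properties using (reverse⁺; reverse⁻)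
  open import Data.List.Relation.Unary.Any using (here; there)
  open import Data.List.Relation.Unary.All using (All; []; _∷_)
  import Data.List.Relation.Unary.All as All
  open import Data.List.Relation.Unary.AllPairs using (AllPairs; []; _∷_)
  open import Relation.Nullary using (¬_)
  open import Relation.Binary.Definitions using (tri<; tri≈; tri>)
  open import Relation.Binary.PropositionalEquality using (_≡_; _≢_; refl; sym; trans; cong; cong₂; subst; subst₂)
  open import Function using (flip)

  cross-of : ∀ {R : Iv → Iv → Set} as {bs} → AllPairs R (as ++ bs) → ∀ {x y} → x ∈ as → y ∈ bs → R x y
  cross-of (a ∷ as) (p ∷ ps) (here refl) j = All.lookup p (∈-++⁺ʳ as j)
  cross-of (a ∷ as) (p ∷ ps) (there i)   j = cross-of as ps i j

  ≤-r : ∀ {a x y} → x ≡ y → a ≤ x → a ≤ y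
  ≤-r refl l = l

  ≤-l : ∀ {a x y} → x ≡ y → x ≤ a → y ≤ a
  ≤-l refl l = l

  module Mk (T : ℕ) where

    -- Exactly the value that `LChain` forces, including 0 for the empty list.
    head-k : Ivs → ℕ
    head-k []      = 0
    head-k (I ∷ _) = T ∸ hi I

    mkL : ∀ {b} ls → All (λ I → lo I ≤ b) ls → AllPairs Within ls → LChain b (head-k ls) (map (relL T) ls)
    mkL [] [] [] = []
    mkL (I ∷ ls) (l ∷ _) (r ∷ rs) = add l (next ls r) (mkL ls (All.map proj₁ r) rs)
      where
      next : ∀ ls → All (Within I) ls → head-k ls ≤ T ∸ hi I
      next [] [] = z≤n
      next (J ∷ _) (w ∷ _) = ℕₚ.∸-monoʳ-≤ T (proj₂ w)

    mkM : ∀ {b a} ms → All (λ I → lo I ≤ b × hi I ∸ T ≤ a × 1 ≤ lo I) ms →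
      AllPairs (λ I J → lo J ≤ lo I × hi J ≤ hi I) ms → MChain b a (map (relM T) ms)
    mkM [] [] [] = []
    mkM (I ∷ ms) ((l₁ , l₂ , l₃) ∷ ls) (r ∷ rs) = add l₁ l₂ l₃
      (mkM ms (All.zipWith (λ { ((_ , _ , p) , (q , s)) → q , ℕₚ.∸-monoˡ-≤ T s , p }) (ls , r)) rs)

    mkZ : ∀ {g q} zs → All (λ I → T ∸ lo I ≤ g × lo I ≤ hi I × q ≤ T ∸ hi I) zs →
      AllPairs (flip Within) zs → Nested g q (map (ivZ T) zs)
    mkZ [] [] [] = []
    mkZ (I ∷ zs) ((l₁ , l₂ , l₃) ∷ ls) (r ∷ rs) = add l₃ (ℕₚ.∸-monoʳ-≤ T l₂) l₁
      (mkZ zs (All.zipWith (λ { ((_ , p , _) , (q , s)) → ℕₚ.∸-monoʳ-≤ T q , p , ℕₚ.∸-monoʳ-≤ T s }) (ls , r)) rs)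

    mkR : ∀ {g a} rs zs → All (λ I → T ∸ lo I ≤ g × lo I ≤ hi I × hi I ∸ T ≤ a) (rs ++ zs) →
      All (λ I → 1 ≤ hi I ∸ T) rs → AllPairs (flip Within) (rs ++ zs) → RChain g a (map (relR T) rs) (map (ivZ T) zs)
    mkR [] zs ls [] ps = [] (mkZ zs (All.map (λ { (p , q , _) → p , q , z≤n }) ls) ps)
    mkR (I ∷ rs) zs ((l₁ , _ , l₂) ∷ ls) (l₃ ∷ ks) (p ∷ ps) = add l₁ l₂ l₃
      (mkR rs zs (All.zipWith (λ { ((_ , m , _) , (q , s)) → ℕₚ.∸-monoʳ-≤ T q , m , ℕₚ.∸-monoˡ-≤ T s }) (ls , p)) ks ps)

  mkS : ∀ {β D q} zs → All (λ I → β ≤ lo I × lo I ≤ hi I × hi I ∸ β ≤ D × q ≤ lo I ∸ β) zs →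
    AllPairs (flip Within) zs → Nested D q (map (relS β) zs)
  mkS [] [] [] = []
  mkS {β} (I ∷ zs) ((_ , l₂ , l₃ , l₄) ∷ ls) (r ∷ rs) = add l₄ (ℕₚ.∸-monoˡ-≤ β l₂) l₃
    (mkS zs (All.zipWith (λ { ((m , n , _) , (q , s)) → m , n , ℕₚ.∸-monoˡ-≤ β s , ℕₚ.∸-monoˡ-≤ β q }) (ls , r)) rs)

  module _ {c r : ℕ} (xs : Ivs) (e : Iv) (ms : Ivs) (w : Iv) (ys : Ivs) where

    private
      cs : Ivs
      cs = xs ++ e ∷ (ms ++ w ∷ ys)

    -- The extremal choice of `e` and `w`, with unimodality, confines each group: columns before `e`
    -- end at most at T, those between start at most at β and end at least at T, those after `w`
    -- start at least at β. Each other alternative would give a further column touching row 0 after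
    -- `e` or row r before `w`.
    gdec-complete : length cs ≡ suc c → ZSeq (suc r) cs → (∀ {I} → I ∈ cs → ¬ Full r I) → lo e ≡ 0 → hi w ≡ r →
      All (λ I → lo I ≢ 0) (ms ++ w ∷ ys) → All (λ I → hi I ≢ r) ms → Σ (GObj c r) λ o → gdec o ≡ cs
    gdec-complete len z nofull e0 wr nb nt = assemble
      where
      open Uni z
      ei wi : ℕ
      ei = length xs
      wi = length xs + suc (length ms)
      len′ : length cs ≡ ei + suc (length ms + suc (length ys))
      len′ = trans (length-++ xs) (cong (λ v → ei + suc v) (length-++ ms))
      ei<wi : ei < wi
      ei<wi = ℕₚ.m<m+n ei (s≤s z≤n)
      wi< : wi < length cs
      wi< = subst (wi <_) (sym len′) (ℕₚ.+-monoʳ-< ei (s≤s (ℕₚ.m<m+n (length ms) (s≤s z≤n))))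
      ei< : ei < length cs
      ei< = ℕₚ.<-trans ei<wi wi<
      posM posY : ℕ → ℕ
      posM p = ei + suc p
      posY q = ei + suc (length ms + suc q)
      ei<posM : ∀ {p} → ei < posM p
      ei<posM = ℕₚ.m<m+n ei (s≤s z≤n)
      posM<wi : ∀ {p} → p < length ms → posM p < wi
      posM<wi l = ℕₚ.+-monoʳ-< ei (s≤s l)
      wi<posY : ∀ {q} → wi < posY q
      wi<posY = ℕₚ.+-monoʳ-< ei (s≤s (ℕₚ.m<m+n (length ms) (s≤s z≤n)))
      posY< : ∀ {q} → q < length ys → posY q < length cs
      posY< l = ≤-r (sym len′) (ℕₚ.+-monoʳ-< ei (s≤s (ℕₚ.+-monoʳ-< (length ms) (s≤s l))))
      atX : ∀ {i} → i < ei → I i ≡ nth xs i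
      atX l = at-++ˡ _ xs _ l
      atE : I ei ≡ e
      atE = trans (cong I (sym (ℕₚ.+-identityʳ ei))) (at-++ʳ _ xs _ 0)
      atM : ∀ {p} → p < length ms → I (posM p) ≡ nth ms p
      atM {p} l = trans (at-++ʳ _ xs _ (suc p)) (at-++ˡ _ ms _ l)
      atW : I wi ≡ w
      atW = trans (at-++ʳ _ xs _ (suc (length ms)))
        (trans (cong (nth (ms ++ w ∷ ys)) (sym (ℕₚ.+-identityʳ (length ms)))) (at-++ʳ _ ms _ 0))
      atY : ∀ q → I (posY q) ≡ nth ys q
      atY q = trans (at-++ʳ _ xs _ (suc (length ms + suc q))) (at-++ʳ _ ms _ (suc q))

      hi≤r : ∀ {i} → i < length cs → hi (I i) ≤ r
      hi≤r l = ℕₚ.≤-pred (proj₂ (valid l))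
      lo-e : lo (I ei) ≡ 0
      lo-e = trans (cong lo atE) e0
      hi-w : hi (I wi) ≡ r
      hi-w = trans (cong hi atW) wr
      T β : ℕ
      T = hi e
      β = lo w
      hi-e : hi (I ei) ≡ T
      hi-e = cong hi atE
      lo-w : lo (I wi) ≡ β
      lo-w = cong lo atW
      e∈ : e ∈ cs
      e∈ = ∈-++⁺ʳ xs (here refl)
      T<r : T < r
      T<r = ℕₚ.≤∧≢⇒< (subst (_≤ r) hi-e (hi≤r ei<)) (λ q → nofull e∈ (e0 , q))
      hi-x : ∀ {i} → i < ei → hi (I i) ≤ T
      hi-x l with uni-hi l ei<wi wi<
      ... | inj₁ p = ≤-r hi-e p
      ... | inj₂ p = ⊥-elim (ℕₚ.<⇒≱ T<r (subst₂ _≤_ hi-w hi-e p))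
      mid-index : ∀ {k} → ei < k → k < wi → Σ ℕ λ p → p < length ms × k ≡ posM p
      mid-index {k} l l′ with ℕₚ.m≤n⇒∃[o]m+o≡n l
      ... | p , refl = p , ℕₚ.≤-pred (ℕₚ.+-cancelˡ-< ei _ _ (subst (_< wi) (sym (ℕₚ.+-suc ei p)) l′)) , sym (ℕₚ.+-suc ei p)
      hi<r : ∀ {k} → k < wi → hi (I k) < r
      hi<r {k} l with ℕₚ.<-cmp k ei
      ... | tri< p _ _ = ℕₚ.≤-<-trans (hi-x p) T<r
      ... | tri≈ _ refl _ = subst (_< r) (sym hi-e) T<r
      ... | tri> _ _ p with mid-index p l
      ...   | q , q< , refl = ℕₚ.≤∧≢⇒< (hi≤r (ℕₚ.<-trans l wi<))
                (λ t → All.lookup nt (at-∈ _ ms q<) (trans (cong hi (sym (atM q<))) t))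
      1≤lo : ∀ {k} → ei < k → k < length cs → 1 ≤ lo (I k)
      1≤lo {k} l l′ with ℕₚ.m≤n⇒∃[o]m+o≡n l
      ... | p , refl = ℕₚ.n≢0⇒n>0 λ t → All.lookup nb (at-∈ _ (ms ++ w ∷ ys) p<)
              (trans (cong lo (sym (trans (cong I (sym (ℕₚ.+-suc ei p))) (at-++ʳ _ xs (e ∷ (ms ++ w ∷ ys)) (suc p))))) t)
        where
        p< : p < length (ms ++ w ∷ ys)
        p< = ℕₚ.≤-pred (ℕₚ.+-cancelˡ-< ei _ _ (subst₂ _<_ (sym (ℕₚ.+-suc ei p)) (length-++ xs) l′))
      hi-m : ∀ {k} → ei < k → k < wi → T ≤ hi (I k)
      hi-m {k} l l′ with uni-hi l l′ wi<
      ... | inj₁ p = subst (_≤ hi (I k)) hi-e p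
      ... | inj₂ p = ℕₚ.<⇒≤ (ℕₚ.<-≤-trans T<r (subst (_≤ hi (I k)) hi-w p))
      lo-m : ∀ {k} → ei < k → k < wi → lo (I k) ≤ β
      lo-m {k} l l′ with uni-lo l l′ wi<
      ... | inj₁ p = ⊥-elim (ℕₚ.<⇒≱ (1≤lo l (ℕₚ.<-trans l′ wi<)) (≤-r lo-e p))
      ... | inj₂ p = ≤-r lo-w p
      lo-y : ∀ {k} → wi < k → k < length cs → β ≤ lo (I k)
      lo-y l l′ with uni-lo ei<wi l l′
      ... | inj₁ p = ⊥-elim (ℕₚ.<⇒≱ (1≤lo ei<wi wi<) (≤-r lo-e p))
      ... | inj₂ p = ≤-l lo-w p
      -- A column before `w` that contained `w` would touch row r earlier, so the link with `w` has
      -- to be an overlap.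
      reach : ∀ {i} → i < wi → β ≤ hi (I i)
      reach {i} l with link l wi<
      ... | inj₁ (_ , p) = subst (_≤ hi (I i)) lo-w p
      ... | inj₂ (k , _ , k<wi , _ , (_ , p)) = ⊥-elim (ℕₚ.<⇒≱ (hi<r k<wi) (≤-l hi-w p))
      β≤T : β ≤ T
      β≤T = subst (β ≤_) hi-e (reach ei<wi)
      lo-y≤T : ∀ {j} → ei < j → j < length cs → lo (I j) ≤ T
      lo-y≤T {j} l l′ with link l l′
      ... | inj₁ (_ , p) = subst (lo (I j) ≤_) hi-e p
      ... | inj₂ (k , l″ , k<j , (p , _) , _) = ⊥-elim (ℕₚ.<⇒≱ (1≤lo l″ (ℕₚ.<-trans k<j l′)) (≤-r lo-e p))
      1≤β : 1 ≤ β
      1≤β = subst (1 ≤_) lo-w (1≤lo ei<wi wi<)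

      pairs-x : AllPairs Within xs
      pairs-x = at-AllPairs (1 , 0) xs λ {i} {j} i<j j< → subst₂ Within (atX (ℕₚ.<-trans i<j j<)) (atX j<) (wit i<j j<)
        where
        wit : ∀ {i j} → i < j → j < ei → Within (I i) (I j)
        -- The comparison columns are `e`, which touches row 0, and `w`, which touches row r. The
        -- other alternatives make column j itself extremal and so imply the same inequalities.
        wit i<j j< with uni-lo i<j j< ei< | uni-hi i<j (ℕₚ.<-trans j< ei<wi) wi<
        ... | p | q = either p (λ t → t) (λ t → ℕₚ.≤-trans (≤-r lo-e t) z≤n) ,
                      either q (λ t → t) (λ t → ℕₚ.≤-trans (hi≤r (ℕₚ.<-trans i<j (ℕₚ.<-trans j< ei<))) (≤-l hi-w t))
          where
          either : ∀ {A B C : Set} → A ⊎ B → (A → C) → (B → C) → C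
          either (inj₁ a) f g = f a
          either (inj₂ b) f g = g b
      pairs-m : AllPairs (λ I J → lo I ≤ lo J × hi I ≤ hi J) ms
      pairs-m = at-AllPairs (1 , 0) ms λ {i} {j} i<j j< →
        subst₂ (λ I J → lo I ≤ lo J × hi I ≤ hi J) (atM (ℕₚ.<-trans i<j j<)) (atM j<) (wit i<j j<)
        where
        wit : ∀ {i j} → i < j → j < length ms → lo (I (posM i)) ≤ lo (I (posM j)) × hi (I (posM i)) ≤ hi (I (posM j))
        wit {i} {j} i<j j< with uni-lo ei<posM (ℕₚ.+-monoʳ-< ei (s≤s i<j)) j<c | uni-hi (ℕₚ.+-monoʳ-< ei (s≤s i<j)) (posM<wi j<) wi<
          where j<c = ℕₚ.<-trans (posM<wi j<) wi<
        ... | inj₁ p | _ = ⊥-elim (ℕₚ.<⇒≱ (1≤lo ei<posM (ℕₚ.<-trans (posM<wi (ℕₚ.<-trans i<j j<)) wi<)) (≤-r lo-e p))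
        ... | inj₂ p | inj₁ q = p , q
        ... | inj₂ p | inj₂ q = ⊥-elim (ℕₚ.<⇒≱ (hi<r (posM<wi j<)) (≤-l hi-w q))
      pairs-y : AllPairs (flip Within) ys
      pairs-y = at-AllPairs (1 , 0) ys λ {i} {j} i<j j< → subst₂ Within (atY j) (atY i) (wit i<j j<)
        where
        wit : ∀ {i j} → i < j → j < length ys → Within (I (posY j)) (I (posY i))
        wit {i} {j} i<j j< with uni-lo (ℕₚ.<-trans ei<wi wi<posY) pos<pos (posY< j<) | uni-hi wi<posY pos<pos (posY< j<)
          where pos<pos = ℕₚ.+-monoʳ-< ei (s≤s (ℕₚ.+-monoʳ-< (length ms) (s≤s i<j)))
        ... | inj₁ p | _ = ⊥-elim (ℕₚ.<⇒≱ (1≤lo (ℕₚ.<-trans ei<wi wi<posY) (posY< (ℕₚ.<-trans i<j j<))) (≤-r lo-e p))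
        ... | inj₂ p | inj₁ q = p , ℕₚ.≤-trans (hi≤r (posY< j<)) (≤-l hi-w q)
        ... | inj₂ p | inj₂ q = p , q

      isX : ∀ {J} → J ∈ xs → β ≤ hi J × hi J ≤ T × lo J ≤ hi J
      isX J∈ with ∈-at (1 , 0) J∈
      ... | i , l , refl = subst (λ K → β ≤ hi K × hi K ≤ T × lo K ≤ hi K) (atX l)
              (reach (ℕₚ.<-trans l ei<wi) , hi-x l , valid< (ℕₚ.<-trans l ei<))
      isMs : ∀ {J} → J ∈ ms → 1 ≤ lo J × lo J ≤ β × T ≤ hi J × hi J < r
      isMs J∈ with ∈-at (1 , 0) J∈
      ... | i , l , refl = subst (λ K → 1 ≤ lo K × lo K ≤ β × T ≤ hi K × hi K < r) (atM l)
              (1≤lo ei<posM (ℕₚ.<-trans (posM<wi l) wi<) , lo-m ei<posM (posM<wi l) , hi-m ei<posM (posM<wi l) , hi<r (posM<wi l))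
      isY : ∀ {J} → J ∈ ys → β ≤ lo J × lo J ≤ T × lo J ≤ hi J × hi J ≤ r
      isY J∈ with ∈-at (1 , 0) J∈
      ... | i , l , refl = subst (λ K → β ≤ lo K × lo K ≤ T × lo K ≤ hi K × hi K ≤ r) (atY i)
              (lo-y wi<posY (posY< l) , lo-y≤T (ℕₚ.<-trans ei<wi wi<posY) (posY< l) , valid< (posY< l) , hi≤r (posY< l))

      -- A column containing both would have to reach below β and above T. This excludes `e`, `w`
      -- and everything outside them, so it is one of `ms`.
      link-xy : ∀ {J K} → J ∈ xs → K ∈ ys → lo J < β → T < hi K →
        lo K ≤ hi J ⊎ Σ Iv λ M → M ∈ ms × lo M ≤ lo J × hi K ≤ hi M
      link-xy J∈ K∈ J< K> with ∈-at (1 , 0) J∈ | ∈-at (1 , 0) K∈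
      ... | i , l , refl | q , l′ , refl with link (ℕₚ.<-trans l (ℕₚ.<-trans ei<wi wi<posY)) (posY< l′)
      ...   | inj₁ (_ , p) = inj₁ (subst₂ _≤_ (cong lo (atY q)) (cong hi (atX l)) p)
      ...   | inj₂ (k , i<k , k<j , (p , _) , (_ , s)) = inj₂ (go (ℕₚ.<-cmp k ei) (ℕₚ.<-cmp k wi))
        where
        p′ : lo (I k) ≤ lo (nth xs i)
        p′ = subst (lo (I k) ≤_) (cong lo (atX l)) p
        s′ : hi (nth ys q) ≤ hi (I k)
        s′ = subst (_≤ hi (I k)) (cong hi (atY q)) s
        too-low : hi (I k) ≤ T → ⊥
        too-low t = ℕₚ.<⇒≱ K> (ℕₚ.≤-trans s′ t)
        too-high : β ≤ lo (I k) → ⊥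
        too-high t = ℕₚ.<⇒≱ J< (ℕₚ.≤-trans t p′)
        go : _ → _ → Σ Iv λ M → M ∈ ms × lo M ≤ lo (nth xs i) × hi (nth ys q) ≤ hi M
        go (tri< t _ _) _ = ⊥-elim (too-low (hi-x t))
        go (tri≈ _ refl _) _ = ⊥-elim (too-low (ℕₚ.≤-reflexive hi-e))
        go (tri> _ _ t) (tri> _ _ t′) = ⊥-elim (too-high (lo-y t′ (ℕₚ.<-trans k<j (posY< l′))))
        go (tri> _ _ t) (tri≈ _ refl _) = ⊥-elim (too-high (ℕₚ.≤-reflexive (sym lo-w)))
        go (tri> _ _ t) (tri< t′ _ _) with mid-index t t′
        ... | m , m< , refl = nth ms m , at-∈ _ ms m< , ≤-l (cong lo (atM m<)) p′ , ≤-r (cong hi (atM m<)) s′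

      open Mk T

      α : ℕ
      α = r ∸ T
      1≤α : 1 ≤ α
      1≤α = ℕₚ.m<n⇒0<n∸m T<r
      T+α : T + α ≡ r
      T+α = ℕₚ.m+[n∸m]≡n (ℕₚ.<⇒≤ T<r)

      assemble : Σ (GObj c r) λ o → gdec o ≡ cs
      -- Left columns grow, so those that stay above row β form an initial segment; right columns
      -- shrink, so those that rise above T do as well.
      assemble with span-by (λ J → β ≤? lo J) (λ { (p , _) q → ℕₚ.≤-trans q p }) pairs-x
                  | span-by (λ J → suc T ≤? hi J) (λ { (_ , p) q → ℕₚ.≤-trans q p }) pairs-y
      ... | l₀ , l₁ , xs≡ , p₀ , p₁ , q₀ , q₁ | r₁ , r₀ , ys≡ , s₁ , s₀ , t₁ , t₀ =
        build (parse-Q {k = k} {D = D} (pred β) (pred α) L M R (mkL l₁ lo-l₁ q₁)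
                 (subst (λ v → MChain v (pred α) M) (sym sβ) mc)
                 (subst (λ v → RChain (D + k) v R Z) (sym sα) (subst (λ v → RChain v α R Z) (sym D+k) rc)) linked)
              (whole-complete {0} {D} nested)
        where
        x₀ : ∀ {J} → J ∈ l₀ → J ∈ xs
        x₀ i = subst (_ ∈_) (sym xs≡) (∈-++⁺ˡ i)
        x₁ : ∀ {J} → J ∈ l₁ → J ∈ xs
        x₁ i = subst (_ ∈_) (sym xs≡) (∈-++⁺ʳ l₀ i)
        y₁ : ∀ {J} → J ∈ r₁ → J ∈ ys
        y₁ i = subst (_ ∈_) (sym ys≡) (∈-++⁺ˡ i)
        y₀ : ∀ {J} → J ∈ r₀ → J ∈ ys
        y₀ i = subst (_ ∈_) (sym ys≡) (∈-++⁺ʳ r₁ i)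
        k D : ℕ
        k = head-k l₁
        -- The distance from the bottom of the core to the top of the first left column that reaches
        -- below the core, or to T if there is none. That column contains the earlier ones, so they
        -- form a stack inside these D + 1 rows.
        D = (T ∸ k) ∸ β
        k-bounds : ∀ ls → (∀ {J} → J ∈ ls → β ≤ hi J × hi J ≤ T) → head-k ls ≤ T × β ≤ T ∸ head-k ls
        k-bounds [] f = z≤n , β≤T
        k-bounds (J ∷ ls) f = ℕₚ.m∸n≤m T (hi J) , subst (β ≤_) (sym (ℕₚ.m∸[m∸n]≡n (proj₂ (f (here refl))))) (proj₁ (f (here refl)))
        k≤T : k ≤ T
        k≤T = proj₁ (k-bounds l₁ λ i → let a , b , _ = isX (x₁ i) in a , b)
        β≤ : β ≤ T ∸ k
        β≤ = proj₂ (k-bounds l₁ λ i → let a , b , _ = isX (x₁ i) in a , b)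
        base≡ : β + (D + k) ≡ T
        base≡ = trans (sym (ℕₚ.+-assoc β D k)) (trans (cong (_+ k) (ℕₚ.m+[n∸m]≡n β≤)) (ℕₚ.m∸n+n≡m k≤T))
        D+k : D + k ≡ T ∸ β
        D+k = trans (sym (ℕₚ.m+n∸m≡n β (D + k))) (cong (_∸ β) base≡)
        L M R Z S : Ivs
        L = map (relL T) l₁
        M = map (relM T) (reverse ms)
        R = map (relR T) r₁
        Z = map (ivZ T) r₀
        S = map (relS β) (reverse l₀)
        sβ : suc (pred β) ≡ β
        sβ = ℕₚ.suc-pred β ⦃ Data.Nat.>-nonZero 1≤β ⦄
        sα : suc (pred α) ≡ α
        sα = ℕₚ.suc-pred α ⦃ Data.Nat.>-nonZero 1≤α ⦄
        lo-l₁ : All (λ J → lo J ≤ pred β) l₁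
        lo-l₁ = All.map (λ n → ℕₚ.≤-pred (≤-r (sym sβ) (ℕₚ.≰⇒> n))) p₁
        mc : MChain β (pred α) M
        mc = mkM (reverse ms)
          (All-reverse {xs = ms} (All.tabulate λ i → let a , b , t , u = isMs i in
            b , ℕₚ.≤-pred (≤-r (sym sα) (ℕₚ.∸-monoˡ-< u t)) , a))
          (AllPairs-reverse pairs-m)
        rc : RChain (T ∸ β) α R Z
        rc = mkR r₁ r₀ (subst (All _) ys≡ (All.tabulate λ i → let a , _ , b , t = isY i in ℕₚ.∸-monoʳ-≤ T a , b , ℕₚ.∸-monoˡ-≤ T t))
          (All.map ℕₚ.m<n⇒0<n∸m s₁) (subst (AllPairs (flip Within)) ys≡ pairs-y)
        linked : Linked L M R
        linked i j with ∈-map⁻ (relL T) i | ∈-map⁻ (relR T) j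
        ... | J , J∈ , refl | K , K∈ , refl with link-xy (x₁ J∈) (y₁ K∈) (ℕₚ.≰⇒> (All.lookup p₁ J∈)) (All.lookup s₁ K∈)
        ...   | inj₁ p = inj₁ (ℕₚ.∸-monoʳ-≤ T p)
        ...   | inj₂ (N , N∈ , p , q) = inj₂ (relM T N , ∈-map⁺ (relM T) (reverse⁺ {xs = ms} N∈) , p , ℕₚ.∸-monoˡ-≤ T q)
        below : ∀ {J} ls → J ∈ l₀ → hi J ≤ T → (∀ {K} → K ∈ ls → Within J K × hi K ≤ T) → hi J ≤ T ∸ head-k ls
        below [] J∈ l f = l
        below (K ∷ ls) J∈ l f = ≤-r (sym (ℕₚ.m∸[m∸n]≡n (proj₂ (f (here refl))))) (proj₂ (proj₁ (f (here refl))))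
        nested : Nested D 0 S
        nested = mkS (reverse l₀)
          (All-reverse {xs = l₀} (All.tabulate λ i → let _ , b , t = isX (x₀ i) in
            All.lookup p₀ i , t ,
            ℕₚ.∸-monoˡ-≤ β (below l₁ i b (λ j → cross-of l₀ (subst (AllPairs Within) xs≡ pairs-x) i j , proj₁ (proj₂ (isX (x₁ j))))) , z≤n))
          (AllPairs-reverse q₀)
        d : Shape
        d = shape (suc (pred β)) k (suc (pred α)) L M R Z

        cols≡ : gcols D d S ≡ cs
        cols≡ = begin
          gcols D d S
            ≡⟨ cong₂ (λ β′ α′ → gcols D (shape β′ k α′ L M R Z) S) sβ sα ⟩
          gcols D (shape β k α L M R Z) S
            ≡⟨ cong (λ T → leftC T (shape β k α L M R Z) S ++ midC T (shape β k α L M R Z) S ++ rightC T (shape β k α L M R Z) S) base≡ ⟩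
          leftC T (shape β k α L M R Z) S ++ midC T (shape β k α L M R Z) S ++ rightC T (shape β k α L M R Z) S
            ≡⟨ cong₂ _++_ left≡ (cong₂ _++_ mid≡ right≡) ⟩
          xs ++ (e ∷ (ms ++ w ∷ [])) ++ ys
            ≡⟨ cong (λ v → xs ++ e ∷ v) (++-assoc ms (w ∷ []) ys) ⟩
          cs ∎
          where
          open Relation.Binary.PropositionalEquality.≡-Reasoning
          left≡ : reverse (map (ivS β) S) ++ map (ivL T) L ≡ xs
          left≡ = trans (cong₂ _++_
            (trans (cong reverse (map-inverse {ivS β} {relS β} (reverse l₀)
                (λ i → let a = All.lookup p₀ (reverse⁻ {xs = l₀} i) ; _ , _ , b = isX (x₀ (reverse⁻ {xs = l₀} i)) in
                  cong₂ _,_ (ℕₚ.m+[n∸m]≡n a) (ℕₚ.m+[n∸m]≡n (ℕₚ.≤-trans a b)))))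
              (reverse-involutive l₀))
            (map-inverse {ivL T} {relL T} l₁ (λ i → let _ , b , _ = isX (x₁ i) in cong (_ ,_) (ℕₚ.m∸[m∸n]≡n b))))
            (sym xs≡)
          mid≡ : (0 , T) ∷ reverse (map (ivM T) M) ++ (β , T + α) ∷ [] ≡ e ∷ (ms ++ w ∷ [])
          mid≡ = cong₂ _∷_ (cong (_, T) (sym e0)) (cong₂ _++_
            (trans (cong reverse (map-inverse {ivM T} {relM T} (reverse ms)
                (λ i → let _ , _ , a , _ = isMs (reverse⁻ {xs = ms} i) in cong (_ ,_) (ℕₚ.m+[n∸m]≡n a))))
              (reverse-involutive ms))
            (cong (λ v → (β , v) ∷ []) (trans T+α (sym wr))))
          right≡ : map (ivR T) R ++ map (ivZ T) Z ≡ ys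
          right≡ = trans (cong₂ _++_
            (map-inverse {ivR T} {relR T} r₁ (λ i → let _ , a , _ = isY (y₁ i) in
              cong₂ _,_ (ℕₚ.m∸[m∸n]≡n a) (ℕₚ.m+[n∸m]≡n (ℕₚ.<⇒≤ (All.lookup s₁ i)))))
            (map-inverse {ivZ T} {ivZ T} r₀ (λ i → let _ , a , _ = isY (y₀ i) in
              ivZ-ivZ a (ℕₚ.≮⇒≥ (All.lookup s₀ i)))))
            (sym ys≡)

        build : Parsed pQ D d → (Σ ℕ λ a → Σ (Stack whole (suc D) a) λ s → stack s 0 ≡ S) → Σ (GObj c r) λ o → gdec o ≡ cs
        build (c′ , r′ , x , ex) (a , s , es) =
          (D , subst (D ≤_) (sym r≡) (ℕₚ.m≤m+n D r′) , a , subst (a ≤_) (sym c≡) (ℕₚ.m≤m+n a c′) , s ,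
            subst₂ (Run pQ D) (sym c∸a) (sym r∸D) x) ,
          trans (cong₂ (gcols D) (trans (decode-cast (sym c∸a) (sym r∸D)) ex) es) cols≡
          where
          decode-cast : ∀ {u v} (p : c′ ≡ u) (q : r′ ≡ v) → decode (subst₂ (Run pQ D) p q x) ≡ decode x
          decode-cast refl refl = refl
          c≡ : c ≡ a + c′
          c≡ = ℕₚ.suc-injective (trans (sym len) (trans (cong length (sym cols≡)) (trans (gcols-length D d S)
            (cong suc (cong₂ _+_ (trans (cong length (sym es)) (stack-length s 0)) (trans (cong columns (sym ex)) (decode-columns x)))))))
          r≡ : r ≡ D + r′
          r≡ = begin
            r                                           ≡⟨ T+α ⟨
            T + α                                       ≡⟨ cong₂ _+_ base≡ sα ⟨
            β + (D + k) + suc (pred α)                  ≡⟨ cong (λ v → v + (D + k) + suc (pred α)) sβ ⟨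
            suc (pred β) + (D + k) + suc (pred α)       ≡⟨ regroup (suc (pred β)) D k (suc (pred α)) ⟩
            D + rows d                                  ≡⟨ cong (λ v → D + v) (trans (cong rows (sym ex)) (decode-rows x)) ⟩
            D + r′                                      ∎
            where
            open Relation.Binary.PropositionalEquality.≡-Reasoning
          c∸a : c ∸ a ≡ c′
          c∸a = trans (cong (_∸ a) c≡) (ℕₚ.m+n∸m≡n a c′)
          r∸D : r ∸ D ≡ r′
          r∸D = trans (cong (_∸ D) r≡) (ℕₚ.m+n∸m≡n D r′)

-- Reflection, and the classification of all column sequences.

module AllObjects where

  open StacksAndRuns
  open StackColumns
  open ColumnSequences
  open Assembly
  open WithFullColumn
  open WithoutFullColumn
  open Parsing
  open import Data.Empty using (⊥; ⊥-elim)
  open import Data.Nat using (ℕ; zero; suc; _∸_; _≤_; _<_; z≤n; s≤s; _≤?_; _≟_)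
  import Data.Nat.Properties as ℕₚ
  open import Data.Product using (Σ; _×_; _,_; proj₁; proj₂)
  open import Data.Sum using (_⊎_; inj₁; inj₂)
  open import Data.List using (_∷_; _++_; map; length)
  open import Data.List.Properties using (length-++; length-map)
  open import Data.List.Membership.Propositional using (_∈_)
  open import Data.List.Membership.Propositional.Properties using (∈-map⁻)
  open import Data.List.Relation.Unary.All using (All; _∷_)
  import Data.List.Relation.Unary.All as All
  open import Data.List.Relation.Unary.AllPairs using (_∷_)
  open import Relation.Nullary using (yes; no; ¬_)
  open import Relation.Binary.Definitions using (tri<; tri≈; tri>)
  open import Relation.Binary.PropositionalEquality using (_≡_; _≢_; refl; sym; trans; cong; cong₂; subst; subst₂)
  open import Function using (_∘_)

  mirror : ℕ → Iv → Iv
  mirror r (s , n) = r ∸ n , r ∸ s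

  mirror-involutive : ∀ {r I} → lo I ≤ r → hi I ≤ r → mirror r (mirror r I) ≡ I
  mirror-involutive l m = cong₂ _,_ (ℕₚ.m∸[m∸n]≡n l) (ℕₚ.m∸[m∸n]≡n m)

  zseq-bounds : ∀ {r cs} → ZSeq (suc r) cs → ∀ {I} → I ∈ cs → lo I ≤ r × hi I ≤ r
  zseq-bounds z I∈ with ∈-at (1 , 0) I∈
  ... | i , l , refl = let p , q = ZSeq.valid z l in ℕₚ.≤-trans p (ℕₚ.≤-pred q) , ℕₚ.≤-pred q

  mirrored-back : ∀ {r cs} → ZSeq (suc r) cs → map (mirror r) (map (mirror r) cs) ≡ cs
  mirrored-back {cs = cs} z = map-inverse cs λ i → let p , q = zseq-bounds z i in mirror-involutive p q

  nth-mirror : ∀ {r} cs i → i < length cs → nth (map (mirror r) cs) i ≡ mirror r (nth cs i)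
  nth-mirror (x ∷ cs) zero    l       = refl
  nth-mirror (x ∷ cs) (suc i) (s≤s l) = nth-mirror cs i l

  mirror-zseq : ∀ {r cs} → ZSeq (suc r) cs → ZSeq (suc r) (map (mirror r) cs)
  mirror-zseq {r} {cs} z = record { valid = valid′ ; cover = cover′ ; conv = conv′ ; link = link′ }
    where
    open ZSeq z
    cs′ = map (mirror r) cs
    len : length cs′ ≡ length cs
    len = length-map (mirror r) cs
    un : ∀ {i} → i < length cs′ → i < length cs
    un = subst (_ <_) len
    re : ∀ {i} → i < length cs → i < length cs′
    re = subst (_ <_) (sym len)
    at′ : ∀ {i} → i < length cs′ → nth cs′ i ≡ mirror r (nth cs i)
    at′ {i} l = nth-mirror cs i (un l)
    in-mirror : ∀ {y I} → y ≤ r → In (r ∸ y) I → In y (mirror r I)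
    in-mirror {y} {I} l (p , q) = ℕₚ.≤-trans (ℕₚ.∸-monoʳ-≤ r q) (ℕₚ.≤-reflexive (ℕₚ.m∸[m∸n]≡n l)) ,
      ℕₚ.≤-trans (ℕₚ.≤-reflexive (sym (ℕₚ.m∸[m∸n]≡n l))) (ℕₚ.∸-monoʳ-≤ r p)
    mirror-in : ∀ {y I} → lo I ≤ r → hi I ≤ r → In y (mirror r I) → In (r ∸ y) I
    mirror-in {y} {I} l m (p , q) = ℕₚ.≤-trans (ℕₚ.≤-reflexive (sym (ℕₚ.m∸[m∸n]≡n l))) (ℕₚ.∸-monoʳ-≤ r q) ,
      ℕₚ.≤-trans (ℕₚ.∸-monoʳ-≤ r p) (ℕₚ.≤-reflexive (ℕₚ.m∸[m∸n]≡n m))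
    bounds : ∀ {i} → i < length cs → lo (nth cs i) ≤ r × hi (nth cs i) ≤ r
    bounds l = zseq-bounds z (at-∈ _ cs l)
    overlap-mirror : ∀ {I J} → Overlap I J → Overlap (mirror r I) (mirror r J)
    overlap-mirror (p , q) = ℕₚ.∸-monoʳ-≤ r q , ℕₚ.∸-monoʳ-≤ r p
    within-mirror : ∀ {I J} → Within I J → Within (mirror r I) (mirror r J)
    within-mirror (p , q) = ℕₚ.∸-monoʳ-≤ r q , ℕₚ.∸-monoʳ-≤ r p
    valid′ : ∀ {i} → i < length cs′ → lo (nth cs′ i) ≤ hi (nth cs′ i) × hi (nth cs′ i) < suc r
    valid′ {i} l = subst (λ I → lo I ≤ hi I × hi I < suc r) (sym (at′ l)) (ℕₚ.∸-monoʳ-≤ r (proj₁ (valid (un l))) , s≤s (ℕₚ.m∸n≤m r (lo (nth cs i))))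
    cover′ : ∀ {y} → y < suc r → Σ ℕ λ i → i < length cs′ × In y (nth cs′ i)
    cover′ {y} (s≤s l) with cover {r ∸ y} (s≤s (ℕₚ.m∸n≤m r y))
    ... | i , i< , p = i , re i< , subst (In y) (sym (at′ (re i<))) (in-mirror l p)
    conv′ : ∀ {i k j y} → i < k → k < j → j < length cs′ → In y (nth cs′ i) → In y (nth cs′ j) → In y (nth cs′ k)
    conv′ {i} {k} {j} {y} i<k k<j j< p q = subst (In y) (sym (at′ k<))
      (in-mirror (ℕₚ.≤-trans (proj₂ q′) (ℕₚ.m∸n≤m r (lo (nth cs j)))) (conv i<k k<j (un j<) (back i< p) (back j< q)))
      where
      k< = ℕₚ.<-trans k<j j<
      i< = ℕₚ.<-trans i<k k<
      q′ : In y (mirror r (nth cs j))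
      q′ = subst (In y) (at′ j<) q
      back : ∀ {i} → i < length cs′ → In y (nth cs′ i) → In (r ∸ y) (nth cs i)
      back l p = let b , t = bounds (un l) in mirror-in b t (subst (In y) (at′ l) p)
    link′ : ∀ {i j} → i < j → j < length cs′ → Overlap (nth cs′ i) (nth cs′ j) ⊎
            Σ ℕ λ k → i < k × k < j × Within (nth cs′ i) (nth cs′ k) × Within (nth cs′ j) (nth cs′ k)
    link′ {i} {j} i<j j< with link i<j (un j<)
    ... | inj₁ o = inj₁ (subst₂ Overlap (sym (at′ (ℕₚ.<-trans i<j j<))) (sym (at′ j<)) (overlap-mirror o))
    ... | inj₂ (k , i<k , k<j , v , w) = inj₂ (k , i<k , k<j ,
      subst₂ Within (sym (at′ (ℕₚ.<-trans i<j j<))) (sym (at′ (ℕₚ.<-trans k<j j<))) (within-mirror v) ,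
      subst₂ Within (sym (at′ j<)) (sym (at′ (ℕₚ.<-trans k<j j<))) (within-mirror w))

  mirror-full : ∀ {r I} → lo I ≤ r → hi I ≤ r → Full r (mirror r I) → Full r I
  mirror-full {r} {I} l m (p , q) = trans (sym (ℕₚ.m∸[m∸n]≡n l)) (trans (cong (r ∸_) q) (ℕₚ.n∸n≡0 r)) ,
    trans (sym (ℕₚ.m∸[m∸n]≡n m)) (cong (r ∸_) p)

  -- Whichever of the two later columns comes first already has one end at the required extreme;
  -- unimodality between two columns with the other extreme supplies the other end, so it is full.
  not-both : ∀ {r cs} → ZSeq (suc r) cs → (∀ {I} → I ∈ cs → ¬ Full r I) → Ascending r cs →
    (Σ ℕ λ i → Σ ℕ λ j → i < j × j < length cs × hi (nth cs i) ≡ r × lo (nth cs j) ≡ 0) → ⊥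
  not-both {r} {cs} z nf (i , j , i<j , j< , lo-i , hi-j) (i′ , j′ , i′<j′ , j′< , hi-i′ , lo-j′) with ℕₚ.<-cmp j j′
    where open Uni z
  ... | tri≈ _ refl _ = nf (at-∈ _ cs j<) (lo-j′ , hi-j)
  ... | tri< j<j′ _ _ = nf (at-∈ _ cs j<) (0-of (Uni.uni-lo z i<j j<j′ j′<) , hi-j)
    where
    0-of : lo (nth cs j) ≤ lo (nth cs i) ⊎ lo (nth cs j) ≤ lo (nth cs j′) → lo (nth cs j) ≡ 0
    0-of (inj₁ p) = ℕₚ.n≤0⇒n≡0 (≤-r lo-i p)
    0-of (inj₂ p) = ℕₚ.n≤0⇒n≡0 (≤-r lo-j′ p)
  ... | tri> _ _ j′<j = nf (at-∈ _ cs j′<) (lo-j′ , r-of (Uni.uni-hi z i′<j′ j′<j j<))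
    where
    r-of : hi (nth cs i′) ≤ hi (nth cs j′) ⊎ hi (nth cs j) ≤ hi (nth cs j′) → hi (nth cs j′) ≡ r
    r-of p = ℕₚ.≤-antisym (proj₂ (zseq-bounds z (at-∈ _ cs j′<))) (go p)
      where
      go : hi (nth cs i′) ≤ hi (nth cs j′) ⊎ hi (nth cs j) ≤ hi (nth cs j′) → r ≤ hi (nth cs j′)
      go (inj₁ p) = ≤-l hi-i′ p
      go (inj₂ p) = ≤-l hi-j p

  Obj⁺ : ℕ → ℕ → Set
  Obj⁺ c r = VObj c r ⊎ (GObj c r ⊎ GObj c r)

  Obj-has : ∀ c r → Obj⁺ c r has #Z (suc c) (suc r)
  Obj-has c r = V-has c r ⊎-has (G-has c r ⊎-has G-has c r)

  cols : ∀ {c r} → Obj⁺ c r → Ivs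
  cols (inj₁ o)               = vdec o
  cols (inj₂ (inj₁ o))        = gdec o
  cols {r = r} (inj₂ (inj₂ o)) = map (mirror r) (gdec o)

  cols-zseq : ∀ {c r} (o : Obj⁺ c r) → ZSeq (suc r) (cols o)
  cols-zseq (inj₁ o)        = vdec-zseq o
  cols-zseq (inj₂ (inj₁ o)) = gdec-zseq o
  cols-zseq (inj₂ (inj₂ o)) = mirror-zseq (gdec-zseq o)

  cols-length : ∀ {c r} (o : Obj⁺ c r) → length (cols o) ≡ suc c
  cols-length (inj₁ o)        = vdec-length o
  cols-length (inj₂ (inj₁ o)) = gdec-length o
  cols-length (inj₂ (inj₂ o)) = trans (length-map _ (gdec o)) (gdec-length o)

  mirrored-notfull : ∀ {c r} (o : GObj c r) → ∀ {I} → I ∈ map (mirror r) (gdec o) → ¬ Full r I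
  mirrored-notfull {r = r} o i f with ∈-map⁻ (mirror r) i
  ... | J , J∈ , refl = let p , q = zseq-bounds (gdec-zseq o) J∈ in gdec-notfull o J∈ (mirror-full p q f)

  full≢notfull : ∀ {c r cs} (o : VObj c r) → (∀ {I} → I ∈ cs → ¬ Full r I) → vdec o ≢ cs
  full≢notfull o nf refl = let I , I∈ , f = vdec-full o in nf I∈ f

  ascending≢mirrored : ∀ {c r} (o o′ : GObj c r) → gdec o ≢ map (mirror r) (gdec o′)
  ascending≢mirrored {r = r} o o′ e with gdec-ascending o′
  ... | i , j , i<j , j< , p , q = not-both (gdec-zseq o) (gdec-notfull o) (gdec-ascending o)
      (i , j , i<j , j<′ , trans (cong hi (at′ (ℕₚ.<-trans i<j j<))) (cong (r ∸_) p) ,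
        trans (cong lo (at′ j<)) (trans (cong (r ∸_) q) (ℕₚ.n∸n≡0 r)))
    where
    j<′ : j < length (gdec o)
    j<′ = subst (j <_) (sym (trans (cong length e) (length-map (mirror r) (gdec o′)))) j<
    at′ : ∀ {i} → i < length (gdec o′) → nth (gdec o) i ≡ mirror r (nth (gdec o′) i)
    at′ {i} l = trans (cong (λ v → nth v i) e) (nth-mirror (gdec o′) i l)

  cols-injective : ∀ {c r} (o o′ : Obj⁺ c r) → cols o ≡ cols o′ → o ≡ o′
  cols-injective (inj₁ o) (inj₁ o′) e = cong inj₁ (vdec-injective o o′ e)
  cols-injective (inj₂ (inj₁ o)) (inj₂ (inj₁ o′)) e = cong (inj₂ ∘ inj₁) (gdec-injective o o′ e)
  cols-injective {r = r} (inj₂ (inj₂ o)) (inj₂ (inj₂ o′)) e = cong (inj₂ ∘ inj₂) (gdec-injective o o′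
    (trans (sym (mirrored-back (gdec-zseq o))) (trans (cong (map (mirror r)) e) (mirrored-back (gdec-zseq o′)))))
  cols-injective (inj₁ o) (inj₂ (inj₁ o′)) e = ⊥-elim (full≢notfull o (gdec-notfull o′) e)
  cols-injective (inj₁ o) (inj₂ (inj₂ o′)) e = ⊥-elim (full≢notfull o (mirrored-notfull o′) e)
  cols-injective (inj₂ (inj₁ o)) (inj₁ o′) e = ⊥-elim (full≢notfull o′ (gdec-notfull o) (sym e))
  cols-injective (inj₂ (inj₂ o)) (inj₁ o′) e = ⊥-elim (full≢notfull o′ (mirrored-notfull o) (sym e))
  cols-injective (inj₂ (inj₁ o)) (inj₂ (inj₂ o′)) e = ⊥-elim (ascending≢mirrored o o′ e)
  cols-injective (inj₂ (inj₂ o)) (inj₂ (inj₁ o′)) e = ⊥-elim (ascending≢mirrored o′ o (sym e))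

  ascending-case : ∀ {c r cs} → length cs ≡ suc c → ZSeq (suc r) cs → (∀ {I} → I ∈ cs → ¬ Full r I) →
    (Σ (GObj c r) λ o → gdec o ≡ cs) ⊎
    (Σ ℕ λ e → e < length cs × lo (nth cs e) ≡ 0 × (∀ {i} → i < length cs → hi (nth cs i) ≡ r → i ≤ e))
  ascending-case {c} {r} {cs} len z nf with last-split {P = λ I → lo I ≡ 0} (λ I → lo I ≟ 0) cs
  ... | inj₁ none with ZSeq.cover z {0} (s≤s z≤n)
  ...   | i , i< , p , _ = ⊥-elim (All.lookup none (at-∈ _ cs i<) (ℕₚ.n≤0⇒n≡0 p))
  ascending-case {c} {r} {cs} len z nf | inj₂ (xs , e , zs , refl , e0 , nb) with first-split {P = λ I → hi I ≡ r} (λ I → hi I ≟ r) zs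
  ... | inj₂ (ms , w , ys , refl , wr , nt) = inj₁ (gdec-complete xs e ms w ys len z nf e0 wr nb nt)
  ... | inj₁ nt = inj₂ (length xs , subst (length xs <_) (sym (length-++ xs)) (ℕₚ.m<m+n _ (s≤s z≤n)) ,
      trans (cong lo (trans (cong (nth (xs ++ e ∷ zs)) (sym (ℕₚ.+-identityʳ _))) (at-++ʳ _ xs _ 0))) e0 , bound)
    where
    bound : ∀ {i} → i < length (xs ++ e ∷ zs) → hi (nth (xs ++ e ∷ zs) i) ≡ r → i ≤ length xs
    bound {i} l q with i ≤? length xs
    ... | yes p = p
    ... | no p with ℕₚ.m≤n⇒∃[o]m+o≡n (ℕₚ.≰⇒> p)
    ...   | j , refl = ⊥-elim (All.lookup nt (at-∈ _ zs j<) (trans (cong hi (sym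
              (trans (cong (nth (xs ++ e ∷ zs)) (sym (ℕₚ.+-suc (length xs) j))) (at-++ʳ _ xs (e ∷ zs) (suc j))))) q))
      where
      j< : j < length zs
      j< = ℕₚ.≤-pred (ℕₚ.+-cancelˡ-< (length xs) _ _ (subst₂ _<_ (sym (ℕₚ.+-suc (length xs) j)) (length-++ xs) l))

  -- If neither the sequence nor its reflection is ascending, the last column on the bottom row
  -- comes no earlier than any column on the top row, and conversely. These two columns then
  -- coincide, and the column would be full.
  cols-complete : ∀ {c r cs} → length cs ≡ suc c → ZSeq (suc r) cs → Σ (Obj⁺ c r) λ o → cols o ≡ cs
  cols-complete {c} {r} {cs} len z with last-split (Full? r) cs
  ... | inj₂ (as , e , bs , eq , f , nf) = let o , p = vdec-complete len z as e bs eq f nf in inj₁ o , p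
  ... | inj₁ none with ascending-case len z (All.lookup none)
  ...   | inj₁ (o , p) = inj₂ (inj₁ o) , p
  ...   | inj₂ (e , e< , e0 , tops) with ascending-case {cs = map (mirror r) cs} (trans (length-map _ cs) len) (mirror-zseq z) nf′
    where
    nf′ : ∀ {I} → I ∈ map (mirror r) cs → ¬ Full r I
    nf′ i f with ∈-map⁻ (mirror r) i
    ... | J , J∈ , refl = let p , q = zseq-bounds z J∈ in All.lookup none J∈ (mirror-full p q f)
  ...     | inj₁ (o , p) = inj₂ (inj₂ o) , trans (cong (map (mirror r)) p) (mirrored-back z)
  ...     | inj₂ (e′ , e′<′ , e′0 , bots) = ⊥-elim (All.lookup none (at-∈ _ cs e<) (e0 , trans (cong (λ v → hi (nth cs v)) e≡) hi-e′))
    where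
    e′< : e′ < length cs
    e′< = subst (e′ <_) (length-map _ cs) e′<′
    hi-e′ : hi (nth cs e′) ≡ r
    hi-e′ = ℕₚ.≤-antisym (proj₂ (zseq-bounds z (at-∈ _ cs e′<)))
      (ℕₚ.m∸n≡0⇒m≤n (trans (sym (cong lo (nth-mirror cs e′ e′<))) e′0))
    e≡ : e ≡ e′
    e≡ = ℕₚ.≤-antisym (bots (subst (e <_) (sym (length-map _ cs)) e<) (trans (cong hi (nth-mirror cs e e<)) (cong (r ∸_) e0)))
      (tops e′< hi-e′)

-- Rendering of columns; the form of monotone paths with at most two turns.

module PathsInPolyominoes where

  open import Defs
  open StackColumns using (Ivs)
  open ColumnSequences
  open import Data.Bool using (Bool; true; false; _∧_; T; if_then_else_)
  open import Data.Empty using (⊥-elim)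
  open import Data.Fin using (Fin; toℕ; fromℕ<)
  import Data.Fin as Fin
  import Data.Fin.Properties as Finₚ
  open import Data.Nat using (ℕ; zero; suc; _≤_; _<_; z≤n; s≤s; _+_; _≤ᵇ_)
  import Data.Nat.Properties as ℕₚ
  open import Data.Integer using (ℤ; +_)
  import Data.Integer as ℤ
  import Data.Integer.Properties as ℤₚ
  open import Data.Product using (Σ; _×_; _,_; proj₁; proj₂)
  open import Data.Sum using (_⊎_; inj₁; inj₂)
  open import Data.Vec using (Vec; []; _∷_; lookup; tabulate)
  open import Data.Vec.Properties using (lookup∘tabulate)
  open import Data.List using (List; []; _∷_; _++_; replicate)
  open import Data.List.Relation.Unary.All using (All; []; _∷_)
  import Data.List.Relation.Unary.All as All
  open import Data.List.Relation.Unary.AllPairs using ([]; _∷_)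
  open import Relation.Nullary using (¬_)
  open import Relation.Binary.PropositionalEquality using (_≡_; _≢_; refl; sym; trans; cong; cong₂; subst)
  open import Function using (_∘_)

  in? : Iv → ℕ → Bool
  in? (s , n) y = (s ≤ᵇ y) ∧ (y ≤ᵇ n)

  in?⇒In : ∀ I y → in? I y ≡ true → In y I
  in?⇒In (s , n) y e with s ≤ᵇ y in p | y ≤ᵇ n in q
  ... | true | true = ℕₚ.≤ᵇ⇒≤ s y (subst T (sym p) _) , ℕₚ.≤ᵇ⇒≤ y n (subst T (sym q) _)

  T⇒≡ : ∀ {b} → T b → b ≡ true
  T⇒≡ {true} _ = refl

  In⇒in? : ∀ I y → In y I → in? I y ≡ true
  In⇒in? (s , n) y (p , q) = cong₂ _∧_ (T⇒≡ (ℕₚ.≤⇒≤ᵇ p)) (T⇒≡ (ℕₚ.≤⇒≤ᵇ q))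

  render : ∀ c r → Ivs → Mat c r
  render c r cs = tabulate λ i → tabulate λ j → in? (nth cs (toℕ i)) (toℕ j)

  render-cell : ∀ c r cs (i : Fin c) (j : Fin r) → lookup (lookup (render c r cs) i) j ≡ in? (nth cs (toℕ i)) (toℕ j)
  render-cell c r cs i j = trans (cong (λ v → lookup v j) (lookup∘tabulate _ i)) (lookup∘tabulate _ j)

  vec-ext : ∀ {A : Set} {n} {u v : Vec A n} → (∀ i → lookup u i ≡ lookup v i) → u ≡ v
  vec-ext {u = []} {[]} e = refl
  vec-ext {u = x ∷ u} {y ∷ v} e = cong₂ _∷_ (e Fin.zero) (vec-ext (e ∘ Fin.suc))

  Has : ∀ {c r} → Mat c r → ℕ → ℕ → Set
  Has M x y = (+ x , + y) ∈Q M

  fin-of : ∀ {n x} → x < n → Σ (Fin n) λ i → toℕ i ≡ x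
  fin-of l = fromℕ< l , Finₚ.toℕ-fromℕ< l

  rep : Dir → ℕ → List Dir
  rep u n = replicate n u

  module _ {P : Cell → Set} where

    positions-++ : ∀ p us {vs} → All P (positions p us) → All P (positions (endpoint p us) vs) → All P (positions p (us ++ vs))
    positions-++ p []       _        b = b
    positions-++ p (u ∷ us) (a ∷ as) b = a ∷ positions-++ (step u p) us as b

    positions-++ʳ : ∀ p us {vs} → All P (positions p (us ++ vs)) → All P (positions (endpoint p us) vs)
    positions-++ʳ p []       a        = a
    positions-++ʳ p (u ∷ us) (_ ∷ as) = positions-++ʳ (step u p) us as

    positions-head : ∀ p us → All P (positions p us) → P p
    positions-head p []       (a ∷ _) = a
    positions-head p (u ∷ us) (a ∷ _) = a

  endpoint-++ : ∀ p us vs → endpoint p (us ++ vs) ≡ endpoint (endpoint p us) vs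
  endpoint-++ p []       vs = refl
  endpoint-++ p (u ∷ us) vs = endpoint-++ (step u p) us vs

  -- This only says that the directions differ, in the Boolean form, and in both orders, in which
  -- `changes` computes.
  Opposed : Dir → Dir → Set
  Opposed u v = sameDir u v ≡ false × sameDir v u ≡ false

  same-refl : ∀ u → sameDir u u ≡ true
  same-refl N = refl
  same-refl S = refl
  same-refl E = refl
  same-refl W = refl

  changes-rep : ∀ u n → changes (rep u n) ≡ 0
  changes-rep u zero          = refl
  changes-rep u (suc zero)    = refl
  changes-rep u (suc (suc n)) = trans (cong (λ b → (if b then 0 else 1) + changes (rep u (suc n))) (same-refl u)) (changes-rep u (suc n))

  changes-++ : ∀ u n vs → changes (rep u n ++ vs) ≤ suc (changes vs)
  changes-++ u zero          vs = ℕₚ.n≤1+n _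
  changes-++ u (suc zero)    [] = z≤n
  changes-++ u (suc zero)    (v ∷ vs) with sameDir u v
  ... | true  = ℕₚ.n≤1+n _
  ... | false = ℕₚ.≤-refl
  changes-++ u (suc (suc n)) vs = subst (λ b → (if b then 0 else 1) + changes (rep u (suc n) ++ vs) ≤ suc (changes vs)) (sym (same-refl u)) (changes-++ u (suc n) vs)

  changes-three : ∀ u v l m n → changes (rep u l ++ rep v m ++ rep u n) ≤ 2
  changes-three u v l m n = ℕₚ.≤-trans (changes-++ u l _)
    (s≤s (ℕₚ.≤-trans (changes-++ v m (rep u n)) (s≤s (ℕₚ.≤-reflexive (changes-rep u n)))))

  module Words (u v : Dir) (opp : Opposed u v) where

    InUV : List Dir → Set
    InUV = All (λ w → w ≡ u ⊎ w ≡ v)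

    straight : ∀ us → InUV us → changes (u ∷ us) ≤ 0 → Σ ℕ λ n → u ∷ us ≡ rep u n
    straight [] [] l = 1 , refl
    straight (w ∷ us) (inj₁ refl ∷ a) l rewrite same-refl u with straight us a l
    ... | n , e = suc n , cong (u ∷_) e
    straight (w ∷ us) (inj₂ refl ∷ a) l rewrite proj₁ opp = ⊥-elim (ℕₚ.<⇒≱ (s≤s z≤n) l)

  -- After a turn the two directions exchange their roles, so each level calls the previous one with
  -- `u` and `v` swapped.
  module Words₁ (u v : Dir) (opp : Opposed u v) where

    open Words u v opp
    module V = Words v u (proj₂ opp , proj₁ opp)

    swap-uv : ∀ {us} → InUV us → V.InUV us
    swap-uv = All.map λ { (inj₁ p) → inj₂ p ; (inj₂ p) → inj₁ p }

    one-turn : ∀ us → InUV us → changes (u ∷ us) ≤ 1 → Σ ℕ λ m → Σ ℕ λ n → u ∷ us ≡ rep u m ++ rep v n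
    one-turn [] [] l = 1 , 0 , refl
    one-turn (w ∷ us) (inj₁ refl ∷ a) l rewrite same-refl u with one-turn us a l
    ... | m , n , e = suc m , n , cong (u ∷_) e
    one-turn (w ∷ us) (inj₂ refl ∷ a) l rewrite proj₁ opp with V.straight us (swap-uv a) (ℕₚ.≤-pred l)
    ... | n , e = 1 , n , cong (u ∷_) e

  module Words₂ (u v : Dir) (opp : Opposed u v) where

    open Words u v opp
    open Words₁ u v opp using (swap-uv)
    module V₁ = Words₁ v u (proj₂ opp , proj₁ opp)

    Three₀ : List Dir → Set
    Three₀ us = Σ ℕ λ l → Σ ℕ λ m → Σ ℕ λ n → us ≡ rep u l ++ rep v m ++ rep u n

    two-turns : ∀ us → InUV us → changes (u ∷ us) ≤ 2 → Three₀ (u ∷ us)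
    two-turns [] [] l = 1 , 0 , 0 , refl
    two-turns (w ∷ us) (inj₁ refl ∷ a) l rewrite same-refl u with two-turns us a l
    ... | k , m , n , e = suc k , m , n , cong (u ∷_) e
    two-turns (w ∷ us) (inj₂ refl ∷ a) l rewrite proj₁ opp with V₁.one-turn us (swap-uv a) (ℕₚ.≤-pred l)
    ... | m , n , e = 1 , m , n , cong (u ∷_) e

  Three : Dir → Dir → List Dir → Set
  Three u v us = Σ ℕ λ l → Σ ℕ λ m → Σ ℕ λ n → us ≡ rep u l ++ rep v m ++ rep u n

  three-runs : ∀ u v → Opposed u v → ∀ us → All (λ w → w ≡ u ⊎ w ≡ v) us → changes us ≤ 2 → Three u v us ⊎ Three v u us
  three-runs u v opp [] [] l = inj₁ (0 , 0 , 0 , refl)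
  three-runs u v opp (w ∷ us) (inj₁ refl ∷ a) l = inj₁ (Words₂.two-turns u v opp us a l)
  three-runs u v opp (w ∷ us) (inj₂ refl ∷ a) l = inj₂ (Words₂.two-turns v u (proj₂ opp , proj₁ opp) us (Words₁.swap-uv u v opp a) l)

  xᶜ yᶜ : Cell → ℤ
  xᶜ = proj₁
  yᶜ = proj₂

  -- Used by contraposition: a path that ends further to the right contains a step `E`.
  fixed-x : ∀ p us → All (λ w → w ≢ E) us → xᶜ (endpoint p us) ℤ.≤ xᶜ p
  fixed-x p [] [] = ℤₚ.≤-refl
  fixed-x p (N ∷ us) (_ ∷ a) = fixed-x (step N p) us a
  fixed-x p (S ∷ us) (_ ∷ a) = fixed-x (step S p) us a
  fixed-x p (E ∷ us) (n ∷ a) = ⊥-elim (n refl)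
  fixed-x p (W ∷ us) (_ ∷ a) = ℤₚ.≤-trans (fixed-x (step W p) us a) (ℤₚ.i-j≤i (xᶜ p) (+ 1))

  fixed-N : ∀ p us → All (λ w → w ≢ N) us → yᶜ (endpoint p us) ℤ.≤ yᶜ p
  fixed-N p [] [] = ℤₚ.≤-refl
  fixed-N p (E ∷ us) (_ ∷ a) = fixed-N (step E p) us a
  fixed-N p (W ∷ us) (_ ∷ a) = fixed-N (step W p) us a
  fixed-N p (N ∷ us) (n ∷ a) = ⊥-elim (n refl)
  fixed-N p (S ∷ us) (_ ∷ a) = ℤₚ.≤-trans (fixed-N (step S p) us a) (ℤₚ.i-j≤i (yᶜ p) (+ 1))

  fixed-S : ∀ p us → All (λ w → w ≢ S) us → yᶜ p ℤ.≤ yᶜ (endpoint p us)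
  fixed-S p [] [] = ℤₚ.≤-refl
  fixed-S p (E ∷ us) (_ ∷ a) = fixed-S (step E p) us a
  fixed-S p (W ∷ us) (_ ∷ a) = fixed-S (step W p) us a
  fixed-S p (S ∷ us) (n ∷ a) = ⊥-elim (n refl)
  fixed-S p (N ∷ us) (_ ∷ a) = ℤₚ.≤-trans (ℤₚ.i≤i+j (yᶜ p) (+ 1)) (fixed-S (step N p) us a)

  _≟ᵈ_ : ∀ (u v : Dir) → u ≡ v ⊎ u ≢ v
  N ≟ᵈ N = inj₁ refl
  S ≟ᵈ S = inj₁ refl
  E ≟ᵈ E = inj₁ refl
  W ≟ᵈ W = inj₁ refl
  N ≟ᵈ S = inj₂ λ ()
  N ≟ᵈ E = inj₂ λ ()
  N ≟ᵈ W = inj₂ λ ()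
  S ≟ᵈ N = inj₂ λ ()
  S ≟ᵈ E = inj₂ λ ()
  S ≟ᵈ W = inj₂ λ ()
  E ≟ᵈ N = inj₂ λ ()
  E ≟ᵈ S = inj₂ λ ()
  E ≟ᵈ W = inj₂ λ ()
  W ≟ᵈ N = inj₂ λ ()
  W ≟ᵈ S = inj₂ λ ()
  W ≟ᵈ E = inj₂ λ ()

  uses : ∀ {us} v → Monotone us → ¬ All (λ w → w ≢ v) us → Σ Dir λ b → All (λ w → w ≡ v ⊎ w ≡ b) us
  uses v (a , b , m) n with a ≟ᵈ v | b ≟ᵈ v
  ... | inj₁ refl | _ = b , m
  ... | inj₂ _ | inj₁ refl = a , All.map (λ { (inj₁ p) → inj₂ p ; (inj₂ p) → inj₁ p }) m
  ... | inj₂ p | inj₂ q = ⊥-elim (n (All.map (λ { (inj₁ refl) → p ; (inj₂ refl) → q }) m))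

  -- `Monotone` gives its two types in no particular order. Two distinct steps that are known to
  -- occur identify them.
  uses-both : ∀ {us} u v → u ≢ v → Monotone us → ¬ All (λ w → w ≢ u) us → ¬ All (λ w → w ≢ v) us → All (λ w → w ≡ u ⊎ w ≡ v) us
  uses-both u v u≢v m n n′ with uses u m n
  ... | b , a with b ≟ᵈ v
  ...   | inj₁ refl = a
  ...   | inj₂ p = ⊥-elim (n′ (All.map (λ { (inj₁ refl) → u≢v ; (inj₂ refl) → p }) a))

  endpoint-E : ∀ x y n → endpoint (+ x , y) (rep E n) ≡ (+ (x + n) , y)
  endpoint-E x y zero    = cong (λ v → + v , y) (sym (ℕₚ.+-identityʳ x))
  endpoint-E x y (suc n) = trans (endpoint-E (x + 1) y n) (cong (λ v → + v , y) (ℕₚ.+-assoc x 1 n))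

  Vertical : Dir → Set
  Vertical v = v ≡ N ⊎ v ≡ S

  endpoint-V : ∀ {v} → Vertical v → ∀ x y n → Σ ℤ λ y′ → endpoint (x , y) (rep v n) ≡ (x , y′)
  endpoint-V vv x y zero = y , refl
  endpoint-V (inj₁ refl) x y (suc n) = endpoint-V (inj₁ refl) x _ n
  endpoint-V (inj₂ refl) x y (suc n) = endpoint-V (inj₂ refl) x _ n

  module _ {c r : ℕ} (M : Mat c r) where

    -- A path E*v*E* gives a column meeting both rows, a path v*E*v* a row meeting both columns.
    corner : ∀ {v} → Vertical v → ∀ {i s j t} us → All (_∈Q M) (positions (+ i , + s) us) → endpoint (+ i , + s) us ≡ (+ j , + t) →
      Three E v us ⊎ Three v E us →
      (Σ ℕ λ k → i ≤ k × k ≤ j × Has M k s × Has M k t) ⊎ (Σ ℤ λ y → (+ i , y) ∈Q M × (+ j , y) ∈Q M)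
    corner {v} vv {i} {s} {j} {t} us a e (inj₁ (l , m , n , refl)) with endpoint-V vv (+ (i + l)) (+ s) m
    ... | y , ey = inj₁ (i + l , ℕₚ.m≤m+n i l , subst (i + l ≤_) (ℤₚ.+-injective (cong proj₁ e₃)) (ℕₚ.m≤m+n (i + l) n) ,
            subst (_∈Q M) e₁ (positions-head _ _ a₁) ,
            subst (_∈Q M) (trans e₂ (cong (+ (i + l) ,_) (cong proj₂ e₃))) (positions-head _ (rep E n) a₂))
      where
      e₁ = endpoint-E i (+ s) l
      a₁ = positions-++ʳ (+ i , + s) (rep E l) a
      a₂ = positions-++ʳ (endpoint (+ i , + s) (rep E l)) (rep v m) a₁
      e₂ : endpoint (endpoint (+ i , + s) (rep E l)) (rep v m) ≡ (+ (i + l) , y)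
      e₂ = trans (cong (λ p → endpoint p (rep v m)) e₁) ey
      e₃ : (+ (i + l + n) , y) ≡ (+ j , + t)
      e₃ = trans (sym (trans (endpoint-++ (+ i , + s) (rep E l) _) (trans (endpoint-++ _ (rep v m) (rep E n))
             (trans (cong (λ p → endpoint p (rep E n)) e₂) (endpoint-E (i + l) y n))))) e
    corner {v} vv {i} {s} {j} {t} us a e (inj₂ (l , m , n , refl)) with endpoint-V vv (+ i) (+ s) l
    ... | y , ey with endpoint-V vv (+ (i + m)) y n
    ...   | y′ , ey′ = inj₂ (y , subst (_∈Q M) ey (positions-head _ _ a₁) ,
              subst (_∈Q M) (trans e₂ (cong (_, y) (cong proj₁ e₃))) (positions-head _ (rep v n) a₂))
      where
      a₁ = positions-++ʳ (+ i , + s) (rep v l) a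
      a₂ = positions-++ʳ (endpoint (+ i , + s) (rep v l)) (rep E m) a₁
      e₂ : endpoint (endpoint (+ i , + s) (rep v l)) (rep E m) ≡ (+ (i + m) , y)
      e₂ = trans (cong (λ p → endpoint p (rep E m)) ey) (endpoint-E i y m)
      e₃ : (+ (i + m) , y′) ≡ (+ j , + t)
      e₃ = trans (sym (trans (endpoint-++ (+ i , + s) (rep v l) _) (trans (endpoint-++ _ (rep E m) (rep v n))
             (trans (cong (λ p → endpoint p (rep v n)) e₂) ey′)))) e

    Corner : ℕ → ℕ → ℕ → ℕ → Set
    Corner i s j t = (Σ ℕ λ k → i ≤ k × k ≤ j × Has M k s × Has M k t) ⊎ (Σ ℤ λ y → (+ i , y) ∈Q M × (+ j , y) ∈Q M)

    ZPath : Cell → Cell → Set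
    ZPath a b = Σ (Path M a b) λ π → Monotone (steps π) × (changes (steps π) ≤ 2)

    corner-up : ∀ {i s j t} → i < j → s < t → ZPath (+ i , + s) (+ j , + t) → Corner i s j t
    corner-up {i} {s} {j} {t} i<j s<t (π , m , ch) = corner (inj₁ refl) (steps π) (inside π) (ends π)
      (three-runs E N (refl , refl) (steps π) (uses-both E N (λ ()) m
        (λ a → ℤₚ.<⇒≱ (ℤ.+<+ i<j) (subst (λ q → xᶜ q ℤ.≤ + i) (ends π) (fixed-x _ (steps π) a)))
        (λ a → ℤₚ.<⇒≱ (ℤ.+<+ s<t) (subst (λ q → yᶜ q ℤ.≤ + s) (ends π) (fixed-N _ (steps π) a)))) ch)

    corner-down : ∀ {i s j t} → i < j → t < s → ZPath (+ i , + s) (+ j , + t) → Corner i s j t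
    corner-down {i} {s} {j} {t} i<j t<s (π , m , ch) = corner (inj₂ refl) (steps π) (inside π) (ends π)
      (three-runs E S (refl , refl) (steps π) (uses-both E S (λ ()) m
        (λ a → ℤₚ.<⇒≱ (ℤ.+<+ i<j) (subst (λ q → xᶜ q ℤ.≤ + i) (ends π) (fixed-x _ (steps π) a)))
        (λ a → ℤₚ.<⇒≱ (ℤ.+<+ t<s) (subst (λ q → + s ℤ.≤ yᶜ q) (ends π) (fixed-S _ (steps π) a)))) ch)

-- The columns of a Z-convex polyomino.

module FromPolyominoes where

  open PathsInPolyominoes
  open import Defs
  open StackColumns using (Ivs)
  open ColumnSequences
  open import Data.Bool using (Bool; true; false)
  open import Data.Empty using (⊥; ⊥-elim)
  open import Data.Fin using (Fin; toℕ; fromℕ<)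
  import Data.Fin as Fin
  import Data.Fin.Properties as Finₚ
  open import Data.Nat using (ℕ; zero; suc; _≤_; _<_; z≤n; s≤s; _+_)
  import Data.Nat.Properties as ℕₚ
  open import Data.Integer using (ℤ; +_)
  import Data.Integer as ℤ
  import Data.Integer.Properties as ℤₚ
  open import Data.Product using (Σ; _×_; _,_; proj₁; proj₂)
  open import Data.Sum using (_⊎_; inj₁; inj₂)
  open import Data.Vec using (Vec; []; _∷_; lookup; tabulate)
  open import Data.List using (List; []; _∷_; length)
  import Data.List as List
  open import Data.List.Properties using (length-tabulate)
  open import Data.List.Relation.Unary.All using ([]; _∷_)
  open import Data.List.Relation.Unary.AllPairs using ([]; _∷_)
  open import Relation.Nullary using (yes; no)
  open import Relation.Binary.PropositionalEquality using (_≡_; refl; sym; trans; cong; subst)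
  open import Function using (_∘_)

  least : ∀ (f : ℕ → Bool) j → f j ≡ true → Σ ℕ λ s → s ≤ j × f s ≡ true × (∀ {i} → i < s → f i ≡ false)
  least f zero    e = 0 , z≤n , e , λ ()
  least f (suc j) e with f 0 in p
  ... | true  = 0 , z≤n , p , λ ()
  ... | false with least (f ∘ suc) j e
  ...   | s , l , q , m = suc s , s≤s l , q , λ { {zero} _ → p ; {suc i} (s≤s k) → m k }

  greatest : ∀ (f : ℕ → Bool) r {j} → j < r → f j ≡ true → Σ ℕ λ n → j ≤ n × n < r × f n ≡ true × (∀ {i} → n < i → i < r → f i ≡ false)
  greatest f (suc r) {j} j<r e with f r in p
  ... | true  = r , ℕₚ.≤-pred j<r , ℕₚ.≤-refl , p , λ l l′ → ⊥-elim (ℕₚ.<⇒≱ l (ℕₚ.≤-pred l′))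
  ... | false with greatest f r (ℕₚ.≤∧≢⇒< (ℕₚ.≤-pred j<r) λ { refl → case-absurd (trans (sym e) p) }) e
    where
    case-absurd : true ≡ false → ⊥
    case-absurd ()
  ...   | n , l , l′ , q , m = n , l , ℕₚ.m≤n⇒m≤1+n l′ , q , λ k k′ → top k (ℕₚ.m≤n⇒m<n∨m≡n (ℕₚ.≤-pred k′))
    where
    top : ∀ {i} → n < i → i < r ⊎ i ≡ r → f i ≡ false
    top k (inj₁ k′) = m k k′
    top k (inj₂ refl) = p

  at-vec : ∀ {n} → Vec Bool n → ℕ → Bool
  at-vec []       y       = false
  at-vec (b ∷ v)  zero    = b
  at-vec (b ∷ v)  (suc y) = at-vec v y

  at-vec-lookup : ∀ {n} (v : Vec Bool n) i → at-vec v (toℕ i) ≡ lookup v i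
  at-vec-lookup (b ∷ v) Fin.zero    = refl
  at-vec-lookup (b ∷ v) (Fin.suc i) = at-vec-lookup v i

  module FromPoly {c r : ℕ} (M : Mat c r) (zp : ZPoly c r M) where

    tight-col : ∀ i → Σ (Fin r) λ j → lookup (lookup M i) j ≡ true
    tight-col = proj₁ (proj₁ zp)
    tight-row : ∀ j → Σ (Fin c) λ i → lookup (lookup M i) j ≡ true
    tight-row = proj₂ (proj₁ zp)
    convex : IsConvex M
    convex = proj₁ (proj₂ (proj₂ zp))
    zpath : ∀ a b → a ∈Q M → b ∈Q M → ZPath M a b
    zpath = proj₂ (proj₂ (proj₂ zp))

    has : ∀ (i : Fin c) (j : Fin r) → lookup (lookup M i) j ≡ true → Has M (toℕ i) (toℕ j)
    has i j e = i , j , refl , refl , e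

    has⁻ : ∀ (i : Fin c) (j : Fin r) → Has M (toℕ i) (toℕ j) → lookup (lookup M i) j ≡ true
    has⁻ i j (i′ , j′ , p , q , e) with Finₚ.toℕ-injective (ℤₚ.+-injective p) | Finₚ.toℕ-injective (ℤₚ.+-injective q)
    ... | refl | refl = e

    Column : Fin c → Iv → Set
    Column i I = lo I ≤ hi I × hi I < r × Has M (toℕ i) (lo I) × Has M (toℕ i) (hi I) × (∀ {y} → Has M (toℕ i) y → In y I)

    column : ∀ i → Σ Iv (Column i)
    column i with tight-col i
    ... | j , e with least (at-vec (lookup M i)) (toℕ j) (trans (at-vec-lookup (lookup M i) j) e)
                   | greatest (at-vec (lookup M i)) r (Finₚ.toℕ<n j) (trans (at-vec-lookup (lookup M i) j) e)
    ...   | s , s≤j , s-in , below | n , j≤n , n<r , n-in , above =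
            (s , n) , ℕₚ.≤-trans s≤j j≤n , n<r , cell (ℕₚ.≤-<-trans s≤j (Finₚ.toℕ<n j)) s-in , cell n<r n-in , inside′
      where
      cell : ∀ {y} → y < r → at-vec (lookup M i) y ≡ true → Has M (toℕ i) y
      cell {y} l p = i , fromℕ< l , refl , cong +_ (sym (Finₚ.toℕ-fromℕ< l)) ,
        trans (sym (at-vec-lookup (lookup M i) (fromℕ< l))) (trans (cong (at-vec (lookup M i)) (Finₚ.toℕ-fromℕ< l)) p)
      clash : ∀ {b} → b ≡ true → b ≡ false → ⊥
      clash refl ()
      inside′ : ∀ {y} → Has M (toℕ i) y → In y (s , n)
      inside′ (i′ , j′ , p , q , e′) with Finₚ.toℕ-injective (ℤₚ.+-injective p) | ℤₚ.+-injective q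
      ... | refl | refl = ℕₚ.≮⇒≥ (λ l → clash (trans (at-vec-lookup (lookup M i) j′) e′) (below l)) ,
                          ℕₚ.≮⇒≥ (λ l → clash (trans (at-vec-lookup (lookup M i) j′) e′) (above l (Finₚ.toℕ<n j′)))

    cs : Ivs
    cs = List.tabulate (proj₁ ∘ column)

    cs-length : length cs ≡ c
    cs-length = length-tabulate (proj₁ ∘ column)

    nth-tabulate : ∀ {m} (f : Fin m → Iv) i → nth (List.tabulate f) (toℕ i) ≡ f i
    nth-tabulate f Fin.zero    = refl
    nth-tabulate f (Fin.suc i) = nth-tabulate (f ∘ Fin.suc) i

    col-at : ∀ {x} → x < length cs → Σ (Fin c) λ i → toℕ i ≡ x × nth cs x ≡ proj₁ (column i)
    col-at l with fin-of (subst (_ <_) cs-length l)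
    ... | i , refl = i , refl , nth-tabulate (proj₁ ∘ column) i

    In⇒Has : ∀ {x y} → x < length cs → In y (nth cs x) → Has M x y
    In⇒Has {x} {y} l p with col-at l
    ... | i , refl , e = let _ , _ , hs , hn , _ = proj₂ (column i) ; p₁ , p₂ = subst (In y) e p in
            proj₁ convex (+ toℕ i) _ _ (+ y) hs hn (ℤ.+≤+ p₁) (ℤ.+≤+ p₂)

    Has⇒In : ∀ {x y} → x < length cs → Has M x y → In y (nth cs x)
    Has⇒In {x} {y} l h with col-at l
    ... | i , refl , e = let _ , _ , _ , _ , f = proj₂ (column i) in subst (In y) (sym e) (f h)

    zseq : ZSeq r cs
    zseq = record { valid = valid ; cover = cover ; conv = conv ; link = link }
      where
      valid : ∀ {i} → i < length cs → lo (nth cs i) ≤ hi (nth cs i) × hi (nth cs i) < r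
      valid l with col-at l
      ... | i , refl , e = let p , q , _ = proj₂ (column i) in subst (λ I → lo I ≤ hi I × hi I < r) (sym e) (p , q)
      cover : ∀ {y} → y < r → Σ ℕ λ i → i < length cs × In y (nth cs i)
      cover l with fin-of l
      ... | j , refl with tight-row j
      ...   | i , e = toℕ i , i< , Has⇒In i< (has i j e)
        where
        i< : toℕ i < length cs
        i< = subst (toℕ i <_) (sym cs-length) (Finₚ.toℕ<n i)
      conv : ∀ {i k j y} → i < k → k < j → j < length cs → In y (nth cs i) → In y (nth cs j) → In y (nth cs k)
      conv {i} {k} {j} {y} i<k k<j l p q = Has⇒In lk (proj₂ convex (+ y) (+ i) (+ j) (+ k)
          (In⇒Has (ℕₚ.<-trans i<k lk) p) (In⇒Has l q) (ℤ.+≤+ (ℕₚ.<⇒≤ i<k)) (ℤ.+≤+ (ℕₚ.<⇒≤ k<j)))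
        where lk = ℕₚ.<-trans k<j l
      Link : ℕ → ℕ → Set
      Link i j = Overlap (nth cs i) (nth cs j) ⊎
        Σ ℕ λ k → i < k × k < j × Within (nth cs i) (nth cs k) × Within (nth cs j) (nth cs k)
      shared : ∀ {i j y} → i < length cs → j < length cs → (+ i , y) ∈Q M → (+ j , y) ∈Q M → Overlap (nth cs i) (nth cs j)
      shared li lj p@(_ , y′ , _ , refl , _) q with Has⇒In li p | Has⇒In lj q
      ... | a , b | a′ , b′ = ℕₚ.≤-trans a b′ , ℕₚ.≤-trans a′ b
      link : ∀ {i j} → i < j → j < length cs → Link i j
      link {i} {j} i<j l with lo (nth cs i) Data.Nat.≤? hi (nth cs j) | lo (nth cs j) Data.Nat.≤? hi (nth cs i)
      ... | yes p | yes q = inj₁ (p , q)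
      -- Column i lies entirely below column j. A path from the bottom of i to the top of j either
      -- gives a row common to both, or a column meeting these two extreme rows, which then contains
      -- both columns.
      ... | _ | no q = up (corner-up M i<j (ℕₚ.≤-<-trans vi (ℕₚ.<-≤-trans gap vj)) (zpath _ _ (In⇒Has li (ℕₚ.≤-refl , vi)) (In⇒Has l (vj , ℕₚ.≤-refl))))
        where
        li = ℕₚ.<-trans i<j l
        vi = proj₁ (valid li)
        vj = proj₁ (valid l)
        gap = ℕₚ.≰⇒> q
        up : Corner M i (lo (nth cs i)) j (hi (nth cs j)) → Link i j
        up (inj₂ (y , p , p′)) = inj₁ (shared li l p p′)
        up (inj₁ (k , i≤k , k≤j , p , p′)) with Has⇒In (ℕₚ.≤-<-trans k≤j l) p | Has⇒In (ℕₚ.≤-<-trans k≤j l) p′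
        ... | a , b | a′ , b′ = inj₂ (k , ℕₚ.≤∧≢⇒< i≤k (λ { refl → ℕₚ.<⇒≱ gap (ℕₚ.≤-trans vj b′) }) ,
              ℕₚ.≤∧≢⇒< k≤j (λ { refl → ℕₚ.<⇒≱ gap (ℕₚ.≤-trans a vi) }) ,
              (a , ℕₚ.≤-trans (ℕₚ.<⇒≤ gap) (ℕₚ.≤-trans vj b′)) , (ℕₚ.≤-trans a (ℕₚ.≤-trans vi (ℕₚ.<⇒≤ gap)) , b′))
      ... | no q | yes _ = down (corner-down M i<j (ℕₚ.≤-<-trans vj (ℕₚ.<-≤-trans gap vi)) (zpath _ _ (In⇒Has li (vi , ℕₚ.≤-refl)) (In⇒Has l (ℕₚ.≤-refl , vj))))
        where
        li = ℕₚ.<-trans i<j l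
        vi = proj₁ (valid li)
        vj = proj₁ (valid l)
        gap = ℕₚ.≰⇒> q
        down : Corner M i (hi (nth cs i)) j (lo (nth cs j)) → Link i j
        down (inj₂ (y , p , p′)) = inj₁ (shared li l p p′)
        down (inj₁ (k , i≤k , k≤j , p , p′)) with Has⇒In (ℕₚ.≤-<-trans k≤j l) p | Has⇒In (ℕₚ.≤-<-trans k≤j l) p′
        ... | a , b | a′ , b′ = inj₂ (k , ℕₚ.≤∧≢⇒< i≤k (λ { refl → ℕₚ.<⇒≱ gap (ℕₚ.≤-trans a′ vj) }) ,
              ℕₚ.≤∧≢⇒< k≤j (λ { refl → ℕₚ.<⇒≱ gap (ℕₚ.≤-trans vi b) }) ,
              (ℕₚ.≤-trans a′ (ℕₚ.≤-trans vj (ℕₚ.<⇒≤ gap)) , b) , (a′ , ℕₚ.≤-trans (ℕₚ.<⇒≤ gap) (ℕₚ.≤-trans vi b)))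

    rendered : render c r cs ≡ M
    rendered = vec-ext λ i → vec-ext λ j → trans (render-cell c r cs i j) (bool-ext (fwd i j) (bwd i j))
      where
      bool-ext : ∀ {a b} → (a ≡ true → b ≡ true) → (b ≡ true → a ≡ true) → a ≡ b
      bool-ext {true}  {b} f g = sym (f refl)
      bool-ext {false} {true} f g = g refl
      bool-ext {false} {false} f g = refl
      i< : ∀ (i : Fin c) → toℕ i < length cs
      i< i = subst (toℕ i <_) (sym cs-length) (Finₚ.toℕ<n i)
      fwd : ∀ i j → in? (nth cs (toℕ i)) (toℕ j) ≡ true → lookup (lookup M i) j ≡ true
      fwd i j e = has⁻ i j (In⇒Has (i< i) (in?⇒In _ _ e))
      bwd : ∀ i j → lookup (lookup M i) j ≡ true → in? (nth cs (toℕ i)) (toℕ j) ≡ true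
      bwd i j e = In⇒in? _ _ (Has⇒In (i< i) (has i j e))

-- The Z-convex polyomino of a sequence of columns.

module ToPolyominoes where

  open PathsInPolyominoes
  open import Defs
  open StackColumns using (Ivs)
  open ColumnSequences
  open import Data.Bool using (true)
  open import Data.Fin using (Fin; toℕ)
  import Data.Fin.Properties as Finₚ
  open import Data.Nat using (ℕ; zero; suc; _≤_; _<_; z≤n; s≤s; _+_; _⊔_; _⊓_)
  import Data.Nat.Properties as ℕₚ
  open import Data.Integer using (ℤ; +_; -[1+_])
  import Data.Integer as ℤ
  import Data.Integer.Properties as ℤₚ
  open import Data.Product using (Σ; _×_; _,_; proj₁; proj₂)
  open import Data.Sum using (_⊎_; inj₁; inj₂)
  open import Data.Vec using ([]; _∷_; lookup)
  open import Data.List using ([]; _∷_; _++_; length)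
  open import Data.List.Relation.Unary.All using (All; []; _∷_)
  import Data.List.Relation.Unary.All as All
  import Data.List.Relation.Unary.All.Properties as Allₚ
  open import Data.List.Relation.Unary.Unique.Propositional using (Unique)
  open import Data.List.Relation.Unary.AllPairs using ([]; _∷_)
  open import Relation.Binary.Definitions using (tri<; tri≈; tri>)
  open import Relation.Binary.PropositionalEquality using (_≡_; refl; sym; trans; cong; cong₂; subst)
  import Data.Integer.Solver

  ≤⇒gap : ∀ {m n} → m ≤ n → Σ ℕ λ o → o + m ≡ n
  ≤⇒gap {m} l with ℕₚ.m≤n⇒∃[o]m+o≡n l
  ... | o , e = o , trans (ℕₚ.+-comm o m) e

  lineE : ∀ {P : Cell → Set} n x y → (∀ {m} → m ≤ n → P (+ (x + m) , y)) → All P (positions (+ x , y) (rep E n))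
  lineE {P} zero x y f = subst (λ v → P (+ v , y)) (ℕₚ.+-identityʳ x) (f z≤n) ∷ []
  lineE {P} (suc n) x y f = subst (λ v → P (+ v , y)) (ℕₚ.+-identityʳ x) (f z≤n) ∷
    lineE n (x + 1) y (λ {m} l → subst (λ v → P (+ v , y)) (sym (ℕₚ.+-assoc x 1 m)) (f (s≤s l)))

  lineN : ∀ {P : Cell → Set} n x y → (∀ {m} → m ≤ n → P (x , + (y + m))) → All P (positions (x , + y) (rep N n))
  lineN {P} zero x y f = subst (λ v → P (x , + v)) (ℕₚ.+-identityʳ y) (f z≤n) ∷ []
  lineN {P} (suc n) x y f = subst (λ v → P (x , + v)) (ℕₚ.+-identityʳ y) (f z≤n) ∷
    lineN n x (y + 1) (λ {m} l → subst (λ v → P (x , + v)) (sym (ℕₚ.+-assoc y 1 m)) (f (s≤s l)))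

  lineW : ∀ {P : Cell → Set} n x y → (∀ {m} → m ≤ n → P (+ (m + x) , y)) → All P (positions (+ (n + x) , y) (rep W n))
  lineW zero x y f = f z≤n ∷ []
  lineW (suc n) x y f = f ℕₚ.≤-refl ∷ lineW n x y (λ l → f (ℕₚ.m≤n⇒m≤1+n l))

  lineS : ∀ {P : Cell → Set} n x y → (∀ {m} → m ≤ n → P (x , + (m + y))) → All P (positions (x , + (n + y)) (rep S n))
  lineS zero x y f = f z≤n ∷ []
  lineS (suc n) x y f = f ℕₚ.≤-refl ∷ lineS n x y (λ l → f (ℕₚ.m≤n⇒m≤1+n l))

  endpoint-N : ∀ x y n → endpoint (x , + y) (rep N n) ≡ (x , + (y + n))
  endpoint-N x y zero    = cong (λ v → x , + v) (sym (ℕₚ.+-identityʳ y))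
  endpoint-N x y (suc n) = trans (endpoint-N x (y + 1) n) (cong (λ v → x , + v) (ℕₚ.+-assoc y 1 n))

  endpoint-W : ∀ x y n → endpoint (+ (n + x) , y) (rep W n) ≡ (+ x , y)
  endpoint-W x y zero    = refl
  endpoint-W x y (suc n) = endpoint-W x y n

  endpoint-S : ∀ x y n → endpoint (x , + (n + y)) (rep S n) ≡ (x , + y)
  endpoint-S x y zero    = refl
  endpoint-S x y (suc n) = endpoint-S x y n

  -- Since φ increases along all steps, the path is self-avoiding.
  module Potential (φ : Cell → ℤ) where

    Climbs : Dir → Set
    Climbs u = ∀ p → φ (step u p) ≡ φ p ℤ.+ + 1

    climb-≤ : ∀ p us → All Climbs us → All (λ q → φ p ℤ.≤ φ q) (positions p us)
    climb-≤ p [] [] = ℤₚ.≤-refl ∷ []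
    climb-≤ p (u ∷ us) (c ∷ cs) = ℤₚ.≤-refl ∷
      All.map (ℤₚ.≤-trans (subst (φ p ℤ.≤_) (sym (c p)) (ℤₚ.i≤i+j (φ p) (+ 1)))) (climb-≤ (step u p) us cs)

    climb-unique : ∀ p us → All Climbs us → Unique (positions p us)
    climb-unique p [] [] = [] ∷ []
    climb-unique p (u ∷ us) (c ∷ cs) =
      All.map (λ {q} l → λ { refl → ℤₚ.<-irrefl refl (ℤₚ.<-≤-trans up l) }) (climb-≤ (step u p) us cs) ∷ climb-unique (step u p) us cs
      where
      up : φ p ℤ.< φ (step u p)
      up = subst (φ p ℤ.<_) (sym (c p)) (subst (ℤ._< φ p ℤ.+ + 1) (ℤₚ.+-identityʳ (φ p)) (ℤₚ.+-monoʳ-< (φ p) (ℤ.+<+ (s≤s z≤n))))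

  Climbing : Dir → Dir → Set
  Climbing u v = Σ (Cell → ℤ) λ φ → Potential.Climbs φ u × Potential.Climbs φ v

  climb-swap : ∀ u v → Climbing u v → Climbing v u
  climb-swap u v (φ , a , b) = φ , b , a

  module _ where
    open Data.Integer.Solver.+-*-Solver

    climbEN : Climbing E N
    climbEN = (λ p → proj₁ p ℤ.+ proj₂ p) ,
      (λ p → solve 2 (λ x y → (x :+ con (+ 1)) :+ y := (x :+ y) :+ con (+ 1)) refl (proj₁ p) (proj₂ p)) ,
      (λ p → solve 2 (λ x y → x :+ (y :+ con (+ 1)) := (x :+ y) :+ con (+ 1)) refl (proj₁ p) (proj₂ p))

    climbES : Climbing E S
    climbES = (λ p → proj₁ p ℤ.- proj₂ p) ,
      (λ p → solve 2 (λ x y → (x :+ con (+ 1)) :- y := (x :- y) :+ con (+ 1)) refl (proj₁ p) (proj₂ p)) ,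
      (λ p → solve 2 (λ x y → x :- (y :+ con (ℤ.- + 1)) := (x :- y) :+ con (+ 1)) refl (proj₁ p) (proj₂ p))

    climbWN : Climbing W N
    climbWN = (λ p → proj₂ p ℤ.- proj₁ p) ,
      (λ p → solve 2 (λ x y → y :- (x :+ con (ℤ.- + 1)) := (y :- x) :+ con (+ 1)) refl (proj₁ p) (proj₂ p)) ,
      (λ p → solve 2 (λ x y → (y :+ con (+ 1)) :- x := (y :- x) :+ con (+ 1)) refl (proj₁ p) (proj₂ p))

    climbWS : Climbing W S
    climbWS = (λ p → ℤ.- (proj₁ p ℤ.+ proj₂ p)) ,
      (λ p → solve 2 (λ x y → :- ((x :+ con (ℤ.- + 1)) :+ y) := :- (x :+ y) :+ con (+ 1)) refl (proj₁ p) (proj₂ p)) ,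
      (λ p → solve 2 (λ x y → :- (x :+ (y :+ con (ℤ.- + 1))) := :- (x :+ y) :+ con (+ 1)) refl (proj₁ p) (proj₂ p))

  module _ {c r : ℕ} (M : Mat c r) where

    Walk : Dir → Cell → Cell → Set
    Walk u p q = Σ ℕ λ n → endpoint p (rep u n) ≡ q × All (_∈Q M) (positions p (rep u n))

    three-walks : ∀ {u v a b c d} → Climbing u v → Walk u a b → Walk v b c → Walk u c d → ZPath M a d
    three-walks {u} {v} {a} {b} {c} {d} (φ , cu , cv) (l , e₁ , i₁) (m , e₂ , i₂) (n , e₃ , i₃) = record
      { steps = us
      ; inside = positions-++ a (rep u l) i₁ (subst (λ p → All (_∈Q M) (positions p (rep v m ++ rep u n))) (sym e₁)
          (positions-++ b (rep v m) i₂ (subst (λ p → All (_∈Q M) (positions p (rep u n))) (sym e₂) i₃)))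
      ; selfAvoiding = Potential.climb-unique φ a us (All.map (λ { (inj₁ refl) → cu ; (inj₂ refl) → cv }) mono)
      ; ends = trans (endpoint-++ a (rep u l) _) (trans (cong (λ p → endpoint p (rep v m ++ rep u n)) e₁)
          (trans (endpoint-++ b (rep v m) (rep u n)) (trans (cong (λ p → endpoint p (rep u n)) e₂) e₃))) } ,
      (u , v , mono) , changes-three u v l m n
      where
      us = rep u l ++ rep v m ++ rep u n
      mono : All (λ w → w ≡ u ⊎ w ≡ v) us
      mono = Allₚ.++⁺ (Allₚ.replicate⁺ l (inj₁ refl)) (Allₚ.++⁺ (Allₚ.replicate⁺ m (inj₂ refl)) (Allₚ.replicate⁺ n (inj₁ refl)))

    walkE : ∀ {x x′ y} → x ≤ x′ → (∀ {k} → x ≤ k → k ≤ x′ → Has M k y) → Walk E (+ x , + y) (+ x′ , + y)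
    walkE {x} {x′} {y} l f with ℕₚ.m≤n⇒∃[o]m+o≡n l
    ... | n , refl = n , endpoint-E x (+ y) n , lineE n x (+ y) (λ {m} k → f (ℕₚ.m≤m+n x m) (ℕₚ.+-monoʳ-≤ x k))

    walkW : ∀ {x x′ y} → x′ ≤ x → (∀ {k} → x′ ≤ k → k ≤ x → Has M k y) → Walk W (+ x , + y) (+ x′ , + y)
    walkW {x} {x′} {y} l f with ≤⇒gap l
    ... | n , refl = n , endpoint-W x′ (+ y) n , lineW n x′ (+ y) (λ {m} k → f (ℕₚ.m≤n+m x′ m) (ℕₚ.+-monoˡ-≤ x′ k))

    walkN : ∀ {x y y′} → y ≤ y′ → (∀ {k} → y ≤ k → k ≤ y′ → Has M x k) → Walk N (+ x , + y) (+ x , + y′)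
    walkN {x} {y} {y′} l f with ℕₚ.m≤n⇒∃[o]m+o≡n l
    ... | n , refl = n , endpoint-N (+ x) y n , lineN n (+ x) y (λ {m} k → f (ℕₚ.m≤m+n y m) (ℕₚ.+-monoʳ-≤ y k))

    walkS : ∀ {x y y′} → y′ ≤ y → (∀ {k} → y′ ≤ k → k ≤ y → Has M x k) → Walk S (+ x , + y) (+ x , + y′)
    walkS {x} {y} {y′} l f with ≤⇒gap l
    ... | n , refl = n , endpoint-S (+ x) y′ n , lineS n (+ x) y′ (λ {m} k → f (ℕₚ.m≤n+m y′ m) (ℕₚ.+-monoˡ-≤ y′ k))

  Between : ℕ → ℕ → ℕ → Set
  Between a b c = (a ≤ b × b ≤ c) ⊎ (c ≤ b × b ≤ a)

  module ToPoly {c r : ℕ} (cs : Ivs) (len : length cs ≡ suc c) (z : ZSeq (suc r) cs) where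

    open ZSeq z

    M : Mat (suc c) (suc r)
    M = render (suc c) (suc r) cs

    I : ℕ → Iv
    I = nth cs

    Has⇒ : ∀ {x y} → Has M x y → x < length cs × In y (I x)
    Has⇒ (i , j , refl , refl , e) = subst (toℕ i <_) (sym len) (Finₚ.toℕ<n i) ,
      in?⇒In _ _ (trans (sym (render-cell _ _ cs i j)) e)

    ⇒Has : ∀ {x y} → x < length cs → In y (I x) → Has M x y
    ⇒Has {x} {y} l (p , q) with fin-of (subst (x <_) len l) | fin-of (ℕₚ.≤-<-trans q (proj₂ (valid l)))
    ... | i , refl | j , refl = i , j , refl , refl , trans (render-cell _ _ cs i j) (In⇒in? _ _ (p , q))

    tight : Tight M
    tight = (λ i → let l = subst (toℕ i <_) (sym len) (Finₚ.toℕ<n i) in from-col i (⇒Has l (ℕₚ.≤-refl , proj₁ (valid l)))) ,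
            (λ j → let x , l , p = cover (Finₚ.toℕ<n j) in from-row j (⇒Has l p))
      where
      from-col : ∀ i {y} → Has M (toℕ i) y → Σ (Fin (suc r)) λ j → lookup (lookup M i) j ≡ true
      from-col i (i′ , j , p , _ , e) with Finₚ.toℕ-injective (ℤₚ.+-injective p)
      ... | refl = j , e
      from-row : ∀ j {x} → Has M x (toℕ j) → Σ (Fin (suc c)) λ i → lookup (lookup M i) j ≡ true
      from-row j (i , j′ , _ , p , e) with Finₚ.toℕ-injective (ℤₚ.+-injective p)
      ... | refl = i , e

    row-conv : ∀ {i k j y} → i ≤ k → k ≤ j → Has M i y → Has M j y → Has M k y
    row-conv {i} {k} {j} i≤k k≤j p q with ℕₚ.m≤n⇒m<n∨m≡n i≤k | ℕₚ.m≤n⇒m<n∨m≡n k≤j | Has⇒ p | Has⇒ q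
    ... | inj₂ refl | _ | _ | _ = p
    ... | _ | inj₂ refl | _ | _ = q
    ... | inj₁ i<k | inj₁ k<j | _ , a | l , b = ⇒Has (ℕₚ.<-trans k<j l) (conv i<k k<j l a b)

    col-conv : ∀ {x a y b} → a ≤ y → y ≤ b → Has M x a → Has M x b → Has M x y
    col-conv l l′ p q with Has⇒ p | Has⇒ q
    ... | k , s , _ | _ , _ , t = ⇒Has k (ℕₚ.≤-trans s l , ℕₚ.≤-trans l′ t)

    nonneg : ∀ {a x} → + a ℤ.≤ x → Σ ℕ λ n → x ≡ + n
    nonneg {x = + n} l = n , refl
    nonneg {x = -[1+ n ]} ()

    convex : IsConvex M
    convex = cols , rws
      where
      cols : ∀ x y₁ y₂ y → (x , y₁) ∈Q M → (x , y₂) ∈Q M → y₁ ℤ.≤ y → y ℤ.≤ y₂ → (x , y) ∈Q M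
      cols x y₁ y₂ y p@(_ , _ , refl , refl , _) q@(_ , _ , _ , refl , _) l l′ with nonneg l
      ... | n , refl = col-conv (ℤₚ.drop‿+≤+ l) (ℤₚ.drop‿+≤+ l′) p q
      rws : ∀ y x₁ x₂ x → (x₁ , y) ∈Q M → (x₂ , y) ∈Q M → x₁ ℤ.≤ x → x ℤ.≤ x₂ → (x , y) ∈Q M
      rws y x₁ x₂ x p@(_ , _ , refl , refl , _) q@(_ , _ , refl , _ , _) l l′ with nonneg l
      ... | n , refl = row-conv (ℤₚ.drop‿+≤+ l) (ℤₚ.drop‿+≤+ l′) p q

    -- The two forms of a Z: the middle leg runs in a column k or along a row h. `Between` keeps the
    -- outer legs in one direction.
    Route : ℕ → ℕ → ℕ → ℕ → Set
    Route i y j y′ = (Σ ℕ λ k → Between i k j × Has M k y × Has M k y′) ⊎ (Σ ℕ λ h → Between y h y′ × Has M i h × Has M j h)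

    -- The row is `y` moved towards `y′` only as far as needed to enter the other column, so both
    -- vertical legs point the same way and the path is monotone.
    common : ∀ {A B y y′} → Overlap A B → In y A → In y′ B → Σ ℕ λ h → Between y h y′ × In h A × In h B
    common {A} {B} {y} {y′} (p , q) (a , b) (a′ , b′) with ℕₚ.≤-total y y′
    ... | inj₁ l = y ⊔ lo B , inj₁ (ℕₚ.m≤m⊔n y _ , ℕₚ.⊔-lub l a′) ,
          (ℕₚ.≤-trans a (ℕₚ.m≤m⊔n y _) , ℕₚ.⊔-lub b q) , (ℕₚ.m≤n⊔m y _ , ℕₚ.⊔-lub (ℕₚ.≤-trans l b′) (ℕₚ.≤-trans a′ b′))
    ... | inj₂ l = y ⊓ hi B , inj₂ (ℕₚ.⊓-glb l b′ , ℕₚ.m⊓n≤m y _) ,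
          (ℕₚ.⊓-glb a p , ℕₚ.≤-trans (ℕₚ.m⊓n≤m y _) b) , (ℕₚ.⊓-glb (ℕₚ.≤-trans a′ l) (ℕₚ.≤-trans a′ b′) , ℕₚ.m⊓n≤n y _)

    within-in : ∀ {A B y} → Within A B → In y A → In y B
    within-in (p , q) (s , t) = ℕₚ.≤-trans p s , ℕₚ.≤-trans t q

    route : ∀ {i y j y′} → Has M i y → Has M j y′ → Route i y j y′
    route {i} {y} {j} {y′} p q with ℕₚ.<-cmp i j | Has⇒ p | Has⇒ q
    ... | tri≈ _ refl _ | _ | _ = inj₁ (i , inj₁ (ℕₚ.≤-refl , ℕₚ.≤-refl) , p , q)
    ... | tri< i<j _ _ | li , a | lj , b with link i<j lj
    ...   | inj₁ o = let h , bt , u , v = common o a b in inj₂ (h , bt , ⇒Has li u , ⇒Has lj v)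
    ...   | inj₂ (k , i<k , k<j , w , w′) = inj₁ (k , inj₁ (ℕₚ.<⇒≤ i<k , ℕₚ.<⇒≤ k<j) ,
              ⇒Has (ℕₚ.<-trans k<j lj) (within-in w a) , ⇒Has (ℕₚ.<-trans k<j lj) (within-in w′ b))
    route {i} {y} {j} {y′} p q | tri> _ _ j<i | li , a | lj , b with link j<i li
    ...   | inj₁ (o , o′) = let h , bt , u , v = common (o′ , o) a b in inj₂ (h , bt , ⇒Has li u , ⇒Has lj v)
    ...   | inj₂ (k , j<k , k<i , w , w′) = inj₁ (k , inj₂ (ℕₚ.<⇒≤ j<k , ℕₚ.<⇒≤ k<i) ,
              ⇒Has (ℕₚ.<-trans k<i li) (within-in w′ a) , ⇒Has (ℕₚ.<-trans k<i li) (within-in w b))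

    goE : ∀ {x x′ y} → x ≤ x′ → Has M x y → Has M x′ y → Walk M E (+ x , + y) (+ x′ , + y)
    goE l p q = walkE M l λ a b → row-conv a b p q
    goW : ∀ {x x′ y} → x′ ≤ x → Has M x y → Has M x′ y → Walk M W (+ x , + y) (+ x′ , + y)
    goW l p q = walkW M l λ a b → row-conv a b q p
    goN : ∀ {x y y′} → y ≤ y′ → Has M x y → Has M x y′ → Walk M N (+ x , + y) (+ x , + y′)
    goN l p q = walkN M l λ a b → col-conv a b p q
    goS : ∀ {x y y′} → y′ ≤ y → Has M x y → Has M x y′ → Walk M S (+ x , + y) (+ x , + y′)
    goS l p q = walkS M l λ a b → col-conv a b q p

    walk : ∀ {i y j y′} → Has M i y → Has M j y′ → Route i y j y′ → ZPath M (+ i , + y) (+ j , + y′)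
    walk {i} {y} {j} {y′} p q (inj₁ (k , b , u , v)) with b | ℕₚ.≤-total y y′
    ... | inj₁ (l , l′) | inj₁ m = three-walks M climbEN (goE l p u) (goN m u v) (goE l′ v q)
    ... | inj₁ (l , l′) | inj₂ m = three-walks M climbES (goE l p u) (goS m u v) (goE l′ v q)
    ... | inj₂ (l′ , l) | inj₁ m = three-walks M climbWN (goW l p u) (goN m u v) (goW l′ v q)
    ... | inj₂ (l′ , l) | inj₂ m = three-walks M climbWS (goW l p u) (goS m u v) (goW l′ v q)
    walk {i} {y} {j} {y′} p q (inj₂ (h , b , u , v)) with b | ℕₚ.≤-total i j
    ... | inj₁ (l , l′) | inj₁ m = three-walks M (climb-swap E N climbEN) (goN l p u) (goE m u v) (goN l′ v q)
    ... | inj₁ (l , l′) | inj₂ m = three-walks M (climb-swap W N climbWN) (goN l p u) (goW m u v) (goN l′ v q)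
    ... | inj₂ (l′ , l) | inj₁ m = three-walks M (climb-swap E S climbES) (goS l p u) (goE m u v) (goS l′ v q)
    ... | inj₂ (l′ , l) | inj₂ m = three-walks M (climb-swap W S climbWS) (goS l p u) (goW m u v) (goS l′ v q)

    zpath : ∀ a b → a ∈Q M → b ∈Q M → ZPath M a b
    zpath a b p@(_ , _ , refl , refl , _) q@(_ , _ , refl , refl , _) = walk p q (route p q)

    zpoly : ZPoly (suc c) (suc r) M
    zpoly = tight , ((let x , l , p = cover (s≤s z≤n) in _ , ⇒Has l p) , λ a b p q → proj₁ (zpath a b p q)) , convex , zpath

  render-injective : ∀ {c r cs cs′} → length cs ≡ suc c → length cs′ ≡ suc c → ZSeq (suc r) cs → ZSeq (suc r) cs′ →
    render (suc c) (suc r) cs ≡ render (suc c) (suc r) cs′ → cs ≡ cs′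
  render-injective {c} {r} {cs} {cs′} len len′ z z′ e = nth-ext cs cs′ (trans len (sym len′)) same
    where
    module P = ToPoly cs len z
    module P′ = ToPoly cs′ len′ z′
    nth-ext : ∀ (u v : Ivs) → length u ≡ length v → (∀ {i} → i < length u → nth u i ≡ nth v i) → u ≡ v
    nth-ext [] [] _ f = refl
    nth-ext (x ∷ u) (y ∷ v) l f = cong₂ _∷_ (f (s≤s z≤n)) (nth-ext u v (ℕₚ.suc-injective l) (λ k → f (s≤s k)))
    same : ∀ {i} → i < length cs → nth cs i ≡ nth cs′ i
    same {i} l = cong₂ _,_ (ℕₚ.≤-antisym (proj₁ (bwd (ℕₚ.≤-refl , v′))) (proj₁ (fwd (ℕₚ.≤-refl , v))))
                           (ℕₚ.≤-antisym (proj₂ (fwd (v , ℕₚ.≤-refl))) (proj₂ (bwd (v′ , ℕₚ.≤-refl))))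
      where
      l′ : i < length cs′
      l′ = subst (i <_) (trans len (sym len′)) l
      v = proj₁ (ZSeq.valid z l)
      v′ = proj₁ (ZSeq.valid z′ l′)
      fwd : ∀ {y} → In y (nth cs i) → In y (nth cs′ i)
      fwd {y} p = proj₂ (P′.Has⇒ (subst (λ M → Has M i y) e (P.⇒Has l p)))
      bwd : ∀ {y} → In y (nth cs′ i) → In y (nth cs i)
      bwd {y} p = proj₂ (P.Has⇒ (subst (λ M → Has M i y) (sym e) (P′.⇒Has l′ p)))

-- The count of matrices and the final assembly.

open import Defs
open GeneratingFunction using (Counted; bivariate)
open BivariateSeries using (d-exists)
open Diagonal using (s-exists; univariate)
open StacksAndRuns
open AllObjects
open PathsInPolyominoes using (render)
open FromPolyominoes
open ToPolyominoes
open import Data.Empty using (⊥; ⊥-elim)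
open import Data.Nat using (ℕ; zero; suc; _∸_)
import Data.Nat as ℕ
import Data.Nat.Properties as ℕₚ
open import Data.Integer using (ℤ; +_)
import Data.Integer as ℤ
open import Data.Product using (Σ; _×_; _,_; proj₁; proj₂)
open import Data.List using (List; []; _∷_; _++_; length; map)
open import Data.List.Properties using (length-map)
open import Data.List.Membership.Propositional using (_∈_)
open import Data.List.Membership.Propositional.Properties using (∈-map⁺; ∈-map⁻; ∈-∃++; ∈-++⁺ˡ; ∈-++⁺ʳ; ∈-++⁻)
open import Data.List.Relation.Unary.Any using (here; there)
open import Data.List.Relation.Unary.All using (All; []; _∷_)
import Data.List.Relation.Unary.All as All
open import Data.List.Relation.Unary.Unique.Propositional using (Unique)
open import Data.List.Relation.Unary.AllPairs using ([]; _∷_)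
import Data.List.Relation.Unary.Unique.Propositional.Properties as Uₚ
open import Data.Sum using (inj₁; inj₂)
open import Data.List.Properties using (length-++)
open import Relation.Binary.PropositionalEquality using (_≡_; refl; sym; trans; cong; cong₂)

unique-length-≤ : ∀ {A : Set} {xs ys : List A} → Unique xs → (∀ {x} → x ∈ xs → x ∈ ys) → length xs ℕ.≤ length ys
unique-length-≤ [] f = ℕ.z≤n
unique-length-≤ {xs = x ∷ xs} (p ∷ u) f with ∈-∃++ (f (here refl))
... | as , bs , refl = ℕₚ.≤-trans (ℕ.s≤s (unique-length-≤ u rest-in))
    (ℕₚ.≤-reflexive (trans (cong suc (length-++ as)) (trans (sym (ℕₚ.+-suc (length as) (length bs))) (sym (length-++ as)))))
  where
  rest-in : ∀ {y} → y ∈ xs → y ∈ as ++ bs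
  rest-in {y} y∈ with ∈-++⁻ as (f (there y∈))
  ... | inj₁ q            = ∈-++⁺ˡ q
  ... | inj₂ (here refl)  = ⊥-elim (All.lookup p y∈ refl)
  ... | inj₂ (there q)    = ∈-++⁺ʳ as q

unique-length : ∀ {A : Set} {xs ys : List A} → Unique xs → Unique ys → (∀ x → (x ∈ xs → x ∈ ys) × (x ∈ ys → x ∈ xs)) → length xs ≡ length ys
unique-length u v f = ℕₚ.≤-antisym (unique-length-≤ u (λ {x} → proj₁ (f x))) (unique-length-≤ v (λ {x} → proj₂ (f x)))

matrix : ∀ {c r} → Obj⁺ c r → Mat (suc c) (suc r)
matrix {c} {r} o = render (suc c) (suc r) (cols o)

matrix-injective : ∀ {c r} {o o′ : Obj⁺ c r} → matrix o ≡ matrix o′ → o ≡ o′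
matrix-injective {o = o} {o′} e =
  cols-injective o o′ (render-injective (cols-length o) (cols-length o′) (cols-zseq o) (cols-zseq o′) e)

matrix-zpoly : ∀ {c r} (o : Obj⁺ c r) → ZPoly (suc c) (suc r) (matrix o)
matrix-zpoly o = ToPoly.zpoly (cols o) (cols-length o) (cols-zseq o)

matrix-onto : ∀ {c r} M → ZPoly (suc c) (suc r) M → Σ (Obj⁺ c r) λ o → matrix o ≡ M
matrix-onto {c} {r} M zp with cols-complete (FromPoly.cs-length M zp) (FromPoly.zseq M zp)
... | o , e = o , trans (cong (render (suc c) (suc r)) e) (FromPoly.rendered M zp)

no-cells : ∀ {c r n} → HasCount c r n → (∀ M → ZPoly c r M → ⊥) → n ≡ 0
no-cells ([]    , _ , _ , refl) f = refl
no-cells (M ∷ _ , _ , m , _)    f = ⊥-elim (f M (proj₁ (m M) (here refl)))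

-- The given list and the rendered objects are duplicate-free with the same members, hence equally
-- long. A box without rows or columns has no cell and so holds no polyomino.
count≡ : ∀ c r n → HasCount c r n → n ≡ #Z c r
count≡ zero    zero    n h = no-cells h λ { M (_ , ((_ , () , _) , _) , _) }
count≡ zero    (suc r) n h = no-cells h λ { M (_ , ((_ , () , _) , _) , _) }
count≡ (suc c) zero    n h = no-cells h λ { M (_ , ((_ , _ , () , _) , _) , _) }
count≡ (suc c) (suc r) n (L , u , m , refl) = trans
  (unique-length u (Uₚ.map⁺ (λ {o} {o′} → matrix-injective {o = o} {o′}) O.unique) λ M → to M , from M)
  (trans (length-map matrix O.list) O.len)
  where
  module O = _has_ (Obj-has c r)
  to : ∀ M → M ∈ L → M ∈ map matrix O.list
  to M i with matrix-onto M (proj₁ (m M) i)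
  ... | o , refl = ∈-map⁺ matrix (O.complete o)
  from : ∀ M → M ∈ map matrix O.list → M ∈ L
  from M i with ∈-map⁻ matrix i
  ... | o , _ , refl = proj₂ (m _) (matrix-zpoly o)

theorem1 : (cnt : ℕ → ℕ → ℕ) → (∀ c r → HasCount c r (cnt c r)) →
    ( (P₁ cnt 0 ≡ + 0) × (P₁ cnt 1 ≡ + 0) × (P₁ cnt 2 ≡ + 1) × (P₁ cnt 3 ≡ + 2) ×
    (P₁ cnt 4 ≡ + 7) × (P₁ cnt 5 ≡ + 28) × (P₁ cnt 6 ≡ + 116) × (P₁ cnt 7 ≡ + 484) )
    ×
    ( (Σ Ser λ s → (s 0 ≡ + 1) × (s *₁ s ≈₁ #₁ 1 -₁ #₁ 4 *₁ t))
    × (∀ (s : Ser) → s 0 ≡ + 1 → s *₁ s ≈₁ #₁ 1 -₁ #₁ 4 *₁ t →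
    P₁ cnt *₁ (#₁ 1 -₁ #₁ 4 *₁ t) ^₁ 2 *₁ (#₁ 1 -₁ #₁ 3 *₁ t) *₁ (#₁ 1 -₁ t)
    ≈₁ t ^₁ 4 *₁ (#₁ 1 -₁ #₁ 2 *₁ t) ^₁ 2 *₁ (#₁ 1 -₁ #₁ 2 *₁ t -₁ s)
    +₁ t ^₁ 2 *₁ (#₁ 1 -₁ #₁ 6 *₁ t +₁ #₁ 10 *₁ t ^₁ 2 -₁ #₁ 2 *₁ t ^₁ 3 -₁ t ^₁ 4)
    *₁ (#₁ 1 -₁ #₁ 4 *₁ t)) )
    ×
    ( (Σ Ser₂ λ d → (d 0 0 ≡ + 0) × (d ≈₂ (X +₂ d) *₂ (Y +₂ d)))
    × (∀ (d : Ser₂) → d 0 0 ≡ + 0 → d ≈₂ (X +₂ d) *₂ (Y +₂ d) →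
    P₂ cnt *₂ Δ ^₂ 2 *₂ ((#₂ 1 -₂ X -₂ Y) ^₂ 2 -₂ X *₂ Y)
    ≈₂ #₂ 2 *₂ X ^₂ 2 *₂ Y ^₂ 2 *₂ d *₂ (#₂ 1 -₂ X -₂ Y) ^₂ 2
    +₂ Δ *₂ ( X *₂ Y *₂ (#₂ 1 -₂ X -₂ Y) ^₂ 2 *₂ (#₂ 1 -₂ X -₂ Y -₂ X *₂ Y)
    -₂ X ^₂ 2 *₂ Y ^₂ 2 *₂ (#₂ 1 -₂ X -₂ Y -₂ #₂ 3 *₂ X *₂ Y) )) )
theorem1 cnt has-count =
  (initial 0 , initial 1 , initial 2 , initial 3 , initial 4 , initial 5 , initial 6 , initial 7) ,
  (s-exists , univariate gf) , (d-exists , bivariate gf)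
  where
  cnt≡ : ∀ c r → cnt c r ≡ #Z c r
  cnt≡ c r = count≡ c r (cnt c r) (has-count c r)
  gf : Counted (P₂ cnt)
  gf = counted cnt cnt≡
  -- For a numeral m the right-hand side evaluates to the stated coefficient, since `#Z` is a closed
  -- recursion on numerals.
  initial : ∀ m → P₁ cnt m ≡ sumTo m (λ c → + #Z c (m ∸ c))
  initial m = go m (λ c → m ∸ c)
    where
    go : ∀ n (f : ℕ → ℕ) → sumTo n (λ c → + cnt c (f c)) ≡ sumTo n (λ c → + #Z c (f c))
    go zero    f = cong +_ (cnt≡ 0 (f 0))
    go (suc n) f = cong₂ ℤ._+_ (go n f) (cong +_ (cnt≡ (suc n) (f (suc n))))
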